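{- Let $G$ be a 2-connected graph on $n$ vertices and let $C$ be a longest cycle in $G$, of length $c$, where $10\leq c\leq n-1$. If the number of edges of $G$ with at most one endpoint in $V(C)$ is more than $(\lfloor c/2\rfloor-1)(n-c)$, then either $G$ is isomorphic to a subgraph of $W_{n,\lfloor c/2\rfloor,c}$, or $c$ is odd and $G$ is isomorphic to a subgraph of a member of $\mathcal{X}_{n,c}\cup\mathcal{Y}_{n,c}$.
   Context: Graphs are simple and finite. $W_{n,k,c}$: a clique $K_{c-k+1}$ plus $n-(c-k+1)$ new vertices each joined exactly to the same $k$ vertices of the clique. For odd $c$: $G\in\mathcal{X}_{n,c}$ if $|V(G)|=n$, $V(G)=A\cup B\cup X$ (disjoint), $G[A]\cong K_{\lfloor c/2\rfloor}$, $B,X$ independent, $A$ completely joined to $B$, and there exist $a\in A,b\in B$ with $N_G(x)=\{a,b\}$ for all $x\in X$. $G\in\mathcal{Y}_{n,c}$ if $|V(G)|=n$, $V(G)=A\cup B\cup Y$ (disjoint), $G[A]\cong K_{\lfloor c/2\rfloor}$, $B$ independent, $A$ completely joined to $B$, $G[Y]$ is a star forest with at least two stars each having at least one edge, and there exist $a,b\in A$ such that for every star $S$ of $G[Y]$, the set of vertices outside $S$ adjacent to $S$ is $\{a,b\}$, and if $|V(S)|\geq 3$ then all leaves of $S$ have degree 2 in $G$ and have a common neighbor in $\{a,b\}$. -}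

module Defs where

open import Data.Nat using (ℕ; zero; suc; _+_; _*_; _∸_; _≤_; _<_; _<ᵇ_; ⌊_/2⌋)
open import Data.Bool using (Bool; true; false; if_then_else_; _∧_; _∨_; not)
open import Data.Fin using (Fin; toℕ; _≟_)
import Data.Fin as F
open import Data.List using (List; []; _∷_; _++_; [_]; length)
open import Data.List.Relation.Unary.Linked using (Linked)
open import Data.List.Relation.Unary.Unique.Propositional using (Unique)
open import Data.Product using (Σ; ∃; ∃-syntax; _×_; _,_)
open import Data.Sum using (_⊎_)
open import Data.Unit using (⊤)
open import Function using (_∘_)
open import Function.Bundles using (_⇔_)
open import Function.Definitions using (Injective)
open import Relation.Nullary using (¬_)
open import Relation.Nullary.Decidable using (⌊_⌋)
open import Relation.Binary.PropositionalEquality using (_≡_; _≢_)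

record Graph (n : ℕ) : Set where
  field
    adj    : Fin n → Fin n → Bool
    sym    : ∀ u v → adj u v ≡ adj v u
    irrefl : ∀ u → adj u u ≡ false
open Graph public

countB : ∀ {n} → (Fin n → Bool) → ℕ
countB {zero}  f = 0
countB {suc n} f = (if f F.zero then 1 else 0) + countB (f ∘ F.suc)

degree : ∀ {n} → Graph n → Fin n → ℕ
degree G v = countB (adj G v)

data Reach {n} (G : Graph n) (P : Fin n → Set) : Fin n → Fin n → Set where
  here : ∀ {u} → P u → Reach G P u u
  step : ∀ {u w v} → P u → adj G u w ≡ true → Reach G P w v → Reach G P u v

Connected : ∀ {n} → Graph n → Set
Connected {n} G = ∀ (u v : Fin n) → Reach G (λ _ → ⊤) u v

TwoConnected : ∀ {n} → Graph n → Set
TwoConnected {n} G =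
  (3 ≤ n) × Connected G ×
  (∀ (x u v : Fin n) → u ≢ x → v ≢ x → Reach G (λ y → y ≢ x) u v)

record Cycle {n} (G : Graph n) : Set where
  field
    v0       : Fin n
    rest     : List (Fin n)
    long     : 2 ≤ length rest
    distinct : Unique (v0 ∷ rest)
    closed   : Linked (λ u v → adj G u v ≡ true) (v0 ∷ rest ++ [ v0 ])
open Cycle public

cycleLength : ∀ {n} {G : Graph n} → Cycle G → ℕ
cycleLength C = suc (length (rest C))

cycleVerts : ∀ {n} {G : Graph n} → Cycle G → List (Fin n)
cycleVerts C = v0 C ∷ rest C

memB : ∀ {n} → Fin n → List (Fin n) → Bool
memB u []       = false
memB u (w ∷ ws) = ⌊ u ≟ w ⌋ ∨ memB u ws

-- number of edges of G with at most one endpoint in V(C)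
-- (each unordered edge {u,v} counted once, via toℕ u < toℕ v)
sumF : ∀ {n} → (Fin n → ℕ) → ℕ
sumF {zero}  f = 0
sumF {suc n} f = f F.zero + sumF (f ∘ F.suc)

outerEdges : ∀ {n} (G : Graph n) → Cycle G → ℕ
outerEdges G C =
  sumF (λ u → countB (λ v →
    adj G u v ∧ (toℕ u <ᵇ toℕ v) ∧ not (inC u ∧ inC v)))
  where
    inC = λ w → memB w (cycleVerts C)

IsLongestCycle : ∀ {n} (G : Graph n) → Cycle G → Set
IsLongestCycle G C = ∀ (D : Cycle G) → cycleLength D ≤ cycleLength C

EmbedsInto : ∀ {n m} → Graph n → (Fin m → Fin m → Set) → Set
EmbedsInto {n} {m} G R =
  Σ (Fin n → Fin m) λ f → Injective _≡_ _≡_ f ×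
    (∀ u v → adj G u v ≡ true → R (f u) (f v))

WAdj : (n k c : ℕ) → Fin n → Fin n → Set
WAdj n k c i j =
  i ≢ j ×
  ((toℕ i < m × toℕ j < m) ⊎ (m ≤ toℕ i × toℕ j < k) ⊎ (m ≤ toℕ j × toℕ i < k))
  where m = c ∸ k + 1

data PartX : Set where
  inA inB inX : PartX

isAX : PartX → Bool
isAX inA = true
isAX _   = false

record InX {n} (c : ℕ) (H : Graph n) : Set where
  field
    part     : Fin n → PartX
    sizeA    : countB (isAX ∘ part) ≡ ⌊ c /2⌋
    cliqueA  : ∀ u v → part u ≡ inA → part v ≡ inA → u ≢ v → adj H u v ≡ true
    indepB   : ∀ u v → part u ≡ inB → part v ≡ inB → adj H u v ≡ false
    indepX   : ∀ u v → part u ≡ inX → part v ≡ inX → adj H u v ≡ false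
    joinAB   : ∀ u v → part u ≡ inA → part v ≡ inB → adj H u v ≡ true
    a b      : Fin n
    aA       : part a ≡ inA
    bB       : part b ≡ inB
    nbhdX    : ∀ x → part x ≡ inX → ∀ v → (adj H x v ≡ true) ⇔ (v ≡ a ⊎ v ≡ b)

-- The family Y_{n,c}
-- G[Y] is described as a star forest by a map `star` sending each vertex of Y
-- to the centre of its star; the stars are the classes {y ∈ Y | star y ≡ z}.

data PartY : Set where
  inA inB inY : PartY

isAY : PartY → Bool
isAY inA = true
isAY _   = false

isYY : PartY → Bool
isYY inY = true
isYY _   = false

record InY {n} (c : ℕ) (H : Graph n) : Set where
  field
    part     : Fin n → PartY
    sizeA    : countB (isAY ∘ part) ≡ ⌊ c /2⌋
    cliqueA  : ∀ u v → part u ≡ inA → part v ≡ inA → u ≢ v → adj H u v ≡ true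
    indepB   : ∀ u v → part u ≡ inB → part v ≡ inB → adj H u v ≡ false
    joinAB   : ∀ u v → part u ≡ inA → part v ≡ inB → adj H u v ≡ true
    star       : Fin n → Fin n
    starCentre : ∀ y → part y ≡ inY → part (star y) ≡ inY × star (star y) ≡ star y
    starEdges  : ∀ y y' → part y ≡ inY → part y' ≡ inY →
                   (adj H y y' ≡ true) ⇔
                   (y ≢ y' × star y ≡ star y' × (y ≡ star y ⊎ y' ≡ star y'))
    starNontriv : ∀ z → part z ≡ inY → star z ≡ z →
                   ∃[ y ] (part y ≡ inY × star y ≡ z × y ≢ z)
    twoStars : ∃[ z₁ ] ∃[ z₂ ] (part z₁ ≡ inY × star z₁ ≡ z₁ ×
                                part z₂ ≡ inY × star z₂ ≡ z₂ × z₁ ≢ z₂)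
    a b      : Fin n
    aA       : part a ≡ inA
    bA       : part b ≡ inA
    starNbhd : ∀ z → part z ≡ inY → star z ≡ z →
                 ∀ v → ¬ (part v ≡ inY × star v ≡ z) →
                 (∃[ s ] (part s ≡ inY × star s ≡ z × adj H s v ≡ true)) ⇔ (v ≡ a ⊎ v ≡ b)
    bigStars : ∀ z → part z ≡ inY → star z ≡ z →
                 3 ≤ countB (λ v → isYY (part v) ∧ ⌊ star v ≟ z ⌋) →
                 (∀ l → part l ≡ inY → star l ≡ z → l ≢ z → degree H l ≡ 2) ×
                 (∃[ w ] ((w ≡ a ⊎ w ≡ b) ×
                   (∀ l → part l ≡ inY → star l ≡ z → l ≢ z → adj H l w ≡ true)))

{-# OPTIONS --safe #-}
module Submission where

-- Let k = ⌊c/2⌋, and suppose first that no vertex outside the longest cycle C has k neighbours on it.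
-- Then the number of edges outside C is at most (k - 1)(n - c).  To see this, remove the outer vertices of
-- degree at most k - 1 one at a time; contracting each into a suitable neighbour keeps the graph
-- 2-connected and never shortens the distances on C forced by outer paths.  If all remaining outer vertices
-- have degree at least k, a Locke-type induction on an end block yields an outer path that is too long for C,
-- unless the block is a small clique of vertices of degree k: three such vertices can be removed at a cost of
-- k + (k - 1) + (k - 2) = 3(k - 1) edges, and a block of at most two vertices forces too many wide gaps on C.
--
-- Otherwise some x outside C is joined to every second vertex of C, with one gap of two vertices if c is odd.
-- Let A be the neighbourhood of x on C.  Rerouting C through x bounds the paths between vertices of A that
-- avoid A: for even c, A meets every edge; for odd c, the graph G - A is a star forest
-- whose attachments to A are determined, and one reads off W, X or Y.

open import Defs hiding (sym)
open import Data.Bool using (Bool; true; false; if_then_else_; T; _∧_; _∨_; not)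
open import Data.Bool.Properties using (∨-comm) renaming (_≟_ to _≟ᵇ_)
open import Data.Empty using (⊥; ⊥-elim)
open import Data.Fin using (Fin; toℕ; fromℕ<; _≟_)
import Data.Fin as F
open import Data.Fin.Properties using (any?; toℕ<n; toℕ-fromℕ<; toℕ-injective)
open import Data.List using (List; []; _∷_; _++_; [_]; length; map; reverse)
open import Data.List.Membership.Propositional using (_∈_)
open import Data.List.Membership.Propositional.Properties using (∈-∃++; ∈-++⁻; ∈-++⁺ˡ; ∈-++⁺ʳ; ∈-map⁺)
open import Data.List.Properties using (length-++; unfold-reverse; length-reverse; ++-assoc; ++-identityʳ; reverse-involutive; reverse-++)
open import Data.List.Relation.Unary.All using ([]; _∷_) renaming (All to Every)
open import Data.List.Relation.Unary.AllPairs using ([]; _∷_)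
open import Data.List.Relation.Unary.Any using (here; there)
open import Data.List.Relation.Unary.Linked using (Linked; []; [-]; _∷_)
open import Data.List.Relation.Unary.Unique.Propositional using (Unique)
open import Data.Nat hiding (_≟_)
open import Data.Nat.DivMod using ([m+kn]%n≡m%n)
open import Data.Nat.Properties hiding (_≟_)
open import Data.Product using (Σ; ∃-syntax; _×_; _,_; proj₁; proj₂)
open import Data.Sum using (_⊎_; inj₁; inj₂; [_,_]′)
open import Data.Unit using (tt)
open import Function using (_∘_)
open import Function.Bundles using (_⇔_; mk⇔)
open import Function.Definitions using (Injective)
open import Relation.Binary.Definitions using (Tri; tri<; tri≈; tri>)
open import Relation.Binary.PropositionalEquality hiding ([_])
open import Relation.Nullary using (¬_; Dec; yes; no)
open import Relation.Nullary.Decidable using (⌊_⌋; _×-dec_; ¬?)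

-- In the counting part `k` stands for one less than half of the length, so that `c ≤ 3 + 2 * k`.
-- Deleting an outer vertex may destroy the 2-connectivity on which the block argument rests;
-- contracting it preserves that, but alters degrees. Hence two relations are carried along: `adj`,
-- in which edges are counted, and a contraction `E`, in which paths are found. This works because
-- `E` keeps every edge of `adj` between the remaining outer vertices, and from these to the cycle.
-- What an end block has to provide is a path for which the number of its vertices plus the number
-- of neighbours of its end on the cycle is large: the cycle has to make room for each of these
-- twice. The degree bound can be missed, by one, only if the block is a clique, which is where the
-- small cliques come from. In the odd case the obstacle is the gap of two vertices: a detour that
-- skips it may be longer by one than any other. It is overcome by reading the cycle in both
-- directions and by exchanging the gap for another edge outside `A`, after which the old gap is
-- subject to the stronger bounds.

-- Linear arithmetic over the natural numbers by reflection

infix  8 #_ κ_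
infix  7 _⊛_
infixl 6 _⊕_

-- Atoms #_ refer to a list of values; κ_ is a constant.
data LinExp : Set where
  #_  : ℕ → LinExp
  κ_  : ℕ → LinExp
  _⊕_ : LinExp → LinExp → LinExp
  _⊛_ : ℕ → LinExp → LinExp

at : List ℕ → ℕ → ℕ
at []       _       = 0
at (x ∷ _)  zero    = x
at (_ ∷ xs) (suc i) = at xs i

value : List ℕ → LinExp → ℕ
value ρ (# i)  = at ρ i
value ρ (κ c) = c
value ρ (e ⊕ f)   = value ρ e + value ρ f
value ρ (c ⊛ e)   = c * value ρ e

-- A normal form lists the constant term and then the coefficients of the atoms.
dot : List ℕ → List ℕ → ℕ
dot []       _        = 0
dot (_ ∷ _)  []       = 0
dot (c ∷ cs) (x ∷ xs) = c * x + dot cs xs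

unit : ℕ → List ℕ
unit zero    = 1 ∷ []
unit (suc i) = 0 ∷ unit i

addᵛ : List ℕ → List ℕ → List ℕ
addᵛ []       ys       = ys
addᵛ (x ∷ xs) []       = x ∷ xs
addᵛ (x ∷ xs) (y ∷ ys) = x + y ∷ addᵛ xs ys

scaleᵛ : ℕ → List ℕ → List ℕ
scaleᵛ c []       = []
scaleᵛ c (x ∷ xs) = c * x ∷ scaleᵛ c xs

normal : LinExp → List ℕ
normal (# i)  = 0 ∷ unit i
normal (κ c) = c ∷ []
normal (e ⊕ f)   = addᵛ (normal e) (normal f)
normal (c ⊛ e)   = scaleᵛ c (normal e)

-- Comparing coefficients is a sufficient test because atoms take values in the natural numbers.
leqᵛ : List ℕ → List ℕ → Bool
leqᵛ []       _        = true
leqᵛ (x ∷ xs) []       = (x ≡ᵇ 0) ∧ leqᵛ xs []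
leqᵛ (x ∷ xs) (y ∷ ys) = (x ≤ᵇ y) ∧ leqᵛ xs ys

dot-unit : ∀ i ρ → dot (unit i) ρ ≡ at ρ i
dot-unit zero    []      = refl
dot-unit zero    (x ∷ ρ) = trans (+-identityʳ _) (*-identityˡ x)
dot-unit (suc i) []      = refl
dot-unit (suc i) (x ∷ ρ) = dot-unit i ρ

+-interchange : ∀ a b c d → (a + b) + (c + d) ≡ (a + c) + (b + d)
+-interchange a b c d = begin
  (a + b) + (c + d) ≡⟨ +-assoc a b (c + d) ⟩
  a + (b + (c + d)) ≡⟨ cong (a +_) (sym (+-assoc b c d)) ⟩
  a + ((b + c) + d) ≡⟨ cong (λ t → a + (t + d)) (+-comm b c) ⟩
  a + ((c + b) + d) ≡⟨ cong (a +_) (+-assoc c b d) ⟩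
  a + (c + (b + d)) ≡⟨ sym (+-assoc a c (b + d)) ⟩
  (a + c) + (b + d) ∎
  where open ≡-Reasoning

dot-add : ∀ xs ys ρ → dot (addᵛ xs ys) ρ ≡ dot xs ρ + dot ys ρ
dot-add []       ys       ρ       = refl
dot-add (x ∷ xs) []       []      = refl
dot-add (x ∷ xs) []       (_ ∷ _) = sym (+-identityʳ _)
dot-add (x ∷ xs) (y ∷ ys) []      = refl
dot-add (x ∷ xs) (y ∷ ys) (r ∷ ρ) =
  trans (cong₂ _+_ (*-distribʳ-+ r x y) (dot-add xs ys ρ)) (+-interchange (x * r) (y * r) _ _)

dot-scale : ∀ c xs ρ → dot (scaleᵛ c xs) ρ ≡ c * dot xs ρ
dot-scale c []       ρ       = sym (*-zeroʳ c)
dot-scale c (x ∷ xs) []      = sym (*-zeroʳ c)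
dot-scale c (x ∷ xs) (r ∷ ρ) =
  trans (cong₂ _+_ (*-assoc c x r) (dot-scale c xs ρ)) (sym (*-distribˡ-+ c (x * r) _))

normal-correct : ∀ e ρ → dot (normal e) (1 ∷ ρ) ≡ value ρ e
normal-correct (# i)  ρ = dot-unit i ρ
normal-correct (κ c) ρ = trans (+-identityʳ _) (*-identityʳ c)
normal-correct (e ⊕ f)   ρ = trans (dot-add (normal e) (normal f) (1 ∷ ρ)) (cong₂ _+_ (normal-correct e ρ) (normal-correct f ρ))
normal-correct (c ⊛ e)   ρ = trans (dot-scale c (normal e) (1 ∷ ρ)) (cong (c *_) (normal-correct e ρ))

∧-T : ∀ a {b} → T (a ∧ b) → T a × T b
∧-T true p = tt , p

leqᵛ-sound : ∀ xs ys ρ → T (leqᵛ xs ys) → dot xs ρ ≤ dot ys ρ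
leqᵛ-sound []       ys       ρ       _ = z≤n
leqᵛ-sound (x ∷ xs) ys       []      _ = z≤n
leqᵛ-sound (x ∷ xs) []       (r ∷ ρ) p with ∧-T (x ≡ᵇ 0) p
... | q , q' rewrite ≡ᵇ⇒≡ x 0 q = ≤-trans (leqᵛ-sound xs [] ρ q') (≤-reflexive (dot-nil ρ))
  where
  dot-nil : ∀ ρ → dot [] ρ ≡ 0
  dot-nil _ = refl
leqᵛ-sound (x ∷ xs) (y ∷ ys) (r ∷ ρ) p with ∧-T (x ≤ᵇ y) p
... | q , q' = +-mono-≤ (*-monoˡ-≤ r (≤ᵇ⇒≤ x y q)) (leqᵛ-sound xs ys ρ q')

abstract
  -- Once `e + b ≤ f + a` holds coefficientwise, add `a ≤ b` and cancel `b`. Several hypotheses are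
  -- first summed to a single `a ≤ b` with `_⊞_`, and the comparison is settled by evaluation, so
  -- that each use is a certificate.
  linear : ∀ ρ a b e f {ok : T (leqᵛ (normal (e ⊕ b)) (normal (f ⊕ a)))} →
           value ρ a ≤ value ρ b → value ρ e ≤ value ρ f
  linear ρ a b e f {ok} h = +-cancelʳ-≤ (value ρ b) (value ρ e) (value ρ f)
    (≤-trans (subst₂ _≤_ (normal-correct (e ⊕ b) ρ) (normal-correct (f ⊕ a) ρ)
                         (leqᵛ-sound (normal (e ⊕ b)) (normal (f ⊕ a)) (1 ∷ ρ) ok))
             (+-monoʳ-≤ (value ρ f) h))

infixr 4 _⊞_
_⊞_ : ∀ {a b c d} → a ≤ b → c ≤ d → a + c ≤ b + d
_⊞_ = +-mono-≤

≡≤ : ∀ {a b : ℕ} → a ≡ b → a ≤ b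
≡≤ = ≤-reflexive

≡≥ : ∀ {a b : ℕ} → a ≡ b → b ≤ a
≡≥ p = ≤-reflexive (sym p)

1≰0 : 1 ≤ 0 → ⊥
1≰0 ()

-- Boolean sets and their cardinalities

⟦_⟧ : Bool → ℕ
⟦ b ⟧ = if b then 1 else 0

BSet : ℕ → Set
BSet n = Fin n → Bool

infix 4 _∈ˢ_ _∉ˢ_
infix 7 _==_
_∈ˢ_ _∉ˢ_ : ∀ {n} → Fin n → BSet n → Set
z ∈ˢ S = S z ≡ true
z ∉ˢ S = S z ≡ false

_==_ : ∀ {n} → Fin n → Fin n → Bool
u == v = ⌊ u ≟ v ⌋

t≢f : ∀ {b} → b ≡ true → b ≡ false → ⊥
t≢f refl ()

¬t⇒f : ∀ {b} → ¬ (b ≡ true) → b ≡ false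
¬t⇒f {true}  p = ⊥-elim (p refl)
¬t⇒f {false} p = refl

¬f⇒t : ∀ {b} → ¬ (b ≡ false) → b ≡ true
¬f⇒t {true}  p = refl
¬f⇒t {false} p = ⊥-elim (p refl)

true⊎false : ∀ b → b ≡ true ⊎ b ≡ false
true⊎false true  = inj₁ refl
true⊎false false = inj₂ refl

∧-i : ∀ {a b} → a ≡ true → b ≡ true → a ∧ b ≡ true
∧-i refl refl = refl

∧-e : ∀ {a b} → a ∧ b ≡ true → a ≡ true × b ≡ true
∧-e {true} p = refl , p

not-i : ∀ {a} → a ≡ false → not a ≡ true
not-i refl = refl

not-e : ∀ {a} → not a ≡ true → a ≡ false
not-e {false} _ = refl

⟦⟧-true : ∀ {b} → b ≡ true → ⟦ b ⟧ ≡ 1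
⟦⟧-true refl = refl

⟦⟧-false : ∀ {b} → b ≡ false → ⟦ b ⟧ ≡ 0
⟦⟧-false refl = refl

⟦⟧≤1 : ∀ b → ⟦ b ⟧ ≤ 1
⟦⟧≤1 true  = s≤s z≤n
⟦⟧≤1 false = z≤n

⟦⟧≥1 : ∀ {b} → 1 ≤ ⟦ b ⟧ → b ≡ true
⟦⟧≥1 {true} _ = refl

⟦⟧-mono : ∀ {a b} → (a ≡ true → b ≡ true) → ⟦ a ⟧ ≤ ⟦ b ⟧
⟦⟧-mono {true}  p rewrite p refl = ≤-refl
⟦⟧-mono {false} p = z≤n

==-refl : ∀ {n} (u : Fin n) → u == u ≡ true
==-refl u with u ≟ u
... | yes _ = refl
... | no ¬p = ⊥-elim (¬p refl)

==⇒≡ : ∀ {n} {u v : Fin n} → u == v ≡ true → u ≡ v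
==⇒≡ {u = u} {v} p with u ≟ v
... | yes q = q

≢⇒==f : ∀ {n} {u v : Fin n} → u ≢ v → u == v ≡ false
≢⇒==f p = ¬t⇒f (p ∘ ==⇒≡)

==f⇒≢ : ∀ {n} {u v : Fin n} → u == v ≡ false → u ≢ v
==f⇒≢ {u = u} p refl = t≢f (==-refl u) p

infixl 6 _∖_ _−_
_∖_ : ∀ {n} → BSet n → Fin n → BSet n
(S ∖ v) z = S z ∧ not (z == v)

_−_ : ∀ {n} → BSet n → BSet n → BSet n
(S − D) z = S z ∧ not (D z)

∖-i : ∀ {n} {S : BSet n} {v z} → z ∈ˢ S → z ≢ v → z ∈ˢ S ∖ v
∖-i p q = ∧-i p (not-i (≢⇒==f q))

∖-e : ∀ {n} {S : BSet n} {v z} → z ∈ˢ S ∖ v → z ∈ˢ S × z ≢ v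
∖-e p = proj₁ (∧-e p) , ==f⇒≢ (not-e (proj₂ (∧-e p)))

−-i : ∀ {n} {S D : BSet n} {z} → z ∈ˢ S → z ∉ˢ D → z ∈ˢ S − D
−-i p q = ∧-i p (not-i q)

−-e : ∀ {n} {S D : BSet n} {z} → z ∈ˢ S − D → z ∈ˢ S × z ∉ˢ D
−-e p = proj₁ (∧-e p) , not-e (proj₂ (∧-e p))

∖-self : ∀ {n} (S : BSet n) v → v ∉ˢ S ∖ v
∖-self S v = ¬t⇒f λ p → proj₂ (∖-e {S = S} p) refl

∈≢ : ∀ {n} (S : BSet n) {z w} → z ∈ˢ S → w ∉ˢ S → z ≢ w
∈≢ S p q refl = t≢f p q

abstract
  sumF-mono : ∀ {n} {f g : Fin n → ℕ} → (∀ i → f i ≤ g i) → sumF f ≤ sumF g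
  sumF-mono {zero}  p = z≤n
  sumF-mono {suc n} p = p F.zero ⊞ sumF-mono (p ∘ F.suc)

  sumF-cong : ∀ {n} {f g : Fin n → ℕ} → (∀ i → f i ≡ g i) → sumF f ≡ sumF g
  sumF-cong {zero}  p = refl
  sumF-cong {suc n} p = cong₂ _+_ (p F.zero) (sumF-cong (p ∘ F.suc))

  sumF-+ : ∀ {n} (f g : Fin n → ℕ) → sumF (λ i → f i + g i) ≡ sumF f + sumF g
  sumF-+ {zero}  f g = refl
  sumF-+ {suc n} f g = trans (cong (f F.zero + g F.zero +_) (sumF-+ (f ∘ F.suc) (g ∘ F.suc)))
                             (+-interchange (f F.zero) (g F.zero) _ _)

  sumF-0 : ∀ {n} {f : Fin n → ℕ} → (∀ i → f i ≡ 0) → sumF f ≡ 0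
  sumF-0 {zero}  p = refl
  sumF-0 {suc n} p = cong₂ _+_ (p F.zero) (sumF-0 (p ∘ F.suc))

  sumF-point : ∀ {n} (a : Fin n) (g : Fin n → ℕ) → sumF (λ z → ⟦ z == a ⟧ * g z) ≡ g a
  sumF-point {suc n} F.zero g = trans (cong₂ _+_ (*-identityˡ (g F.zero)) (sumF-0 {n} λ i → refl)) (+-identityʳ _)
  sumF-point (F.suc a) g = trans (sumF-cong λ i → cong (λ b → ⟦ b ⟧ * g (F.suc i)) (suc-== i)) (sumF-point a (g ∘ F.suc))
    where
    suc-== : ∀ i → (F.suc i == F.suc a) ≡ (i == a)
    suc-== i with i ≟ a
    ... | yes refl = refl
    ... | no  _    = refl

  countB≡ : ∀ {n} (f : BSet n) → countB f ≡ sumF (λ z → ⟦ f z ⟧)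
  countB≡ {zero}  f = refl
  countB≡ {suc n} f = cong (⟦ f F.zero ⟧ +_) (countB≡ (f ∘ F.suc))

  countB-≤+ : ∀ {n} (f g h : BSet n) → (∀ z → ⟦ f z ⟧ ≤ ⟦ g z ⟧ + ⟦ h z ⟧) → countB f ≤ countB g + countB h
  countB-≤+ f g h p rewrite countB≡ f | countB≡ g | countB≡ h =
    ≤-trans (sumF-mono p) (≤-reflexive (sumF-+ (λ z → ⟦ g z ⟧) (λ z → ⟦ h z ⟧)))

  countB-+≤ : ∀ {n} (f g h : BSet n) → (∀ z → ⟦ f z ⟧ + ⟦ g z ⟧ ≤ ⟦ h z ⟧) → countB f + countB g ≤ countB h
  countB-+≤ f g h p rewrite countB≡ f | countB≡ g | countB≡ h =
    ≤-trans (≤-reflexive (sym (sumF-+ (λ z → ⟦ f z ⟧) (λ z → ⟦ g z ⟧)))) (sumF-mono p)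

  countB-mono : ∀ {n} (f g : BSet n) → (∀ z → z ∈ˢ f → z ∈ˢ g) → countB f ≤ countB g
  countB-mono f g p rewrite countB≡ f | countB≡ g = sumF-mono λ z → ⟦⟧-mono (p z)

  -- The summand `⟦ f a ⟧`, instead of 1, later makes an adjacency to the exceptional vertex
  -- provable: where the bound has no slack, `f a` must hold.
  countB-≤point : ∀ {n} (f g : BSet n) a → (∀ z → z ∈ˢ f → z ≢ a → z ∈ˢ g) → countB f ≤ countB g + ⟦ f a ⟧
  countB-≤point f g a p rewrite countB≡ f | countB≡ g =
    ≤-trans (sumF-mono q) (≤-reflexive (trans (sumF-+ (λ z → ⟦ g z ⟧) (λ z → ⟦ z == a ⟧ * ⟦ f z ⟧))
                                              (cong (sumF (λ z → ⟦ g z ⟧) +_) (sumF-point a (λ z → ⟦ f z ⟧)))))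
    where
    q : ∀ z → ⟦ f z ⟧ ≤ ⟦ g z ⟧ + ⟦ z == a ⟧ * ⟦ f z ⟧
    q z with z ≟ a
    ... | yes refl = ≤-trans (≤-reflexive (sym (*-identityˡ _))) (m≤n+m _ ⟦ g z ⟧)
    ... | no z≢a = ≤-trans (⟦⟧-mono λ r → p z r z≢a) (m≤m+n _ _)

  countB-point : ∀ {n} (a : Fin n) → countB (_== a) ≡ 1
  countB-point {n} a = trans (countB≡ (_== a)) (trans (sumF-cong {n} λ z → sym (*-identityʳ ⟦ z == a ⟧)) (sumF-point a (λ _ → 1)))

  countB-∖≤ : ∀ {n} (f : BSet n) a → countB f ≤ suc (countB (f ∖ a))
  countB-∖≤ f a = linear (countB f ∷ ⟦ f a ⟧ ∷ countB (f ∖ a) ∷ []) (# 0 ⊕ # 1) (# 2 ⊕ # 1 ⊕ κ 1) (# 0) (κ 1 ⊕ # 2) (countB-≤point f (f ∖ a) a (λ z q r → ∖-i {S = f} q r) ⊞ ⟦⟧≤1 (f a))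

  countB-∖ : ∀ {n} (f : BSet n) {a} → a ∈ˢ f → countB f ≡ suc (countB (f ∖ a))
  countB-∖ f {a} p = ≤-antisym (countB-∖≤ f a)
    (linear (countB (f ∖ a) ∷ countB (_== a) ∷ countB f ∷ []) (# 0 ⊕ # 1 ⊕ κ 1) (# 2 ⊕ # 1) (κ 1 ⊕ # 0) (# 2) (countB-+≤ (f ∖ a) (_== a) f q ⊞ ≡≥ (countB-point a)))
    where
    q : ∀ z → ⟦ (f ∖ a) z ⟧ + ⟦ z == a ⟧ ≤ ⟦ f z ⟧
    q z with z ≟ a
    ... | yes refl rewrite p = ≤-refl
    ... | no _ with f z
    ...   | true = ≤-refl
    ...   | false = ≤-refl

  countB-< : ∀ {n} (f g : BSet n) a → (∀ z → z ∈ˢ f → z ∈ˢ g) → a ∉ˢ f → a ∈ˢ g → countB f < countB g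
  countB-< f g a p q r = ≤-trans (s≤s (countB-mono f (g ∖ a) λ z s → ∖-i {S = g} (p z s) λ { refl → t≢f s q })) (≤-reflexive (sym (countB-∖ g r)))

  countB-false : ∀ {n} (f : BSet n) → (∀ z → z ∉ˢ f) → countB f ≡ 0
  countB-false {n} f p = trans (countB≡ f) (sumF-0 {n} λ z → ⟦⟧-false (p z))

  countB-true : ∀ n → countB {n} (λ _ → true) ≡ n
  countB-true zero    = refl
  countB-true (suc n) = cong suc (countB-true n)

  countB-pos : ∀ {n} (f : BSet n) {a} → a ∈ˢ f → 1 ≤ countB f
  countB-pos f p = ≤-trans (s≤s z≤n) (≤-reflexive (sym (countB-∖ f p)))

  pick : ∀ {n} (f : BSet n) → 1 ≤ countB f → ∃[ a ] a ∈ˢ f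
  pick f p with any? (λ a → f a ≟ᵇ true)
  ... | yes q = q
  ... | no ¬q = ⊥-elim (1≰0 (≤-trans p (≤-reflexive (countB-false f λ z → ¬t⇒f λ r → ¬q (z , r)))))

  pick≢ : ∀ {n} (f : BSet n) b → 2 ≤ countB f → ∃[ a ] (a ∈ˢ f × a ≢ b)
  pick≢ f b p with pick (f ∖ b) (linear (countB f ∷ countB (f ∖ b) ∷ []) (κ 2 ⊕ # 0) (# 0 ⊕ (κ 1 ⊕ # 1)) (κ 1) (# 1) (p ⊞ countB-∖≤ f b))
  ... | a , q = a , ∖-e {S = f} q

  pick≢₂ : ∀ {n} (f : BSet n) b c → 3 ≤ countB f → ∃[ a ] (a ∈ˢ f × a ≢ b × a ≢ c)
  pick≢₂ f b c p with pick≢ (f ∖ b) c (linear (countB f ∷ countB (f ∖ b) ∷ []) (κ 3 ⊕ # 0) (# 0 ⊕ (κ 1 ⊕ # 1)) (κ 2) (# 1) (p ⊞ countB-∖≤ f b))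
  ... | a , q , r = a , proj₁ (∖-e {S = f} q) , proj₂ (∖-e {S = f} q) , r

-- Lists as multisets

cnt : ∀ {n} → Fin n → List (Fin n) → ℕ
cnt z []       = 0
cnt z (w ∷ ws) = ⟦ z == w ⟧ + cnt z ws

infix 4 _⊑_
-- Free of repetitions and contained in `S`, expressed by one inequality between multiplicities,
-- which `linear` can add to others.
record _⊑_ {n} (l : List (Fin n)) (S : BSet n) : Set where
  constructor ⊑-i
  field ⊑-e : ∀ z → cnt z l ≤ ⟦ S z ⟧
open _⊑_ public

abstract
  cnt-++ : ∀ {n} (z : Fin n) xs ys → cnt z (xs ++ ys) ≡ cnt z xs + cnt z ys
  cnt-++ z []       ys = refl
  cnt-++ z (x ∷ xs) ys = trans (cong (⟦ z == x ⟧ +_) (cnt-++ z xs ys)) (sym (+-assoc ⟦ z == x ⟧ _ _))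

  length≡ : ∀ {n} (l : List (Fin n)) → length l ≡ sumF (λ z → cnt z l)
  length≡ {n} []      = sym (sumF-0 {n} λ _ → refl)
  length≡ {n} (w ∷ l) = trans (cong₂ _+_ (sym one) (length≡ l)) (sym (sumF-+ (λ z → ⟦ z == w ⟧) (λ z → cnt z l)))
    where
    one : sumF (λ z → ⟦ z == w ⟧) ≡ 1
    one = trans (sumF-cong {n} λ z → sym (*-identityʳ ⟦ z == w ⟧)) (sumF-point w (λ _ → 1))

cntB : ∀ {n} → BSet n → List (Fin n) → ℕ
cntB P []       = 0
cntB P (w ∷ ws) = ⟦ P w ⟧ + cntB P ws

cntB≡ : ∀ {n} (P : BSet n) l → cntB P l ≡ sumF (λ z → cnt z l * ⟦ P z ⟧)
cntB≡ {n} P []      = sym (sumF-0 {n} λ _ → refl)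
cntB≡ P (w ∷ l) = trans (cong₂ _+_ (sym (sumF-point w (λ z → ⟦ P z ⟧))) (cntB≡ P l))
  (trans (sym (sumF-+ (λ z → ⟦ z == w ⟧ * ⟦ P z ⟧) (λ z → cnt z l * ⟦ P z ⟧)))
         (sumF-cong λ z → sym (*-distribʳ-+ ⟦ P z ⟧ ⟦ z == w ⟧ (cnt z l))))

abstract
  ⊑-mono : ∀ {n} {l} {S T : BSet n} → l ⊑ S → (∀ z → z ∈ˢ S → z ∈ˢ T) → l ⊑ T
  ⊑-mono p q = ⊑-i λ z → ≤-trans (⊑-e p z) (⟦⟧-mono (q z))

  ⊑-∷ : ∀ {n} {l} {S : BSet n} {a} → a ∈ˢ S → l ⊑ S ∖ a → a ∷ l ⊑ S
  ⊑-∷ {l = l} {S} {a} p q = ⊑-i go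
    where
    go : ∀ z → cnt z (a ∷ l) ≤ ⟦ S z ⟧
    go z with ⊑-e q z
    ... | r with z ≟ a
    ...   | yes refl rewrite p = s≤s r
    ...   | no _ with S z
    ...     | true  = r
    ...     | false = r

  ⊑-[] : ∀ {n} {S : BSet n} → [] ⊑ S
  ⊑-[] = ⊑-i λ z → z≤n

  ⊑-∈ : ∀ {n} {l} {S : BSet n} {z} → l ⊑ S → 1 ≤ cnt z l → z ∈ˢ S
  ⊑-∈ {z = z} p q = ⟦⟧≥1 (≤-trans q (⊑-e p z))

  ⊑-++ : ∀ {n} {l l'} {S T W : BSet n} → l ⊑ S → l' ⊑ T →
         (∀ z → z ∈ˢ S → z ∈ˢ W × z ∉ˢ T) → (∀ z → z ∈ˢ T → z ∈ˢ W) → l ++ l' ⊑ W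
  ⊑-++ {l = l} {l'} {S} {T} {W} p q r s = ⊑-i go
    where
    go : ∀ z → cnt z (l ++ l') ≤ ⟦ W z ⟧
    go z rewrite cnt-++ z l l' with ⊑-e p z | ⊑-e q z | r z | s z
    ... | p' | q' | r' | s' with S z
    ...   | true rewrite proj₁ (r' refl) | proj₂ (r' refl) = ≤-trans (p' ⊞ q') ≤-refl
    ...   | false with T z
    ...     | true  rewrite s' refl = p' ⊞ q'
    ...     | false = ≤-trans (p' ⊞ q') z≤n

  cnt-reverse : ∀ {n} (z : Fin n) l → cnt z (reverse l) ≡ cnt z l
  cnt-reverse z []      = refl
  cnt-reverse z (w ∷ l) rewrite unfold-reverse w l | cnt-++ z (reverse l) [ w ] | cnt-reverse z l | +-identityʳ ⟦ z == w ⟧ =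
    +-comm (cnt z l) ⟦ z == w ⟧

  ⊑-reverse : ∀ {n} {l} {S : BSet n} → l ⊑ S → reverse l ⊑ S
  ⊑-reverse {l = l} p = ⊑-i λ z → ≤-trans (≤-reflexive (cnt-reverse z l)) (⊑-e p z)

  cnt-∈ : ∀ {n} (z : Fin n) l → 1 ≤ cnt z l → ∃[ l₁ ] ∃[ l₂ ] l ≡ l₁ ++ z ∷ l₂
  cnt-∈ z (w ∷ l) p with z ≟ w
  ... | yes refl = [] , l , refl
  ... | no _ with cnt-∈ z l p
  ...   | l₁ , l₂ , refl = w ∷ l₁ , l₂ , refl

  cnt-mid : ∀ {n} (z : Fin n) l₁ l₂ → 1 ≤ cnt z (l₁ ++ z ∷ l₂)
  cnt-mid z l₁ l₂ rewrite cnt-++ z l₁ (z ∷ l₂) | ==-refl z = ≤-trans (s≤s z≤n) (m≤n+m _ (cnt z l₁))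

-- Walks, reachability and separation by one vertex

Rel : ℕ → Set
Rel n = Fin n → Fin n → Bool

Symm : ∀ {n} → Rel n → Set
Symm E = ∀ {u v} → E u v ≡ true → E v u ≡ true

-- Ch E u l v: the vertices of l are the interior vertices of a walk from u to v.
Ch : ∀ {n} → Rel n → Fin n → List (Fin n) → Fin n → Set
Ch E u []      v = E u v ≡ true
Ch E u (w ∷ l) v = E u w ≡ true × Ch E w l v

abstract
  Ch-++ : ∀ {n} (E : Rel n) {u w v} l {l'} → Ch E u l w → Ch E w l' v → Ch E u (l ++ w ∷ l') v
  Ch-++ E []      p q = p , q
  Ch-++ E (x ∷ l) p q = proj₁ p , Ch-++ E l (proj₂ p) q

  Ch-split : ∀ {n} (E : Rel n) {u w v} l {l'} → Ch E u (l ++ w ∷ l') v → Ch E u l w × Ch E w l' v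
  Ch-split E []      p = p
  Ch-split E (x ∷ l) p with Ch-split E l (proj₂ p)
  ... | q , r = (proj₁ p , q) , r

  Ch-reverse : ∀ {n} (E : Rel n) → Symm E → ∀ {u v} l → Ch E u l v → Ch E v (reverse l) u
  Ch-reverse E s []      p = s p
  Ch-reverse E s {u} {v} (x ∷ l) p rewrite unfold-reverse x l =
    Ch-++ E (reverse l) (Ch-reverse E s l (proj₂ p)) (s (proj₁ p))

data Rc {n} (E : Rel n) (S : BSet n) : Fin n → Fin n → Set where
  here : ∀ {u} → u ∈ˢ S → Rc E S u u
  step : ∀ {u w v} → u ∈ˢ S → E u w ≡ true → Rc E S w v → Rc E S u v

module _ {n} {E : Rel n} where
  Rc-l : ∀ {S u v} → Rc E S u v → u ∈ˢ S
  Rc-l (here p) = p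
  Rc-l (step p _ _) = p

  Rc-r : ∀ {S u v} → Rc E S u v → v ∈ˢ S
  Rc-r (here p) = p
  Rc-r (step _ _ r) = Rc-r r

  Rc-trans : ∀ {S u v w} → Rc E S u v → Rc E S v w → Rc E S u w
  Rc-trans (here _) q = q
  Rc-trans (step a b p) q = step a b (Rc-trans p q)

  Rc-mono : ∀ {S T u v} → (∀ z → z ∈ˢ S → z ∈ˢ T) → Rc E S u v → Rc E T u v
  Rc-mono f (here p) = here (f _ p)
  Rc-mono f (step p e r) = step (f _ p) e (Rc-mono f r)

  Rc-sym : Symm E → ∀ {S u v} → Rc E S u v → Rc E S v u
  Rc-sym s (here p) = here p
  Rc-sym s (step p e r) = Rc-trans (Rc-sym s r) (step (Rc-l r) (s e) (here p))

  -- The second alternative is the part of the walk after its last visit to `u`.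
  Rc-leave : ∀ {S u w v} → Rc E S w v → v ≢ u → Rc E (S ∖ u) w v ⊎ (∃[ w' ] (E u w' ≡ true × Rc E (S ∖ u) w' v))
  Rc-leave {S} {u} (here p) q = inj₁ (here (∖-i {S = S} p q))
  Rc-leave {S} {u} {w} (step p e r) q with Rc-leave {u = u} r q
  ... | inj₂ x = inj₂ x
  ... | inj₁ x with w ≟ u
  ...   | yes refl = inj₂ (_ , e , x)
  ...   | no w≢u = inj₁ (step (∖-i {S = S} p w≢u) e x)

  Rc-step : ∀ {S u v} → Rc E S u v → v ≢ u → ∃[ w ] (E u w ≡ true × Rc E (S ∖ u) w v)
  Rc-step {S} {u} r q with Rc-leave {u = u} r q
  ... | inj₂ x = x
  ... | inj₁ x = ⊥-elim (proj₂ (∖-e {S = S} (Rc-l x)) refl)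

  -- Exhaustive search. Removing `u` before going on loses nothing, by `Rc-step`, and lets the fuel
  -- decrease.
  Rc-dec : ∀ N S → countB S ≤ N → ∀ u v → Dec (Rc E S u v)
  Rc-dec N S h u v with true⊎false (S u)
  ... | inj₂ p = no λ r → t≢f (Rc-l r) p
  Rc-dec zero S h u v | inj₁ p = ⊥-elim (1≰0 (≤-trans (countB-pos S p) h))
  Rc-dec (suc N) S h u v | inj₁ p with v ≟ u
  ... | yes refl = yes (here p)
  ... | no q with any? (λ w → dec× (E u w ≟ᵇ true) (Rc-dec N (S ∖ u) (≤-pred (≤-trans (≤-reflexive (sym (countB-∖ S p))) h)) w v))
    where
    dec× : ∀ {A B : Set} → Dec A → Dec B → Dec (A × B)
    dec× (yes a) (yes b) = yes (a , b)
    dec× (no a) _ = no λ x → a (proj₁ x)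
    dec× _ (no b) = no λ x → b (proj₂ x)
  ...   | yes (w , e , r) = yes (step p e (Rc-mono (λ z m → proj₁ (∖-e {S = S} m)) r))
  ...   | no ¬r = no λ r → ¬r (Rc-step r q)

  rc? : ∀ S u v → Dec (Rc E S u v)
  rc? S = Rc-dec (countB S) S ≤-refl

  -- Each recursive call works in `S ∖ u`, so no vertex occurs twice. The target `t` may lie outside
  -- `S`, and `s` is the last interior vertex unless it is the start.
  Rc-simple : ∀ N {S u s t} → countB S ≤ N → Rc E S u s → E s t ≡ true → ∃[ l ] (Ch E u l t × l ⊑ S ∖ u)
  Rc-simple zero {S} h r e = ⊥-elim (1≰0 (≤-trans (countB-pos S (Rc-l r)) h))
  Rc-simple (suc N) {S} {u} {s} h r e with s ≟ u
  ... | yes refl = [] , e , ⊑-[]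
  ... | no q with Rc-step r q
  ...   | w , e' , r' with Rc-simple N (≤-pred (≤-trans (≤-reflexive (sym (countB-∖ S (Rc-l r)))) h)) r' e
  ...     | l , c , m = w ∷ l , (e' , c) , ⊑-∷ (Rc-l r') m

  simple : ∀ {S u s t} → Rc E S u s → E s t ≡ true → ∃[ l ] (Ch E u l t × l ⊑ S ∖ u)
  simple {S} = Rc-simple (countB S) ≤-refl

  Rc-hit : ∀ {S u v} T → Rc E S u v → u ∉ˢ T → v ∈ˢ T → ∃[ s ] ∃[ t ] (Rc E (S − T) u s × E s t ≡ true × t ∈ˢ T × t ∈ˢ S)
  Rc-hit T (here p) q q' = ⊥-elim (t≢f q' q)
  Rc-hit {S} T (step {w = w} p e r) q q' with true⊎false (T w)
  ... | inj₁ m = _ , w , here (−-i {S = S} {T} p q) , e , m , Rc-l r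
  ... | inj₂ m with Rc-hit T r m q'
  ...   | s , t , x , y = s , t , step (−-i {S = S} {T} p q) e x , y

  Rc-hit₁ : ∀ {S u v} → Rc E S u v → u ≢ v → ∃[ s ] (Rc E (S ∖ v) u s × E s v ≡ true)
  Rc-hit₁ {v = v} r q with Rc-hit (_== v) r (≢⇒==f q) (==-refl v)
  ... | s , t , x , e , m , _ rewrite ==⇒≡ m = s , x , e

  -- `z` separates `D` from the rest of `S`.
  ClosedIn : BSet n → BSet n → Fin n → Set
  ClosedIn S D z = ∀ {p q} → p ∈ˢ D → E p q ≡ true → q ∈ˢ S → q ∈ˢ D ⊎ q ≡ z

  stay : ∀ {S D z u v} → ClosedIn S D z → z ∉ˢ S → Rc E S u v → u ∈ˢ D → Rc E D u v
  stay cl z (here p) d = here d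
  stay cl z (step p e r) d with cl d e (Rc-l r)
  ... | inj₁ x = step d e (stay cl z r x)
  ... | inj₂ refl = ⊥-elim (t≢f (Rc-l r) z)

  module _ (E-sym : Symm E) where
    -- An excursion into `D` begins and ends at `z`, so it can be cut out; a walk that starts inside
    -- `D` comes out at `z`.
    avoid : ∀ {S D z u v} → ClosedIn S D z → z ∉ˢ D → v ∉ˢ D → Rc E S u v →
            (u ∉ˢ D → Rc E (S − D) u v) × (u ∈ˢ D → Rc E (S − D) z v)
    avoid {S} {D} cl z v (here p) = (λ u → here (−-i {S = S} {D} p u)) , λ u → ⊥-elim (t≢f u v)
    avoid {S} {D} {z} {u} cl z∉ v (step {w = w} p e r) with avoid cl z∉ v r | true⊎false (D w)
    ... | i , j | inj₂ w∉ = (λ u∉ → step (−-i {S = S} {D} p u∉) e (i w∉)) , λ u∈ → back u∈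
      where
      back : u ∈ˢ D → Rc E (S − D) z _
      back u∈ with cl u∈ e (Rc-l r)
      ... | inj₁ w∈ = ⊥-elim (t≢f w∈ w∉)
      ... | inj₂ refl = i w∉
    ... | i , j | inj₁ w∈ = (λ u∉ → forth u∉) , λ _ → j w∈
      where
      forth : u ∉ˢ D → Rc E (S − D) u _
      forth u∉ with cl w∈ (E-sym e) p
      ... | inj₁ u∈ = ⊥-elim (t≢f u∈ u∉)
      ... | inj₂ refl = j w∈

⌊⌋-i : ∀ {A : Set} {d : Dec A} → A → ⌊ d ⌋ ≡ true
⌊⌋-i {d = yes _} _ = refl
⌊⌋-i {d = no ¬a} a = ⊥-elim (¬a a)

⌊⌋-e : ∀ {A : Set} {d : Dec A} → ⌊ d ⌋ ≡ true → A
⌊⌋-e {d = yes a} _ = a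

-- End blocks and long paths inside them

module Ends {n} (E : Rel n) (E-sym : Symm E) (E-irr : ∀ u → E u u ≡ false) where

  abstract
    comp : BSet n → Fin n → BSet n
    comp S a w = ⌊ rc? {E = E} S a w ⌋

    comp-e : ∀ {S a w} → w ∈ˢ comp S a → Rc E S a w
    comp-e {S} {a} {w} = ⌊⌋-e {d = rc? S a w}

    comp-i : ∀ {S a w} → Rc E S a w → w ∈ˢ comp S a
    comp-i {S} {a} {w} = ⌊⌋-i {d = rc? S a w}

  comp-from : ∀ {S a u w} → Rc E S a u → Rc E S u w → Rc E (comp S a) u w
  comp-from q (here p) = here (comp-i q)
  comp-from q (step p e r) = step (comp-i q) e (comp-from (Rc-trans q (step p e (here (Rc-l r)))) r)

  comp-conn : ∀ {S a} u w → u ∈ˢ comp S a → w ∈ˢ comp S a → Rc E (comp S a) u w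
  comp-conn u w p q = comp-from (comp-e p) (Rc-trans (Rc-sym E-sym (comp-e p)) (comp-e q))

  comp-closed : ∀ {S a y} → ClosedIn {E = E} S (comp (S ∖ y) a) y
  comp-closed {S} {a} {y} {p} {q} m e q∈ with q ≟ y
  ... | yes refl = inj₂ refl
  ... | no q≢y = inj₁ (comp-i (Rc-trans (comp-e m) (step (Rc-r (comp-e m)) e (here (∖-i {S = S} q∈ q≢y)))))

  out : ∀ {S D z u v} → ClosedIn {E = E} S D z → z ∉ˢ S → z ∉ˢ D → Rc E S u v → u ∉ˢ D → Rc E (S − D) u v
  out {S} {D} {z} {u} {v} cl z∉ z∉D r u∉ with true⊎false (D v)
  ... | inj₂ v∉ = proj₁ (avoid E-sym cl z∉D v∉ r) u∉
  ... | inj₁ v∈ = ⊥-elim (t≢f (Rc-r (stay cl z∉ (Rc-sym E-sym r) v∈)) u∉)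

  -- D together with y is 2-connected, except that y may have a single neighbour in D.
  record Rooted (D : BSet n) (y : Fin n) : Set where
    field
      y∉   : y ∉ˢ D
      conn : ∀ u v → u ∈ˢ D → v ∈ˢ D → Rc E D u v
      cut  : ∀ v u → v ∈ˢ D → u ∈ˢ D → u ≢ v → ∃[ s ] (Rc E (D ∖ v) u s × E s y ≡ true)
      att  : ∃[ s ] (s ∈ˢ D × E s y ≡ true)
  open Rooted public

  -- `access` leads from the root to `y` without entering the block; along it a path can later leave
  -- the block towards the cycle.
  record End (S D : BSet n) (y : Fin n) : Set where
    field
      set    : BSet n
      root   : Fin n
      rooted : Rooted set root
      sub    : ∀ z → z ∈ˢ set → z ∈ˢ D
      closedIn : ClosedIn {E = E} S set root
      access : root ≡ y ⊎ (root ∈ˢ D × ∃[ s ] (Rc E (D − set) root s × E s y ≡ true))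

  -- If some `v` cuts `u` off from `y`, the component of `u` in `D ∖ v` contains no neighbour of
  -- `y`, so `v` alone separates it from the rest of `S`. The search continues with this smaller set
  -- and the root `v`.
  shrink : ∀ N S D y → countB D ≤ N → (∀ z → z ∈ˢ D → z ∈ˢ S) → y ∉ˢ D → ClosedIn {E = E} S D y →
           (∀ u v → u ∈ˢ D → v ∈ˢ D → Rc E D u v) → ∃[ s ] (s ∈ˢ D × E s y ≡ true) → End S D y
  shrink zero S D y h D⊆S y∉ cl cn (s , s∈ , _) = ⊥-elim (1≰0 (≤-trans (countB-pos D s∈) h))
  shrink (suc N) S D y h D⊆S y∉ cl cn (s , s∈ , esy)
    with any? (λ v → any? (λ u → (D v ≟ᵇ true) ×-dec ((D u ≟ᵇ true) ×-dec (¬? (u ≟ v) ×-dec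
           ¬? (any? (λ t → rc? {E = E} (D ∖ v) u t ×-dec (E t y ≟ᵇ true)))))))
  ... | no good = record { set = D ; root = y ; rooted = record { y∉ = y∉ ; conn = cn ; cut = ct ; att = s , s∈ , esy }
                         ; sub = λ z p → p ; closedIn = cl ; access = inj₁ refl }
    where
    ct : ∀ v u → v ∈ˢ D → u ∈ˢ D → u ≢ v → ∃[ t ] (Rc E (D ∖ v) u t × E t y ≡ true)
    ct v u v∈ u∈ u≢v with any? (λ t → rc? {E = E} (D ∖ v) u t ×-dec (E t y ≟ᵇ true))
    ... | yes p = p
    ... | no ¬p = ⊥-elim (good (v , u , v∈ , u∈ , u≢v , ¬p))
  ... | yes (v , u , v∈ , u∈ , u≢v , bad) =
    widen (shrink N S D₁ v (≤-pred (≤-trans (countB-< D₁ D v D₁⊆D v∉ v∈) h)) (λ z p → D⊆S z (D₁⊆D z p)) v∉ cl₁ comp-conn at₁)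
    where
    D₁ : BSet n
    D₁ = comp (D ∖ v) u
    D₁⊆ : ∀ z → z ∈ˢ D₁ → z ∈ˢ D ∖ v
    D₁⊆ z p = Rc-r (comp-e p)
    D₁⊆D : ∀ z → z ∈ˢ D₁ → z ∈ˢ D
    D₁⊆D z p = proj₁ (∖-e {S = D} (D₁⊆ z p))
    v∉ : v ∉ˢ D₁
    v∉ = ¬t⇒f λ p → proj₂ (∖-e {S = D} (D₁⊆ v p)) refl
    no-y : ∀ {p} → p ∈ˢ D₁ → E p y ≡ true → ⊥
    no-y p e = bad (_ , comp-e p , e)
    clD : ClosedIn {E = E} D D₁ v
    clD = comp-closed
    cl₁ : ClosedIn {E = E} S D₁ v
    cl₁ {p} {q} m e q∈ with cl (D₁⊆D p m) e q∈
    ... | inj₁ q∈D = clD m e q∈D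
    ... | inj₂ refl = ⊥-elim (no-y m e)
    at₁ : ∃[ t ] (t ∈ˢ D₁ × E t v ≡ true)
    at₁ with Rc-hit₁ (cn u v u∈ v∈) u≢v
    ... | t , r , e = t , comp-i r , e
    s∉ : s ∉ˢ D₁
    s∉ = ¬t⇒f λ p → no-y p esy
    widen : End S D₁ v → End S D y
    widen e = record { set = set ; root = root ; rooted = rooted ; sub = λ z p → D₁⊆D z (sub z p) ; closedIn = closedIn ; access = inj₂ (acc access) }
      where
      open End e
      up : ∀ z → z ∈ˢ D − D₁ → z ∈ˢ D − set
      up z p = −-i {S = D} {set} (proj₁ (−-e {S = D} {D₁} p)) (¬t⇒f λ q → t≢f (sub z q) (proj₂ (−-e {S = D} {D₁} p)))
      up' : ∀ z → z ∈ˢ D₁ − set → z ∈ˢ D − set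
      up' z p = −-i {S = D} {set} (D₁⊆D z (proj₁ (−-e {S = D₁} {set} p))) (proj₂ (−-e {S = D₁} {set} p))
      v→s : Rc E (D − set) v s
      v→s = Rc-mono up (proj₁ (avoid E-sym clD v∉ s∉ (cn v s v∈ s∈)) v∉)
      acc : root ≡ v ⊎ (root ∈ˢ D₁ × ∃[ t ] (Rc E (D₁ − set) root t × E t v ≡ true)) →
            root ∈ˢ D × ∃[ t ] (Rc E (D − set) root t × E t y ≡ true)
      acc (inj₁ q) = subst (_∈ˢ D) (sym q) v∈ , s , subst (λ r → Rc E (D − set) r s) (sym q) v→s , esy
      acc (inj₂ (r∈ , t , r , e)) = D₁⊆D _ r∈ , s , Rc-trans (Rc-mono up' r) (step (up' t (Rc-r r)) e v→s) , esy

  nb : Fin n → BSet n → ℕ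
  nb u D = countB (λ z → E u z ∧ D z)

  nb< : ∀ u D → u ∈ˢ D → nb u D < countB D
  nb< u D p = countB-< (λ z → E u z ∧ D z) D u (λ z q → proj₂ (∧-e q)) (¬t⇒f λ q → t≢f (proj₁ (∧-e q)) (E-irr u)) p

  nb-≤ : ∀ u D D' z → (∀ w → w ∈ˢ D → E u w ≡ true → w ≢ z → w ∈ˢ D') → nb u D ≤ nb u D' + ⟦ E u z ⟧
  nb-≤ u D D' z p = ≤-trans (countB-≤point (λ w → E u w ∧ D w) (λ w → E u w ∧ D' w) z
      (λ w q r → ∧-i (proj₁ (∧-e q)) (p w (proj₂ (∧-e q)) (proj₁ (∧-e q)) r)))
    (+-monoʳ-≤ (nb u D') (⟦⟧-mono λ q → proj₁ (∧-e q)))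

  -- The value `len` adds the weight of the end to the number of vertices between the root and the
  -- end. In the application `τ` counts neighbours on the cycle.
  record Route (D : BSet n) (y : Fin n) (τ : Fin n → ℕ) : Set where
    field
      end      : Fin n
      via      : List (Fin n)
      end∈     : end ∈ˢ D
      path     : Ch E y via end
      within   : via ⊑ D ∖ end
      attached : 1 ≤ τ end
    len : ℕ
    len = length via + τ end
  open Route

  -- Together with `Degrees` this forces equality: every vertex of `D` is joined to `y` and to all
  -- others of `D`, and `countB D + τ v` equals `d`.
  Tight : BSet n → ℕ → (Fin n → ℕ) → Set
  Tight D d τ = ∀ v → v ∈ˢ D → countB D + τ v ≤ d

  -- The second alternative does occur: if `D` with `y` is complete and tight, a path through all of
  -- `D` has `countB D - 1` vertices before its end, hence value `d - 1`.
  LongRoute : BSet n → Fin n → ℕ → (Fin n → ℕ) → Set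
  LongRoute D y d τ = Σ (Route D y τ) λ r → d ≤ len r ⊎ (d ≤ suc (len r) × Tight D d τ)

  Degrees : BSet n → Fin n → ℕ → (Fin n → ℕ) → Set
  Degrees D y d τ = ∀ u → u ∈ˢ D → d ≤ nb u D + ⟦ E u y ⟧ + τ u

  module Step {N} (IH : ∀ D y d τ → countB D ≤ N → Rooted D y → Degrees D y d τ →
                        (∃[ u ] (u ∈ˢ D × 1 ≤ τ u)) → LongRoute D y d τ)
              {D y d τ} (|D| : countB D ≤ suc N) (R : Rooted D y) (deg : Degrees D y (suc d) τ)
              (u₀ : Fin n) (u₀∈ : u₀ ∈ˢ D) (u₀-att : 1 ≤ τ u₀) where

    abstract
      -- Weight 1 at `x` alone forces the route to end at `x`, so `D'` is crossed between `x` and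
      -- the root. Tightness at `x` would require more neighbours than `D'` and `z` offer.
      through : ∀ {d' D' z x} → countB D' ≤ N → Rooted D' z → (∀ u → u ∈ˢ D' → d' ≤ nb u D' + ⟦ E u z ⟧) → x ∈ˢ D' →
             ∃[ l ] (Ch E x l z × (x ∷ l) ⊑ D' × d' ≤ suc (length l))
      through {d'} {D'} {z} {x} |D'| R' deg' x∈ with IH D' z d' (λ v → ⟦ v == x ⟧) |D'| R'
          (λ u p → ≤-trans (deg' u p) (m≤m+n _ _)) (x , x∈ , ≤-reflexive (sym (⟦⟧-true (==-refl x))))
      ... | r , alt with ==⇒≡ (⟦⟧≥1 (attached r))
      ...   | refl = reverse (via r) , Ch-reverse E E-sym (via r) (path r) , ⊑-∷ x∈ (⊑-reverse (within r))
                    , ≤-trans (bound alt) (≤-reflexive (cong suc (sym (length-reverse (via r)))))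
        where
        bound : d' ≤ len r ⊎ (d' ≤ suc (len r) × Tight D' d' (λ v → ⟦ v == x ⟧)) → d' ≤ suc (length (via r))
        bound (inj₁ p) = linear (d' ∷ ⟦ x == x ⟧ ∷ length (via r) ∷ []) (# 0 ⊕ # 1) (# 2 ⊕ # 1 ⊕ κ 1) (# 0) (κ 1 ⊕ # 2) (p ⊞ ⟦⟧≤1 (x == x))
        bound (inj₂ (_ , q)) = ⊥-elim (1≰0 (linear (countB D' ∷ ⟦ x == x ⟧ ∷ d' ∷ nb x D' ∷ ⟦ E x z ⟧ ∷ []) (# 0 ⊕ # 1 ⊕ (κ 1 ⊕ (# 2 ⊕ (κ 1 ⊕ # 3 ⊕ # 4)))) (# 2 ⊕ (# 1 ⊕ (# 3 ⊕ # 4 ⊕ (# 0 ⊕ κ 1)))) (κ 1) (κ 0) (q x x∈ ⊞ ≡≥ (⟦⟧-true (==-refl x)) ⊞ deg' x x∈ ⊞ nb< x D' x∈ ⊞ ⟦⟧≤1 (E x z))))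

    module Cut (v a b : Fin n) (v∈ : v ∈ˢ D) (a∈ : a ∈ˢ D ∖ v) (b∈ : b ∈ˢ D ∖ v) (¬ab : ¬ Rc E (D ∖ v) a b) where
      D₁ = comp (D ∖ v) a
      D₁⊆ : ∀ z → z ∈ˢ D₁ → z ∈ˢ D ∖ v
      D₁⊆ z p = Rc-r (comp-e p)
      D₁⊆D : ∀ z → z ∈ˢ D₁ → z ∈ˢ D
      D₁⊆D z p = proj₁ (∖-e {S = D} (D₁⊆ z p))
      v∉ : v ∉ˢ D₁
      v∉ = ¬t⇒f λ p → proj₂ (∖-e {S = D} (D₁⊆ v p)) refl
      at₁ : ∃[ t ] (t ∈ˢ D₁ × E t v ≡ true)
      at₁ with Rc-hit₁ (conn R a v (proj₁ (∖-e {S = D} a∈)) v∈) (proj₂ (∖-e {S = D} a∈))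
      ... | t , r , e = t , comp-i r , e
      D₁<D = countB-< D₁ D v D₁⊆D v∉ v∈
      end₁ : End D D₁ v
      end₁ = shrink N D D₁ v (≤-pred (≤-trans D₁<D |D|)) D₁⊆D v∉ comp-closed comp-conn at₁
      b∈D = proj₁ (∖-e {S = D} b∈)
      b∉₁ : b ∉ˢ D₁
      b∉₁ = ¬t⇒f λ p → ¬ab (comp-e p)

    module Detour (v a b : Fin n) (v∈ : v ∈ˢ D) (a∈ : a ∈ˢ D ∖ v) (b∈ : b ∈ˢ D ∖ v) (¬ab : ¬ Rc E (D ∖ v) a b)
                  (e₁ : End D (comp (D ∖ v) a) v) where
      open Cut v a b v∈ a∈ b∈ ¬ab
      open End e₁ renaming (set to D'; root to z)
      |D'| : countB D' ≤ N
      |D'| = ≤-trans (countB-mono D' D₁ sub) (≤-pred (≤-trans D₁<D |D|))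
      D'⊆D : ∀ w → w ∈ˢ D' → w ∈ˢ D
      D'⊆D w p = D₁⊆D w (sub w p)
      z∈ : z ∈ˢ D
      z∈ with access
      ... | inj₁ q = subst (_∈ˢ D) (sym q) v∈
      ... | inj₂ (p , _) = D₁⊆D _ p
      b∉ : b ∉ˢ D'
      b∉ = ¬t⇒f λ p → t≢f (sub b p) b∉₁
      b≢z : b ≢ z
      b≢z q with access
      ... | inj₁ r = proj₂ (∖-e {S = D} b∈) (trans q r)
      ... | inj₂ (p , _) = t≢f (subst (_∈ˢ D₁) (sym q) p) b∉₁
      W : BSet n
      W = D ∖ z − D'
      W-e : ∀ {w} → w ∈ˢ W → w ∈ˢ D × w ≢ z × w ∉ˢ D'
      W-e p with −-e {S = D ∖ z} {D'} p
      ... | q , r = proj₁ (∖-e {S = D} q) , proj₂ (∖-e {S = D} q) , r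
      clz : ClosedIn {E = E} (D ∖ z) D' z
      clz m e q = closedIn m e (proj₁ (∖-e {S = D} q))
      out' : ∀ {p q} → Rc E (D ∖ z) p q → p ∉ˢ D' → Rc E W p q
      out' = out clz (∖-self D z) (y∉ rooted)
      detour : ∃[ s ] ∃[ l ] (E y s ≡ true × Ch E s l z × (s ∷ l) ⊑ W)
      detour with cut R z b z∈ b∈D b≢z | Rc-hit₁ (conn R b z b∈D z∈) b≢z
      ... | s , r , e | s' , r' , e' with simple (Rc-trans (Rc-sym E-sym (out' r b∉)) (out' r' b∉)) e'
      ...   | l , c , m = s , l , E-sym e , c , ⊑-∷ (Rc-r (out' r b∉)) m
      deg' : ∀ u → u ∈ˢ D' → d ≤ nb u D' + ⟦ E u z ⟧ + τ u
      deg' u p = linear (d ∷ nb u D ∷ ⟦ E u y ⟧ ∷ τ u ∷ nb u D' ∷ ⟦ E u z ⟧ ∷ []) (κ 1 ⊕ # 0 ⊕ (# 1 ⊕ # 2)) (# 1 ⊕ # 2 ⊕ # 3 ⊕ (# 4 ⊕ # 5 ⊕ κ 1)) (# 0) (# 4 ⊕ # 5 ⊕ # 3) (deg u (D'⊆D u p) ⊞ nb-≤ u D D' z (λ w q e r → [ (λ x → x) , (λ x → ⊥-elim (r x)) ]′ (closedIn p e q)) ⊞ ⟦⟧≤1 (E u y))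

      -- `D'` is an end block of `D` behind a cut vertex. If it carries weight, go from `y` around
      -- `D'` to its root `z` and use induction inside: the two extra vertices `s` and `z` pay for
      -- the lost neighbour `y` and for a possible deficit of one. If it carries none, enter `D'`
      -- directly from `y`, cross it to `z`, and go on outside `D'` to `u₀`.
      result : LongRoute D y (suc d) τ
      result with any? (λ u → (D' u ≟ᵇ true) ×-dec (1 ≤? τ u))
      ... | yes (u , u∈ , uτ) with IH D' z d τ |D'| rooted deg' (u , u∈ , uτ) | detour
      ...   | r , alt | s , l , e , c , m = record
              { end = end r ; via = s ∷ l ++ z ∷ via r ; end∈ = D'⊆D _ (end∈ r)
              ; path = e , Ch-++ E l c (path r) ; within = inside ; attached = attached r }
              , inj₁ (linear (length l ∷ length (via r) ∷ d ∷ length (l ++ z ∷ via r) ∷ τ (end r) ∷ []) (# 0 ⊕ (κ 1 ⊕ # 1) ⊕ # 2) (# 3 ⊕ (κ 1 ⊕ (# 1 ⊕ # 4))) (κ 1 ⊕ # 2) (κ 1 ⊕ # 3 ⊕ # 4) (≡≥ (length-++ l {z ∷ via r}) ⊞ weak alt))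
        where
        weak : d ≤ len r ⊎ (d ≤ suc (len r) × Tight D' d τ) → d ≤ suc (len r)
        weak (inj₁ p) = ≤-trans p (n≤1+n _)
        weak (inj₂ (p , _)) = p
        T' : BSet n
        T' = D ∖ end r − W
        T'-i : ∀ {w} → w ∈ˢ D → w ≢ end r → w ∉ˢ W → w ∈ˢ T'
        T'-i p q x = −-i {S = D ∖ end r} {W} (∖-i {S = D} p q) x
        inside : (s ∷ l ++ z ∷ via r) ⊑ D ∖ end r
        inside = ⊑-++ {l = s ∷ l} {l' = z ∷ via r} {S = W} {T = T'} m
          (⊑-∷ (T'-i z∈ (λ q → ∈≢ D' (end∈ r) (y∉ rooted) (sym q)) (¬t⇒f λ p → proj₁ (proj₂ (W-e p)) refl))
               (⊑-mono (within r) λ w p → ∖-i {S = T'} (T'-i (D'⊆D w (proj₁ (∖-e {S = D'} p))) (proj₂ (∖-e {S = D'} p))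
                    (¬t⇒f λ q → t≢f (proj₁ (∖-e {S = D'} p)) (proj₂ (proj₂ (W-e q)))))
                 (∈≢ D' (proj₁ (∖-e {S = D'} p)) (y∉ rooted))))
          (λ w p → ∖-i {S = D} (proj₁ (W-e p)) (λ q → ∈≢ D' (end∈ r) (proj₂ (proj₂ (W-e p))) (sym q))
                 , ¬t⇒f λ q → t≢f p (proj₂ (−-e {S = D ∖ end r} {W} q)))
          (λ w p → proj₁ (−-e {S = D ∖ end r} {W} p))
      result | no none with far none
        where
        deg₀ : ¬ (∃[ u ] (u ∈ˢ D' × 1 ≤ τ u)) → ∀ u → u ∈ˢ D' → d ≤ nb u D' + ⟦ E u z ⟧
        deg₀ none u q = linear (d ∷ τ u ∷ nb u D' ∷ ⟦ E u z ⟧ ∷ []) (# 0 ⊕ # 1) (# 2 ⊕ # 3 ⊕ # 1 ⊕ κ 0) (# 0) (# 2 ⊕ # 3) (deg' u q ⊞ ≤-pred (≰⇒> λ t → none (u , q , t)))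
        far : ¬ (∃[ u ] (u ∈ˢ D' × 1 ≤ τ u)) → ∃[ x ] ∃[ l ] (E y x ≡ true × Ch E x l z × (x ∷ l) ⊑ D' × d ≤ suc (length l))
        far none with att rooted
        -- Without `z` the block can reach `y` only by an edge at a vertex `x` of the block itself.
        ... | p , p∈ , _ with cut R z p z∈ (D'⊆D p p∈) (∈≢ D' p∈ (y∉ rooted))
        ...   | x , r , e with through |D'| rooted
                                 (deg₀ none) (Rc-r (stay clz (∖-self D z) r p∈))
        ...     | l , c , m , d≤ = x , l , E-sym e , c , m , d≤
      ... | x , l , eyx , c , l-within , l-long = go (u₀ ≟ z)
        where
        u₀∉ : u₀ ∉ˢ D'
        u₀∉ = ¬t⇒f λ p → none (u₀ , p , u₀-att)
        go : Dec (u₀ ≡ z) → LongRoute D y (suc d) τ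
        go (yes u≡z) = record { end = z ; via = x ∷ l ; end∈ = z∈ ; path = eyx , c ; attached = subst (λ r → 1 ≤ τ r) u≡z u₀-att
               ; within = ⊑-mono l-within λ w p → ∖-i {S = D} (D'⊆D w p) (∈≢ D' p (y∉ rooted)) }
               , inj₁ (linear (d ∷ length l ∷ τ z ∷ []) (# 0 ⊕ κ 1) (κ 1 ⊕ # 1 ⊕ # 2) (κ 1 ⊕ # 0) (κ 1 ⊕ (# 1 ⊕ # 2)) (l-long ⊞ subst (λ r → 1 ≤ τ r) u≡z u₀-att))
        go (no u≢z) with Rc-hit₁ (conn R u₀ z u₀∈ z∈) u≢z
        ... | s , r , e with simple (out' r u₀∉) e
        ...   | l₂ , c₂ , m = record
               { end = u₀ ; via = x ∷ l ++ z ∷ reverse l₂ ; end∈ = u₀∈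
               ; path = eyx , Ch-++ E l c (Ch-reverse E E-sym l₂ c₂) ; attached = u₀-att ; within = inside }
               , inj₁ (linear (length l ∷ length (reverse l₂) ∷ d ∷ length (l ++ z ∷ reverse l₂) ∷ τ u₀ ∷ []) (# 0 ⊕ (κ 1 ⊕ # 1) ⊕ (# 2 ⊕ κ 1)) (# 3 ⊕ (κ 1 ⊕ # 0 ⊕ # 4)) (κ 1 ⊕ # 2) (κ 1 ⊕ # 3 ⊕ # 4) (≡≥ (length-++ l {z ∷ reverse l₂}) ⊞ l-long ⊞ u₀-att))
          where
          T' : BSet n
          T' = D ∖ u₀ − D'
          inside : (x ∷ l ++ z ∷ reverse l₂) ⊑ D ∖ u₀
          inside = ⊑-++ {l = x ∷ l} {l' = z ∷ reverse l₂} {S = D'} {T = T'} l-within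
            (⊑-∷ (−-i {S = D ∖ u₀} {D'} (∖-i {S = D} z∈ (λ q → u≢z (sym q))) (y∉ rooted))
              (⊑-reverse (⊑-mono m λ w p → ∖-i {S = T'}
                 (−-i {S = D ∖ u₀} {D'} (∖-i {S = D} (proj₁ (W-e (proj₁ (∖-e {S = W} p)))) (proj₂ (∖-e {S = W} p)))
                   (proj₂ (proj₂ (W-e (proj₁ (∖-e {S = W} p))))))
                 (proj₁ (proj₂ (W-e (proj₁ (∖-e {S = W} p))))))))
            (λ w p → ∖-i {S = D} (D'⊆D w p) (∈≢ D' p u₀∉) , ¬t⇒f λ q → t≢f p (proj₂ (−-e {S = D ∖ u₀} {D'} q)))
            (λ w p → proj₁ (−-e {S = D ∖ u₀} {D'} p))

    module NoCut (nc : ∀ v a b → v ∈ˢ D → a ∈ˢ D ∖ v → b ∈ˢ D ∖ v → Rc E (D ∖ v) a b) where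
      ∖⊆ : ∀ z w → w ∈ˢ D ∖ z → w ∈ˢ D
      ∖⊆ z w p = proj₁ (∖-e {S = D} p)

      -- The root moves to the neighbour `z` of `y`. As `D` has no cut vertex, `D ∖ z` is rooted at
      -- `z`. In the deficient case tightness passes from `D ∖ z` to all vertices of `D` except `z`.
      below : ∀ z r → z ∈ˢ D → E z y ≡ true → r ∈ˢ D → r ≢ z →
              LongRoute D y (suc d) τ ⊎ (Σ (Route D y τ) λ r → suc d ≤ suc (len r)) × (∀ v → v ∈ˢ D → v ≢ z → countB D + τ v ≤ suc d)
      below z r z∈ ezy r∈ r≢z = go (any? (λ u → (D' u ≟ᵇ true) ×-dec (1 ≤? τ u)))
        where
        D' = D ∖ z
        |D'| : countB D' ≤ N
        |D'| = ≤-pred (≤-trans (≤-reflexive (sym (countB-∖ D z∈))) |D|)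
        rz : ∃[ s ] (Rc E D' r s × E s z ≡ true)
        rz = Rc-hit₁ (conn R r z r∈ z∈) r≢z
        R' : Rooted D' z
        y∉ R' = ∖-self D z
        conn R' u v p q = nc z u v z∈ p q
        cut R' v u v∈ u∈ u≢v with Rc-hit₁ (nc v u z (∖⊆ z v v∈) (∖-i {S = D} (∖⊆ z u u∈) u≢v) (∖-i {S = D} z∈ λ { refl → proj₂ (∖-e {S = D} v∈) refl })) (proj₂ (∖-e {S = D} u∈))
        ... | s , q , e = s , Rc-mono (λ w p → let p₁ = ∖-e {S = D ∖ v} p ; p₂ = ∖-e {S = D} (proj₁ p₁) in
                                ∖-i {S = D'} (∖-i {S = D} (proj₁ p₂) (proj₂ p₁)) (proj₂ p₂)) q , e
        att R' = proj₁ rz , Rc-r (proj₁ (proj₂ rz)) , proj₂ (proj₂ rz)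
        deg' : ∀ u → u ∈ˢ D' → d ≤ nb u D' + ⟦ E u z ⟧ + τ u
        deg' u p = linear (d ∷ nb u D ∷ ⟦ E u y ⟧ ∷ τ u ∷ nb u D' ∷ ⟦ E u z ⟧ ∷ []) (κ 1 ⊕ # 0 ⊕ (# 1 ⊕ # 2)) (# 1 ⊕ # 2 ⊕ # 3 ⊕ (# 4 ⊕ # 5 ⊕ κ 1)) (# 0) (# 4 ⊕ # 5 ⊕ # 3) (deg u (∖⊆ z u p) ⊞ nb-≤ u D D' z (λ w q e x → ∖-i {S = D} q x) ⊞ ⟦⟧≤1 (E u y))
        deg₀ : ¬ (∃[ u ] (u ∈ˢ D' × 1 ≤ τ u)) → ∀ u → u ∈ˢ D' → d ≤ nb u D' + ⟦ E u z ⟧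
        deg₀ none u q = linear (d ∷ τ u ∷ nb u D' ∷ ⟦ E u z ⟧ ∷ []) (# 0 ⊕ # 1) (# 2 ⊕ # 3 ⊕ # 1 ⊕ κ 0) (# 0) (# 2 ⊕ # 3) (deg' u q ⊞ ≤-pred (≰⇒> λ t → none (u , q , t)))
        go : Dec (∃[ u ] (u ∈ˢ D' × 1 ≤ τ u)) → LongRoute D y (suc d) τ ⊎ (Σ (Route D y τ) λ r → suc d ≤ suc (len r)) × (∀ v → v ∈ˢ D → v ≢ z → countB D + τ v ≤ suc d)
        go (yes a) with IH D' z d τ |D'| R' deg' a
        ... | r' , alt = conv alt
          where
          ext : Route D y τ
          ext = record { end = end r' ; via = z ∷ via r' ; end∈ = ∖⊆ z _ (end∈ r') ; path = E-sym ezy , path r'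
            ; attached = attached r'
            ; within = ⊑-∷ (∖-i {S = D} z∈ λ q → proj₂ (∖-e {S = D} (end∈ r')) (sym q))
                (⊑-mono (within r') λ w p → let p₁ = ∖-e {S = D'} p ; p₂ = ∖-e {S = D} (proj₁ p₁) in
                                ∖-i {S = D ∖ end r'} (∖-i {S = D} (proj₁ p₂) (proj₂ p₁)) (proj₂ p₂)) }
          conv : d ≤ len r' ⊎ (d ≤ suc (len r') × Tight D' d τ) → LongRoute D y (suc d) τ ⊎ (Σ (Route D y τ) λ r → suc d ≤ suc (len r)) × (∀ v → v ∈ˢ D → v ≢ z → countB D + τ v ≤ suc d)
          conv (inj₁ p) = inj₁ (ext , inj₁ (linear (d ∷ length (via r') ∷ τ (end r') ∷ []) (# 0) (# 1 ⊕ # 2) (κ 1 ⊕ # 0) (κ 1 ⊕ (# 1 ⊕ # 2)) p))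
          conv (inj₂ (p , t)) = inj₂ ((ext , linear (d ∷ length (via r') ∷ τ (end r') ∷ []) (# 0) (κ 1 ⊕ (# 1 ⊕ # 2)) (κ 1 ⊕ # 0) (κ 2 ⊕ (# 1 ⊕ # 2)) p) , tight)
            where
            tight : ∀ v → v ∈ˢ D → v ≢ z → countB D + τ v ≤ suc d
            tight v v∈ v≢z = linear (countB D' ∷ τ v ∷ countB D ∷ d ∷ []) (# 0 ⊕ # 1 ⊕ # 2) (# 3 ⊕ (κ 1 ⊕ # 0)) (# 2 ⊕ # 1) (κ 1 ⊕ # 3) (t v (∖-i {S = D} v∈ v≢z) ⊞ ≡≤ (countB-∖ D z∈))
        go (no none) with cut R z r z∈ r∈ r≢z
        ... | x , rx , exy with through |D'| R' (deg₀ none) (Rc-r rx)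
        ...   | l , c , m , d≤ = inj₁ (record
               { end = z ; via = x ∷ l ; end∈ = z∈ ; path = E-sym exy , c ; within = m ; attached = z-att }
               , inj₁ (linear (d ∷ length l ∷ τ z ∷ []) (# 0 ⊕ κ 1) (κ 1 ⊕ # 1 ⊕ # 2) (κ 1 ⊕ # 0) (κ 1 ⊕ # 1 ⊕ # 2) (d≤ ⊞ z-att)))
          where
          z-att : 1 ≤ τ z
          z-att with u₀ ≟ z
          ... | yes refl = u₀-att
          ... | no u≢z = ⊥-elim (none (u₀ , ∖-i {S = D} u₀∈ u≢z , u₀-att))

      -- Tightness away from `z` makes `r` a neighbour of `y`; exchanging `z` and `r` then gives
      -- tightness at `z` too.
      result : ∀ z r → z ∈ˢ D → E z y ≡ true → r ∈ˢ D → r ≢ z → LongRoute D y (suc d) τ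
      result z r z∈ ezy r∈ r≢z with below z r z∈ ezy r∈ r≢z
      ... | inj₁ x = x
      ... | inj₂ ((p , q) , t) with below r z r∈ (¬f⇒t ery) z∈ (λ x → r≢z (sym x))
        where
        ery : E r y ≡ false → ⊥
        ery f = 1≰0 (linear (d ∷ nb r D ∷ ⟦ E r y ⟧ ∷ countB D ∷ τ r ∷ []) (κ 1 ⊕ # 0 ⊕ (κ 1 ⊕ # 1 ⊕ (# 2 ⊕ (# 3 ⊕ # 4)))) (# 1 ⊕ # 2 ⊕ # 4 ⊕ (# 3 ⊕ (κ 0 ⊕ (κ 1 ⊕ # 0)))) (κ 1) (κ 0) (deg r r∈ ⊞ nb< r D r∈ ⊞ ≡≤ (⟦⟧-false f) ⊞ t r r∈ r≢z))
      ...   | inj₁ x = x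
      ...   | inj₂ (_ , t') = p , inj₂ (q , all)
        where
        all : Tight D (suc d) τ
        all v v∈ with v ≟ z
        ... | no v≢z = t v v∈ v≢z
        ... | yes refl = t' v v∈ λ x → r≢z (sym x)

    result : LongRoute D y (suc d) τ
    result with att R
    ... | z , z∈ , ezy with any? (λ r → (D r ≟ᵇ true) ×-dec ¬? (r ≟ z))
    ...   | no single = record { end = z ; via = [] ; end∈ = z∈ ; path = E-sym ezy ; within = ⊑-[] ; attached = z-att } , go (suc d ≤? τ z)
      where
      only : ∀ r → r ∈ˢ D → r ≡ z
      only r p with r ≟ z
      ... | yes q = q
      ... | no ¬q = ⊥-elim (single (r , p , ¬q))
      z-att : 1 ≤ τ z
      z-att = subst (λ r → 1 ≤ τ r) (only u₀ u₀∈) u₀-att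
      |D|≡1 : countB D ≡ 1
      |D|≡1 = trans (countB-∖ D z∈) (cong suc (countB-false (D ∖ z) λ r → ¬t⇒f λ p → proj₂ (∖-e {S = D} p) (only r (proj₁ (∖-e {S = D} p)))))
      go : Dec (suc d ≤ τ z) → suc d ≤ τ z ⊎ (suc d ≤ suc (τ z) × Tight D (suc d) τ)
      go (yes p) = inj₁ p
      go (no ¬p) = inj₂ (linear (d ∷ nb z D ∷ countB D ∷ ⟦ E z y ⟧ ∷ τ z ∷ []) (κ 1 ⊕ # 0 ⊕ (κ 1 ⊕ # 1 ⊕ (# 2 ⊕ # 3))) (# 1 ⊕ # 3 ⊕ # 4 ⊕ (# 2 ⊕ (κ 1 ⊕ κ 1))) (κ 1 ⊕ # 0) (κ 1 ⊕ # 4) (deg z z∈ ⊞ nb< z D z∈ ⊞ ≡≤ |D|≡1 ⊞ ⟦⟧≤1 (E z y))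
                        , λ v v∈ → subst (λ v → countB D + τ v ≤ suc d) (sym (only v v∈)) (linear (τ z ∷ countB D ∷ d ∷ []) (κ 1 ⊕ # 0 ⊕ # 1) (κ 1 ⊕ # 2 ⊕ κ 1) (# 1 ⊕ # 0) (κ 1 ⊕ # 2) (≰⇒> ¬p ⊞ ≡≤ |D|≡1)))
    ...   | yes (r , r∈ , r≢z) with any? (λ v → any? (λ a → any? (λ b → (D v ≟ᵇ true) ×-dec (((D ∖ v) a ≟ᵇ true) ×-dec
                 (((D ∖ v) b ≟ᵇ true) ×-dec ¬? (rc? {E = E} (D ∖ v) a b))))))
    ...     | yes (v , a , b , v∈ , a∈ , b∈ , ¬ab) = Detour.result v a b v∈ a∈ b∈ ¬ab (Cut.end₁ v a b v∈ a∈ b∈ ¬ab)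
    ...     | no conn' = NoCut.result nc z r z∈ ezy r∈ r≢z
      where
      nc : ∀ v a b → v ∈ˢ D → a ∈ˢ D ∖ v → b ∈ˢ D ∖ v → Rc E (D ∖ v) a b
      nc v a b v∈ a∈ b∈ with rc? {E = E} (D ∖ v) a b
      ... | yes p = p
      ... | no ¬p = ⊥-elim (conn' (v , a , b , v∈ , a∈ , b∈ , ¬p))

  -- A weighted form of the theorem that any two vertices of a 2-connected graph of minimum degree
  -- `d` are joined by a path of length at least `d`: instead of a prescribed end, any vertex of
  -- positive weight may be the end.
  long-route : ∀ N D y d τ → countB D ≤ N → Rooted D y → Degrees D y d τ →
               (∃[ u ] (u ∈ˢ D × 1 ≤ τ u)) → LongRoute D y d τ
  long-route N D y zero τ h R deg (u , u∈ , uτ) with att R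
  ... | s , s∈ , e with simple (conn R u s u∈ s∈) e
  ...   | l , c , m = record { end = u ; via = reverse l ; end∈ = u∈ ; path = Ch-reverse E E-sym l c
                             ; within = ⊑-reverse m ; attached = uτ } , inj₁ z≤n
  long-route zero D y (suc d) τ h R deg (u , u∈ , uτ) = ⊥-elim (1≰0 (≤-trans (countB-pos D u∈) h))
  long-route (suc N) D y (suc d) τ h R deg (u , u∈ , uτ) = Step.result (long-route N) h R deg u u∈ uτ

-- Outer vertices of high degree

∨-i₁ : ∀ {a b} → a ≡ true → a ∨ b ≡ true
∨-i₁ refl = refl

∨-i₂ : ∀ {a b} → b ≡ true → a ∨ b ≡ true
∨-i₂ {true}  refl = refl
∨-i₂ {false} refl = refl

∨-e : ∀ {a b} → a ∨ b ≡ true → a ≡ true ⊎ b ≡ true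
∨-e {true}  p = inj₁ refl
∨-e {false} p = inj₂ p

abstract
  countB-∪ : ∀ {n} (f g h : BSet n) → (∀ z → z ∈ˢ f → z ∈ˢ g ⊎ z ∈ˢ h) → countB f ≤ countB g + countB h
  countB-∪ f g h p = countB-≤+ f g h q
    where
    q : ∀ z → ⟦ f z ⟧ ≤ ⟦ g z ⟧ + ⟦ h z ⟧
    q z with true⊎false (f z)
    ... | inj₂ x rewrite x = z≤n
    ... | inj₁ x with p z x
    ...   | inj₁ y rewrite x | y = s≤s z≤n
    ...   | inj₂ y rewrite x | y = m≤n+m 1 ⟦ g z ⟧

-- `Far p w w'` stands for at least `p` vertices between `w` and `w'` on the cycle, whose shape
-- enters this part in no other way. The total in `hub` consists of `w₀`, two gaps of `p`, the set
-- `T`, and `countB T - 1` gaps of one.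
record Spread {n} (C : BSet n) (c : ℕ) (Far : ℕ → Fin n → Fin n → Set) : Set where
  field
    far-mono : ∀ {p q w w'} → p ≤ q → Far q w w' → Far p w w'
    hub      : ∀ w₀ T p → w₀ ∈ˢ C → (∀ w → w ∈ˢ T → w ∈ˢ C ∖ w₀) → 1 ≤ countB T →
               (∀ w → w ∈ˢ T → Far p w₀ w × Far p w w₀) → (∀ w w' → w ∈ˢ T → w' ∈ˢ T → w ≢ w' → Far 1 w w') →
               2 * p + 2 * countB T ≤ c
    apart    : ∀ S p → (∀ w → w ∈ˢ S → w ∈ˢ C) → 2 ≤ countB S →
               (∀ w w' → w ∈ˢ S → w' ∈ˢ S → w ≢ w' → Far p w w') → suc p * countB S ≤ c

-- E is a contraction of G: it contains the edges of G that touch U (with both ends in U ∪ C).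
record State {n} (adj : Rel n) (C : BSet n) (Far : ℕ → Fin n → Fin n → Set) (U : BSet n) (E : Rel n) : Set where
  field
    E-sym : Symm E
    E-irr : ∀ u → E u u ≡ false
    off   : ∀ u → u ∈ˢ U → u ∉ˢ C
    real  : ∀ u v → u ∈ˢ U → v ∈ˢ U ⊎ v ∈ˢ C → adj u v ≡ true → E u v ≡ true
    two   : ∀ x u → u ∈ˢ U → u ≢ x → ∃[ z ] ∃[ w ] (Rc E (U ∖ x) u z × E z w ≡ true × w ∈ˢ C × w ≢ x)
    ear   : ∀ w l w' → w ∈ˢ C → w' ∈ˢ C → w ≢ w' → l ⊑ U → Ch E w l w' → Far (length l) w w'

-- Taken in `adj`, not in the contraction, so that these degrees add up to edges of the graph
-- itself.
rdeg : ∀ {n} → Rel n → BSet n → BSet n → Fin n → ℕ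
rdeg adj C U u = countB (λ z → adj u z ∧ (U z ∨ C z))

module Dense {n} (adj : Rel n) (C : BSet n) (c : ℕ) (Far : ℕ → Fin n → Fin n → Set) (spread : Spread C c Far)
             (k : ℕ) (4≤k : 4 ≤ k) (c≤ : c ≤ 3 + 2 * k)
             (U : BSet n) (E : Rel n) (st : State adj C Far U E)
             (few : ∀ u → u ∈ˢ U → countB (λ z → adj u z ∧ C z) ≤ k)
             (many : ∀ u → u ∈ˢ U → suc k ≤ rdeg adj C U u) where
  open State st
  open Spread spread
  open Ends E E-sym E-irr

  -- One vertex of degree `k + 1` is too expensive by one to be removed; three mutually adjacent
  -- ones cost only `(k + 1) + k + (k - 1)`.
  Triangle : Set
  Triangle = ∃[ v₁ ] ∃[ v₂ ] ∃[ v₃ ] (v₁ ∈ˢ U × v₂ ∈ˢ U × v₃ ∈ˢ U × v₂ ≢ v₁ × v₃ ≢ v₁ × v₃ ≢ v₂ ×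
    (adj v₂ v₁ ≡ true × adj v₃ v₁ ≡ true × adj v₃ v₂ ≡ true) ×
    (rdeg adj C U v₁ ≤ suc k × rdeg adj C U v₂ ≤ suc k × rdeg adj C U v₃ ≤ suc k))

  C≢ : ∀ {u w} → u ∈ˢ U → w ∈ˢ C → u ≢ w
  C≢ {u} p q refl = t≢f q (off u p)

  inner-nbr : ∀ u → u ∈ˢ U → ∃[ r ] (r ∈ˢ U × E u r ≡ true)
  inner-nbr u u∈ with pick (λ z → adj u z ∧ U z) (linear (k ∷ countB (λ z → adj u z ∧ C z) ∷ countB (λ z → adj u z ∧ (U z ∨ C z)) ∷ countB (λ z → adj u z ∧ U z) ∷ []) (κ 1 ⊕ # 0 ⊕ (# 1 ⊕ # 2)) (# 2 ⊕ (# 0 ⊕ (# 1 ⊕ # 3))) (κ 1) (# 3) (many u u∈ ⊞ few u u∈ ⊞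
      countB-∪ (λ z → adj u z ∧ (U z ∨ C z)) (λ z → adj u z ∧ C z) (λ z → adj u z ∧ U z)
        λ z p → [ (λ q → inj₂ (∧-i (proj₁ (∧-e p)) q)) , (λ q → inj₁ (∧-i (proj₁ (∧-e p)) q)) ]′ (∨-e {U z} (proj₂ (∧-e p)))))
  ... | r , p = r , proj₂ (∧-e p) , real u r u∈ (inj₁ (proj₂ (∧-e p))) (proj₁ (∧-e p))

  record EndBlock (D : BSet n) (y : Fin n) : Set where
    field
      D⊆U    : ∀ z → z ∈ˢ D → z ∈ˢ U
      y∈U    : y ∈ˢ U
      closes : ClosedIn {E = E} U D y
      root2  : Rooted D y

  -- `w` is an exit: a vertex of the cycle that the root reaches outside the block.
  Acc : BSet n → Fin n → Fin n → Set
  Acc D y w = w ∈ˢ C × ∃[ z ] (Rc E (U − D) y z × E z w ≡ true)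

  nbC : Fin n → ℕ
  nbC v = countB (λ w → E v w ∧ C w)

  -- What the tight case leaves when the block is too small for a triangle; every exit is then a
  -- common neighbour of the block.
  Thin : BSet n → Fin n → Set
  Thin D y = countB D ≤ 2 × (∀ v → v ∈ˢ D → suc k ≤ countB D + nbC v) × (∀ w v → Acc D y w → v ∈ˢ D → E v w ≡ true)

  nbrs-apart : ∀ u w w' → u ∈ˢ U → w ∈ˢ C → w' ∈ˢ C → E u w ≡ true → E u w' ≡ true → w ≢ w' → Far 1 w w'
  nbrs-apart u w w' u∈ w∈ w'∈ e e' q = ear w [ u ] w' w∈ w'∈ q (⊑-∷ u∈ ⊑-[]) (E-sym e , e')

  module Block {D y} (B : EndBlock D y) where
    open EndBlock B

    y∈U−D : y ∈ˢ U − D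
    y∈U−D = −-i {S = U} {D} y∈U (y∉ root2)

    join : ∀ {l l' u} → u ∈ˢ D → l ⊑ (U − D) ∖ y → l' ⊑ D ∖ u → (reverse l ++ y ∷ l' ++ [ u ]) ⊑ U
    join {l} {l'} {u} u∈ m m' = ⊑-++ {l = reverse l} {S = (U − D) ∖ y} {T = D∪y} (⊑-reverse m)
        (⊑-∷ (∨-i₂ {D y} (==-refl y)) (⊑-++ {l = l'} {S = D ∖ u} {T = _== u} m' (⊑-∷ (==-refl u) ⊑-[])
          (λ z p → ∖-i {S = D∪y} (∨-i₁ (proj₁ (∖-e {S = D} p))) (∈≢ D (proj₁ (∖-e {S = D} p)) (y∉ root2)) , ≢⇒==f (proj₂ (∖-e {S = D} p)))
          (λ z p → subst (_∈ˢ D∪y ∖ y) (sym (==⇒≡ p)) (∖-i {S = D∪y} (∨-i₁ u∈) (∈≢ D u∈ (y∉ root2))))))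
        (λ z p → let p₁ = ∖-e {S = U − D} p ; p₂ = −-e {S = U} {D} (proj₁ p₁) in
                 proj₁ p₂ , ¬t⇒f λ q → [ (λ x → t≢f x (proj₂ p₂)) , (λ x → proj₂ p₁ (==⇒≡ x)) ]′ (∨-e {D z} q))
        (λ z p → [ D⊆U z , (λ x → subst (_∈ˢ U) (sym (==⇒≡ x)) y∈U) ]′ (∨-e {D z} p))
      where
      D∪y : BSet n
      D∪y z = D z ∨ z == y

    -- The exit path, the root, `l` and `u` form an ear from `w₀` to `w`; the root and `u` account
    -- for the 2.
    through-root : ∀ {w₀ u w} l → Acc D y w₀ → u ∈ˢ D → Ch E y l u → l ⊑ D ∖ u → w ∈ˢ C → E u w ≡ true → w ≢ w₀ →
                   Far (2 + length l) w₀ w × Far (2 + length l) w w₀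
    through-root {w₀} {u} {w} l (w₀∈ , z , r , e) u∈ c₁ m w∈ euw w≢ with simple r e
    ... | l₀ , c₀ , m₀ = far-mono long₁ (ear w₀ L w w₀∈ w∈ (λ q → w≢ (sym q)) L⊑ L-path)
                       , far-mono long₂ (ear w (reverse L) w₀ w∈ w₀∈ w≢ (⊑-reverse L⊑) (Ch-reverse E E-sym L L-path))
      where
      L : List (Fin n)
      L = reverse l₀ ++ y ∷ l ++ [ u ]
      L⊑ : L ⊑ U
      L⊑ = join u∈ m₀ m
      L-path : Ch E w₀ L w
      L-path = Ch-++ E (reverse l₀) (Ch-reverse E E-sym l₀ c₀) (Ch-++ E l c₁ euw)
      long₁ : 2 + length l ≤ length L
      long₁ = linear (length (reverse l₀) ∷ length (l ++ [ u ]) ∷ length l ∷ length (reverse l₀ ++ y ∷ l ++ [ u ]) ∷ []) (# 0 ⊕ (κ 1 ⊕ # 1) ⊕ (# 2 ⊕ κ 1)) (# 3 ⊕ # 1) (κ 2 ⊕ # 2) (# 3) (≡≥ (length-++ (reverse l₀) {y ∷ l ++ [ u ]}) ⊞ ≡≥ (length-++ l {[ u ]}))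
      long₂ : 2 + length l ≤ length (reverse L)
      long₂ = ≤-trans long₁ (≡≥ (length-reverse L))

    module Portal (w₀ : Fin n) (acc : Acc D y w₀) where
      -- The vertex `w₀` is reserved for the exit path and therefore carries no weight.
      τ : Fin n → ℕ
      τ v = countB (λ w → E v w ∧ (C ∖ w₀) w)

      τ-e : ∀ v w → E v w ∧ (C ∖ w₀) w ≡ true → E v w ≡ true × w ∈ˢ C × w ≢ w₀
      τ-e v w p with ∧-e {E v w} p
      ... | q , r = q , ∖-e {S = C} r

      deg-≤ : ∀ v → v ∈ˢ D → (g : BSet n) → (∀ z → z ∈ˢ D → adj v z ≡ true → z ∈ˢ g) →
              rdeg adj C U v ≤ countB g + τ v + ⟦ adj v y ⟧ + ⟦ adj v w₀ ⟧
      deg-≤ v v∈ g D→g = linear (countB f ∷ ⟦ f w₀ ⟧ ∷ countB (f ∖ w₀) ∷ ⟦ (f ∖ w₀) y ⟧ ∷ countB (f ∖ w₀ ∖ y) ∷ ⟦ adj v w₀ ⟧ ∷ ⟦ adj v y ⟧ ∷ countB g ∷ countB (λ w → E v w ∧ (C ∖ w₀) w) ∷ []) (# 0 ⊕ (# 1 ⊕ (# 2 ⊕ (# 3 ⊕ # 4)))) (# 2 ⊕ # 1 ⊕ (# 5 ⊕ (# 4 ⊕ # 3 ⊕ (# 6 ⊕ (# 7 ⊕ # 8))))) (# 0) (# 7 ⊕ # 8 ⊕ # 6 ⊕ # 5) (countB-≤point f (f ∖ w₀) w₀ (λ z p q → ∖-i {S = f} p q) ⊞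
                          ⟦⟧-mono {f w₀} {adj v w₀} (λ p → proj₁ (∧-e p)) ⊞
                          countB-≤point (f ∖ w₀) (f ∖ w₀ ∖ y) y (λ z p q → ∖-i {S = f ∖ w₀} p q) ⊞
                          ⟦⟧-mono {(f ∖ w₀) y} {adj v y} (λ p → proj₁ (∧-e (proj₁ (∖-e {S = f} p)))) ⊞
                          countB-∪ (f ∖ w₀ ∖ y) g (λ w → E v w ∧ (C ∖ w₀) w) rest')
        where
        f : BSet n
        f z = adj v z ∧ (U z ∨ C z)
        rest' : ∀ z → z ∈ˢ f ∖ w₀ ∖ y → z ∈ˢ g ⊎ (E v z ∧ (C ∖ w₀) z ≡ true)
        rest' z p with ∖-e {S = f ∖ w₀} p
        ... | p₁ , z≢y with ∖-e {S = f} p₁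
        ...   | p₂ , z≢w₀ with ∨-e {U z} (proj₂ (∧-e p₂))
        ...     | inj₂ z∈C = inj₂ (∧-i (real v z (D⊆U v v∈) (inj₂ z∈C) (proj₁ (∧-e p₂))) (∖-i {S = C} z∈C z≢w₀))
        ...     | inj₁ z∈U with closes v∈ (real v z (D⊆U v v∈) (inj₁ z∈U) (proj₁ (∧-e p₂))) z∈U
        ...       | inj₁ z∈D = inj₁ (D→g z z∈D (proj₁ (∧-e p₂)))
        ...       | inj₂ q = ⊥-elim (z≢y q)

      -- A route of value `k` would, by `hub`, satisfy `2 * (2 + length via) + 2 * countB Q ≤ c`,
      -- hence `4 + 2 * k ≤ 3 + 2 * k`. So only the tight alternative of `long-route` remains.
      tight : ∃[ u ] ∃[ w ] (u ∈ˢ D × w ∈ˢ C × E u w ≡ true × w ≢ w₀) → Tight D k τ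
      tight (u , w , u∈ , w∈ , e , w≢) with long-route (countB D) D y k τ ≤-refl root2 degs
             (u , u∈ , countB-pos (λ w → E u w ∧ (C ∖ w₀) w) (∧-i e (∖-i {S = C} w∈ w≢)))
        where
        degs : Degrees D y k τ
        degs v v∈ = linear (k ∷ rdeg adj C U v ∷ ⟦ adj v y ⟧ ∷ ⟦ adj v w₀ ⟧ ∷ countB (λ z → E v z ∧ D z) ∷ τ v ∷ ⟦ E v y ⟧ ∷ []) (κ 1 ⊕ # 0 ⊕ (# 1 ⊕ (# 2 ⊕ # 3))) (# 1 ⊕ (# 4 ⊕ # 5 ⊕ # 2 ⊕ # 3 ⊕ (# 6 ⊕ κ 1))) (# 0) (# 4 ⊕ # 6 ⊕ # 5) (many v (D⊆U v v∈) ⊞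
          deg-≤ v v∈ (λ z → E v z ∧ D z) (λ z p q → ∧-i (real v z (D⊆U v v∈) (inj₁ (D⊆U z p)) q) p) ⊞
          ⟦⟧-mono {adj v y} {E v y} (real v y (D⊆U v v∈) (inj₁ y∈U)) ⊞ ⟦⟧≤1 (adj v w₀))
      ... | r , inj₂ (_ , t) = t
      ... | r , inj₁ p = ⊥-elim (1≰0 (linear (k ∷ c ∷ length via ∷ countB Q ∷ []) (# 0 ⊕ (# 0 ⊕ (# 1 ⊕ (2 ⊛ (κ 2 ⊕ # 2) ⊕ (2 ⊛ # 3))))) (# 2 ⊕ # 3 ⊕ (# 2 ⊕ # 3 ⊕ (κ 3 ⊕ (2 ⊛ # 0) ⊕ # 1))) (κ 1) (κ 0) (p ⊞ p ⊞ c≤ ⊞ hub w₀ Q (2 + length via) (proj₁ acc) (λ w q → proj₂ (∧-e {E end w} q)) attached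
              (λ w q → let e , w∈ , w≢ = τ-e end w q in through-root via acc end∈ path within w∈ e w≢)
              (λ w w' q q' → let e , w∈ , _ = τ-e end w q ; e' , w'∈ , _ = τ-e end w' q' in nbrs-apart end w w' (D⊆U end end∈) w∈ w'∈ e e'))))
        where
        open Route r
        Q : BSet n
        Q w = E end w ∧ (C ∖ w₀) w

      -- A degree of at least `k + 1` leaves no slack in `bound`; each missing adjacency within `D`,
      -- or to `w₀`, would violate it.
      module Tightness (t : Tight D k τ) (v : Fin n) (v∈ : v ∈ˢ D) where
        g : BSet n
        g z = adj v z ∧ D z
        v∉g : ∀ {z} → z ∈ˢ g → z ≢ v
        v∉g {z} p refl = t≢f (real v v (D⊆U v v∈) (inj₁ (D⊆U v v∈)) (proj₁ (∧-e p))) (E-irr v)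
        g≤ : suc (countB g) ≤ countB D
        g≤ = countB-< g D v (λ z p → proj₂ (∧-e p)) (¬t⇒f λ p → v∉g p refl) v∈
        bound : rdeg adj C U v ≤ countB g + τ v + ⟦ adj v y ⟧ + ⟦ adj v w₀ ⟧
        bound = deg-≤ v v∈ g (λ z p q → ∧-i q p)
        small : rdeg adj C U v ≤ suc k
        small = linear (rdeg adj C U v ∷ countB g ∷ countB D ∷ τ v ∷ ⟦ adj v y ⟧ ∷ ⟦ adj v w₀ ⟧ ∷ k ∷ []) (# 0 ⊕ (κ 1 ⊕ # 1 ⊕ (# 2 ⊕ # 3 ⊕ (# 4 ⊕ # 5)))) (# 1 ⊕ # 3 ⊕ # 4 ⊕ # 5 ⊕ (# 2 ⊕ (# 6 ⊕ (κ 1 ⊕ κ 1)))) (# 0) (κ 1 ⊕ # 6) (bound ⊞ g≤ ⊞ t v v∈ ⊞ ⟦⟧≤1 (adj v y) ⊞ ⟦⟧≤1 (adj v w₀))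
        portal : E v w₀ ≡ true
        portal = real v w₀ (D⊆U v v∈) (inj₂ (proj₁ acc)) (⟦⟧≥1 (linear (rdeg adj C U v ∷ countB g ∷ countB D ∷ τ v ∷ ⟦ adj v y ⟧ ∷ k ∷ ⟦ adj v w₀ ⟧ ∷ []) (# 0 ⊕ (κ 1 ⊕ # 1 ⊕ (# 2 ⊕ # 3 ⊕ (# 4 ⊕ (κ 1 ⊕ # 5))))) (# 1 ⊕ # 3 ⊕ # 4 ⊕ # 6 ⊕ (# 2 ⊕ (# 5 ⊕ (κ 1 ⊕ # 0)))) (κ 1) (# 6) (bound ⊞ g≤ ⊞ t v v∈ ⊞ ⟦⟧≤1 (adj v y) ⊞ many v (D⊆U v v∈))))
        clique : ∀ z → z ∈ˢ D → z ≢ v → adj v z ≡ true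
        clique z z∈ z≢v = ¬f⇒t λ q → 1≰0 (linear (rdeg adj C U v ∷ countB D ∷ τ v ∷ ⟦ adj v y ⟧ ∷ ⟦ adj v w₀ ⟧ ∷ k ∷ countB g ∷ countB (D ∖ v) ∷ []) (# 0 ⊕ (# 1 ⊕ # 2 ⊕ (# 3 ⊕ (# 4 ⊕ (κ 1 ⊕ # 5 ⊕ (κ 1 ⊕ # 6 ⊕ (κ 1 ⊕ # 7))))))) (# 6 ⊕ # 2 ⊕ # 3 ⊕ # 4 ⊕ (# 5 ⊕ (κ 1 ⊕ (κ 1 ⊕ (# 0 ⊕ (# 7 ⊕ # 1)))))) (κ 1) (κ 0) (bound ⊞ t v v∈ ⊞ ⟦⟧≤1 (adj v y) ⊞ ⟦⟧≤1 (adj v w₀) ⊞ many v (D⊆U v v∈) ⊞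
              countB-< g (D ∖ v) z (λ x p → ∖-i {S = D} (proj₂ (∧-e p)) (v∉g p)) (¬t⇒f λ p → t≢f (proj₁ (∧-e p)) q) (∖-i {S = D} z∈ z≢v)
              ⊞ ≡≥ (countB-∖ D v∈)))
        wide : suc k ≤ countB D + nbC v
        wide = linear (k ∷ rdeg adj C U v ∷ countB g ∷ ⟦ adj v y ⟧ ∷ ⟦ adj v w₀ ⟧ ∷ countB ((λ w → E v w ∧ C w) ∖ w₀) ∷ countB (λ w → E v w ∧ (C ∖ w₀) w) ∷ countB D ∷ countB (λ w → E v w ∧ C w) ∷ []) (κ 1 ⊕ # 0 ⊕ (# 1 ⊕ (κ 1 ⊕ # 2 ⊕ (# 3 ⊕ (# 4 ⊕ (κ 1 ⊕ # 5 ⊕ # 6)))))) (# 1 ⊕ (# 2 ⊕ # 6 ⊕ # 3 ⊕ # 4 ⊕ (# 7 ⊕ (κ 1 ⊕ (κ 1 ⊕ (# 8 ⊕ # 5)))))) (κ 1 ⊕ # 0) (# 7 ⊕ # 8) (many v (D⊆U v v∈) ⊞ bound ⊞ g≤ ⊞ ⟦⟧≤1 (adj v y) ⊞ ⟦⟧≤1 (adj v w₀) ⊞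
              ≡≥ (countB-∖ (λ w → E v w ∧ C w) {w₀} (∧-i portal (proj₁ acc))) ⊞
              countB-mono (λ w → E v w ∧ (C ∖ w₀) w) ((λ w → E v w ∧ C w) ∖ w₀)
                 (λ w p → let e , w∈ , w≢ = τ-e v w p in ∖-i {S = λ w → E v w ∧ C w} (∧-i e w∈) w≢))

    -- `Portal.tight` needs positive weight in the block. If the neighbour on the cycle found for
    -- the block is the given exit itself, deleting that vertex produces either another exit or
    -- another neighbour.
    portal : ∀ w → Acc D y w → ∃[ w₀ ] (Acc D y w₀ × ∃[ u ] ∃[ w ] (u ∈ˢ D × w ∈ˢ C × E u w ≡ true × w ≢ w₀))
    portal w* acc with att root2
    ... | s , s∈ , _ with two y s (D⊆U s s∈) (∈≢ D s∈ (y∉ root2))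
    ...   | z₁ , w₁ , r₁ , e₁ , w₁∈ , _ with w₁ ≟ w*
    ...     | no q = w* , acc , z₁ , w₁ , Rc-r (stay (λ m e x → closes m e (proj₁ (∖-e {S = U} x))) (∖-self U y) r₁ s∈) , w₁∈ , e₁ , q
    ...     | yes refl with two w₁ y y∈U (C≢ y∈U w₁∈)
    ...       | z , w , r , e , w∈ , w≢ with true⊎false (D z)
    ...         | inj₁ z∈ = w₁ , acc , z , w , z∈ , w∈ , e , w≢
    ...         | inj₂ z∉ = w , (w∈ , z , Rc-mono (λ x p → −-i {S = U} {D} (proj₁ (∖-e {S = U} (proj₁ (−-e {S = U ∖ w₁} {D} p)))) (proj₂ (−-e {S = U ∖ w₁} {D} p)))
                        (proj₁ (avoid E-sym (λ m e x → closes m e (proj₁ (∖-e {S = U} x))) (y∉ root2) z∉ r) (y∉ root2)) , e)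
                        , z₁ , w₁ , Rc-r (stay (λ m e x → closes m e (proj₁ (∖-e {S = U} x))) (∖-self U y) r₁ s∈) , w₁∈ , e₁ , (λ q → w≢ (sym q))

    thin : ∀ w → Acc D y w → Triangle ⊎ Thin D y
    thin w* acc* with portal w* acc*
    ... | w₀ , acc , ex with Portal.tight w₀ acc ex | 3 ≤? countB D
    ...   | t | yes 3≤ with pick D (≤-trans (s≤s z≤n) 3≤)
    ...     | v₁ , v₁∈ with pick≢ D v₁ (≤-trans (s≤s (s≤s z≤n)) 3≤) | att root2
    ...       | v₂ , v₂∈ , v₂≢ | _ with pick≢₂ D v₁ v₂ 3≤
    ...         | v₃ , v₃∈ , v₃≢ , v₃≢' = inj₁ (v₁ , v₂ , v₃ , D⊆U _ v₁∈ , D⊆U _ v₂∈ , D⊆U _ v₃∈ , v₂≢ , v₃≢ , v₃≢' ,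
                  (clique v₂ v₂∈ v₁ v₁∈ (λ q → v₂≢ (sym q)) , clique v₃ v₃∈ v₁ v₁∈ (λ q → v₃≢ (sym q)) , clique v₃ v₃∈ v₂ v₂∈ (λ q → v₃≢' (sym q))) ,
                  (small v₁ v₁∈ , small v₂ v₂∈ , small v₃ v₃∈))
      where open Portal.Tightness w₀ acc t
    thin w* acc* | w₀ , acc , ex | t | no ≱3 = inj₂ (≤2 , wide , all)
      where
      open Portal.Tightness w₀ acc t using (wide)
      ≤2 : countB D ≤ 2
      ≤2 = ≤-pred (≰⇒> ≱3)
      all : ∀ w v → Acc D y w → v ∈ˢ D → E v w ≡ true
      -- Here `v` has at least `k - 1`, hence three, neighbours on the cycle. One of them differs
      -- from `w`, so any exit can play the part of `w₀`.
      all w v acc' v∈ with pick≢ (λ w → E v w ∧ C w) w (linear (k ∷ countB D ∷ nbC v ∷ []) (κ 1 ⊕ # 0 ⊕ (# 1 ⊕ κ 4)) (# 1 ⊕ # 2 ⊕ (κ 2 ⊕ # 0)) (κ 2) (# 2) (wide v v∈ ⊞ ≤2 ⊞ 4≤k))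
      ... | w' , p , w'≢ = Portal.Tightness.portal w acc' (Portal.tight w acc' (v , w' , v∈ , proj₂ (∧-e p) , proj₁ (∧-e p) , w'≢)) v v∈

  end-at : ∀ y r → r ∈ˢ U → E y r ≡ true → End U (comp (U ∖ y) r) y
  end-at y r r∈ e = shrink (countB (comp (U ∖ y) r)) U _ y ≤-refl (λ z p → proj₁ (∖-e {S = U} (Rc-r (comp-e p))))
    (¬t⇒f λ p → proj₂ (∖-e {S = U} (Rc-r (comp-e p))) refl) comp-closed comp-conn
    (r , comp-i (here (∖-i {S = U} r∈ r≢y)) , E-sym e)
    where
    r≢y : r ≢ y
    r≢y refl = t≢f e (E-irr r)

  module AtEnd {y r} (y∈ : y ∈ˢ U) (e : End U (comp (U ∖ y) r) y) where
    open End e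
    set⊆ : ∀ z → z ∈ˢ set → z ∈ˢ U ∖ y
    set⊆ z p = Rc-r (comp-e (sub z p))
    to-y : ∀ V → (∀ z → z ∈ˢ comp (U ∖ y) r → z ∉ˢ set → z ∈ˢ V) → y ∈ˢ V → Rc E V root y
    to-y V f y∈V with access
    ... | inj₁ q = subst (λ x → Rc E V x y) (sym q) (here y∈V)
    ... | inj₂ (_ , s , q , esy) = Rc-trans (Rc-mono g q) (step (g s (Rc-r q)) esy (here y∈V))
      where
      g : ∀ z → z ∈ˢ comp (U ∖ y) r − set → z ∈ˢ V
      g z p = let p₁ , p₂ = −-e {S = comp (U ∖ y) r} {set} p in f z p₁ p₂
    y∉ˢ : y ∉ˢ set
    y∉ˢ = ¬t⇒f λ p → proj₂ (∖-e {S = U} (set⊆ y p)) refl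
    home : Rc E (U − set) root y
    home = to-y (U − set) (λ z p q → −-i {S = U} {set} (proj₁ (∖-e {S = U} (Rc-r (comp-e p)))) q) (−-i {S = U} {set} y∈ y∉ˢ)
    block : EndBlock set root
    block = record { D⊆U = λ z p → proj₁ (∖-e {S = U} (set⊆ z p)) ; y∈U = proj₁ (−-e {S = U} {set} (Rc-l home)) ; closes = closedIn ; root2 = rooted }

  path-apart : ∀ x l t {s s'} → (x ∷ l ++ [ t ]) ⊑ U → s ∈ˢ C → s' ∈ˢ C → s ≢ s' → E x s ≡ true → Ch E x l t → E t s' ≡ true →
               Far (2 + length l) s s'
  path-apart x l t {s} {s'} m s∈ s'∈ s≢ e c e' =
    far-mono {q = length (x ∷ l ++ [ t ])} (linear (length l ∷ length (l ++ [ t ]) ∷ []) (# 0 ⊕ κ 1) (# 1) (κ 2 ⊕ # 0) (κ 1 ⊕ # 1) (≡≥ (length-++ l {[ t ]}))) (ear s (x ∷ l ++ [ t ]) s' s∈ s'∈ s≢ m (E-sym e , Ch-++ E l c e'))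

  -- Gaps of three at `k - 1` vertices require `4 * (k - 1) ≤ 2 * k + 3`, which fails from `k = 4`
  -- on. This is where a cycle of length at least 10 is used.
  too-many : ∀ S → (∀ w → w ∈ˢ S → w ∈ˢ C) → k ≤ suc (countB S) →
             (∀ w w' → w ∈ˢ S → w' ∈ˢ S → w ≢ w' → Far 3 w w') → ⊥
  too-many S S⊆C k≤ f = 1≰0 (linear (c ∷ countB S ∷ k ∷ []) (# 0 ⊕ (4 ⊛ # 1 ⊕ (# 2 ⊕ (# 2 ⊕ (# 2 ⊕ (# 2 ⊕ (κ 4 ⊕ κ 4))))))) (κ 3 ⊕ (2 ⊛ # 2) ⊕ (# 0 ⊕ (κ 1 ⊕ # 1 ⊕ (κ 1 ⊕ # 1 ⊕ (κ 1 ⊕ # 1 ⊕ (κ 1 ⊕ # 1 ⊕ (# 2 ⊕ # 2))))))) (κ 1) (κ 0) (c≤ ⊞ apart S 3 S⊆C (linear (k ∷ countB S ∷ []) (# 0 ⊕ κ 4) (κ 1 ⊕ # 1 ⊕ # 0) (κ 2) (# 1) (k≤ ⊞ 4≤k)) f ⊞ k≤ ⊞ k≤ ⊞ k≤ ⊞ k≤ ⊞ 4≤k ⊞ 4≤k))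

  module Final {D y} (B : EndBlock D y) (slim : Thin D y) where
    open EndBlock B
    |D|≤2 = proj₁ slim
    wide = proj₁ (proj₂ slim)
    all = proj₂ (proj₂ slim)
    v : Fin n
    v = proj₁ (att root2)
    v∈ : v ∈ˢ D
    v∈ = proj₁ (proj₂ (att root2))
    evy : E v y ≡ true
    evy = proj₂ (proj₂ (att root2))
    y∉D = y∉ root2
    y∈U−D : y ∈ˢ U − D
    y∈U−D = −-i {S = U} {D} y∈U y∉D

    -- The end block `D₂` beyond `y` is thin as well, or yields the triangle. The neighbours of its
    -- vertex `v₂` on the cycle are exits of `D`, hence also neighbours of `v`; the path from `v`
    -- through `y` to `v₂` has at least three vertices and puts them too far apart.
    crossing : ∀ r → E y r ≡ true → r ∉ˢ D → End U (comp (U ∖ y) r) y → Triangle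
    crossing r e r∉ e₂ = go (Block.thin block w₁ acc₂)
      where
      open End e₂ renaming (set to D₂; root to y₂)
      open AtEnd y∈U e₂
      disjoint : ∀ z → z ∈ˢ comp (U ∖ y) r → z ∉ˢ D
      disjoint z p = ¬t⇒f λ q → t≢f (Rc-r (stay (λ m e x → closes m e (proj₁ (∖-e {S = U} x))) (∖-self U y) (Rc-sym E-sym (comp-e p)) q)) r∉
      v∉₂ : v ∉ˢ D₂
      v∉₂ = ¬t⇒f λ p → t≢f v∈ (disjoint v (sub v p))
      some-w : ∃[ w ] (E v w ∧ C w ≡ true)
      some-w = pick (λ w → E v w ∧ C w) (linear (k ∷ countB D ∷ nbC v ∷ []) (κ 1 ⊕ # 0 ⊕ (# 1 ⊕ κ 4)) (# 1 ⊕ # 2 ⊕ (κ 2 ⊕ # 0)) (κ 1) (# 2) (wide v v∈ ⊞ |D|≤2 ⊞ 4≤k))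
      w₁ = proj₁ some-w
      acc₂ : Acc D₂ y₂ w₁
      acc₂ = proj₂ (∧-e {E v w₁} (proj₂ some-w)) , v ,
        Rc-trans home (step (Rc-r home) (E-sym evy) (here (−-i {S = U} {D₂} (D⊆U v v∈) v∉₂))) , proj₁ (∧-e (proj₂ some-w))
      v₂ : Fin n
      v₂ = proj₁ (att rooted)
      v₂∈ : v₂ ∈ˢ D₂
      v₂∈ = proj₁ (proj₂ (att rooted))
      v₂∈U : v₂ ∈ˢ U ∖ y
      v₂∈U = set⊆ v₂ v₂∈
      out-D : ∀ z → z ∈ˢ comp (U ∖ y) r → z ∈ˢ U − D
      out-D z p = −-i {S = U} {D} (proj₁ (∖-e {S = U} (Rc-r (comp-e p)))) (disjoint z p)
      y→v₂ : Rc E (U − D) y v₂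
      y→v₂ = Rc-sym E-sym (step (out-D v₂ (sub v₂ v₂∈)) (proj₂ (proj₂ (att rooted))) (to-y (U − D) (λ z p _ → out-D z p) y∈U−D))
      S : BSet n
      S w = E v₂ w ∧ C w
      v-s : ∀ s → s ∈ˢ S → E v s ≡ true
      v-s s p = all s v (proj₂ (∧-e p) , v₂ , y→v₂ , proj₁ (∧-e p)) v∈
      far3 : ∀ s s' → s ∈ˢ S → s' ∈ˢ S → s ≢ s' → Far 3 s s'
      far3 s s' p p' s≢ with Rc-hit₁ y→v₂ (λ q → proj₂ (∖-e {S = U} v₂∈U) (sym q))
      ... | q , rq , eq with simple rq eq
      ...   | l₀ , c₀ , m₀ = far-mono (s≤s (s≤s (s≤s z≤n))) (path-apart v (y ∷ l₀) v₂
                (⊑-∷ (D⊆U v v∈) (⊑-∷ (∖-i {S = U} y∈U (λ q → ∈≢ D v∈ y∉D (sym q))) inside))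
                (proj₂ (∧-e p)) (proj₂ (∧-e p')) s≢ (v-s s p) (evy , c₀) (proj₁ (∧-e p')))
        where
        S₁ : BSet n
        S₁ = (U − D) ∖ v₂ ∖ y
        W : BSet n
        W = U ∖ v ∖ y
        inside : (l₀ ++ [ v₂ ]) ⊑ W
        inside = ⊑-++ {l = l₀} {S = S₁} {T = _== v₂} m₀ (⊑-∷ (==-refl v₂) ⊑-[])
          (λ z m → let m₁ , z≢y = ∖-e {S = (U − D) ∖ v₂} m ; m₂ , z≢v₂ = ∖-e {S = U − D} m₁ ; m₃ , z∉D = −-e {S = U} {D} m₂ in
                   ∖-i {S = U ∖ v} (∖-i {S = U} m₃ (λ q → ∈≢ D v∈ z∉D (sym q))) z≢y , ≢⇒==f z≢v₂)
          (λ z m → subst (_∈ˢ W) (sym (==⇒≡ m)) (∖-i {S = U ∖ v} (∖-i {S = U} (proj₁ (∖-e {S = U} v₂∈U)) (∈≢ D₂ v₂∈ v∉₂)) (proj₂ (∖-e {S = U} v₂∈U))))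
      go : Triangle ⊎ Thin D₂ y₂ → Triangle
      go (inj₁ t) = t
      go (inj₂ (≤2 , wide₂ , _)) = ⊥-elim (too-many S (λ w p → proj₂ (∧-e p)) (linear (k ∷ countB D₂ ∷ nbC v₂ ∷ []) (κ 1 ⊕ # 0 ⊕ # 1) (# 1 ⊕ # 2 ⊕ κ 2) (# 0) (κ 1 ⊕ # 2) (wide₂ v₂ v₂∈ ⊞ ≤2)) far3)

    -- At least `k + 1 - countB D` neighbours of `y` lie on the cycle; they are exits, hence common
    -- neighbours of `D`. If `D` is a single vertex, gaps of two give `3 * k ≤ 2 * k + 3`; if it has
    -- two, the path through both and `y` gives gaps of three.
    pendant : (∀ r → r ∈ˢ U → E y r ≡ true → r ∈ˢ D) → ⊥
    pendant nbrs with 2 ≤? countB D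
    ... | no ≱2 = 1≰0 (linear (c ∷ countB S ∷ k ∷ countB D ∷ []) (# 0 ⊕ (3 ⊛ # 1 ⊕ (κ 1 ⊕ # 2 ⊕ (κ 1 ⊕ # 2 ⊕ (κ 1 ⊕ # 2 ⊕ (κ 1 ⊕ # 3 ⊕ (κ 1 ⊕ # 3 ⊕ (κ 1 ⊕ # 3 ⊕ κ 4)))))))) (κ 3 ⊕ (2 ⊛ # 2) ⊕ (# 0 ⊕ (# 3 ⊕ # 1 ⊕ (# 3 ⊕ # 1 ⊕ (# 3 ⊕ # 1 ⊕ (κ 2 ⊕ (κ 2 ⊕ (κ 2 ⊕ # 2)))))))) (κ 1) (κ 0) (c≤ ⊞ apart S 2 (λ w p → proj₂ (∧-e p)) (linear (k ∷ countB D ∷ countB S ∷ []) (κ 1 ⊕ # 0 ⊕ (κ 1 ⊕ # 1 ⊕ κ 4)) (# 1 ⊕ # 2 ⊕ (κ 2 ⊕ # 0)) (κ 2) (# 2) (S≥ ⊞ ≰⇒> ≱2 ⊞ 4≤k)) far2 ⊞ S≥ ⊞ S≥ ⊞ S≥ ⊞ ≰⇒> ≱2 ⊞ ≰⇒> ≱2 ⊞ ≰⇒> ≱2 ⊞ 4≤k))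
      where
      S : BSet n
      S w = E y w ∧ C w
      v-s : ∀ s → s ∈ˢ S → E v s ≡ true
      v-s s p = all s v (proj₂ (∧-e p) , y , here y∈U−D , proj₁ (∧-e p)) v∈
      S≥ : suc k ≤ countB D + countB S
      S≥ = ≤-trans (many y y∈U) (countB-∪ (λ z → adj y z ∧ (U z ∨ C z)) D S
         λ z p → [ (λ q → inj₁ (nbrs z q (real y z y∈U (inj₁ q) (proj₁ (∧-e p))))) , (λ q → inj₂ (∧-i (real y z y∈U (inj₂ q) (proj₁ (∧-e p))) q)) ]′ (∨-e {U z} (proj₂ (∧-e {adj y z} p))))
      far2 : ∀ s s' → s ∈ˢ S → s' ∈ˢ S → s ≢ s' → Far 2 s s'
      far2 s s' p p' s≢ = path-apart v [] y (⊑-∷ (D⊆U v v∈) (⊑-∷ (∖-i {S = U} y∈U (λ q → ∈≢ D v∈ y∉D (sym q))) ⊑-[]))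
         (proj₂ (∧-e p)) (proj₂ (∧-e p')) s≢ (v-s s p) evy (proj₁ (∧-e p'))
    ... | yes ≥2 with pick≢ D v ≥2
    ...   | v' , v'∈ , v'≢ with Rc-hit₁ (conn root2 v' v v'∈ v∈) v'≢
    ...     | q , rq , eq with simple rq eq
    ...       | l , c , m = too-many S (λ w p → proj₂ (∧-e p)) (linear (k ∷ countB D ∷ countB S ∷ []) (κ 1 ⊕ # 0 ⊕ # 1) (# 1 ⊕ # 2 ⊕ κ 2) (# 0) (κ 1 ⊕ # 2) (S≥ ⊞ |D|≤2)) far3
      where
      S : BSet n
      S w = E y w ∧ C w
      v-s : ∀ s → s ∈ˢ S → E v' s ≡ true
      v-s s p = all s v' (proj₂ (∧-e p) , y , here y∈U−D , proj₁ (∧-e p)) v'∈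
      S≥ : suc k ≤ countB D + countB S
      S≥ = ≤-trans (many y y∈U) (countB-∪ (λ z → adj y z ∧ (U z ∨ C z)) D S
         λ z p → [ (λ q → inj₁ (nbrs z q (real y z y∈U (inj₁ q) (proj₁ (∧-e p))))) , (λ q → inj₂ (∧-i (real y z y∈U (inj₂ q) (proj₁ (∧-e p))) q)) ]′ (∨-e {U z} (proj₂ (∧-e {adj y z} p))))
      W : BSet n
      W = U ∖ v'
      T₁ : BSet n
      T₁ z = z == v ∨ z == y
      inside : (l ++ v ∷ [ y ]) ⊑ W
      inside = ⊑-++ {l = l} {S = D ∖ v ∖ v'} {T = T₁} m
          (⊑-∷ (∨-i₁ {v == v} (==-refl v)) (⊑-∷ (∖-i {S = T₁} (∨-i₂ {y == v} (==-refl y)) (λ q → ∈≢ D v∈ y∉D (sym q))) ⊑-[]))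
          (λ z x → let x₁ , z≢v' = ∖-e {S = D ∖ v} x ; x₂ , z≢v = ∖-e {S = D} x₁ in ∖-i {S = U} (D⊆U z x₂) z≢v' ,
              ¬t⇒f λ t → [ (λ q → z≢v (==⇒≡ q)) , (λ q → ∈≢ D x₂ y∉D (==⇒≡ q)) ]′ (∨-e {z == v} t))
          (λ z t → [ (λ q → subst (_∈ˢ W) (sym (==⇒≡ q)) (∖-i {S = U} (D⊆U v v∈) (λ x → v'≢ (sym x))))
                   , (λ q → subst (_∈ˢ W) (sym (==⇒≡ q)) (∖-i {S = U} y∈U (λ x → ∈≢ D v'∈ y∉D (sym x)))) ]′ (∨-e {z == v} t))
      far3 : ∀ s s' → s ∈ˢ S → s' ∈ˢ S → s ≢ s' → Far 3 s s'
      far3 s s' p p' s≢ = far-mono {q = 2 + length (l ++ v ∷ [])} (linear (length l ∷ length (l ++ v ∷ []) ∷ []) (# 0 ⊕ κ 1) (# 1) (κ 3) (κ 2 ⊕ # 1) (≡≥ (length-++ l {v ∷ []}))) (path-apart v' (l ++ v ∷ []) y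
         (⊑-∷ (D⊆U v' v'∈) (subst (_⊑ W) (sym (++-assoc l [ v ] [ y ])) inside))
         (proj₂ (∧-e p)) (proj₂ (∧-e p')) s≢ (v-s s p) (Ch-++ E l c evy) (proj₁ (∧-e p')))

    result : Triangle
    result with any? (λ r → (U r ≟ᵇ true) ×-dec ((E y r ≟ᵇ true) ×-dec (D r ≟ᵇ false)))
    ... | yes (r , r∈ , e , r∉) = crossing r e r∉ (end-at y r r∈ e)
    ... | no none = ⊥-elim (pendant λ r r∈ e → ¬f⇒t λ r∉ → none (r , r∈ , e , r∉))

  -- The start `y` has a neighbour on the cycle, so the end block found beyond `y` has an exit.
  triangle : ∀ u → u ∈ˢ U → Triangle
  triangle u u∈ with inner-nbr u u∈
  ... | x , _ , eux with two x u u∈ (λ { refl → t≢f eux (E-irr u) })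
  ...   | y , w , r , eyw , w∈ , _ with inner-nbr y (proj₁ (∖-e {S = U} (Rc-r r)))
  ...     | r₁ , r₁∈ , e = go (end-at y r₁ r₁∈ e)
    where
    y∈ = proj₁ (∖-e {S = U} (Rc-r r))
    go : End U (comp (U ∖ y) r₁) y → Triangle
    go e₁ with Block.thin block w (w∈ , y , home , eyw)
      where open AtEnd y∈ e₁
    ... | inj₁ t = t
    ... | inj₂ th = Final.result (AtEnd.block y∈ e₁) th

-- Contraction of an outer vertex into a neighbour

module Contraction {n} (adj : Rel n) (C : BSet n) (c : ℕ) (Far : ℕ → Fin n → Fin n → Set) (spread : Spread C c Far)
             (U : BSet n) (E : Rel n) (st : State adj C Far U E) (v : Fin n) (v∈ : v ∈ˢ U) (w₀ : Fin n) (w₀∈ : w₀ ∈ˢ C) where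
  open State st
  open Spread spread

  C≢ : ∀ {u w} → u ∈ˢ U → w ∈ˢ C → u ≢ w
  C≢ {u} p q refl = t≢f q (off u p)

  E≢ : ∀ {p q} → E p q ≡ true → p ≢ q
  E≢ e refl = t≢f e (E-irr _)

  -- If this fails for `u`, then `a` separates `u` from the rest of the cycle once `v` is contracted
  -- into `a`.
  Free : Fin n → Fin n → Set
  Free a u = ∃[ z ] ∃[ w ] (Rc E (U ∖ v ∖ a) u z × E z w ≡ true × w ∈ˢ C × w ≢ a)

  free? : ∀ a u → Dec (Free a u)
  free? a u = any? λ z → any? λ w → rc? (U ∖ v ∖ a) u z ×-dec ((E z w ≟ᵇ true) ×-dec ((C w ≟ᵇ true) ×-dec ¬? (w ≟ a)))

  abstract
    Stuck : Fin n → BSet n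
    Stuck a u = (U ∖ v ∖ a) u ∧ not ⌊ free? a u ⌋

    stuck-i : ∀ {a u} → u ∈ˢ U ∖ v ∖ a → ¬ Free a u → u ∈ˢ Stuck a
    stuck-i {a} {u} p q = −-i {S = U ∖ v ∖ a} {λ u → ⌊ free? a u ⌋} p (¬t⇒f λ x → q (⌊⌋-e {d = free? a u} x))

    stuck-e : ∀ {a u} → u ∈ˢ Stuck a → u ∈ˢ U ∖ v ∖ a × ¬ Free a u
    stuck-e {a} {u} p with −-e {S = U ∖ v ∖ a} {λ u → ⌊ free? a u ⌋} p
    ... | q , r = q , λ f → t≢f (⌊⌋-i {d = free? a u} f) r

  Nbr : Fin n → Set
  Nbr a = E v a ≡ true × (a ∈ˢ U ⊎ a ∈ˢ C)

  in-U : ∀ {x y z} → z ∈ˢ U ∖ x ∖ y → z ∈ˢ U × z ≢ x × z ≢ y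
  in-U {x} {y} p with ∖-e {S = U ∖ x} p
  ... | q , r = proj₁ (∖-e {S = U} q) , proj₂ (∖-e {S = U} q) , r

  U∖∖ : ∀ {x y z} → z ∈ˢ U → z ≢ x → z ≢ y → z ∈ˢ U ∖ x ∖ y
  U∖∖ {x} p q r = ∖-i {S = U ∖ x} (∖-i {S = U} p q) r

  -- A walk through `b` would make `b` free.
  free-avoids : ∀ {a b q z w} → ¬ Free a b → E z w ≡ true → w ∈ˢ C → w ≢ a → Rc E (U ∖ v ∖ a) q z → Rc E (U ∖ v ∖ b) q z
  free-avoids {a} {b} {q} ¬f ezw w∈ w≢ (here p) with in-U p
  ... | q∈ , q≢v , q≢a = here (U∖∖ q∈ q≢v λ { refl → ¬f (_ , _ , here p , ezw , w∈ , w≢) })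
  free-avoids {a} {b} {q} ¬f ezw w∈ w≢ (step p e r) with in-U p
  ... | q∈ , q≢v , q≢a = step (U∖∖ q∈ q≢v λ { refl → ¬f (_ , _ , step p e r , ezw , w∈ , w≢) }) e (free-avoids ¬f ezw w∈ w≢ r)

  -- A stuck vertex reaches the cycle without `a`, and the first step out of the stuck set can only
  -- lead to `v`.
  stuck-nbr : ∀ {a u} → u ∈ˢ Stuck a → ∃[ b ] (b ∈ˢ Stuck a × E b v ≡ true)
  stuck-nbr {a} {u} u∈ with stuck-e u∈
  ... | u∈' , ¬f with in-U u∈'
  ...   | u∈U , u≢v , u≢a with two a u u∈U u≢a
  ...     | z , w , r , ezw , w∈ , w≢ with true⊎false (Stuck a z)
  ...       | inj₁ z∈ = ⊥-elim (proj₂ (stuck-e z∈) (z , w , here (proj₁ (stuck-e z∈)) , ezw , w∈ , w≢))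
  ...       | inj₂ z∉ with Rc-hit (λ q → not (Stuck a q)) r (¬t⇒f λ x → t≢f u∈ (not-e x)) (not-i z∉)
  ...         | s , t , rs , est , t∉ , t∈ with −-e {S = U ∖ a} {λ q → not (Stuck a q)} (Rc-r rs)
  ...           | _ , s¬ = s , s∈ , subst (λ x → E s x ≡ true) t≡v est
    where
    s∈ : s ∈ˢ Stuck a
    s∈ = ¬f⇒t λ x → t≢f (not-i x) s¬
    t≡v : t ≡ v
    t≡v with t ≟ v
    ... | yes q = q
    ... | no q with free? a t
    ...   | yes (z , w , r' , e' , w∈ , w≢) = ⊥-elim (proj₂ (stuck-e s∈) (z , w , step (proj₁ (stuck-e s∈)) est r' , e' , w∈ , w≢))
    ...   | no ¬f = ⊥-elim (t≢f (stuck-i (U∖∖ (proj₁ (∖-e {S = U} t∈)) q (proj₂ (∖-e {S = U} t∈))) ¬f) (not-e t∉))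

  -- A walk that frees `z` for `a` cannot meet the stuck vertex `b`, so it frees `z` for `b` too.
  -- And `a` is not stuck for `b`, because it reaches the cycle without `v`, again missing `b`.
  stuck-⊆ : ∀ {a b} → Nbr a → b ∈ˢ Stuck a → ∀ z → z ∈ˢ Stuck b → z ∈ˢ Stuck a
  stuck-⊆ {a} {b} (eva , a∈) b∈ z z∈ with stuck-e b∈ | stuck-e z∈
  ... | b∈' , ¬fb | z∈' , ¬fz with in-U b∈' | in-U z∈'
  ...   | b∈U , b≢v , b≢a | z∈U , z≢v , z≢b = stuck-i (U∖∖ z∈U z≢v z≢a)
          λ { (z' , w , r , e , w∈ , w≢) → ¬fz (z' , w , free-avoids ¬fb e w∈ w≢ r , e , w∈ , λ q → C≢ b∈U w∈ (sym q)) }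
    where
    z≢a : z ≢ a
    z≢a refl with two v z z∈U z≢v
    ... | z' , w , r , e , w∈ , w≢ with z' ≟ z
    ...   | yes refl = ¬fz (z , w , here z∈' , e , w∈ , λ q → C≢ b∈U w∈ (sym q))
    ...   | no z'≢ with Rc-step r z'≢
    ...     | q , ezq , r' = ¬fz (z' , w , step z∈' ezq (free-avoids ¬fb e w∈ (λ q → C≢ z∈U w∈ (sym q)) r') , e , w∈ , λ q → C≢ b∈U w∈ (sym q))

  Good : Fin n → Set
  Good a = Nbr a × (∀ u → u ∈ˢ U ∖ v ∖ a → Free a u)

  -- As long as something is stuck, pass to a stuck neighbour `b` of `v`; the stuck set loses at
  -- least `b`.
  descend : ∀ N a → countB (Stuck a) ≤ N → Nbr a → ∃[ a ] Good a
  descend N a h nb with any? (λ u → Stuck a u ≟ᵇ true)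
  ... | no none = a , nb , λ u u∈ → fr u u∈
    where
    fr : ∀ u → u ∈ˢ U ∖ v ∖ a → Free a u
    fr u u∈ with free? a u
    ... | yes f = f
    ... | no ¬f = ⊥-elim (none (u , stuck-i u∈ ¬f))
  descend zero a h nb | yes (u , u∈) = ⊥-elim (1≰0 (≤-trans (countB-pos (Stuck a) u∈) h))
  descend (suc N) a h nb | yes (u , u∈) with stuck-nbr u∈
  ... | b , b∈ , ebv = descend N b (≤-pred (≤-trans (countB-< (Stuck b) (Stuck a) b (stuck-⊆ nb b∈)
           (¬t⇒f λ x → proj₂ (proj₂ (in-U (proj₁ (stuck-e x)))) refl) b∈) h)) (E-sym ebv , inj₁ (proj₁ (in-U (proj₁ (stuck-e b∈)))))

  good : ∃[ a ] Good a
  good with two w₀ v v∈ (C≢ v∈ w₀∈)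
  ... | z , w , r , e , w∈ , _ with z ≟ v
  ...   | yes refl = descend _ w ≤-refl (e , inj₂ w∈)
  ...   | no q with Rc-step r q
  ...     | x , e' , r' = descend _ x ≤-refl (e' , inj₁ (proj₁ (in-U (Rc-l r'))))

  module Into (a : Fin n) (eva : E v a ≡ true) (a∈ : a ∈ˢ U ⊎ a ∈ˢ C) (free : ∀ u → u ∈ˢ U ∖ v ∖ a → Free a u) where
    -- `v` keeps its edges in `E'`; it disappears only by leaving `U`.
    E' : Rel n
    E' p q = not (p == q) ∧ (E p q ∨ (p == a ∧ E v q ∨ q == a ∧ E v p))

    E'-e : ∀ {p q} → E' p q ≡ true → p ≢ q × (E p q ≡ true ⊎ (p ≡ a × E v q ≡ true) ⊎ (q ≡ a × E v p ≡ true))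
    E'-e {p} {q} e with ∧-e {not (p == q)} e
    ... | e₁ , e₂ = ==f⇒≢ (not-e e₁) , go (∨-e {E p q} e₂)
      where
      go : _ → E p q ≡ true ⊎ (p ≡ a × E v q ≡ true) ⊎ (q ≡ a × E v p ≡ true)
      go (inj₁ x) = inj₁ x
      go (inj₂ x) with ∨-e {p == a ∧ E v q} x
      ... | inj₁ y = inj₂ (inj₁ (==⇒≡ (proj₁ (∧-e {p == a} y)) , proj₂ (∧-e {p == a} y)))
      ... | inj₂ y = inj₂ (inj₂ (==⇒≡ (proj₁ (∧-e {q == a} y)) , proj₂ (∧-e {q == a} y)))

    E'-i : ∀ {p q} → E p q ≡ true → E' p q ≡ true
    E'-i e = ∧-i (not-i (≢⇒==f (E≢ e))) (∨-i₁ e)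

    E'-a : ∀ {q} → E v q ≡ true → a ≢ q → E' a q ≡ true
    E'-a {q} e r = ∧-i (not-i (≢⇒==f r)) (∨-i₂ {E a q} (∨-i₁ (∧-i (==-refl a) e)))

    E'-a' : ∀ {q} → E v q ≡ true → a ≢ q → E' q a ≡ true
    E'-a' {q} e r = ∧-i (not-i (≢⇒==f (λ x → r (sym x)))) (∨-i₂ {E q a} (∨-i₂ {q == a ∧ E v a} (∧-i (==-refl a) e)))

    E'-sym : Symm E'
    E'-sym {p} {q} e with E'-e {p} {q} e
    ... | r , inj₁ x = E'-i (E-sym x)
    ... | r , inj₂ (inj₁ (refl , x)) = E'-a' x r
    ... | r , inj₂ (inj₂ (refl , x)) = E'-a x (λ y → r (sym y))

    E'-mono : ∀ {S p q} → Rc E S p q → Rc E' S p q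
    E'-mono (here p) = here p
    E'-mono (step p e r) = step p (E'-i e) (E'-mono r)

    Goal : Fin n → Fin n → Set
    Goal x q = ∃[ z ] ∃[ w ] (Rc E' (U ∖ v ∖ x) q z × E' z w ≡ true × w ∈ˢ C × w ≢ x)

    extend : ∀ {x p q} → p ∈ˢ U ∖ v ∖ x → E' p q ≡ true → Goal x q → Goal x p
    extend p∈ e (z , w , r , y) = z , w , step p∈ e r , y

    -- The walk is repeated with `a` in place of `v`. If `a` is on the cycle, it has already arrived
    -- there.
    reroute : ∀ {x z w} → x ≢ a → E z w ≡ true → w ∈ˢ C → w ≢ x → ∀ {q} → Rc E (U ∖ x) q z →
              (q ≢ v → Goal x q) × (q ≡ v → a ∈ˢ C ⊎ Goal x a)
    reroute {x} x≢ ezw w∈ w≢ {q} (here q∈) = near , λ e → far e a∈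
      where
      q∈U = proj₁ (∖-e {S = U} q∈)
      near : q ≢ v → Goal x q
      near q≢v = q , _ , here (U∖∖ q∈U q≢v (proj₂ (∖-e {S = U} q∈))) , E'-i ezw , w∈ , w≢
      far : q ≡ v → a ∈ˢ U ⊎ a ∈ˢ C → a ∈ˢ C ⊎ Goal x a
      far refl (inj₂ y) = inj₁ y
      far refl (inj₁ y) = inj₂ (a , _ , here (U∖∖ y (λ z → E≢ eva (sym z)) (λ z → x≢ (sym z))) , E'-a ezw (C≢ y w∈) , w∈ , w≢)
    reroute {x} x≢ ezw w∈ w≢ {q} (step {w = q'} q∈ e r) with reroute x≢ ezw w∈ w≢ r | q' ≟ v
    ... | i , j | no q'≢v = near , λ e → far e a∈
      where
      q∈U = proj₁ (∖-e {S = U} q∈)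
      near : q ≢ v → Goal x q
      near q≢v = extend (U∖∖ q∈U q≢v (proj₂ (∖-e {S = U} q∈))) (E'-i e) (i q'≢v)
      far : q ≡ v → a ∈ˢ U ⊎ a ∈ˢ C → a ∈ˢ C ⊎ Goal x a
      far refl (inj₂ y) = inj₁ y
      far refl (inj₁ y) with a ≟ q'
      ... | yes refl = inj₂ (i q'≢v)
      ... | no a≢ = inj₂ (extend (U∖∖ y (λ z → E≢ eva (sym z)) (λ z → x≢ (sym z))) (E'-a e a≢) (i q'≢v))
    ... | i , j | yes refl = near , λ { refl → ⊥-elim (E≢ e refl) }
      where
      q∈U = proj₁ (∖-e {S = U} q∈)
      near : q ≢ q' → Goal x q
      near q≢v with j refl | a ≟ q
      ... | inj₁ y | _ = q , a , here (U∖∖ q∈U q≢v (proj₂ (∖-e {S = U} q∈))) , E'-a' (E-sym e) (λ z → C≢ q∈U y (sym z)) , y , (λ z → x≢ (sym z))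
      ... | inj₂ y | yes refl = y
      ... | inj₂ y | no a≢ = extend (U∖∖ q∈U q≢v (proj₂ (∖-e {S = U} q∈))) (E'-a' (E-sym e) a≢) y

    two' : ∀ x u → u ∈ˢ U ∖ v → u ≢ x → ∃[ z ] ∃[ w ] (Rc E' (U ∖ v ∖ x) u z × E' z w ≡ true × w ∈ˢ C × w ≢ x)
    two' x u u∈ u≢x with x ≟ a
    ... | yes refl with free u (∖-i {S = U ∖ v} u∈ u≢x)
    ...   | z , w , r , e , w∈ , w≢ = z , w , E'-mono r , E'-i e , w∈ , w≢
    two' x u u∈ u≢x | no x≢ with two x u (proj₁ (∖-e {S = U} u∈)) u≢x
    ...   | z , w , r , e , w∈ , w≢ = proj₁ (reroute x≢ e w∈ w≢ r) (proj₂ (∖-e {S = U} u∈))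

    not-head : ∀ {x l} → cnt a (x ∷ l) ≡ 0 → x ≢ a × cnt a l ≡ 0
    not-head {x} {l} h = (λ { refl → 1≰0 (≤-trans (cnt-mid a [] l) (≤-reflexive h)) }) , m+n≡0⇒n≡0 ⟦ a == x ⟧ h

    avoiding : ∀ {p q} l → p ≢ a → q ≢ a → cnt a l ≡ 0 → Ch E' p l q → Ch E p l q
    avoiding {p} {q} [] p≢ q≢ h e with E'-e {p} {q} e
    ... | _ , inj₁ x = x
    ... | _ , inj₂ (inj₁ (y , _)) = ⊥-elim (p≢ y)
    ... | _ , inj₂ (inj₂ (y , _)) = ⊥-elim (q≢ y)
    avoiding {p} {q} (x ∷ l) p≢ q≢ h (e , c) with not-head {x} {l} h
    ... | x≢ , h' = avoiding [] p≢ x≢ refl e , avoiding l x≢ q≢ h' c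

    arriving : ∀ {p} l → p ≢ a → cnt a l ≡ 0 → Ch E' p l a → Ch E p l a ⊎ Ch E p l v
    arriving {p} [] p≢ h e with E'-e {p} {a} e
    ... | _ , inj₁ x = inj₁ x
    ... | _ , inj₂ (inj₁ (y , _)) = ⊥-elim (p≢ y)
    ... | _ , inj₂ (inj₂ (_ , y)) = inj₂ (E-sym y)
    arriving {p} (x ∷ l) p≢ h (e , c) with not-head {x} {l} h
    ... | x≢ , h' with arriving l x≢ h' c
    ...   | inj₁ y = inj₁ (avoiding [] p≢ x≢ refl e , y)
    ...   | inj₂ y = inj₂ (avoiding [] p≢ x≢ refl e , y)

    leaving : ∀ {q} l → q ≢ a → cnt a l ≡ 0 → Ch E' a l q → Ch E a l q ⊎ Ch E v l q
    leaving {q} l q≢ h c with arriving (reverse l) q≢ (trans (cnt-reverse a l) h) (Ch-reverse E' E'-sym l c)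
    ... | inj₁ x = inj₁ (subst (λ m → Ch E a m q) (reverse-involutive l) (Ch-reverse E E-sym (reverse l) x))
    ... | inj₂ x = inj₂ (subst (λ m → Ch E v m q) (reverse-involutive l) (Ch-reverse E E-sym (reverse l) x))

    grow : ∀ {l l'} → l ⊑ U ∖ v → (∀ z → cnt z l' ≤ cnt z l + ⟦ z == v ⟧) → l' ⊑ U
    grow {l} {l'} m f = ⊑-i λ z → ≤-trans (f z) (≤-trans (+-monoˡ-≤ ⟦ z == v ⟧ (⊑-e m z)) (g z))
      where
      g : ∀ z → ⟦ (U ∖ v) z ⟧ + ⟦ z == v ⟧ ≤ ⟦ U z ⟧
      g z with z ≟ v
      ... | yes refl rewrite v∈ = ≤-refl
      ... | no _ with U z
      ...   | true = ≤-refl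
      ...   | false = ≤-refl

    inner : ∀ {l} → l ⊑ U ∖ v → l ⊑ U
    inner m = ⊑-mono m λ z p → proj₁ (∖-e {S = U} p)

    -- Lifting an ear from `E'` to `E` keeps it, inserts `v` next to `a`, or puts `v` in place of
    -- `a`, so it never becomes shorter. The vertex `a` occurs at most once, in the interior or as
    -- an end on the cycle.
    ear' : ∀ w l w' → w ∈ˢ C → w' ∈ˢ C → w ≢ w' → l ⊑ U ∖ v → Ch E' w l w' → Far (length l) w w'
    ear' w l w' w∈ w'∈ w≢ m c with 1 ≤? cnt a l
    ... | yes a∈l with cnt-∈ a l a∈l
    ...   | l₁ , l₂ , refl = go (arriving l₁ w≢a h₁ (proj₁ (Ch-split E' l₁ c))) (leaving l₂ w'≢a h₂ (proj₂ (Ch-split E' l₁ c)))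
      where
      a∈U : a ∈ˢ U
      a∈U = ⊑-∈ {l = l} (inner m) a∈l
      w≢a : w ≢ a
      w≢a q = C≢ a∈U w∈ (sym q)
      w'≢a : w' ≢ a
      w'≢a q = C≢ a∈U w'∈ (sym q)
      total : cnt a l₁ + (1 + cnt a l₂) ≤ 1
      total = ≤-trans (≤-reflexive (sym (trans (cnt-++ a l₁ (a ∷ l₂)) (cong (λ b → cnt a l₁ + (b + cnt a l₂)) (⟦⟧-true (==-refl a)))))) (≤-trans (⊑-e m a) (⟦⟧≤1 _))
      h₁ : cnt a l₁ ≡ 0
      h₁ = n≤0⇒n≡0 (linear (cnt a l₁ ∷ cnt a l₂ ∷ []) (# 0 ⊕ (κ 1 ⊕ # 1)) (κ 1) (# 0) (κ 0) total)
      h₂ : cnt a l₂ ≡ 0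
      h₂ = n≤0⇒n≡0 (linear (cnt a l₁ ∷ cnt a l₂ ∷ []) (# 0 ⊕ (κ 1 ⊕ # 1)) (κ 1) (# 1) (κ 0) total)
      e : ∀ z → cnt z (l₁ ++ a ∷ l₂) ≡ cnt z l₁ + (⟦ z == a ⟧ + cnt z l₂)
      e z = cnt-++ z l₁ (a ∷ l₂)
      go : Ch E w l₁ a ⊎ Ch E w l₁ v → Ch E a l₂ w' ⊎ Ch E v l₂ w' → Far (length l) w w'
      go (inj₁ x) (inj₁ y) = ear w l w' w∈ w'∈ w≢ (inner m) (Ch-++ E l₁ x y)
      go (inj₁ x) (inj₂ y) = far-mono (linear (length l₁ ∷ length l₂ ∷ length (l₁ ++ a ∷ l₂) ∷ length (l₁ ++ a ∷ v ∷ l₂) ∷ []) (# 0 ⊕ (κ 2 ⊕ # 1) ⊕ # 2) (# 3 ⊕ (# 0 ⊕ (κ 1 ⊕ # 1))) (# 2) (# 3) (≡≥ (length-++ l₁ {a ∷ v ∷ l₂}) ⊞ ≡≤ (length-++ l₁ {a ∷ l₂})))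
           (ear w (l₁ ++ a ∷ v ∷ l₂) w' w∈ w'∈ w≢ (grow m cn) (Ch-++ E l₁ x (E-sym eva , y)))
        where
        cn : ∀ z → cnt z (l₁ ++ a ∷ v ∷ l₂) ≤ cnt z (l₁ ++ a ∷ l₂) + ⟦ z == v ⟧
        cn z = linear (cnt z l₁ ∷ ⟦ z == a ⟧ ∷ cnt z l₂ ∷ cnt z (l₁ ++ a ∷ v ∷ l₂) ∷ cnt z (l₁ ++ a ∷ l₂) ∷ ⟦ z == v ⟧ ∷ []) (# 0 ⊕ (# 1 ⊕ # 2) ⊕ # 3) (# 4 ⊕ (# 0 ⊕ (# 1 ⊕ (# 5 ⊕ # 2)))) (# 3) (# 4 ⊕ # 5) (≡≥ (e z) ⊞ ≡≤ (cnt-++ z l₁ (a ∷ v ∷ l₂)))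
      go (inj₂ x) (inj₁ y) = far-mono (linear (length l₁ ∷ length l₂ ∷ length (l₁ ++ a ∷ l₂) ∷ length (l₁ ++ v ∷ a ∷ l₂) ∷ []) (# 0 ⊕ (κ 2 ⊕ # 1) ⊕ # 2) (# 3 ⊕ (# 0 ⊕ (κ 1 ⊕ # 1))) (# 2) (# 3) (≡≥ (length-++ l₁ {v ∷ a ∷ l₂}) ⊞ ≡≤ (length-++ l₁ {a ∷ l₂})))
           (ear w (l₁ ++ v ∷ a ∷ l₂) w' w∈ w'∈ w≢ (grow m cn) (Ch-++ E l₁ x (eva , y)))
        where
        cn : ∀ z → cnt z (l₁ ++ v ∷ a ∷ l₂) ≤ cnt z (l₁ ++ a ∷ l₂) + ⟦ z == v ⟧
        cn z = linear (cnt z l₁ ∷ ⟦ z == a ⟧ ∷ cnt z l₂ ∷ cnt z (l₁ ++ v ∷ a ∷ l₂) ∷ cnt z (l₁ ++ a ∷ l₂) ∷ ⟦ z == v ⟧ ∷ []) (# 0 ⊕ (# 1 ⊕ # 2) ⊕ # 3) (# 4 ⊕ (# 0 ⊕ (# 5 ⊕ (# 1 ⊕ # 2)))) (# 3) (# 4 ⊕ # 5) (≡≥ (e z) ⊞ ≡≤ (cnt-++ z l₁ (v ∷ a ∷ l₂)))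
      go (inj₂ x) (inj₂ y) = far-mono (linear (length l₁ ∷ length l₂ ∷ length (l₁ ++ a ∷ l₂) ∷ length (l₁ ++ v ∷ l₂) ∷ []) (# 0 ⊕ (κ 1 ⊕ # 1) ⊕ # 2) (# 3 ⊕ (# 0 ⊕ (κ 1 ⊕ # 1))) (# 2) (# 3) (≡≥ (length-++ l₁ {v ∷ l₂}) ⊞ ≡≤ (length-++ l₁ {a ∷ l₂})))
           (ear w (l₁ ++ v ∷ l₂) w' w∈ w'∈ w≢ (grow m cn) (Ch-++ E l₁ x y))
        where
        cn : ∀ z → cnt z (l₁ ++ v ∷ l₂) ≤ cnt z (l₁ ++ a ∷ l₂) + ⟦ z == v ⟧
        cn z = ≤-trans (≤-reflexive (cnt-++ z l₁ (v ∷ l₂))) (linear (cnt z l₁ ∷ ⟦ z == a ⟧ ∷ cnt z l₂ ∷ cnt z (l₁ ++ a ∷ l₂) ∷ ⟦ z == v ⟧ ∷ []) (# 0 ⊕ (# 1 ⊕ # 2)) (# 3) (# 0 ⊕ (# 4 ⊕ # 2)) (# 3 ⊕ # 4) (≡≥ (e z)))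
    ear' w l w' w∈ w'∈ w≢ m c | no a∉l with w ≟ a | w' ≟ a
    ... | no w≢a | no w'≢a = ear w l w' w∈ w'∈ w≢ (inner m) (avoiding l w≢a w'≢a (n≤0⇒n≡0 (≤-pred (≰⇒> a∉l))) c)
    ... | yes refl | yes refl = ⊥-elim (w≢ refl)
    ... | yes refl | no w'≢a with leaving l w'≢a (n≤0⇒n≡0 (≤-pred (≰⇒> a∉l))) c
    ...   | inj₁ x = ear w l w' w∈ w'∈ w≢ (inner m) x
    ...   | inj₂ x = far-mono (n≤1+n _) (ear w (v ∷ l) w' w∈ w'∈ w≢ (⊑-∷ v∈ m) (E-sym eva , x))
    ear' w l w' w∈ w'∈ w≢ m c | no a∉l | no w≢a | yes refl with arriving l w≢a (n≤0⇒n≡0 (≤-pred (≰⇒> a∉l))) c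
    ...   | inj₁ x = ear w l w' w∈ w'∈ w≢ (inner m) x
    ...   | inj₂ x = far-mono (≤-trans (n≤1+n _) (≤-reflexive (trans (sym (cong suc (length-reverse l))) (sym (length-reverse (v ∷ reverse l))))))
               (ear w (reverse (v ∷ reverse l)) w' w∈ w'∈ w≢ (⊑-reverse (⊑-∷ v∈ (⊑-reverse m)))
                 (Ch-reverse E E-sym (v ∷ reverse l) (E-sym eva , Ch-reverse E E-sym l x)))

    state : State adj C Far (U ∖ v) E'
    state = record
      { E-sym = λ {p} {q} → E'-sym {p} {q}
      ; E-irr = λ u → ¬t⇒f λ p → proj₁ (E'-e {u} {u} p) refl
      ; off = λ u p → off u (proj₁ (∖-e {S = U} p))
      ; real = λ u w u∈ w∈ e → E'-i (real u w (proj₁ (∖-e {S = U} u∈)) ([ (λ x → inj₁ (proj₁ (∖-e {S = U} x))) , inj₂ ]′ w∈) e)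
      ; two = two'
      ; ear = ear' }

  contract : ∃[ E' ] State adj C Far (U ∖ v) E'
  contract with good
  ... | a , (eva , a∈) , free = Into.E' a eva a∈ free , Into.state a eva a∈ free

-- Counting the edges outside the cycle

⟦⟧-excl : ∀ {a b d} → (a ≡ true → d ≡ true) → (b ≡ true → d ≡ true) → (a ≡ true → b ≡ true → ⊥) → ⟦ a ⟧ + ⟦ b ⟧ ≤ ⟦ d ⟧
⟦⟧-excl {true}  {true}  f g h = ⊥-elim (h refl refl)
⟦⟧-excl {true}  {false} f g h rewrite f refl = ≤-refl
⟦⟧-excl {false} {b}     f g h = ⟦⟧-mono g

module Outer {n} (adj : Rel n) (C : BSet n) (adj-sym : Symm adj) where

  pairs : BSet n → Fin n → BSet n
  pairs U p q = adj p q ∧ ((toℕ p <ᵇ toℕ q) ∧ (not (C p ∧ C q) ∧ ((U p ∨ C p) ∧ (U q ∨ C q))))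

  pairs-e : ∀ U p q → q ∈ˢ pairs U p → adj p q ≡ true × toℕ p < toℕ q × not (C p ∧ C q) ≡ true × U p ∨ C p ≡ true × U q ∨ C q ≡ true
  pairs-e U p q h with ∧-e {adj p q} h
  ... | h₁ , t₁ with ∧-e {toℕ p <ᵇ toℕ q} t₁
  ...   | h₂ , t₂ with ∧-e {not (C p ∧ C q)} t₂
  ...     | h₃ , t₃ with ∧-e {U p ∨ C p} t₃
  ...       | h₄ , h₅ = h₁ , <ᵇ⇒< (toℕ p) (toℕ q) (subst T (sym h₂) tt) , h₃ , h₄ , h₅

  pairs-i : ∀ {U p q} → adj p q ≡ true → toℕ p < toℕ q → not (C p ∧ C q) ≡ true → U p ∨ C p ≡ true → U q ∨ C q ≡ true → q ∈ˢ pairs U p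
  pairs-i {U} {p} {q} a b c d e = ∧-i a (∧-i (T⇒ (<⇒<ᵇ b)) (∧-i c (∧-i d e)))
    where
    T⇒ : ∀ {x} → T x → x ≡ true
    T⇒ {true} _ = refl

  outer : BSet n → ℕ
  outer U = sumF λ p → countB (pairs U p)

  abstract
    outer-∖ : ∀ U u → outer U ≤ outer (U ∖ u) + rdeg adj C U u
    outer-∖ U u = ≤-trans (sumF-mono row) (≤-trans (≤-reflexive split) (+-monoʳ-≤ (outer (U ∖ u)) both))
      where
      U' : BSet n
      U' = U ∖ u
      keep : ∀ z → z ≢ u → U z ∨ C z ≡ true → U' z ∨ C z ≡ true
      keep z z≢u h = [ (λ x → ∨-i₁ (∖-i {S = U} x z≢u)) , ∨-i₂ {U' z} ]′ (∨-e {U z} h)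
      row : ∀ p → countB (pairs U p) ≤ countB (pairs U' p) + (⟦ p == u ⟧ * countB (pairs U u) + ⟦ pairs U p u ⟧)
      row p = [ same , other ]′ (true⊎false (p == u))
        where
        Row : Set
        Row = countB (pairs U p) ≤ countB (pairs U' p) + (⟦ p == u ⟧ * countB (pairs U u) + ⟦ pairs U p u ⟧)
        same : p == u ≡ true → Row
        same h = ≤-trans (≤-reflexive (trans (cong (λ x → countB (pairs U x)) (==⇒≡ h))
                   (trans (sym (*-identityˡ _)) (cong (_* countB (pairs U u)) (sym (⟦⟧-true h))))))
                 (≤-trans (m≤m+n _ _) (m≤n+m _ (countB (pairs U' p))))
        other : p == u ≡ false → Row
        other h = ≤-trans (countB-≤point (pairs U p) (pairs U' p) u λ q h' q≢u →
              let a , b , c , d , e = pairs-e U p q h' in pairs-i {U'} a b c (keep p (==f⇒≢ h) d) (keep q q≢u e))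
              (+-monoʳ-≤ (countB (pairs U' p)) (m≤n+m _ _))
      split : sumF (λ p → countB (pairs U' p) + (⟦ p == u ⟧ * countB (pairs U u) + ⟦ pairs U p u ⟧)) ≡
              outer U' + (countB (pairs U u) + countB (λ p → pairs U p u))
      split = trans (sumF-+ (λ p → countB (pairs U' p)) (λ p → ⟦ p == u ⟧ * countB (pairs U u) + ⟦ pairs U p u ⟧))
        (cong (outer U' +_) (trans (sumF-+ (λ p → ⟦ p == u ⟧ * countB (pairs U u)) (λ p → ⟦ pairs U p u ⟧))
           (cong₂ _+_ (sumF-point u (λ _ → countB (pairs U u))) (sym (countB≡ (λ p → pairs U p u))))))
      both : countB (pairs U u) + countB (λ p → pairs U p u) ≤ rdeg adj C U u
      both = countB-+≤ (pairs U u) (λ p → pairs U p u) (λ z → adj u z ∧ (U z ∨ C z)) λ z → ⟦⟧-excl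
        (λ h → let a , _ , _ , _ , e = pairs-e U u z h in ∧-i a e)
        (λ h → let a , _ , _ , d , _ = pairs-e U z u h in ∧-i (adj-sym a) d)
        (λ h h' → <-asym (proj₁ (proj₂ (pairs-e U u z h))) (proj₁ (proj₂ (pairs-e U z u h'))))

    outer-empty : ∀ U → countB U ≡ 0 → outer U ≡ 0
    outer-empty U h = sumF-0 {n} λ p → countB-false (pairs U p) λ q → ¬t⇒f λ x →
      let _ , _ , c , d , e = pairs-e U p q x in t≢f (∧-i (inC d) (inC e)) (not-e c)
      where
      inC : ∀ {z} → U z ∨ C z ≡ true → C z ≡ true
      inC {z} x = [ (λ y → ⊥-elim (1≰0 (≤-trans (countB-pos U y) (≤-reflexive h)))) , (λ y → y) ]′ (∨-e {U z} x)

    rdeg-∖ : ∀ U u z → z ∈ˢ U → z ∉ˢ C → adj u z ≡ true → suc (rdeg adj C (U ∖ z) u) ≤ rdeg adj C U u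
    rdeg-∖ U u z z∈ z∉ e = countB-< (λ w → adj u w ∧ ((U ∖ z) w ∨ C w)) (λ w → adj u w ∧ (U w ∨ C w)) z
      (λ w h → let a , b = ∧-e {adj u w} h in ∧-i a ([ (λ x → ∨-i₁ (proj₁ (∖-e {S = U} x))) , ∨-i₂ {U w} ]′ (∨-e {(U ∖ z) w} b)))
      (¬t⇒f λ h → [ (λ x → proj₂ (∖-e {S = U} x) refl) , (λ x → t≢f x z∉) ]′ (∨-e {(U ∖ z) z} (proj₂ (∧-e {adj u z} h))))
      (∧-i e (∨-i₁ z∈))

  module Descent (c : ℕ) (Far : ℕ → Fin n → Fin n → Set) (spread : Spread C c Far) (k : ℕ) (4≤k : 4 ≤ k) (c≤ : c ≤ 3 + 2 * k)
                 (w₀ : Fin n) (w₀∈ : w₀ ∈ˢ C) (few : ∀ u → u ∉ˢ C → countB (λ z → adj u z ∧ C z) ≤ k) where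

    -- Each removal replaces `E` by a further contraction, while `outer` and `rdeg` refer to the
    -- original relation throughout.
    sparse : ∀ N U E → countB U ≤ N → State adj C Far U E → outer U ≤ k * countB U
    sparse N U E h st with 1 ≤? countB U
    ... | no none = ≤-trans (≤-reflexive (outer-empty U (n≤0⇒n≡0 (≤-pred (≰⇒> none))))) z≤n
    sparse zero U E h st | yes some = ⊥-elim (1≰0 (≤-trans some h))
    sparse (suc N) U E h st | yes some with any? (λ u → (U u ≟ᵇ true) ×-dec (rdeg adj C U u ≤? k))
    ... | yes (u , u∈ , low) with Contraction.contract adj C c Far spread U E st u u∈ w₀ w₀∈
    ...   | E' , st' = ≤-trans (outer-∖ U u) (≤-trans (+-mono-≤ (sparse N (U ∖ u) E' (linear (countB U ∷ countB (U ∖ u) ∷ N ∷ []) (# 0 ⊕ (κ 1 ⊕ # 1)) (κ 1 ⊕ # 2 ⊕ # 0) (# 1) (# 2) (h ⊞ ≡≥ (countB-∖ U u∈))) st') low)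
              (≤-reflexive (trans (+-comm (k * countB (U ∖ u)) k) (trans (sym (*-suc k (countB (U ∖ u)))) (cong (k *_) (sym (countB-∖ U u∈)))))))
    sparse (suc N) U E h st | yes some | no high = peel (Dense.triangle adj C c Far spread k 4≤k c≤ U E st few' many (proj₁ (pick U some)) (proj₂ (pick U some)))
      where
      few' : ∀ u → u ∈ˢ U → countB (λ z → adj u z ∧ C z) ≤ k
      few' u u∈ = few u (State.off st u u∈)
      many : ∀ u → u ∈ˢ U → suc k ≤ rdeg adj C U u
      many u u∈ = ≰⇒> λ x → high (u , u∈ , x)
      peel : Dense.Triangle adj C c Far spread k 4≤k c≤ U E st few' many → outer U ≤ k * countB U
      peel (v₁ , v₂ , v₃ , i₁ , i₂ , i₃ , n₂₁ , n₃₁ , n₃₂ , (a₂₁ , a₃₁ , a₃₂) , (r₁ , r₂ , r₃)) = ≤-trans bound (≤-reflexive tot)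
        where
        U₁ = U ∖ v₁
        U₂ = U₁ ∖ v₂
        U₃ = U₂ ∖ v₃
        j₂ : v₂ ∈ˢ U₁
        j₂ = ∖-i {S = U} i₂ n₂₁
        j₃ : v₃ ∈ˢ U₁
        j₃ = ∖-i {S = U} i₃ n₃₁
        m₃ : v₃ ∈ˢ U₂
        m₃ = ∖-i {S = U₁} j₃ n₃₂
        s₁ = Contraction.contract adj C c Far spread U E st v₁ i₁ w₀ w₀∈
        s₂ = Contraction.contract adj C c Far spread U₁ (proj₁ s₁) (proj₂ s₁) v₂ j₂ w₀ w₀∈
        s₃ = Contraction.contract adj C c Far spread U₂ (proj₁ s₂) (proj₂ s₂) v₃ m₃ w₀ w₀∈
        c₁ : countB U ≡ suc (countB U₁)
        c₁ = countB-∖ U i₁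
        c₂ : countB U₁ ≡ suc (countB U₂)
        c₂ = countB-∖ U₁ j₂
        c₃ : countB U₂ ≡ suc (countB U₃)
        c₃ = countB-∖ U₂ m₃
        IH : outer U₃ ≤ k * countB U₃
        IH = sparse N U₃ (proj₁ s₃) (linear (countB U ∷ countB U₁ ∷ countB U₂ ∷ countB U₃ ∷ N ∷ []) (# 0 ⊕ (κ 1 ⊕ # 1 ⊕ (κ 1 ⊕ # 2 ⊕ (κ 1 ⊕ # 3)))) (κ 1 ⊕ # 4 ⊕ (# 0 ⊕ (# 1 ⊕ # 2))) (# 3) (# 4) (h ⊞ ≡≥ c₁ ⊞ ≡≥ c₂ ⊞ ≡≥ c₃)) (proj₂ s₃)
        bound : outer U ≤ k + (k + (k + k * countB U₃))
        bound = linear (outer U ∷ outer U₁ ∷ outer U₂ ∷ rdeg adj C U v₁ ∷ rdeg adj C U v₂ ∷ rdeg adj C U v₃ ∷ rdeg adj C (U ∖ v₁) v₂ ∷ rdeg adj C (U ∖ v₁) v₃ ∷ rdeg adj C (U₁ ∖ v₂) v₃ ∷ outer U₃ ∷ k ∷ k * countB U₃ ∷ []) (# 0 ⊕ (# 1 ⊕ (# 2 ⊕ (# 3 ⊕ (# 4 ⊕ (# 5 ⊕ (κ 1 ⊕ # 6 ⊕ (κ 1 ⊕ # 7 ⊕ (κ 1 ⊕ # 8 ⊕ # 9))))))))) (# 1 ⊕ # 3 ⊕ (# 2 ⊕ # 6 ⊕ (# 9 ⊕ # 8 ⊕ (κ 1 ⊕ # 10 ⊕ (κ 1 ⊕ #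 10 ⊕ (κ 1 ⊕ # 10 ⊕ (# 4 ⊕ (# 5 ⊕ (# 7 ⊕ # 11))))))))) (# 0) (# 10 ⊕ (# 10 ⊕ (# 10 ⊕ # 11))) (outer-∖ U v₁ ⊞ outer-∖ U₁ v₂ ⊞ outer-∖ U₂ v₃ ⊞ r₁ ⊞ r₂ ⊞ r₃ ⊞ rdeg-∖ U v₂ v₁ i₁ (State.off st v₁ i₁) a₂₁
              ⊞ rdeg-∖ U v₃ v₁ i₁ (State.off st v₁ i₁) a₃₁ ⊞ rdeg-∖ U₁ v₃ v₂ j₂ (State.off st v₂ i₂) a₃₂ ⊞ IH)
        tot : k + (k + (k + k * countB U₃)) ≡ k * countB U
        tot rewrite c₁ | c₂ | c₃ | *-suc k (suc (suc (countB U₃))) | *-suc k (suc (countB U₃)) | *-suc k (countB U₃) = refl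

-- Gaps on the longest cycle

module Gaps {n} (P : BSet n) where
  -- `a` is the number of vertices still due before the next member of `P`; the recursion resets it
  -- to `g` at each member.
  gaps : ∀ g q a r t →
    (∀ l₁ w l₂ → r ≡ l₁ ++ w ∷ l₂ → w ∈ˢ P → a ≤ length l₁) →
    (∀ l₁ w l₂ → r ≡ l₁ ++ w ∷ l₂ → w ∈ˢ P → q ≤ length l₂) →
    (∀ l₁ w l₂ w' l₃ → r ≡ l₁ ++ w ∷ l₂ ++ w' ∷ l₃ → w ∈ˢ P → w' ∈ˢ P → g ≤ length l₂) →
    cntB P r ≡ suc t → a + q + suc t + t * g ≤ length r
  gaps g q a (z ∷ r) t fs ls md ct with true⊎false (P z)
  gaps g q zero (z ∷ r) t fs ls md ct | inj₂ z∉ rewrite z∉ =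
    ≤-trans (gaps g q zero r t (λ _ _ _ _ _ → z≤n) (λ l₁ w l₂ e → ls (z ∷ l₁) w l₂ (cong (z ∷_) e))
       (λ l₁ w l₂ w' l₃ e → md (z ∷ l₁) w l₂ w' l₃ (cong (z ∷_) e)) ct) (n≤1+n _)
  gaps g q (suc a) (z ∷ r) t fs ls md ct | inj₂ z∉ rewrite z∉ =
    s≤s (gaps g q a r t (λ l₁ w l₂ e w∈ → ≤-pred (fs (z ∷ l₁) w l₂ (cong (z ∷_) e) w∈)) (λ l₁ w l₂ e → ls (z ∷ l₁) w l₂ (cong (z ∷_) e))
       (λ l₁ w l₂ w' l₃ e → md (z ∷ l₁) w l₂ w' l₃ (cong (z ∷_) e)) ct)
  gaps g q a (z ∷ r) zero fs ls md ct | inj₁ z∈ = linear (a ∷ q ∷ length r ∷ g ∷ []) (# 0 ⊕ # 1) (κ 0 ⊕ # 2) (# 0 ⊕ # 1 ⊕ κ 1 ⊕ (0 ⊛ # 3)) (κ 1 ⊕ # 2) (fs [] z r refl z∈ ⊞ ls [] z r refl z∈)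
  gaps g q a (z ∷ r) (suc t) fs ls md ct | inj₁ z∈ rewrite z∈ =
    linear (a ∷ g ∷ q ∷ t ∷ t * g ∷ length r ∷ []) (# 0 ⊕ (# 1 ⊕ # 2 ⊕ (κ 1 ⊕ # 3) ⊕ # 4)) (κ 0 ⊕ # 5) (# 0 ⊕ # 2 ⊕ (κ 2 ⊕ # 3) ⊕ (# 1 ⊕ # 4)) (κ 1 ⊕ # 5) (fs [] z r refl z∈ ⊞ gaps g q g r t (λ l₁ w l₂ e w∈ → md [] z l₁ w l₂ (cong (z ∷_) e) z∈ w∈) (λ l₁ w l₂ e → ls (z ∷ l₁) w l₂ (cong (z ∷_) e))
       (λ l₁ w l₂ w' l₃ e → md (z ∷ l₁) w l₂ w' l₃ (cong (z ∷_) e)) (suc-injective ct))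

Simple : ∀ {n} → List (Fin n) → Set
Simple l = ∀ z → cnt z l ≤ 1

module Cyclic {n} (G : Graph n) where
  ad : Rel n
  ad = adj G

  ad-sym : Symm ad
  ad-sym {u} {v} e = trans (sym (Graph.sym G u v)) e

  memB-cnt : ∀ (z : Fin n) l → Unique l → cnt z l ≡ ⟦ memB z l ⟧
  memB-cnt z [] _ = refl
  memB-cnt z (w ∷ l) (a ∷ u) with z ≟ w
  ... | no _ = memB-cnt z l u
  ... | yes refl = cong suc (fresh l a)
    where
    fresh : ∀ l → Every (λ x → z ≢ x) l → cnt z l ≡ 0
    fresh [] _ = refl
    fresh (x ∷ l) (p ∷ a) rewrite ≢⇒==f p = fresh l a

  Simple⇒Unique : ∀ (l : List (Fin n)) → Simple l → Unique l
  Simple⇒Unique [] _ = []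
  Simple⇒Unique (w ∷ l) s = fresh l no-w ∷ Simple⇒Unique l (λ z → ≤-trans (m≤n+m _ ⟦ z == w ⟧) (s z))
    where
    no-w : cnt w l ≡ 0
    no-w = n≤0⇒n≡0 (≤-pred (≤-trans (≤-reflexive (cong (λ b → ⟦ b ⟧ + cnt w l) (sym (==-refl w)))) (s w)))
    fresh : ∀ l → cnt w l ≡ 0 → Every (λ x → w ≢ x) l
    fresh [] _ = []
    fresh (x ∷ l) h = (λ { refl → 1≰0 (≤-trans (cnt-mid w [] l) (≤-reflexive h)) }) ∷ fresh l (m+n≡0⇒n≡0 ⟦ w == x ⟧ h)

  Linked⇒Ch : ∀ u l v → Linked (λ u v → ad u v ≡ true) (u ∷ l ++ [ v ]) → Ch ad u l v
  Linked⇒Ch u [] v (e ∷ _) = e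
  Linked⇒Ch u (x ∷ l) v (e ∷ r) = e , Linked⇒Ch x l v r

  Ch⇒Linked : ∀ u l v → Ch ad u l v → Linked (λ u v → ad u v ≡ true) (u ∷ l ++ [ v ])
  Ch⇒Linked u [] v e = e ∷ [-]
  Ch⇒Linked u (x ∷ l) v (e , r) = e ∷ Ch⇒Linked x l v r

module OnCycle {n} (G : Graph n) (K : Cycle G) (longest : IsLongestCycle G K) where
  open Cyclic G public

  c : ℕ
  c = cycleLength K

  longest' : ∀ v r → Ch ad v r v → Simple (v ∷ r) → 2 ≤ length r → suc (length r) ≤ c
  longest' v r ch s l = longest (record { v0 = v ; rest = r ; long = l ; distinct = Simple⇒Unique (v ∷ r) s ; closed = Ch⇒Linked v r v ch })

  abstract
    C : BSet n
    C z = memB z (cycleVerts K)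

    C≡memB : ∀ z → C z ≡ memB z (cycleVerts K)
    C≡memB z = refl

  -- Any cycle on the vertices of the given one, so that start and direction are at disposal.
  record Cyc (w : Fin n) (r : List (Fin n)) : Set where
    constructor cyc
    field
      chain : Ch ad w r w
      verts : ∀ z → cnt z (w ∷ r) ≡ ⟦ C z ⟧
      size  : suc (length r) ≡ c
  open Cyc public

  base : Cyc (v0 K) (rest K)
  base = cyc (Linked⇒Ch _ _ _ (Cycle.closed K)) (λ z → trans (memB-cnt z _ (distinct K)) (cong ⟦_⟧ (sym (C≡memB z)))) refl

  Cyc-simple : ∀ {w r} → Cyc w r → Simple (w ∷ r)
  Cyc-simple q z = ≤-trans (≤-reflexive (verts q z)) (⟦⟧≤1 (C z))

  rotate : ∀ {w w'} l₁ {l₂} → Cyc w (l₁ ++ w' ∷ l₂) → Cyc w' (l₂ ++ w ∷ l₁)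
  rotate {w} {w'} l₁ {l₂} (cyc ch vs sz) = cyc (Ch-++ ad l₂ (proj₂ (Ch-split ad l₁ ch)) (proj₁ (Ch-split ad l₁ ch)))
      (λ z → trans (vs' z) (vs z)) (trans (cong suc len) sz)
    where
    vs' : ∀ z → cnt z (w' ∷ l₂ ++ w ∷ l₁) ≡ cnt z (w ∷ l₁ ++ w' ∷ l₂)
    vs' z rewrite cnt-++ z l₂ (w ∷ l₁) | cnt-++ z l₁ (w' ∷ l₂) = ≤-antisym (linear (⟦ z == w' ⟧ ∷ cnt z l₂ ∷ ⟦ z == w ⟧ ∷ cnt z l₁ ∷ []) (κ 0) (κ 0) (# 0 ⊕ (# 1 ⊕ (# 2 ⊕ # 3))) (# 2 ⊕ (# 3 ⊕ (# 0 ⊕ # 1))) (z≤n {0})) (linear (⟦ z == w ⟧ ∷ cnt z l₁ ∷ ⟦ z == w' ⟧ ∷ cnt z l₂ ∷ []) (κ 0) (κ 0) (# 0 ⊕ (# 1 ⊕ (# 2 ⊕ # 3))) (# 2 ⊕ (# 3 ⊕ (# 0 ⊕ # 1))) (z≤n {0}))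
    len : length (l₂ ++ w ∷ l₁) ≡ length (l₁ ++ w' ∷ l₂)
    len rewrite length-++ l₂ {w ∷ l₁} | length-++ l₁ {w' ∷ l₂} = ≤-antisym (linear (length l₂ ∷ length l₁ ∷ []) (κ 0) (κ 0) (# 0 ⊕ (κ 1 ⊕ # 1)) (# 1 ⊕ (κ 1 ⊕ # 0)) (z≤n {0})) (linear (length l₁ ∷ length l₂ ∷ []) (κ 0) (κ 0) (# 0 ⊕ (κ 1 ⊕ # 1)) (# 1 ⊕ (κ 1 ⊕ # 0)) (z≤n {0}))

  at-vertex : ∀ w → w ∈ˢ C → ∃[ r ] Cyc w r
  at-vertex w w∈ = go (w ≟ v0 K)
    where
    go : Dec (w ≡ v0 K) → ∃[ r ] Cyc w r
    go (yes refl) = rest K , base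
    go (no q) with cnt-∈ w (rest K) (linear (⟦ C w ⟧ ∷ ⟦ w == v0 K ⟧ ∷ cnt w (rest K) ∷ []) (# 0 ⊕ (κ 1 ⊕ # 1)) (# 1 ⊕ # 2 ⊕ (# 0 ⊕ κ 0)) (κ 1) (# 2) (≡≥ (verts base w) ⊞ ≡≥ (⟦⟧-true w∈) ⊞ ≡≤ (⟦⟧-false (≢⇒==f q))))
    ... | l₁ , l₂ , e = l₂ ++ v0 K ∷ l₁ , rotate l₁ (subst (Cyc (v0 K)) e base)

  -- The quantification over all cycles on these vertices includes both arcs of the given cycle.
  Far : ℕ → Fin n → Fin n → Set
  Far p w w' = ∀ l₁ l₂ → Cyc w (l₁ ++ w' ∷ l₂) → p ≤ length l₁

  -- Otherwise replacing the arc `l₁` by `l` gives a longer cycle.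
  ear : ∀ w l w' → l ⊑ (λ z → not (C z)) → Ch ad w l w' → Far (length l) w w'
  ear w l w' m ch l₁ l₂ q with length l ≤? length l₁
  ... | yes p = p
  ... | no ¬p = linear (length (l ++ w' ∷ l₂) ∷ length (rest K) ∷ length (l₁ ++ w' ∷ l₂) ∷ length l ∷ length l₂ ∷ length l₁ ∷ []) (κ 1 ⊕ # 0 ⊕ (κ 1 ⊕ # 1 ⊕ (# 2 ⊕ (# 3 ⊕ (κ 1 ⊕ # 4))))) (κ 1 ⊕ # 1 ⊕ (κ 1 ⊕ # 2 ⊕ (# 5 ⊕ (κ 1 ⊕ # 4) ⊕ # 0))) (# 3) (# 5) (longest' w (l ++ w' ∷ l₂) (Ch-++ ad l ch (proj₂ (Ch-split ad l₁ (chain q)))) simp two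
                ⊞ ≡≤ (sym (size q)) ⊞ ≡≤ (length-++ l₁ {w' ∷ l₂}) ⊞ ≡≥ (length-++ l {w' ∷ l₂}))
    where
    two : 2 ≤ length (l ++ w' ∷ l₂)
    two = linear (length l ∷ length l₂ ∷ length l₁ ∷ length (l ++ w' ∷ l₂) ∷ []) (# 0 ⊕ (κ 1 ⊕ # 1) ⊕ (κ 1 ⊕ # 2)) (# 3 ⊕ # 0) (κ 2) (# 3) (≡≥ (length-++ l {w' ∷ l₂}) ⊞ ≰⇒> ¬p)
    both : ∀ b → ⟦ not b ⟧ + ⟦ b ⟧ ≤ 1
    both true = ≤-refl
    both false = ≤-refl
    simp : Simple (w ∷ l ++ w' ∷ l₂)
    simp z = linear (cnt z l ∷ ⟦ z == w ⟧ ∷ cnt z (l₁ ++ w' ∷ l₂) ∷ ⟦ not (C z) ⟧ ∷ ⟦ C z ⟧ ∷ cnt z l₁ ∷ ⟦ z == w' ⟧ ∷ cnt z l₂ ∷ cnt z (l ++ w' ∷ l₂) ∷ []) (# 0 ⊕ (# 1 ⊕ # 2 ⊕ (# 3 ⊕ # 4 ⊕ (# 5 ⊕ (# 6 ⊕ # 7) ⊕ # 8)))) (# 3 ⊕ (# 4 ⊕ (κ 1 ⊕ (# 2 ⊕ (# 0 ⊕ (# 6 ⊕ # 7)))))) (# 1 ⊕ # 8) (κ 1) (⊑-e m z ⊞ ≡≤ (verts q z) ⊞ both (C z) ⊞ ≡≥ (cnt-++ z l₁ (w' ∷ l₂)) ⊞ ≡≤ (cnt-++ z l (w' ∷ l₂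)))

  cntB-all : ∀ {w r} (P : BSet n) → Cyc w r → (∀ z → z ∈ˢ P → z ∈ˢ C ∖ w) → cntB P r ≡ countB P
  cntB-all {w} {r} P q sub = trans (cntB≡ P r) (trans (sumF-cong one) (sym (countB≡ P)))
    where
    one : ∀ z → cnt z r * ⟦ P z ⟧ ≡ ⟦ P z ⟧
    one z with true⊎false (P z)
    ... | inj₂ f rewrite f = *-zeroʳ (cnt z r)
    ... | inj₁ p with ∖-e {S = C} (sub z p) | verts q z
    ...   | z∈ , z≢ | v rewrite p | ≢⇒==f z≢ | z∈ = trans (*-identityʳ (cnt z r)) v

  spread : Spread C c Far
  spread = record
    { far-mono = λ p f l₁ l₂ q → ≤-trans p (f l₁ l₂ q)
    ; hub = hub
    ; apart = apart }
    where
    bound : ∀ w₀ r P g p t → Cyc w₀ r → (∀ z → z ∈ˢ P → z ∈ˢ C ∖ w₀) → countB P ≡ suc t →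
            (∀ w → w ∈ˢ P → Far p w₀ w × Far p w w₀) → (∀ w w' → w ∈ˢ P → w' ∈ˢ P → w ≢ w' → Far g w w') →
            p + p + suc t + t * g ≤ length r
    bound w₀ r P g p t q sub ct hubs mids = Gaps.gaps P g p p r t
      (λ l₁ w l₂ e w∈ → proj₁ (hubs w w∈) l₁ l₂ (subst (Cyc w₀) e q))
      -- The vertices after `w` lead back to `w₀`; rotated to start at `w`, they become the first
      -- arc.
      (λ l₁ w l₂ e w∈ → proj₂ (hubs w w∈) l₂ l₁ (rotate l₁ (subst (Cyc w₀) e q)))
      (λ l₁ w l₂ w' l₃ e w∈ w'∈ → mids w w' w∈ w'∈ (λ { refl → distinct₂ l₁ w l₂ l₃ e }) l₂ (l₃ ++ w₀ ∷ l₁)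
         (subst (Cyc w) (++-assoc l₂ (w' ∷ l₃) (w₀ ∷ l₁)) (rotate l₁ (subst (Cyc w₀) e q))))
      (trans (cntB-all P q sub) ct)
      where
      distinct₂ : ∀ l₁ w l₂ l₃ → r ≡ l₁ ++ w ∷ l₂ ++ w ∷ l₃ → ⊥
      distinct₂ l₁ w l₂ l₃ refl = 1≰0 (linear (⟦ w == w₀ ⟧ ∷ cnt w (l₁ ++ w ∷ l₂ ++ w ∷ l₃) ∷ cnt w l₁ ∷ ⟦ w == w ⟧ ∷ cnt w (l₂ ++ w ∷ l₃) ∷ []) (# 0 ⊕ # 1 ⊕ (# 2 ⊕ (# 3 ⊕ # 4) ⊕ (κ 1 ⊕ κ 1))) (κ 1 ⊕ (# 1 ⊕ (# 3 ⊕ # 4))) (κ 1) (κ 0) (Cyc-simple q w ⊞ ≡≥ (cnt-++ w l₁ (w ∷ l₂ ++ w ∷ l₃)) ⊞ ≡≥ (⟦⟧-true (==-refl w)) ⊞ cnt-mid w l₂ l₃))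
    hub : ∀ w₀ P p → w₀ ∈ˢ C → (∀ w → w ∈ˢ P → w ∈ˢ C ∖ w₀) → 1 ≤ countB P →
          (∀ w → w ∈ˢ P → Far p w₀ w × Far p w w₀) → (∀ w w' → w ∈ˢ P → w' ∈ˢ P → w ≢ w' → Far 1 w w') →
          2 * p + 2 * countB P ≤ c
    hub w₀ P p w₀∈ sub pos hubs mids with countB P in ct | at-vertex w₀ w₀∈
    ... | suc t | r , q = linear (p ∷ t ∷ t * 1 ∷ length r ∷ length (rest K) ∷ []) (# 0 ⊕ # 0 ⊕ (κ 1 ⊕ # 1) ⊕ # 2 ⊕ (κ 1 ⊕ # 3 ⊕ # 1)) (# 3 ⊕ (κ 1 ⊕ # 4 ⊕ # 2)) (# 0 ⊕ (# 0 ⊕ κ 0) ⊕ (κ 1 ⊕ # 1 ⊕ (κ 1 ⊕ # 1 ⊕ κ 0))) (κ 1 ⊕ # 4) (bound w₀ r P 1 p t q sub ct hubs mids ⊞ ≡≤ (size q) ⊞ ≡≥ (*-identityʳ t))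
    apart : ∀ S p → (∀ w → w ∈ˢ S → w ∈ˢ C) → 2 ≤ countB S →
            (∀ w w' → w ∈ˢ S → w' ∈ˢ S → w ≢ w' → Far p w w') → suc p * countB S ≤ c
    apart S p sub two f with pick S (≤-trans (s≤s z≤n) two)
    ... | w₀ , w₀∈ with at-vertex w₀ (sub w₀ w₀∈) | countB (S ∖ w₀) in ct
    ...   | r , q | zero = ⊥-elim (1≰0 (linear (countB S ∷ countB (λ z → S z ∧ not (z == w₀)) ∷ []) (κ 2 ⊕ (# 0 ⊕ # 1)) (# 0 ⊕ (κ 1 ⊕ # 1 ⊕ κ 0)) (κ 1) (κ 0) (two ⊞ ≡≤ (countB-∖ S w₀∈) ⊞ ≡≤ ct)))
    ...   | r , q | suc t = ≤-trans (≤-reflexive (trans (*-comm (suc p) (countB S)) (cong (_* suc p) (trans (countB-∖ S w₀∈) (cong suc ct)))))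
              (linear (p ∷ t ∷ t * p ∷ length r ∷ t * suc p ∷ length (rest K) ∷ []) (# 0 ⊕ # 0 ⊕ (κ 1 ⊕ # 1) ⊕ # 2 ⊕ (κ 1 ⊕ # 3 ⊕ # 4)) (# 3 ⊕ (κ 1 ⊕ # 5 ⊕ (# 1 ⊕ # 2))) (κ 1 ⊕ (# 0 ⊕ (κ 1 ⊕ (# 0 ⊕ # 4)))) (κ 1 ⊕ # 5) (bound w₀ r (S ∖ w₀) p p t q (λ z z∈ → ∖-i {S = C} (sub z (proj₁ (∖-e {S = S} z∈))) (proj₂ (∖-e {S = S} z∈))) ct
                 (λ w w∈ → let w∈S , w≢ = ∖-e {S = S} w∈ in f w₀ w w₀∈ w∈S (λ x → w≢ (sym x)) , f w w₀ w∈S w₀∈ w≢)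
                 (λ w w' w∈ w'∈ → f w w' (proj₁ (∖-e {S = S} w∈)) (proj₁ (∖-e {S = S} w'∈)))
               ⊞ ≡≤ (size q) ⊞ ≡≤ (*-suc t p)))

  outside : BSet n
  outside z = not (C z)

-- A vertex joined to half of the cycle

half-≥ : ∀ c → ⌊ c /2⌋ + ⌊ c /2⌋ ≤ c
half-≥ zero = z≤n
half-≥ (suc zero) = z≤n
half-≥ (suc (suc c)) = linear (⌊ c /2⌋ ∷ c ∷ []) (# 0 ⊕ # 0) (# 1) (κ 1 ⊕ # 0 ⊕ (κ 1 ⊕ # 0)) (κ 2 ⊕ # 1) (half-≥ c)

half-≤ : ∀ c → c ≤ suc (⌊ c /2⌋ + ⌊ c /2⌋)
half-≤ zero = z≤n
half-≤ (suc zero) = s≤s z≤n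
half-≤ (suc (suc c)) = linear (c ∷ ⌊ c /2⌋ ∷ []) (# 0) (κ 1 ⊕ (# 1 ⊕ # 1)) (κ 2 ⊕ # 0) (κ 1 ⊕ (κ 1 ⊕ # 1 ⊕ (κ 1 ⊕ # 1))) (half-≤ c)

module Rich {n} (G : Graph n) (tc : TwoConnected G) (K : Cycle G) (longest : IsLongestCycle G K) (10≤c : 10 ≤ cycleLength K) where
  open OnCycle G K longest
  open Outer ad C ad-sym

  |C|≡c : countB C ≡ c
  |C|≡c = trans (countB≡ C) (trans (sumF-cong {n} λ z → sym (verts base z)) (sym (length≡ (v0 K ∷ rest K))))

  |outside| : countB outside + c ≡ n
  |outside| = trans (cong (countB outside +_) (sym |C|≡c)) (trans (≤-antisym
      (countB-+≤ outside C (λ _ → true) (λ z → ⟦⟧-excl {not (C z)} {C z} (λ _ → refl) (λ _ → refl) λ p q → t≢f q (not-e {C z} p)))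
      (countB-∪ (λ _ → true) outside C λ z _ → [ inj₂ , (λ f → inj₁ (not-i f)) ]′ (true⊎false (C z)))) (countB-true n))

  on-C : ∀ x → ∃[ w ] (w ∈ˢ C × w ≢ x)
  on-C x = pick≢ C x (linear (length (rest K) ∷ countB C ∷ []) (κ 10 ⊕ (κ 1 ⊕ # 0)) (κ 1 ⊕ # 0 ⊕ # 1) (κ 2) (# 1) (10≤c ⊞ ≡≥ |C|≡c))

  -- The walk is cut at its first vertex on the cycle.
  to-C : ∀ {x u w} → Reach G (λ y → y ≢ x) u w → u ∉ˢ C → w ∈ˢ C →
         ∃[ z ] ∃[ w' ] (Rc ad (outside ∖ x) u z × ad z w' ≡ true × w' ∈ˢ C × w' ≢ x)
  to-C (Reach.here _) p q = ⊥-elim (t≢f q p)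
  to-C {x} {u} (Reach.step {w = w} u≢ e r) p q = go (true⊎false (C w))
    where
    u∈ : u ∈ˢ outside ∖ x
    u∈ = ∖-i {S = outside} (not-i p) u≢
    start : ∀ {a b} → Reach G (λ y → y ≢ x) a b → a ≢ x
    start (Reach.here p) = p
    start (Reach.step p _ _) = p
    go : _ → ∃[ z ] ∃[ w' ] (Rc ad (outside ∖ x) u z × ad z w' ≡ true × w' ∈ˢ C × w' ≢ x)
    go (inj₁ w∈) = u , w , Rc.here u∈ , e , w∈ , start r
    go (inj₂ w∉) with to-C r w∉ q
    ... | z , w' , r' , y = z , w' , Rc.step u∈ e r' , y

  state : State ad C Far outside ad
  state = record
    { E-sym = ad-sym
    ; E-irr = irrefl G
    ; off = λ u p → not-e p
    ; real = λ u v _ _ e → e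
    ; two = λ x u u∈ u≢x → let w , w∈ , w≢ = on-C x in to-C (proj₂ (proj₂ tc) x u w u≢x w≢) (not-e u∈) w∈
    ; ear = λ w l w' _ _ _ m ch → ear w l w' m ch }

  outer-≥ : outerEdges G K ≤ outer outside
  outer-≥ = sumF-mono λ u → countB-mono _ (pairs outside u) λ v h →
    let a , t = ∧-e {adj G u v} h ; b , d = ∧-e {toℕ u <ᵇ toℕ v} t
    in ∧-i a (∧-i b (∧-i (trans (cong₂ (λ x y → not (x ∧ y)) (C≡memB u) (C≡memB v)) d) (∧-i (any (C u)) (any (C v)))))
    where
    any : ∀ b → not b ∨ b ≡ true
    any true = refl
    any false = refl

  -- The largest number of neighbours on the cycle that an outer vertex can have without satisfying
  -- the conclusion of `rich`.
  k : ℕ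
  k = ⌊ c /2⌋ ∸ 1

  5≤half : 5 ≤ ⌊ c /2⌋
  5≤half with 5 ≤? ⌊ c /2⌋
  ... | yes p = p
  ... | no ¬p = ⊥-elim (1≰0 (linear (⌊ suc (length (rest K)) /2⌋ ∷ length (rest K) ∷ []) (κ 1 ⊕ # 0 ⊕ (κ 1 ⊕ # 0 ⊕ (κ 1 ⊕ # 1 ⊕ κ 10))) (κ 5 ⊕ (κ 5 ⊕ (κ 1 ⊕ (# 0 ⊕ # 0) ⊕ (κ 1 ⊕ # 1)))) (κ 1) (κ 0) (≰⇒> ¬p ⊞ ≰⇒> ¬p ⊞ half-≤ c ⊞ 10≤c)))

  half≡ : ⌊ c /2⌋ ≡ suc k
  half≡ with ⌊ c /2⌋ | 5≤half
  ... | suc h | _ = refl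

  rich : k * (n ∸ c) < outerEdges G K → ∃[ x ] (x ∉ˢ C × ⌊ c /2⌋ ≤ countB (λ z → ad x z ∧ C z))
  rich big with any? (λ x → (C x ≟ᵇ false) ×-dec (⌊ c /2⌋ ≤? countB (λ z → ad x z ∧ C z)))
  ... | yes p = p
  ... | no none = ⊥-elim (<⇒≱ big (≤-trans outer-≥ (≤-trans (Descent.sparse c Far spread k
        (linear (⌊ c /2⌋ ∷ k ∷ []) (κ 5 ⊕ # 0) (# 0 ⊕ (κ 1 ⊕ # 1)) (κ 4) (# 1) (5≤half ⊞ ≡≤ half≡)) (linear (length (rest K) ∷ ⌊ c /2⌋ ∷ k ∷ []) (κ 1 ⊕ # 0 ⊕ (# 1 ⊕ # 1)) (κ 1 ⊕ (# 1 ⊕ # 1) ⊕ (κ 1 ⊕ # 2 ⊕ (κ 1 ⊕ # 2))) (κ 1 ⊕ # 0) (κ 3 ⊕ (2 ⊛ # 2)) (half-≤ c ⊞ ≡≤ half≡ ⊞ ≡≤ half≡)) (proj₁ (on-C (v0 K))) (proj₁ (proj₂ (on-C (v0 K))))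
        (λ u u∉ → ≤-pred (≤-trans (≰⇒> λ x → none (u , u∉ , x)) (≤-reflexive half≡))) (countB outside) outside ad ≤-refl state)
        (≤-reflexive (cong (k *_) (trans (sym (m+n∸n≡m (countB outside) c)) (cong (_∸ c) |outside|)))))))

-- Rerouting a longest cycle through an extra vertex

module Surgery {n} (G : Graph n) (c : ℕ)
               (longest : ∀ v r → Ch (adj G) v r v → Simple (v ∷ r) → 2 ≤ length r → suc (length r) ≤ c) where
  open Cyclic G public

  V : Set
  V = Fin n

  Closed : List V → Set
  Closed []      = ⊥
  Closed (v ∷ r) = Ch ad v r v

  -- `In` is a parameter because exchanging the gap changes the vertex set of the cycle.
  record CycL (In : BSet n) (L : List V) : Set where
    constructor cycl
    field
      closed-walk : Closed L
      vertices    : ∀ z → cnt z L ≡ ⟦ In z ⟧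
      size-c      : length L ≡ c
  open CycL public

  turn : ∀ {In} xs ys → CycL In (xs ++ ys) → CycL In (ys ++ xs)
  turn {In} xs ys (cycl cl vs sz) = cycl (cl' xs ys cl) (λ z → trans (vs' z) (vs z)) (trans len sz)
    where
    cl' : ∀ xs ys → Closed (xs ++ ys) → Closed (ys ++ xs)
    cl' [] ys p = subst Closed (sym (++-identityʳ ys)) p
    cl' (x ∷ xs) [] p = subst Closed (++-identityʳ (x ∷ xs)) p
    cl' (x ∷ xs) (y ∷ ys) p = Ch-++ ad ys (proj₂ (Ch-split ad xs p)) (proj₁ (Ch-split ad xs p))
    vs' : ∀ z → cnt z (ys ++ xs) ≡ cnt z (xs ++ ys)
    vs' z = trans (cnt-++ z ys xs) (trans (+-comm (cnt z ys) (cnt z xs)) (sym (cnt-++ z xs ys)))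
    len : length (ys ++ xs) ≡ length (xs ++ ys)
    len = trans (length-++ ys {xs}) (trans (+-comm (length ys) (length xs)) (sym (length-++ xs {ys})))

  backwards : ∀ {In} L → CycL In L → CycL In (reverse L)
  backwards {In} L (cycl cl vs sz) = cycl (cl' L cl) (λ z → trans (cnt-reverse z L) (vs z)) (trans (length-reverse L) sz)
    where
    cl' : ∀ L → Closed L → Closed (reverse L)
    cl' (v ∷ r) p with reverse r | unfold-reverse v r | Ch-reverse ad ad-sym r p
    ... | [] | e | q rewrite e = q
    ... | y ∷ ys | e | q rewrite e = Ch-++ ad ys (proj₂ q) (proj₁ q)

  -- The new segment `l` may reuse vertices of the segment `J` that it replaces.
  splice : ∀ {In s J t R l} → CycL In (s ∷ J ++ t ∷ R) → Ch ad s l t → (∀ z → cnt z l ≤ ⟦ not (In z) ⟧ + cnt z J) →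
           length l ≤ length J
  splice {In} {s} {J} {t} {R} {l} q ch f with length l ≤? length J
  ... | yes p = p
  ... | no ¬p = linear (length (l ++ t ∷ R) ∷ c ∷ length l ∷ length R ∷ length (J ++ t ∷ R) ∷ length J ∷ []) (κ 1 ⊕ # 0 ⊕ (# 1 ⊕ (# 2 ⊕ (κ 1 ⊕ # 3) ⊕ # 4))) (# 1 ⊕ (κ 1 ⊕ # 4 ⊕ (# 0 ⊕ (# 5 ⊕ (κ 1 ⊕ # 3))))) (# 2) (# 5) (longest s (l ++ t ∷ R) (Ch-++ ad l ch (proj₂ (Ch-split ad J (closed-walk q)))) simp two
                     ⊞ ≡≥ (size-c q) ⊞ ≡≥ (length-++ l {t ∷ R}) ⊞ ≡≤ (length-++ J {t ∷ R}))
    where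
    two : 2 ≤ length (l ++ t ∷ R)
    two = linear (length l ∷ length R ∷ length J ∷ length (l ++ t ∷ R) ∷ []) (# 0 ⊕ (κ 1 ⊕ # 1) ⊕ (κ 1 ⊕ # 2)) (# 3 ⊕ # 0) (κ 2) (# 3) (≡≥ (length-++ l {t ∷ R}) ⊞ ≰⇒> ¬p)
    both : ∀ b → ⟦ not b ⟧ + ⟦ b ⟧ ≤ 1
    both true = ≤-refl
    both false = ≤-refl
    simp : Simple (s ∷ l ++ t ∷ R)
    simp z = linear (cnt z l ∷ ⟦ z == s ⟧ ∷ cnt z (J ++ t ∷ R) ∷ ⟦ not (In z) ⟧ ∷ ⟦ In z ⟧ ∷ cnt z J ∷ ⟦ z == t ⟧ ∷ cnt z R ∷ cnt z (l ++ t ∷ R) ∷ []) (# 0 ⊕ (# 1 ⊕ # 2 ⊕ (# 3 ⊕ # 4 ⊕ (# 5 ⊕ (# 6 ⊕ # 7) ⊕ # 8)))) (# 3 ⊕ # 5 ⊕ (# 4 ⊕ (κ 1 ⊕ (# 2 ⊕ (# 0 ⊕ (# 6 ⊕ # 7)))))) (# 1 ⊕ # 8) (κ 1) (f z ⊞ ≡≤ (vertices q z) ⊞ both (In z) ⊞ ≡≥ (cnt-++ z J (t ∷ R)) ⊞ ≡≤ (cnt-++ z l (t ∷ R)))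

  -- The cycle s l t S₂ reversed x S₃ passes through the extra vertex x and skips J and J'.
  detour : ∀ {In x s J S₂ t J' S₃ l} → CycL In (s ∷ J ++ S₂ ++ t ∷ J' ++ S₃) → x ∉ˢ In → ad x s ≡ true → ad x t ≡ true →
           (∀ h S → S₂ ≡ h ∷ S → ad x h ≡ true) → (∀ h S → S₃ ≡ h ∷ S → ad x h ≡ true) →
           Ch ad s l t → (∀ z → cnt z l ≤ ⟦ ((λ y → not (In y)) ∖ x) z ⟧ + (cnt z J + cnt z J')) → suc (length l) ≤ length J + length J'
  detour {In} {x} {s} {J} {S₂} {t} {J'} {S₃} {l} q x∉ xs xt h₂ h₃ ch f =
    linear (length (l ++ t ∷ reverse S₂ ++ x ∷ S₃) ∷ c ∷ length l ∷ length S₂ ∷ length S₃ ∷ length (J ++ S₂ ++ t ∷ J' ++ S₃) ∷ length (S₂ ++ t ∷ J' ++ S₃) ∷ length (J' ++ S₃) ∷ length J ∷ length J' ∷ []) (κ 1 ⊕ # 0 ⊕ (# 1 ⊕ (# 2 ⊕ (κ 1 ⊕ (# 3 ⊕ (κ 1 ⊕ # 4))) ⊕ (# 5 ⊕ (# 6 ⊕ # 7))))) (# 1 ⊕ (κ 1 ⊕ # 5 ⊕ (# 0 ⊕ (# 8 ⊕ # 6 ⊕ (# 3 ⊕ (κ 1 ⊕ # 7) ⊕ (# 9 ⊕ # 4)))))) (κ 1 ⊕ # 2) (# 8 ⊕ # 9) (longest s (l ++ t ∷ reverse S₂ ++ x ∷ S₃) (Ch-++ ad l ch (Ch-++ ad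 (reverse S₂) (back S₂ h₂ w₂) (forth S₃ h₃ w₃))) simp two
         ⊞ ≡≥ (size-c q) ⊞ ≡≥ len ⊞ ≡≤ (length-++ J {S₂ ++ t ∷ J' ++ S₃}) ⊞ ≡≤ (length-++ S₂ {t ∷ J' ++ S₃}) ⊞ ≡≤ (length-++ J' {S₃}))
    where
    len : length (l ++ t ∷ reverse S₂ ++ x ∷ S₃) ≡ length l + suc (length S₂ + suc (length S₃))
    len = trans (length-++ l {t ∷ reverse S₂ ++ x ∷ S₃}) (cong (λ m → length l + suc m)
          (trans (length-++ (reverse S₂) {x ∷ S₃}) (cong (_+ suc (length S₃)) (length-reverse S₂))))
    two : 2 ≤ length (l ++ t ∷ reverse S₂ ++ x ∷ S₃)
    two = linear (length l ∷ length S₂ ∷ length S₃ ∷ length (l ++ t ∷ reverse S₂ ++ x ∷ S₃) ∷ []) (# 0 ⊕ (κ 1 ⊕ (# 1 ⊕ (κ 1 ⊕ # 2)))) (# 3) (κ 2) (# 3) (≡≥ len)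
    w₂ : ∀ h S → S₂ ≡ h ∷ S → Ch ad h S t
    w₂ h S refl = proj₁ (Ch-split ad S (proj₂ (Ch-split ad J (closed-walk q))))
    from-t : Ch ad t (J' ++ S₃) s
    from-t = go S₂ (closed-walk q)
      where
      go : ∀ S → Ch ad s (J ++ S ++ t ∷ J' ++ S₃) s → Ch ad t (J' ++ S₃) s
      go [] p = proj₂ (Ch-split ad J p)
      go (y ∷ S) p = proj₂ (Ch-split ad S (proj₂ (Ch-split ad J p)))
    w₃ : ∀ h S → S₃ ≡ h ∷ S → Ch ad h S s
    w₃ h S refl = proj₂ (Ch-split ad J' from-t)
    back : ∀ S → (∀ h S' → S ≡ h ∷ S' → ad x h ≡ true) → (∀ h S' → S ≡ h ∷ S' → Ch ad h S' t) → Ch ad t (reverse S) x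
    back [] _ _ = ad-sym xt
    back (h ∷ S) p w rewrite unfold-reverse h S = Ch-++ ad (reverse S) (Ch-reverse ad ad-sym S (w h S refl)) (ad-sym (p h S refl))
    forth : ∀ S → (∀ h S' → S ≡ h ∷ S' → ad x h ≡ true) → (∀ h S' → S ≡ h ∷ S' → Ch ad h S' s) → Ch ad x S s
    forth [] _ _ = xs
    forth (h ∷ S) p w = p h S refl , w h S refl
    total : ∀ z → ⟦ ((λ y → not (In y)) ∖ x) z ⟧ + (⟦ z == x ⟧ + ⟦ In z ⟧) ≤ 1
    total z with z ≟ x
    ... | yes refl rewrite x∉ = ≤-refl
    ... | no _ with In z
    ...   | true = ≤-refl
    ...   | false = ≤-refl
    simp : Simple (s ∷ l ++ t ∷ reverse S₂ ++ x ∷ S₃)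
    simp z = linear (cnt z l ∷ ⟦ ((λ y → not (In y)) ∖ x) z ⟧ ∷ ⟦ z == x ⟧ ∷ ⟦ In z ⟧ ∷ ⟦ z == s ⟧ ∷ cnt z (J ++ S₂ ++ t ∷ J' ++ S₃) ∷ cnt z J ∷ cnt z (S₂ ++ t ∷ J' ++ S₃) ∷ cnt z S₂ ∷ ⟦ z == t ⟧ ∷ cnt z (J' ++ S₃) ∷ cnt z J' ∷ cnt z S₃ ∷ cnt z (l ++ t ∷ reverse S₂ ++ x ∷ S₃) ∷ cnt z (reverse S₂ ++ x ∷ S₃) ∷ cnt z (reverse S₂) ∷ []) (# 0 ⊕ (# 1 ⊕ (# 2 ⊕ # 3) ⊕ (# 4 ⊕ # 5 ⊕ (# 6 ⊕ # 7 ⊕ (# 8 ⊕ (# 9 ⊕ # 10) ⊕ (# 11 ⊕ # 12 ⊕ (# 13 ⊕ (# 14 ⊕ # 15)))))))) (# 1 ⊕ (# 6 ⊕ # 11) ⊕ (κ 1 ⊕ (# 3 ⊕ (# 5 ⊕ (# 7 ⊕ (# 10 ⊕ (# 0 ⊕ (# 9 ⊕ # 14) ⊕ (# 15 ⊕ (# 2 ⊕ # 12) ⊕ # 8)))))))) (# 4 ⊕ # 13) (κ 1) (f z ⊞ total z ⊞ ≡≤ (vertices q z) ⊞ ≡≥ (cnt-++ z J (S₂ ++ t ∷ J' ++ S₃)) ⊞ ≡≥ (cnt-++ z S₂ (t ∷ J' ++ S₃)) ⊞ ≡≥ (cnt-++ z J' S₃)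
      ⊞ ≡≤ (cnt-++ z l (t ∷ reverse S₂ ++ x ∷ S₃)) ⊞ ≡≤ (cnt-++ z (reverse S₂) (x ∷ S₃)) ⊞ ≡≤ (cnt-reverse z S₂))

  -- A vertex of `A` with the run of vertices outside `A` that follows it on the cycle.
  Block : Set
  Block = V × List V

  flat : List Block → List V
  flat []             = []
  flat ((a , J) ∷ bs) = a ∷ J ++ flat bs

  flat-++ : ∀ bs bs' → flat (bs ++ bs') ≡ flat bs ++ flat bs'
  flat-++ []             bs' = refl
  flat-++ ((a , J) ∷ bs) bs' = cong (a ∷_) (trans (cong (J ++_) (flat-++ bs bs')) (sym (++-assoc J (flat bs) (flat bs'))))

  flat₂ : List (V × V) → List V
  flat₂ []             = []
  flat₂ ((i , a) ∷ ps) = i ∷ a ∷ flat₂ ps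

  blocks : V → List (V × V) → List V → List Block
  blocks a []              I = (a , I) ∷ []
  blocks a ((i , a') ∷ ps) I = (a , i ∷ []) ∷ blocks a' ps I

  flat-blocks : ∀ a ps I → flat (blocks a ps I) ≡ a ∷ flat₂ ps ++ I
  flat-blocks a []              I = cong (a ∷_) (++-identityʳ I)
  flat-blocks a ((i , a') ∷ ps) I = cong (λ l → a ∷ i ∷ l) (flat-blocks a' ps I)

  final : V → List (V × V) → V
  final a []             = a
  final a ((_ , a') ∷ ps) = final a' ps

  mirror : List (V × V) → V → List (V × V) → V × List (V × V)
  mirror acc a []              = a , acc
  mirror acc a ((i , a') ∷ ps) = mirror ((i , a) ∷ acc) a' ps

  mirror-start : ∀ acc a ps → proj₁ (mirror acc a ps) ≡ final a ps
  mirror-start acc a []              = refl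
  mirror-start acc a ((i , a') ∷ ps) = mirror-start _ a' ps

  mirror-final : ∀ acc a ps → final (proj₁ (mirror acc a ps)) (proj₂ (mirror acc a ps)) ≡ final a acc
  mirror-final acc a []              = refl
  mirror-final acc a ((i , a') ∷ ps) = mirror-final _ a' ps

  mirror-flat : ∀ acc a ps → proj₁ (mirror acc a ps) ∷ flat₂ (proj₂ (mirror acc a ps)) ≡ reverse (a ∷ flat₂ ps) ++ flat₂ acc
  mirror-flat acc a []              = refl
  mirror-flat acc a ((i , a') ∷ ps) = trans (mirror-flat ((i , a) ∷ acc) a' ps) (sym (begin
    reverse (a ∷ i ∷ a' ∷ flat₂ ps) ++ flat₂ acc            ≡⟨ cong (_++ flat₂ acc) (unfold-reverse a (i ∷ a' ∷ flat₂ ps)) ⟩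
    (reverse (i ∷ a' ∷ flat₂ ps) ++ [ a ]) ++ flat₂ acc     ≡⟨ cong (λ l → (l ++ [ a ]) ++ flat₂ acc) (unfold-reverse i (a' ∷ flat₂ ps)) ⟩
    ((reverse (a' ∷ flat₂ ps) ++ [ i ]) ++ [ a ]) ++ flat₂ acc ≡⟨ ++-assoc (reverse (a' ∷ flat₂ ps) ++ [ i ]) [ a ] (flat₂ acc) ⟩
    (reverse (a' ∷ flat₂ ps) ++ [ i ]) ++ a ∷ flat₂ acc     ≡⟨ ++-assoc (reverse (a' ∷ flat₂ ps)) [ i ] (a ∷ flat₂ acc) ⟩
    reverse (a' ∷ flat₂ ps) ++ i ∷ a ∷ flat₂ acc            ∎))
    where open ≡-Reasoning

  module _ (A In : BSet n) (x : V) where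

    Alternating : List (V × V) → Set
    Alternating ps = ∀ {i a} → (i , a) ∈ ps → i ∉ˢ A × a ∈ˢ A

    -- The cycle a₁ i₁ a₂ … i_{k-1} a_k I, where the vertices of A are a₁, …, a_k.
    record Config : Set where
      field
        a₁    : V
        steps : List (V × V)
        gap   : List V
        cycle : CycL In (a₁ ∷ flat₂ steps ++ gap)
        a₁∈   : a₁ ∈ˢ A
        alt   : Alternating steps
        gap∉  : ∀ z → 1 ≤ cnt z gap → z ∉ˢ A
        some  : ∃[ i ] ∃[ a ] ∃[ ps ] steps ≡ (i , a) ∷ ps
      aₖ : V
      aₖ = final a₁ steps
      bs : List Block
      bs = blocks a₁ steps gap

  module _ {A In : BSet n} {x : V} where
    final-∈ : ∀ a ps → a ∈ˢ A → Alternating A In x ps → final a ps ∈ˢ A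
    final-∈ a [] p q = p
    final-∈ a ((i , a') ∷ ps) p q = final-∈ a' ps (proj₂ (q (here refl))) (λ m → q (there m))

    -- Reversal would put the gap first; a rotation brings it back to the end, with `a₁` and `aₖ`
    -- exchanged.
    opposite : Config A In x → Config A In x
    opposite k = record
      { a₁ = proj₁ m ; steps = proj₂ m ; gap = reverse gap
      ; cycle = subst (CycL In) eq (turn (reverse gap) (reverse (a₁ ∷ flat₂ steps))
                  (subst (CycL In) (reverse-++ (a₁ ∷ flat₂ steps) gap) (backwards _ cycle)))
      ; a₁∈ = subst (_∈ˢ A) (sym (mirror-start [] a₁ steps)) (final-∈ a₁ steps a₁∈ alt)
      ; alt = mirror-alt [] a₁ steps (λ ()) a₁∈ alt
      ; gap∉ = λ z h → gap∉ z (subst (1 ≤_) (cnt-reverse z gap) h)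
      ; some = nonempty }
      where
      open Config k
      m = mirror [] a₁ steps
      eq : reverse (a₁ ∷ flat₂ steps) ++ reverse gap ≡ proj₁ m ∷ flat₂ (proj₂ m) ++ reverse gap
      eq = cong (_++ reverse gap) (sym (trans (mirror-flat [] a₁ steps) (++-identityʳ _)))
      mirror-alt : ∀ acc a ps → Alternating A In x acc → a ∈ˢ A → Alternating A In x ps → Alternating A In x (proj₂ (mirror acc a ps))
      mirror-alt acc a [] p q r = p
      mirror-alt acc a ((i , a') ∷ ps) p q r = mirror-alt ((i , a) ∷ acc) a' ps
        (λ { (here refl) → proj₁ (r (here refl)) , q ; (there m) → p m }) (proj₂ (r (here refl))) (λ m → r (there m))
      longer : ∀ acc a ps → ∃[ i ] ∃[ b ] ∃[ qs ] acc ≡ (i , b) ∷ qs → ∃[ i ] ∃[ b ] ∃[ qs ] proj₂ (mirror acc a ps) ≡ (i , b) ∷ qs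
      longer acc a [] e = e
      longer acc a ((i , a') ∷ ps) e = longer ((i , a) ∷ acc) a' ps (i , a , acc , refl)
      nonempty : ∃[ i ] ∃[ a ] ∃[ qs ] proj₂ m ≡ (i , a) ∷ qs
      nonempty with steps | some
      ... | (i , a) ∷ ps | _ = longer ((i , a₁) ∷ []) a ps (i , a₁ , [] , refl)

    opposite-aₖ : ∀ k → Config.aₖ (opposite k) ≡ Config.a₁ k
    opposite-aₖ k = mirror-final [] (Config.a₁ k) (Config.steps k)

  module InConfig {A In : BSet n} {x : V} (x∉ : x ∉ˢ In) (x-adj : ∀ a → a ∈ˢ A → ad x a ≡ true) (k : Config A In x) where
    open Config k

    Off : BSet n
    Off = (λ z → not (In z)) ∖ x

    cycle-bs : CycL In (flat bs)
    cycle-bs = subst (CycL In) (sym (flat-blocks a₁ steps gap)) cycle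

    block-head : ∀ {s J} → (s , J) ∈ bs → s ∈ˢ A
    block-head = go a₁ steps a₁∈ alt
      where
      go : ∀ a ps → a ∈ˢ A → Alternating A In x ps → ∀ {s J} → (s , J) ∈ blocks a ps gap → s ∈ˢ A
      go a [] p q (here refl) = p
      go a ((i , a') ∷ ps) p q (here refl) = p
      go a ((i , a') ∷ ps) p q (there m) = go a' ps (proj₂ (q (here refl))) (λ m → q (there m)) m

    aₖ∈ : aₖ ∈ˢ A
    aₖ∈ = final-∈ {A} {In} {x} a₁ steps a₁∈ alt

    last-block : (aₖ , gap) ∈ bs
    last-block = go a₁ steps
      where
      go : ∀ a ps → (final a ps , gap) ∈ blocks a ps gap
      go a [] = here refl
      go a (_ ∷ ps) = there (go _ ps)

    data Place (z : V) : Set where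
      onA    : ∀ {J} → z ∈ˢ A → (z , J) ∈ bs → (J ≡ gap × z ≡ aₖ) ⊎ (∃[ i ] J ≡ [ i ]) → Place z
      inGap  : z ∉ˢ A → 1 ≤ cnt z gap → Place z
      single : ∀ {s} → z ∉ˢ A → (s , [ z ]) ∈ bs → cnt z gap ≡ 0 → Place z

    private
      Simple-tail : ∀ (a : V) l → Simple (a ∷ l) → Simple l
      Simple-tail a l p z = ≤-trans (m≤n+m _ ⟦ z == a ⟧) (p z)

    place : ∀ z → z ∈ˢ In → Place z
    place z z∈ = go a₁ steps a₁∈ alt (λ m → m) refl (≤-reflexive (sym (trans (vertices cycle z) (⟦⟧-true z∈))))
                    (λ y → ≤-trans (≤-reflexive (vertices cycle y)) (⟦⟧≤1 (In y)))
      where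
      go : ∀ a ps → a ∈ˢ A → Alternating A In x ps → (∀ {B} → B ∈ blocks a ps gap → B ∈ bs) → final a ps ≡ aₖ →
           1 ≤ cnt z (a ∷ flat₂ ps ++ gap) → Simple (a ∷ flat₂ ps ++ gap) → Place z
      go a ps p q f fin h sm with z ≟ a
      go a [] p q f fin h sm | yes refl = onA p (f (here refl)) (inj₁ (refl , fin))
      go a ((i , a') ∷ ps) p q f fin h sm | yes refl = onA p (f (here refl)) (inj₂ (i , refl))
      go a [] p q f fin h sm | no z≢a = inGap (gap∉ z h) h
      go a ((i , a') ∷ ps) p q f fin h sm | no z≢a with z ≟ i
      ... | no z≢i = go a' ps (proj₂ (q (here refl))) (λ m → q (there m)) (λ m → f (there m)) fin h
                       (Simple-tail i (a' ∷ flat₂ ps ++ gap) (Simple-tail a (i ∷ a' ∷ flat₂ ps ++ gap) sm))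
      ... | yes refl = single (proj₁ (q (here refl))) (f (here refl))
              (n≤0⇒n≡0 (linear (⟦ i == a ⟧ ∷ ⟦ i == i ⟧ ∷ ⟦ i == a' ⟧ ∷ cnt i (flat₂ ps ++ gap) ∷ cnt i (flat₂ ps) ∷ cnt i gap ∷ []) (# 0 ⊕ (# 1 ⊕ (# 2 ⊕ # 3)) ⊕ (κ 1 ⊕ (# 4 ⊕ # 5))) (κ 1 ⊕ (# 1 ⊕ # 3)) (# 5) (κ 0) (sm z ⊞ ≡≥ (⟦⟧-true (==-refl z)) ⊞ ≡≥ (cnt-++ z (flat₂ ps) gap))))

    Located : V → Set
    Located a = ∃[ J ] ((a , J) ∈ bs × ((J ≡ gap × a ≡ aₖ) ⊎ (∃[ i ] J ≡ [ i ])))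

    locate : ∀ a → a ∈ˢ A → a ∈ˢ In → Located a
    locate a a∈ a∈In with place a a∈In
    ... | onA _ m e = _ , m , e
    ... | inGap a∉ _ = ⊥-elim (t≢f a∈ a∉)
    ... | single a∉ _ _ = ⊥-elim (t≢f a∈ a∉)

    heads : ∀ {S : List Block} → (∀ {B} → B ∈ S → B ∈ bs) → ∀ h r → flat S ≡ h ∷ r → ad x h ≡ true
    heads {(s , J) ∷ S} f h r refl = x-adj s (block-head (f (here refl)))

    -- All other blocks are kept as blocks, so a second one can be located in the rest of the
    -- rotated cycle.
    front-first : ∀ {s J} → (s , J) ∈ bs → ∃[ B ] ((∀ {b} → b ∈ B → b ∈ bs) × (∀ {t J'} → (t , J') ∈ bs → t ≢ s → (t , J') ∈ B) × CycL In (s ∷ J ++ flat B))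
    front-first {s} {J} m with ∈-∃++ m
    ... | B₁ , B₂ , e = B₂ ++ B₁ , sub , other , subst (CycL In) eq (turn (flat B₁) (s ∷ J ++ flat B₂) (subst (CycL In) eq₁ cycle-bs))
      where
      eq₁ : flat bs ≡ flat B₁ ++ s ∷ J ++ flat B₂
      eq₁ = trans (cong flat e) (flat-++ B₁ _)
      eq : (s ∷ J ++ flat B₂) ++ flat B₁ ≡ s ∷ J ++ flat (B₂ ++ B₁)
      eq = cong (s ∷_) (trans (++-assoc J (flat B₂) (flat B₁)) (cong (J ++_) (sym (flat-++ B₂ B₁))))
      sub : ∀ {b} → b ∈ B₂ ++ B₁ → b ∈ bs
      sub {b} p = subst (b ∈_) (sym e) ([ (λ q → ∈-++⁺ʳ B₁ (there q)) , (λ q → ∈-++⁺ˡ q) ]′ (∈-++⁻ B₂ p))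
      other : ∀ {t J'} → (t , J') ∈ bs → t ≢ s → (t , J') ∈ B₂ ++ B₁
      other {t} {J'} p t≢s with ∈-++⁻ B₁ (subst ((t , J') ∈_) e p)
      ... | inj₁ q = ∈-++⁺ʳ B₂ q
      ... | inj₂ (here refl) = ⊥-elim (t≢s refl)
      ... | inj₂ (there q) = ∈-++⁺ˡ q

    block-unique : ∀ {s J J'} → (s , J) ∈ bs → (s , J') ∈ bs → J ≡ J'
    block-unique {s} {J} {J'} m m' with ∈-∃++ m
    ... | B₁ , B₂ , e = go (∈-++⁻ B₁ (subst ((s , J') ∈_) e m'))
      where
      once : cnt s (flat B₁) + (⟦ s == s ⟧ + (cnt s J + cnt s (flat B₂))) ≤ 1
      once = ≤-trans (≤-reflexive (sym (trans (cong (cnt s) (trans (cong flat e) (flat-++ B₁ _)))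
               (trans (cnt-++ s (flat B₁) _) (cong (λ m → cnt s (flat B₁) + (⟦ s == s ⟧ + m)) (cnt-++ s J (flat B₂)))))))
               (≤-trans (≤-reflexive (vertices cycle-bs s)) (⟦⟧≤1 (In s)))
      head-in : ∀ B → (s , J') ∈ B → 1 ≤ cnt s (flat B)
      head-in ((a , K) ∷ B) (here refl) = cnt-mid s [] (K ++ flat B)
      head-in ((a , K) ∷ B) (there p) = linear (cnt s K ∷ cnt s (flat B) ∷ cnt s (K ++ flat B) ∷ ⟦ s == a ⟧ ∷ []) (κ 1 ⊕ (# 0 ⊕ # 1)) (# 1 ⊕ # 2) (κ 1) (# 3 ⊕ # 2) (head-in B p ⊞ ≡≥ (cnt-++ s K (flat B)))
      go : (s , J') ∈ B₁ ⊎ (s , J') ∈ (s , J) ∷ B₂ → J ≡ J'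
      go (inj₁ q) = ⊥-elim (1≰0 (linear (cnt s (flat B₁) ∷ ⟦ s == s ⟧ ∷ cnt s J ∷ cnt s (flat B₂) ∷ []) (# 0 ⊕ (# 1 ⊕ (# 2 ⊕ # 3)) ⊕ (κ 1 ⊕ κ 1)) (κ 1 ⊕ (# 0 ⊕ # 1)) (κ 1) (κ 0) (once ⊞ head-in B₁ q ⊞ ≡≥ (⟦⟧-true (==-refl s)))))
      go (inj₂ (here refl)) = refl
      go (inj₂ (there q)) = ⊥-elim (1≰0 (linear (cnt s (flat B₁) ∷ ⟦ s == s ⟧ ∷ cnt s J ∷ cnt s (flat B₂) ∷ []) (# 0 ⊕ (# 1 ⊕ (# 2 ⊕ # 3)) ⊕ (κ 1 ⊕ κ 1)) (κ 1 ⊕ (# 3 ⊕ # 1)) (κ 1) (κ 0) (once ⊞ head-in B₂ q ⊞ ≡≥ (⟦⟧-true (==-refl s)))))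

    a₁≢aₖ : a₁ ≢ aₖ
    a₁≢aₖ with steps | some | vertices cycle a₁
    ... | (i , a) ∷ ps | _ | v = λ e → 1≰0 (linear (⟦ a₁ == a₁ ⟧ ∷ ⟦ a₁ == i ⟧ ∷ ⟦ a₁ == a ⟧ ∷ cnt a₁ (flat₂ ps ++ gap) ∷ ⟦ In a₁ ⟧ ∷ cnt a₁ (flat₂ ps) ∷ cnt a₁ gap ∷ []) (# 0 ⊕ (# 1 ⊕ (# 2 ⊕ # 3)) ⊕ (# 4 ⊕ (κ 1 ⊕ (# 1 ⊕ (# 2 ⊕ # 5) ⊕ # 6 ⊕ κ 1)))) (# 4 ⊕ (κ 1 ⊕ (# 0 ⊕ (# 1 ⊕ (# 2 ⊕ # 3) ⊕ (# 2 ⊕ # 5))))) (κ 1) (κ 0) (≡≤ v ⊞ ⟦⟧≤1 (In a₁) ⊞ ≡≥ (⟦⟧-true (==-refl a₁)) ⊞ ≡≥ (cnt-++ a₁ (i ∷ a ∷ flat₂ ps) gap) ⊞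
                                        subst (λ y → 1 ≤ cnt y (a ∷ flat₂ ps)) (sym e) (final-in a ps)))
      where
      final-in : ∀ a ps → 1 ≤ cnt (final a ps) (a ∷ flat₂ ps)
      final-in a [] = cnt-mid a [] []
      final-in a ((i , a') ∷ ps) = linear (⟦ final a' ps == a' ⟧ ∷ cnt (final a' ps) (flat₂ ps) ∷ ⟦ final a' ps == a ⟧ ∷ ⟦ final a' ps == i ⟧ ∷ []) (κ 1) (# 0 ⊕ # 1) (κ 1) (# 2 ⊕ (# 3 ⊕ (# 0 ⊕ # 1))) (final-in a' ps)

    -- What follows a block begins with a vertex of `A`, hence with a neighbour of `x`; this is what
    -- `detour` asks of `x`.
    reroute : ∀ {s J t J' l} → (s , J) ∈ bs → (t , J') ∈ bs → t ≢ s → Ch ad s l t →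
              (∀ z → cnt z l ≤ ⟦ Off z ⟧ + (cnt z J + cnt z J')) → suc (length l) ≤ length J + length J'
    reroute {s} {J} {t} {J'} {l} m m' t≢s ch f with front-first m
    ... | B , sub , other , q with ∈-∃++ (other m' t≢s)
    ...   | D₁ , D₂ , refl = detour {J = J} {S₂ = flat D₁} {J' = J'} {S₃ = flat D₂} {l = l} (subst (λ w → CycL In (s ∷ J ++ w)) (flat-++ D₁ _) q) x∉ (x-adj s (block-head m)) (x-adj t (block-head m'))
                (heads {D₁} (λ p → sub (∈-++⁺ˡ p))) (heads {D₂} (λ p → sub (∈-++⁺ʳ D₁ (there p)))) ch f

    no-insert : ∀ {s b J l} → (s , b ∷ J) ∈ bs → Ch ad s l b → l ⊑ (λ z → not (In z)) → length l ≤ 0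
    no-insert {s} {b} {J} {l} m ch f with front-first m
    ... | B , _ , _ , q = splice {J = []} q ch (λ z → ≤-trans (⊑-e f z) (m≤m+n _ _))

    successor : ∀ {s i} → (s , [ i ]) ∈ bs → s ≢ aₖ → ∃[ t ] ∃[ R ] (t ∈ˢ A × CycL In (s ∷ i ∷ t ∷ R))
    successor {s} {i} m s≢ with front-first m
    ... | [] , sub , other , q = ⊥-elim (empty (other last-block (λ e → s≢ (sym e))))
      where
      empty : ∀ {b : Block} → b ∈ [] → ⊥
      empty ()
    ... | (t , J) ∷ B , sub , other , q = t , J ++ flat B , block-head (sub (here refl)) , q

-- Two disjoint paths to a set

mem⁺ : ∀ {n} (z : Fin n) l → memB z l ≡ true → 1 ≤ cnt z l
mem⁺ z (w ∷ l) h with z ≟ w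
... | yes _ = s≤s z≤n
... | no _ = mem⁺ z l h

mem⁻ : ∀ {n} (z : Fin n) l → memB z l ≡ false → cnt z l ≡ 0
mem⁻ z [] h = refl
mem⁻ z (w ∷ l) h with z ≟ w
... | no _ = mem⁻ z l h

module Menger {n} (E : Rel n) (E-sym : Symm E) (E-irr : ∀ u → E u u ≡ false) (A : BSet n)
              (reach : ∀ y u → u ≢ y → ∃[ a ] (a ∈ˢ A × Rc E ((λ _ → true) ∖ y) u a)) where

  Q : BSet n
  Q z = not (A z)

  All : BSet n
  All _ = true

  record Fan (w : Fin n) : Set where
    field
      s₁ s₂  : Fin n
      l₁ l₂  : List (Fin n)
      apart  : s₁ ≢ s₂
      s₁∈    : s₁ ∈ˢ A
      s₂∈    : s₂ ∈ˢ A
      path₁  : Ch E w l₁ s₁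
      path₂  : Ch E w l₂ s₂
      disj   : ∀ z → cnt z l₁ + cnt z l₂ ≤ ⟦ (Q ∖ w) z ⟧

  -- With the edge between `w` and `u`, the two paths form a path between distinct vertices of `A`.
  record Ear (w u : Fin n) : Set where
    constructor mkEar
    field
      s₁ s₂  : Fin n
      l₁ l₂  : List (Fin n)
      apart  : s₁ ≢ s₂
      s₁∈    : s₁ ∈ˢ A
      s₂∈    : s₂ ∈ˢ A
      path₁  : Ch E w l₁ s₁
      path₂  : Ch E u l₂ s₂
      disj   : ∀ z → cnt z l₁ + cnt z l₂ ≤ ⟦ (Q ∖ u ∖ w) z ⟧

  drop : ∀ (S : BSet n) u z {m} → m + ⟦ z == u ⟧ ≤ ⟦ S z ⟧ → m ≤ ⟦ (S ∖ u) z ⟧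
  drop S u z {m} h with z ≟ u
  ... | no _ with S z
  ...   | true = linear (m ∷ []) (# 0 ⊕ κ 0) (κ 1) (# 0) (κ 1) h
  ...   | false = linear (m ∷ []) (# 0 ⊕ κ 0) (κ 0) (# 0) (κ 0) h
  drop S u z {m} h | yes refl with S z
  ...   | true = linear (m ∷ []) (# 0 ⊕ κ 1) (κ 1) (# 0) (κ 0) h
  ...   | false = linear (m ∷ []) (# 0 ⊕ κ 1) (κ 0) (# 0) (κ 0) h

  undrop : ∀ (S : BSet n) u z {m} → u ∈ˢ S → m ≤ ⟦ (S ∖ u) z ⟧ → ⟦ z == u ⟧ + m ≤ ⟦ S z ⟧
  undrop S u z {m} u∈ h with z ≟ u
  undrop S u z {m} u∈ h | no _ with S z
  ...   | true = h
  ...   | false = h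
  undrop S u z {m} u∈ h | yes refl rewrite u∈ = linear (m ∷ []) (# 0) (κ 0) (κ 1 ⊕ # 0) (κ 1) h

  swap∖ : ∀ (S : BSet n) u w z → ⟦ (S ∖ u ∖ w) z ⟧ ≤ ⟦ (S ∖ w ∖ u) z ⟧
  swap∖ S u w z = ⟦⟧-mono λ p → let p₁ , z≢w = ∖-e {S = S ∖ u} p ; p₂ , z≢u = ∖-e {S = S} p₁ in ∖-i {S = S ∖ w} (∖-i {S = S} p₂ z≢w) z≢u

  module _ {w u} (F : Fan w) (w∉ : w ∉ˢ A) (u∉ : u ∉ˢ A) (u≢w : u ≢ w) (e : E w u ≡ true) where
    open Fan F

    flip : ∀ z {m m'} → m + m' + ⟦ z == u ⟧ ≤ ⟦ (Q ∖ w) z ⟧ → m + m' ≤ ⟦ (Q ∖ u ∖ w) z ⟧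
    flip z h = ≤-trans (drop (Q ∖ w) u z h) (swap∖ Q w u z)

    -- If `u` lies on the fan, cut the fan there. Otherwise follow a path from `u` that avoids `w`
    -- to its first vertex `t` in `A` or on the fan, and from there along the fan if `t` is not yet
    -- in `A`; `w` keeps a path of the fan that ends elsewhere.
    ear-edge : Ear w u
    ear-edge with 1 ≤? cnt u l₁ | 1 ≤? cnt u l₂
    ... | yes p | _ with cnt-∈ u l₁ p
    ...   | m₁ , m₂ , refl = mkEar s₂ s₁ l₂ m₂ (λ q → apart (sym q)) s₂∈ s₁∈ path₂ (proj₂ (Ch-split E m₁ path₁))
              λ z → flip z {cnt z l₂} {cnt z m₂} (linear (cnt z (m₁ ++ u ∷ m₂) ∷ cnt z l₂ ∷ cnt z m₁ ∷ ⟦ z == u ⟧ ∷ cnt z m₂ ∷ ⟦ (Q ∖ w) z ⟧ ∷ []) (# 0 ⊕ # 1 ⊕ (# 2 ⊕ (# 3 ⊕ # 4))) (# 5 ⊕ # 0) (# 1 ⊕ # 4 ⊕ # 3) (# 5) (disj z ⊞ ≡≥ (cnt-++ z m₁ (u ∷ m₂))))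
    ear-edge | no _ | yes p with cnt-∈ u l₂ p
    ...   | m₁ , m₂ , refl = mkEar s₁ s₂ l₁ m₂ apart s₁∈ s₂∈ path₁ (proj₂ (Ch-split E m₁ path₂))
              λ z → flip z {cnt z l₁} {cnt z m₂} (linear (cnt z l₁ ∷ cnt z (m₁ ++ u ∷ m₂) ∷ cnt z m₁ ∷ ⟦ z == u ⟧ ∷ cnt z m₂ ∷ ⟦ (Q ∖ w) z ⟧ ∷ []) (# 0 ⊕ # 1 ⊕ (# 2 ⊕ (# 3 ⊕ # 4))) (# 5 ⊕ # 1) (# 0 ⊕ # 4 ⊕ # 3) (# 5) (disj z ⊞ ≡≥ (cnt-++ z m₁ (u ∷ m₂))))
    ear-edge | no u∉₁ | no u∉₂ with reach w u u≢w
    ...   | a , a∈ , r with Rc-hit (λ z → A z ∨ memB z (l₁ ++ l₂)) r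
                              (¬t⇒f λ h → [ (λ x → t≢f x u∉) , (λ x → 1≰0 (linear (cnt u (l₁ ++ l₂) ∷ cnt u l₁ ∷ cnt u l₂ ∷ []) (κ 1 ⊕ (# 0 ⊕ (# 1 ⊕ # 2))) (# 0 ⊕ (# 1 ⊕ # 2 ⊕ (κ 0 ⊕ κ 0))) (κ 1) (κ 0) (mem⁺ u (l₁ ++ l₂) x ⊞ ≡≤ (cnt-++ u l₁ l₂) ⊞ ≤-pred (≰⇒> u∉₁) ⊞ ≤-pred (≰⇒> u∉₂)))) ]′ (∨-e {A u} h)) (∨-i₁ a∈)
    ...     | s , t , r' , est , t∈T , t∈ with simple r' est
    ...       | lR , cR , mR = finish (1 ≤? cnt t l₁) (1 ≤? cnt t l₂)
      where
      T₀ : BSet n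
      T₀ z = A z ∨ memB z (l₁ ++ l₂)
      R : BSet n
      R = (All ∖ w − T₀) ∖ u
      total : ∀ z → cnt z lR + (cnt z l₁ + cnt z l₂) ≤ ⟦ (Q ∖ u ∖ w) z ⟧
      total z with true⊎false (R z)
      ... | inj₂ f = ≤-trans (≤-trans (+-monoˡ-≤ (cnt z l₁ + cnt z l₂) (≤-trans (⊑-e mR z) (≤-reflexive (⟦⟧-false f)))) ≤-refl) (flip z {cnt z l₁} {cnt z l₂} no-u)
        where
        no-u : cnt z l₁ + cnt z l₂ + ⟦ z == u ⟧ ≤ ⟦ (Q ∖ w) z ⟧
        no-u with z ≟ u
        ... | no _ = ≤-trans (≤-reflexive (+-identityʳ _)) (disj z)
        ... | yes refl = linear (cnt u l₁ ∷ cnt u l₂ ∷ ⟦ (Q ∖ w) u ⟧ ∷ []) (# 0 ⊕ (# 1 ⊕ κ 1)) (κ 0 ⊕ (κ 0 ⊕ # 2)) (# 0 ⊕ # 1 ⊕ κ 1) (# 2) (≤-pred (≰⇒> u∉₁) ⊞ ≤-pred (≰⇒> u∉₂) ⊞ ≡≥ (⟦⟧-true (∖-i {S = Q} {v = w} (not-i u∉) u≢w)))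
      ... | inj₁ y with ∖-e {S = All ∖ w − T₀} y
      ...   | y₁ , z≢u with −-e {S = All ∖ w} {T₀} y₁
      ...     | y₂ , z∉T = linear (cnt z lR ∷ ⟦ R z ⟧ ∷ cnt z (l₁ ++ l₂) ∷ cnt z l₁ ∷ cnt z l₂ ∷ ⟦ (Q ∖ u ∖ w) z ⟧ ∷ []) (# 0 ⊕ (# 1 ⊕ (# 2 ⊕ (# 3 ⊕ # 4 ⊕ κ 1)))) (# 1 ⊕ (κ 1 ⊕ (κ 0 ⊕ (# 2 ⊕ # 5)))) (# 0 ⊕ (# 3 ⊕ # 4)) (# 5) (⊑-e mR z ⊞ ⟦⟧≤1 (R z) ⊞ ≡≤ zero-l ⊞ ≡≥ (cnt-++ z l₁ l₂) ⊞ ≡≥ (⟦⟧-true (∖-i {S = Q ∖ u} {v = w} (∖-i {S = Q} (not-i z∉A) z≢u) (proj₂ (∖-e {S = All} y₂)))))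
        where
        z∉A : z ∉ˢ A
        z∉A = ¬t⇒f λ h → t≢f (∨-i₁ h) z∉T
        zero-l : cnt z (l₁ ++ l₂) ≡ 0
        zero-l = mem⁻ z (l₁ ++ l₂) (¬t⇒f λ h → t≢f (∨-i₂ {A z} h) z∉T)
      finish : Dec (1 ≤ cnt t l₁) → Dec (1 ≤ cnt t l₂) → Ear w u
      finish (yes p) _ with cnt-∈ t l₁ p
      ... | m₁ , m₂ , eq = mkEar s₂ s₁ l₂ (lR ++ t ∷ m₂) (λ q → apart (sym q)) s₂∈ s₁∈ path₂ (Ch-++ E lR cR (proj₂ (Ch-split E m₁ (subst (λ l → Ch E w l s₁) eq path₁))))
             λ z → ≤-trans (linear (cnt z (lR ++ t ∷ m₂) ∷ cnt z m₁ ∷ ⟦ z == t ⟧ ∷ cnt z m₂ ∷ cnt z lR ∷ cnt z l₁ ∷ cnt z l₂ ∷ []) (# 0 ⊕ (# 1 ⊕ (# 2 ⊕ # 3))) (# 4 ⊕ (# 2 ⊕ # 3) ⊕ # 5) (# 6 ⊕ # 0) (# 4 ⊕ (# 5 ⊕ # 6)) (≡≤ (cnt-++ z lR (t ∷ m₂)) ⊞ ≡≥ (trans (cong (cnt z) eq) (cnt-++ z m₁ (t ∷ m₂))))) (total z)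
      finish (no _) (yes p) with cnt-∈ t l₂ p
      ... | m₁ , m₂ , eq = mkEar s₁ s₂ l₁ (lR ++ t ∷ m₂) apart s₁∈ s₂∈ path₁ (Ch-++ E lR cR (proj₂ (Ch-split E m₁ (subst (λ l → Ch E w l s₂) eq path₂))))
             λ z → ≤-trans (linear (cnt z (lR ++ t ∷ m₂) ∷ cnt z m₁ ∷ ⟦ z == t ⟧ ∷ cnt z m₂ ∷ cnt z lR ∷ cnt z l₂ ∷ cnt z l₁ ∷ []) (# 0 ⊕ (# 1 ⊕ (# 2 ⊕ # 3))) (# 4 ⊕ (# 2 ⊕ # 3) ⊕ # 5) (# 6 ⊕ # 0) (# 4 ⊕ (# 6 ⊕ # 5)) (≡≤ (cnt-++ z lR (t ∷ m₂)) ⊞ ≡≥ (trans (cong (cnt z) eq) (cnt-++ z m₁ (t ∷ m₂))))) (total z)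
      finish (no t∉₁) (no t∉₂) with t ≟ s₁
      ... | no t≢ = mkEar s₁ t l₁ lR (λ q → t≢ (sym q)) s₁∈ t∈A path₁ cR λ z → ≤-trans (linear (cnt z l₂ ∷ cnt z l₁ ∷ cnt z lR ∷ []) (κ 0) (# 0) (# 1 ⊕ # 2) (# 2 ⊕ (# 1 ⊕ # 0)) (z≤n {cnt z l₂})) (total z)
        where
        t∈A : t ∈ˢ A
        t∈A = [ (λ x → x) , (λ x → ⊥-elim (1≰0 (linear (cnt t (l₁ ++ l₂) ∷ cnt t l₁ ∷ cnt t l₂ ∷ []) (κ 1 ⊕ (# 0 ⊕ (# 1 ⊕ # 2))) (# 0 ⊕ (# 1 ⊕ # 2 ⊕ (κ 0 ⊕ κ 0))) (κ 1) (κ 0) (mem⁺ t (l₁ ++ l₂) x ⊞ ≡≤ (cnt-++ t l₁ l₂) ⊞ ≤-pred (≰⇒> t∉₁) ⊞ ≤-pred (≰⇒> t∉₂))))) ]′ (∨-e {A t} t∈T)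
      ... | yes t≡ = mkEar s₂ t l₂ lR (λ q → apart (sym (trans q t≡))) s₂∈ (subst (_∈ˢ A) (sym t≡) s₁∈) path₂ cR λ z → ≤-trans (linear (cnt z l₁ ∷ cnt z l₂ ∷ cnt z lR ∷ []) (κ 0) (# 0) (# 1 ⊕ # 2) (# 2 ⊕ (# 0 ⊕ # 1)) (z≤n {cnt z l₁})) (total z)

  E≢ : ∀ {p q} → E p q ≡ true → p ≢ q
  E≢ e refl = t≢f e (E-irr _)

  -- Induction along a walk to `A`: the fan of the next vertex becomes an ear at the edge, and thus
  -- two paths from `u`. If the next vertex is in `A`, a second path avoids it.
  fan : ∀ {S u a} → Rc E S u a → a ∈ˢ A → u ∉ˢ A → Fan u
  fan (here _) p q = ⊥-elim (t≢f p q)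
  fan {S} {u} (step {w = w} _ e r) p q with true⊎false (A w)
  ... | inj₂ w∉ = record
      { s₁ = s₁ ; s₂ = s₂ ; l₁ = w ∷ l₁ ; l₂ = l₂ ; apart = apart ; s₁∈ = s₁∈ ; s₂∈ = s₂∈ ; path₁ = e , path₁ ; path₂ = path₂
      ; disj = λ z → ≤-trans (linear (⟦ z == w ⟧ ∷ cnt z l₁ ∷ cnt z l₂ ∷ []) (κ 0) (κ 0) (# 0 ⊕ # 1 ⊕ # 2) (# 0 ⊕ (# 1 ⊕ # 2)) (z≤n {0})) (undrop (Q ∖ u) w z {cnt z l₁ + cnt z l₂} (∖-i {S = Q} (not-i w∉) (λ x → E≢ e (sym x))) (disj z)) }
    where open Ear (ear-edge (fan r p w∉) w∉ q (E≢ e) (E-sym e))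
  ... | inj₁ w∈ with reach w u (E≢ e)
  ...   | a , a∈ , r' with Rc-hit A r' q a∈
  ...     | s , t , rs , est , t∈A , t∈ with simple rs est
  ...       | l , c , m = record { s₁ = w ; s₂ = t ; l₁ = [] ; l₂ = l ; apart = λ x → proj₂ (∖-e {S = All} t∈) (sym x) ; s₁∈ = w∈ ; s₂∈ = t∈A ; path₁ = e ; path₂ = c
             ; disj = λ z → ≤-trans (⊑-e m z) (⟦⟧-mono λ h → let h₁ , z≢u = ∖-e {S = All ∖ w − A} h in ∖-i {S = Q} (not-i (proj₂ (−-e {S = All ∖ w} {A} h₁))) z≢u) }

  ear : ∀ u v → u ∉ˢ A → v ∉ˢ A → E u v ≡ true → Ear u v
  ear u v u∉ v∉ e with reach v u (E≢ e)
  ... | a , a∈ , r = ear-edge (fan r a∈ u∉) u∉ v∉ (λ x → E≢ e (sym x)) e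

-- The graph outside the neighbourhood of the extra vertex

cnt-[] : ∀ {n} {h i : Fin n} → 1 ≤ cnt h [ i ] → h ≡ i
cnt-[] {h = h} {i} p = ==⇒≡ (⟦⟧≥1 (≤-trans p (≤-reflexive (+-identityʳ _))))

-- All that the construction of the host graphs needs from rerouting. `ends-of` exempts edges that
-- touch the gap; exchanging the gap takes care of these.
record OddFacts {n} (G : Graph n) (A In : BSet n) (x a₁ aₖ p q : Fin n) : Set where
  field
    isolated   : ∀ b → b ∈ˢ In → b ∉ˢ A → b ≢ p → b ≢ q → ∀ v → adj G b v ≡ true → v ∈ˢ A
    isolated-x : ∀ v → adj G x v ≡ true → v ∈ˢ A
    p∉A        : p ∉ˢ A
    q∉A        : q ∉ˢ A
    a₁∈A       : a₁ ∈ˢ A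
    aₖ∈A       : aₖ ∈ˢ A
    p~q        : adj G p q ≡ true
    attached   : ∀ {u v} → u ∉ˢ A → v ∉ˢ A → adj G u v ≡ true →
                 ∃[ s ] ∃[ t ] (s ∈ˢ A × t ∈ˢ A × s ≢ t × adj G u s ≡ true × adj G v t ≡ true)
    no-long    : ∀ {s t} u l v → s ∈ˢ A → t ∈ˢ A → adj G s u ≡ true → Ch (adj G) u l v → adj G v t ≡ true →
                 (u ∷ l ++ [ v ]) ⊑ (λ z → not (A z)) → 1 ≤ length l → s ≡ t
    ends-of    : ∀ {s t u v} → s ∈ˢ A → t ∈ˢ A → s ≢ t → u ∉ˢ A → v ∉ˢ A → u ≢ p → u ≢ q → v ≢ p → v ≢ q →
                 adj G u s ≡ true → adj G u v ≡ true → adj G v t ≡ true → (s ≡ aₖ × t ≡ a₁) ⊎ (s ≡ a₁ × t ≡ aₖ)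

module Structure {n} (G : Graph n) (c : ℕ)
               (longest : ∀ v r → Ch (adj G) v r v → Simple (v ∷ r) → 2 ≤ length r → suc (length r) ≤ c)
               {A In : BSet n} {x : Fin n} (x∉ : x ∉ˢ In) (x-adj : ∀ a → a ∈ˢ A → adj G x a ≡ true)
               (x-In : ∀ z → z ∈ˢ In → adj G x z ≡ true → z ∈ˢ A) (A⊆In : ∀ z → z ∈ˢ A → z ∈ˢ In)
               (reach : ∀ y u → u ≢ y → ∃[ a ] (a ∈ˢ A × Rc (adj G) ((λ _ → true) ∖ y) u a)) where
  open Surgery G c longest

  private
    ad-irr : ∀ u → ad u u ≡ false
    ad-irr = irrefl G

  ad≢ : ∀ {u v} → ad u v ≡ true → u ≢ v
  ad≢ {u} e refl = t≢f e (ad-irr u)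

  open Menger ad ad-sym ad-irr A reach using (Q; All; Ear) renaming (ear to menger)

  Off : BSet n
  Off = (λ z → not (In z)) ∖ x

  Off-e : ∀ {z} → z ∈ˢ Off → z ∉ˢ In × z ≢ x
  Off-e p = let a , b = ∖-e {S = λ z → not (In z)} p in not-e a , b

  Off⊆ : ∀ {l} → l ⊑ Off → l ⊑ (λ z → not (In z))
  Off⊆ m = ⊑-mono m λ z p → not-i (proj₁ (Off-e p))

  touch : BSet n
  touch z = In z ∨ z == x

  -- The edge is continued outside the cycle until it returns to the cycle or meets `x`.
  record Exit (b v : V) : Set where
    field
      P    : List V
      h    : V
      path : Ch ad b P h
      P⊑   : P ⊑ Off
      h∈   : h ∈ˢ touch
      h≢   : h ≢ b
      ends : (P ≡ [] × h ≡ v) ⊎ 1 ≤ length P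

  exit : ∀ b v → ad b v ≡ true → Exit b v
  exit b v e with true⊎false (touch v)
  ... | inj₁ v∈ = record { P = [] ; h = v ; path = e ; P⊑ = ⊑-[] ; h∈ = v∈ ; h≢ = λ q → ad≢ e (sym q) ; ends = inj₁ (refl , refl) }
  ... | inj₂ v∉ with reach b v (λ q → ad≢ e (sym q))
  ...   | a , a∈ , r with Rc-hit touch r v∉ (∨-i₁ (A⊆In a a∈))
  ...     | s , t , r' , est , t∈ , t∈' with simple r' est
  ...       | l , c' , m = record { P = v ∷ l ; h = t ; path = e , c' ; h∈ = t∈ ; h≢ = proj₂ (∖-e {S = All} t∈') ; ends = inj₂ (s≤s z≤n)
                ; P⊑ = ⊑-mono (⊑-∷ (Rc-l r') m) λ z p → let p₁ = proj₂ (−-e {S = All ∖ b} {touch} p) in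
                    ∖-i {S = λ z → not (In z)} (not-i (¬t⇒f λ q → t≢f (∨-i₁ q) p₁)) λ { refl → t≢f (∨-i₂ {In z} (==-refl z)) p₁ } }

  Iso : V → Set
  Iso b = ∀ v → ad b v ≡ true → v ∈ˢ A

  module One (k : Config A In x) where
    open Config k
    open InConfig x∉ x-adj k hiding (Off) public

    single-exit : ∀ {a b P h} → (a , [ b ]) ∈ bs → Ch ad b P h → P ⊑ Off → h ∈ˢ touch → h ≢ b → (h ∈ˢ A → 1 ≤ length P) →
                  (h ≡ aₖ → a ≡ aₖ) → (1 ≤ cnt h gap → ∃[ pre ] gap ≡ pre ++ [ h ]) → ⊥
    single-exit {a} {b} {P} {h} m ch P⊑ h∈ h≢b pos endA endG with ∨-e {In h} h∈
    ... | inj₂ h≡x = 1≰0 (≤-trans (s≤s z≤n) (no-insert {l = x ∷ reverse P} m (ad-sym (x-adj a (block-head m)) , subst (λ y → Ch ad y (reverse P) b) (==⇒≡ h≡x) (Ch-reverse ad ad-sym P ch))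
                        (⊑-∷ (not-i x∉) (⊑-reverse (⊑-mono P⊑ λ z p → ∖-i {S = λ z → not (In z)} (not-i (proj₁ (Off-e p))) (proj₂ (Off-e p)))))))
    ... | inj₁ h∈In with place h h∈In
    ...   | single {s} h∉ m' _ with s ≟ a
    ...     | yes refl with block-unique m m'
    ...       | refl = h≢b refl
    single-exit {a} {b} {P} {h} m ch P⊑ h∈ h≢b pos endA endG | inj₁ h∈In | single {s} h∉ m' _ | no s≢a =
      -- The detour goes from `a` through `b`, `P` and `h` to `s`, the vertex before `h`.
      1≰0 (linear (length (P ++ [ h ]) ∷ length P ∷ []) (κ 2 ⊕ # 0 ⊕ (# 1 ⊕ κ 1)) (κ 1 ⊕ κ 1 ⊕ # 0) (κ 1) (κ 0) (reroute {l = b ∷ P ++ [ h ]} m m' s≢a (walk-in m , Ch-++ ad P ch (walk-out m'))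
        (λ z → linear (cnt z P ∷ cnt z (P ++ [ h ]) ∷ ⟦ Off z ⟧ ∷ ⟦ z == h ⟧ ∷ ⟦ z == b ⟧ ∷ []) (# 0 ⊕ # 1) (# 2 ⊕ (# 0 ⊕ (# 3 ⊕ κ 0))) (# 4 ⊕ # 1) (# 2 ⊕ (# 4 ⊕ κ 0 ⊕ (# 3 ⊕ κ 0))) (⊑-e P⊑ z ⊞ ≡≤ (cnt-++ z P [ h ]))) ⊞ ≡≥ (length-++ P {[ h ]})))
      where
      walk-in : ∀ {s i} → (s , [ i ]) ∈ bs → ad s i ≡ true
      walk-in m = let _ , _ , _ , q = front-first m in proj₁ (closed-walk q)
      walk-out : ∀ {s i} → (s , [ i ]) ∈ bs → ad i s ≡ true
      walk-out m = ad-sym (walk-in m)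
    single-exit {a} {b} {P} {h} m ch P⊑ h∈ h≢b pos endA endG | inj₁ h∈In | inGap h∉ hg with endG hg
    ... | pre , e with a ≟ aₖ
    ...   | yes refl = h≢b (cnt-[] (subst (λ g → 1 ≤ cnt h g) (sym (block-unique m last-block)) hg))
    ...   | no a≢ = 1≰0 (linear (length (P ++ h ∷ reverse pre) ∷ length P ∷ length (reverse pre) ∷ length pre ∷ length gap ∷ []) (κ 2 ⊕ # 0 ⊕ (# 1 ⊕ (κ 1 ⊕ # 2) ⊕ (# 3 ⊕ # 4))) (κ 1 ⊕ # 4 ⊕ (# 0 ⊕ (# 2 ⊕ (# 3 ⊕ κ 1)))) (κ 1) (κ 0) (reroute {l = b ∷ P ++ h ∷ reverse pre} m last-block (λ q → a≢ (sym q))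
              (proj₁ (closed-walk (proj₂ (proj₂ (proj₂ (front-first m))))) , Ch-++ ad P ch (Ch-reverse ad ad-sym pre in-gap))
              (λ z → linear (cnt z P ∷ cnt z (P ++ h ∷ reverse pre) ∷ cnt z (reverse pre) ∷ cnt z pre ∷ ⟦ z == h ⟧ ∷ ⟦ Off z ⟧ ∷ cnt z gap ∷ ⟦ z == b ⟧ ∷ []) (# 0 ⊕ (# 1 ⊕ (# 2 ⊕ (# 3 ⊕ (# 4 ⊕ κ 0))))) (# 5 ⊕ (# 0 ⊕ (# 4 ⊕ # 2) ⊕ (# 3 ⊕ # 6))) (# 7 ⊕ # 1) (# 5 ⊕ (# 7 ⊕ κ 0 ⊕ # 6)) (⊑-e P⊑ z ⊞ ≡≤ (cnt-++ z P (h ∷ reverse pre)) ⊞ ≡≤ (cnt-reverse z pre) ⊞ ≡≥ (trans (cong (cnt z) e) (cnt-++ z pre [ h ]))))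
              ⊞ ≡≥ (length-++ P {h ∷ reverse pre}) ⊞ ≡≥ (length-reverse pre) ⊞ ≡≤ (trans (cong length e) (length-++ pre))))
      where
      in-gap : Ch ad aₖ pre h
      in-gap = let B , _ , _ , q = front-first last-block in
        proj₁ (Ch-split ad pre (subst (λ l → Ch ad aₖ l aₖ) (trans (cong (_++ flat B) e) (++-assoc pre [ h ] (flat B))) (closed-walk q)))
    single-exit {a} {b} {P} {h} m ch P⊑ h∈ h≢b pos endA endG | inj₁ h∈In | onA {J} h∈A m' e with h ≟ a
    ... | yes refl = 1≰0 (≤-trans (pos h∈A) (≤-trans (≤-reflexive (sym (length-reverse P))) (no-insert m (Ch-reverse ad ad-sym P ch) (⊑-reverse (Off⊆ P⊑)))))
    ... | no h≢a with e
    ...   | inj₁ (_ , h≡) = h≢a (trans h≡ (sym (endA h≡)))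
    ...   | inj₂ (i , refl) = 1≰0 (linear (length P ∷ []) (κ 2 ⊕ # 0 ⊕ κ 1) (κ 1 ⊕ κ 1 ⊕ # 0) (κ 1) (κ 0) (reroute {l = b ∷ P} m m' h≢a (proj₁ (closed-walk (proj₂ (proj₂ (proj₂ (front-first m))))) , ch)
              (λ z → linear (cnt z P ∷ ⟦ Off z ⟧ ∷ ⟦ z == b ⟧ ∷ ⟦ z == i ⟧ ∷ []) (# 0) (# 1) (# 2 ⊕ # 0) (# 1 ⊕ (# 2 ⊕ κ 0 ⊕ (# 3 ⊕ κ 0))) (⊑-e P⊑ z)) ⊞ pos h∈A))

    -- If `h` is outside `A`, the path is inserted together with `x` before `h`. If `h` is in `A`,
    -- it replaces, together with `x`, the single vertex after `h`; after `aₖ` there is the gap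
    -- instead.
    x-exit : ∀ {P h} → Ch ad x P h → P ⊑ Off → h ∈ˢ In → 1 ≤ length P → h ≢ aₖ → (1 ≤ cnt h gap → ∃[ r ] gap ≡ h ∷ r) → ⊥
    x-exit {P} {h} ch P⊑ h∈ pos h≢ endG with place h h∈
    ... | single {s} h∉ m _ = 1≰0 (≤-trans (s≤s z≤n) (no-insert {l = x ∷ P} m (ad-sym (x-adj s (block-head m)) , ch) x∷P))
      where
      x∷P : (x ∷ P) ⊑ (λ z → not (In z))
      x∷P = ⊑-∷ (not-i x∉) P⊑
    ... | inGap h∉ hg with endG hg
    ...   | r , e = 1≰0 (≤-trans (s≤s z≤n) (no-insert {l = x ∷ P} (subst (λ g → (aₖ , g) ∈ bs) e last-block) (ad-sym (x-adj aₖ aₖ∈) , ch) (⊑-∷ (not-i x∉) P⊑)))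
    x-exit {P} {h} ch P⊑ h∈ pos h≢ endG | onA {J} h∈A m e with e
    ... | inj₁ (_ , h≡) = h≢ h≡
    ... | inj₂ (i , refl) with successor m h≢
    ...   | t , R , t∈ , q = 1≰0 (linear (length (reverse P ++ [ x ]) ∷ length (reverse P) ∷ length P ∷ []) (# 0 ⊕ (κ 1 ⊕ (# 1 ⊕ κ 1 ⊕ # 2))) (κ 1 ⊕ (# 2 ⊕ (# 0 ⊕ # 1))) (κ 1) (κ 0) (splice {J = [ i ]} {l = reverse P ++ [ x ]} q (Ch-++ ad (reverse P) (Ch-reverse ad ad-sym P ch) (x-adj t t∈))
              (λ z → linear (cnt z (reverse P ++ [ x ]) ∷ ⟦ not (In z) ⟧ ∷ ⟦ z == i ⟧ ∷ []) (# 0) (# 1) (# 0) (# 1 ⊕ (# 2 ⊕ κ 0)) (⊑-e all z)) ⊞ pos ⊞ ≡≥ (length-++ (reverse P) {[ x ]}) ⊞ ≡≥ (length-reverse P)))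
      where
      all : (reverse P ++ [ x ]) ⊑ (λ z → not (In z))
      all = ⊑-++ {l = reverse P} {S = Off} {T = _== x} (⊑-reverse P⊑) (⊑-∷ (==-refl x) ⊑-[])
        (λ z p → not-i (proj₁ (Off-e p)) , ≢⇒==f (proj₂ (Off-e p)))
        (λ z p → subst (λ y → not (In y) ≡ true) (sym (==⇒≡ p)) (not-i x∉))

    Cond : List V → Set
    Cond l = ∀ z → cnt z l ≤ ⟦ Off z ⟧ + cnt z gap

    -- The detour skips the gap and the single vertex after `t`, and gains `x`.
    len-end : ∀ {l t} → t ∈ˢ A → t ≢ aₖ → Ch ad aₖ l t → Cond l → length l ≤ length gap
    len-end {l} {t} t∈ t≢ ch f with locate t t∈ (A⊆In t t∈)
    ... | J , m , inj₁ (_ , e) = ⊥-elim (t≢ e)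
    ... | J , m , inj₂ (i , refl) = linear (length l ∷ length gap ∷ []) (κ 1 ⊕ # 0) (# 1 ⊕ κ 1) (# 0) (# 1) (reroute last-block m t≢ ch (λ z → linear (cnt z l ∷ ⟦ Off z ⟧ ∷ cnt z gap ∷ ⟦ z == i ⟧ ∷ []) (# 0) (# 1 ⊕ # 2) (# 0) (# 1 ⊕ (# 2 ⊕ (# 3 ⊕ κ 0))) (f z)))

    len-mid : ∀ {s l t} → s ∈ˢ A → t ∈ˢ A → t ≢ s → s ≢ aₖ → t ≢ aₖ → Ch ad s l t → (∀ z → cnt z l ≤ ⟦ Off z ⟧) → length l ≤ 1
    len-mid {s} {l} {t} s∈ t∈ t≢s s≢ t≢ ch f with locate s s∈ (A⊆In s s∈) | locate t t∈ (A⊆In t t∈)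
    ... | J , m , inj₁ (_ , e) | _ = ⊥-elim (s≢ e)
    ... | J , m , inj₂ _ | J' , m' , inj₁ (_ , e') = ⊥-elim (t≢ e')
    ... | J , m , inj₂ (i , refl) | J' , m' , inj₂ (i' , refl) = linear (length l ∷ []) (κ 1 ⊕ # 0) (κ 1 ⊕ κ 1) (# 0) (κ 1) (reroute m m' t≢s ch (λ z → linear (cnt z l ∷ ⟦ Off z ⟧ ∷ ⟦ z == i ⟧ ∷ ⟦ z == i' ⟧ ∷ []) (# 0) (# 1) (# 0) (# 1 ⊕ (# 2 ⊕ κ 0 ⊕ (# 3 ⊕ κ 0))) (f z)))

  module Two (k : Config A In x)
             (gap-ok : ∀ h → 1 ≤ cnt h (Config.gap k) → (∃[ pre ] Config.gap k ≡ pre ++ [ h ]) ⊎ (∃[ r ] Config.gap k ≡ h ∷ r)) where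
    open Config k
    open One k
    module Opp = One (opposite k)

    gap-opp : ∀ h → 1 ≤ cnt h (reverse gap) → 1 ≤ cnt h gap
    gap-opp h = subst (1 ≤_) (cnt-reverse h gap)

    not-both : ∀ {h} → h ∈ˢ A → 1 ≤ cnt h gap → ⊥
    not-both p q = t≢f p (gap∉ _ q)

    abstract
      -- Returns to `aₖ` and to the first vertex of the gap are treated in the opposite direction,
      -- where `aₖ` starts the cycle and that vertex comes last.
      iso-single : ∀ b → b ∈ˢ In → b ∉ˢ A → cnt b gap ≡ 0 → Iso b
      iso-single b b∈ b∉ b0 v e = ¬f⇒t λ v∉ → go v∉ (exit b v e)
        where
        go : v ∉ˢ A → Exit b v → ⊥
        go v∉ X = cases (h ≟ aₖ) (1 ≤? cnt h gap) (place b b∈) (Opp.place b b∈)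
          where
          open Exit X
          pos : h ∈ˢ A → 1 ≤ length P
          pos h∈A = [ (λ { (_ , refl) → ⊥-elim (t≢f h∈A v∉) }) , (λ y → y) ]′ ends
          cases : Dec (h ≡ aₖ) → Dec (1 ≤ cnt h gap) → Place b → Opp.Place b → ⊥
          cases _ _ (onA b∈A _ _) _ = t≢f b∈A b∉
          cases _ _ (inGap _ g) _ = 1≰0 (≤-trans g (≤-reflexive b0))
          cases _ _ _ (Opp.onA b∈A _ _) = t≢f b∈A b∉
          cases _ _ _ (Opp.inGap _ g) = 1≰0 (≤-trans (gap-opp b g) (≤-reflexive b0))
          cases (yes e) _ _ (Opp.single _ m _) = Opp.single-exit m path P⊑ h∈ h≢ pos
            (λ q → ⊥-elim (a₁≢aₖ (trans (sym (trans q (opposite-aₖ k))) e)))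
            (λ g → ⊥-elim (not-both (subst (_∈ˢ A) (sym e) aₖ∈) (gap-opp h g)))
          cases (no h≢aₖ) (no ¬g) (single _ m _) _ = single-exit m path P⊑ h∈ h≢ pos (λ q → ⊥-elim (h≢aₖ q)) (λ g → ⊥-elim (¬g g))
          cases (no h≢aₖ) (yes g) (single _ m _) (Opp.single _ m' _) with gap-ok h g
          ... | inj₁ x = single-exit m path P⊑ h∈ h≢ pos (λ q → ⊥-elim (h≢aₖ q)) (λ _ → x)
          ... | inj₂ (r , e) = Opp.single-exit m' path P⊑ h∈ h≢ pos (λ q → ⊥-elim (not-both (subst (_∈ˢ A) (sym (trans q (opposite-aₖ k))) a₁∈) g))
                  (λ _ → reverse r , trans (cong reverse e) (unfold-reverse h r))

      iso-x : Iso x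
      iso-x v e = ¬f⇒t λ v∉ → go v∉ (exit x v e)
        where
        go : v ∉ˢ A → Exit x v → ⊥
        go v∉ X = cases (h ≟ aₖ) (1 ≤? cnt h gap)
          where
          open Exit X
          h∈In : h ∈ˢ In
          h∈In = [ (λ y → y) , (λ y → ⊥-elim (h≢ (==⇒≡ y))) ]′ (∨-e {In h} h∈)
          pos : 1 ≤ length P
          pos = [ (λ { (_ , refl) → ⊥-elim (t≢f (x-In v h∈In e) v∉) }) , (λ y → y) ]′ ends
          cases : Dec (h ≡ aₖ) → Dec (1 ≤ cnt h gap) → ⊥
          cases (yes e) _ = Opp.x-exit path P⊑ h∈In pos (λ q → a₁≢aₖ (trans (sym (trans q (opposite-aₖ k))) e))
                              (λ g → ⊥-elim (not-both (subst (_∈ˢ A) (sym e) aₖ∈) (gap-opp h g)))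
          cases (no h≢aₖ) (no ¬g) = x-exit path P⊑ h∈In pos h≢aₖ (λ g → ⊥-elim (¬g g))
          cases (no h≢aₖ) (yes g) with gap-ok h g
          ... | inj₂ y = x-exit path P⊑ h∈In pos h≢aₖ (λ _ → y)
          ... | inj₁ (pre , e) = Opp.x-exit path P⊑ h∈In pos (λ q → not-both (subst (_∈ˢ A) (sym (trans q (opposite-aₖ k))) a₁∈) g)
                  (λ _ → reverse pre , trans (cong reverse e) (reverse-++ pre [ h ]))

    interior : ∀ {s t} l → Ch ad s l t → 2 ≤ length l → l ⊑ Q → ∀ z → 1 ≤ cnt z l → ∃[ v ] (ad z v ≡ true × v ∉ˢ A)
    interior l ch two m z z∈ with cnt-∈ z l z∈
    ... | l₁ , v ∷ l₂ , refl = v , proj₁ (proj₂ (Ch-split ad l₁ ch)) , not-e (⊑-∈ m (≤-trans (cnt-mid v (l₁ ++ [ z ]) l₂) (≤-reflexive (cong (cnt v) (++-assoc l₁ [ z ] (v ∷ l₂))))))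
    ... | l₁ , [] , refl with reverse l₁ in eq | Ch-reverse ad ad-sym l₁ (proj₁ (Ch-split ad l₁ ch))
    ...   | [] | _ = ⊥-elim (1≰0 (linear (length (l₁ ++ [ z ]) ∷ length l₁ ∷ []) (κ 2 ⊕ (# 0 ⊕ # 1)) (# 0 ⊕ (# 1 ⊕ κ 1 ⊕ κ 0)) (κ 1) (κ 0) (two ⊞ ≡≤ (length-++ l₁ {[ z ]}) ⊞ ≡≤ (trans (sym (length-reverse l₁)) (cong length eq)))))
    ...   | v ∷ r | c' = v , proj₁ c' , not-e (⊑-∈ {S = Q} {z = v} m (linear (⟦ v == v ⟧ ∷ cnt v r ∷ cnt v l₁ ∷ ⟦ v == z ⟧ ∷ cnt v (l₁ ++ [ z ]) ∷ []) (κ 1 ⊕ (# 0 ⊕ # 1 ⊕ (# 2 ⊕ (# 3 ⊕ κ 0)))) (# 0 ⊕ # 1 ⊕ (# 2 ⊕ # 4)) (κ 1) (# 4) (cnt-mid v [] r ⊞ ≡≤ (trans (sym (cong (cnt v) eq)) (cnt-reverse v l₁)) ⊞ ≡≥ (cnt-++ v l₁ [ z ]))))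

    abstract
      -- Each vertex of such an ear has a neighbour outside `A`. By `iso-x` and `iso-single` it is
      -- therefore neither `x` nor on the cycle outside the gap.
      ear-cond : ∀ {s t} l → Ch ad s l t → 2 ≤ length l → l ⊑ Q → Cond l
      ear-cond l ch two m z with 1 ≤? cnt z l
      ... | no z∉ = ≤-trans (≤-pred (≰⇒> z∉)) z≤n
      ... | yes z∈ with interior l ch two m z z∈
      ...   | v , e , v∉ = ≤-trans (≤-trans (⊑-e m z) (⟦⟧≤1 (Q z))) (free (true⊎false (In z)))
        where
        z∉A : z ∉ˢ A
        z∉A = not-e (⊑-∈ m z∈)
        z≢x : z ≢ x
        z≢x refl = t≢f (iso-x v e) v∉
        free : In z ≡ true ⊎ In z ≡ false → 1 ≤ ⟦ Off z ⟧ + cnt z gap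
        free (inj₂ z∉In) = ≤-trans (≤-reflexive (sym (⟦⟧-true (∖-i {S = λ z → not (In z)} (not-i z∉In) z≢x)))) (m≤m+n _ _)
        free (inj₁ z∈In) with 1 ≤? cnt z gap
        ... | yes g = ≤-trans g (m≤n+m _ _)
        ... | no ¬g = ⊥-elim (t≢f (iso-single z z∈In z∉A (n≤0⇒n≡0 (≤-pred (≰⇒> ¬g))) v e) v∉)

    len-start : ∀ {l t} → t ∈ˢ A → t ≢ a₁ → Ch ad a₁ l t → Cond l → length l ≤ length gap
    len-start {l} {t} t∈ t≢ ch f = ≤-trans (Opp.len-end t∈ (λ q → t≢ (trans q (opposite-aₖ k))) (subst (λ y → Ch ad y l t) (sym (opposite-aₖ k)) ch)
      (λ z → ≤-trans (f z) (≤-reflexive (cong (⟦ Off z ⟧ +_) (sym (cnt-reverse z gap)))))) (≤-reflexive (length-reverse gap))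

    len-mid' : ∀ {s l t} → s ∈ˢ A → t ∈ˢ A → t ≢ s → s ≢ a₁ → t ≢ a₁ → Ch ad s l t → (∀ z → cnt z l ≤ ⟦ Off z ⟧) → length l ≤ 1
    len-mid' s∈ t∈ t≢s s≢ t≢ = Opp.len-mid s∈ t∈ t≢s (λ q → s≢ (trans q (opposite-aₖ k))) (λ q → t≢ (trans q (opposite-aₖ k)))

    cnt-ear : ∀ (z u v : V) l₁ l₂ → cnt z (reverse l₁ ++ u ∷ v ∷ l₂) ≡ ⟦ z == v ⟧ + (⟦ z == u ⟧ + (cnt z l₁ + cnt z l₂))
    cnt-ear z u v l₁ l₂ = trans (trans (cnt-++ z (reverse l₁) (u ∷ v ∷ l₂)) (cong (_+ _) (cnt-reverse z l₁)))
      (≤-antisym (linear (cnt z l₁ ∷ ⟦ z == u ⟧ ∷ ⟦ z == v ⟧ ∷ cnt z l₂ ∷ []) (κ 0) (κ 0) (# 0 ⊕ (# 1 ⊕ (# 2 ⊕ # 3))) (# 2 ⊕ (# 1 ⊕ (# 0 ⊕ # 3))) (z≤n {0})) (linear (⟦ z == v ⟧ ∷ ⟦ z == u ⟧ ∷ cnt z l₁ ∷ cnt z l₂ ∷ []) (κ 0) (κ 0) (# 0 ⊕ (# 1 ⊕ (# 2 ⊕ # 3))) (# 2 ⊕ (# 1 ⊕ (# 0 ⊕ # 3))) (z≤n {0})))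

    abstract
      ear-path : ∀ {u v} → ad u v ≡ true → u ∉ˢ A → v ∉ˢ A → ∃[ s ] ∃[ t ] ∃[ l₁ ] ∃[ l₂ ]
                 (s ∈ˢ A × t ∈ˢ A × s ≢ t × Ch ad u l₁ s × Ch ad v l₂ t × Ch ad s (reverse l₁ ++ u ∷ v ∷ l₂) t × (reverse l₁ ++ u ∷ v ∷ l₂) ⊑ Q)
      ear-path {u} {v} e u∉ v∉ = s₁ , s₂ , l₁ , l₂ , s₁∈ , s₂∈ , apart , path₁ , path₂ ,
          Ch-++ ad (reverse l₁) (Ch-reverse ad ad-sym l₁ path₁) (e , path₂) , ⊑-i sound
        where
        open Ear (menger u v u∉ v∉ e)
        sound : ∀ z → cnt z (reverse l₁ ++ u ∷ v ∷ l₂) ≤ ⟦ Q z ⟧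
        sound z = ≤-trans (≤-reflexive (cnt-ear z u v l₁ l₂))
          (undrop Q v z {⟦ z == u ⟧ + (cnt z l₁ + cnt z l₂)} (not-i v∉) (undrop (Q ∖ v) u z (∖-i {S = Q} (not-i u∉) (ad≢ e)) (disj z)))
          where open Menger ad ad-sym ad-irr A reach using (undrop)

  module Even (k : Config A In x) (i : V) (gap≡ : Config.gap k ≡ [ i ]) where
    open Config k
    open One k
    private
      gap-ok : ∀ h → 1 ≤ cnt h gap → (∃[ pre ] gap ≡ pre ++ [ h ]) ⊎ (∃[ r ] gap ≡ h ∷ r)
      gap-ok h g = inj₁ ([] , trans gap≡ (cong [_] (sym (cnt-[] (subst (λ l → 1 ≤ cnt h l) gap≡ g)))))
    open Two k gap-ok

    iso-gap : Iso i
    iso-gap v e = ¬f⇒t λ v∉ → go v∉ (exit i v e)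
      where
      go : v ∉ˢ A → Exit i v → ⊥
      go v∉ X = single-exit (subst (λ g → (aₖ , g) ∈ bs) gap≡ last-block) path P⊑ h∈ h≢
          (λ h∈A → [ (λ { (_ , refl) → ⊥-elim (t≢f h∈A v∉) }) , (λ y → y) ]′ ends) (λ _ → refl)
          (λ g → ⊥-elim (h≢ (cnt-[] (subst (λ l → 1 ≤ cnt h l) gap≡ g))))
        where open Exit X

    abstract
      -- An edge would lie on an ear with at least two interior vertices, all off the cycle, whereas
      -- between two blocks with runs of length one `reroute` allows a single one.
      independent : ∀ u v → u ∉ˢ A → v ∉ˢ A → ad u v ≡ true → ⊥
      independent u v u∉ v∉ e with ear-path e u∉ v∉
      ... | s , t , l₁ , l₂ , s∈ , t∈ , s≢t , _ , _ , ch , m = go (locate s s∈ (A⊆In s s∈)) (locate t t∈ (A⊆In t t∈))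
        where
        l : List V
        l = reverse l₁ ++ u ∷ v ∷ l₂
        two : 2 ≤ length l
        two = linear (length (reverse l₁) ∷ length l₂ ∷ length (reverse l₁ ++ u ∷ v ∷ l₂) ∷ []) (# 0 ⊕ (κ 2 ⊕ # 1)) (# 2) (κ 2) (# 2) (≡≥ (length-++ (reverse l₁) {u ∷ v ∷ l₂}))
        f : ∀ z → cnt z l ≤ ⟦ Off z ⟧
        f z with 1 ≤? cnt z gap
        ... | no ¬g = linear (cnt z l ∷ cnt z gap ∷ ⟦ Off z ⟧ ∷ []) (# 0 ⊕ # 1) (# 2 ⊕ # 1 ⊕ κ 0) (# 0) (# 2) (ear-cond l ch two m z ⊞ ≤-pred (≰⇒> ¬g))
        ... | yes g with 1 ≤? cnt z l
        ...   | no z∉ = ≤-trans (≤-pred (≰⇒> z∉)) z≤n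
        ...   | yes z∈ with interior l ch two m z z∈
        ...     | w , ezw , w∉ = ⊥-elim (t≢f (iso-gap w (subst (λ y → ad y w ≡ true) (cnt-[] (subst (λ l → 1 ≤ cnt z l) gap≡ g)) ezw)) w∉)
        one : ∀ {J : List V} {y : V} → (J ≡ gap × y ≡ aₖ) ⊎ (∃[ i ] J ≡ [ i ]) → length J ≡ 1
        one (inj₁ (p , _)) = trans (cong length p) (cong length gap≡)
        one (inj₂ (_ , p)) = cong length p
        go : Located s → Located t → ⊥
        go (J , m₁ , e₁) (J' , m₂ , e₂) = 1≰0 (linear (length (reverse l₁ ++ u ∷ v ∷ l₂) ∷ length J ∷ length J' ∷ []) (κ 1 ⊕ # 0 ⊕ (κ 2 ⊕ (# 1 ⊕ # 2))) (# 1 ⊕ # 2 ⊕ (# 0 ⊕ (κ 1 ⊕ κ 1))) (κ 1) (κ 0) (reroute m₁ m₂ (λ q → s≢t (sym q)) ch (λ z → ≤-trans (f z) (m≤m+n _ _)) ⊞ two ⊞ ≡≤ (one e₁) ⊞ ≡≤ (one e₂)))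

  module Odd (k : Config A In x) (p q : V) (gap≡ : Config.gap k ≡ p ∷ q ∷ []) where
    open Config k
    open One k
    private
      gap-cnt : ∀ {h} → 1 ≤ cnt h gap → h ≡ p ⊎ h ≡ q
      gap-cnt {h} g with true⊎false (h == p)
      ... | inj₁ e = inj₁ (==⇒≡ e)
      ... | inj₂ e = inj₂ (cnt-[] (≤-trans (subst (λ l → 1 ≤ cnt h l) gap≡ g) (≤-reflexive (cong (λ b → ⟦ b ⟧ + cnt h [ q ]) e))))
      gap-ok : ∀ h → 1 ≤ cnt h gap → (∃[ pre ] gap ≡ pre ++ [ h ]) ⊎ (∃[ r ] gap ≡ h ∷ r)
      gap-ok h g with gap-cnt g
      ... | inj₁ refl = inj₂ ([ q ] , gap≡)
      ... | inj₂ refl = inj₁ ([ p ] , gap≡)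
    open Two k gap-ok

    aₖ~p : ad aₖ p ≡ true
    aₖ~p = let B , _ , _ , r = front-first last-block in proj₁ (subst (λ g → Ch ad aₖ (g ++ flat B) aₖ) gap≡ (closed-walk r))

    p~q~a₁ : ad p q ≡ true × ad q a₁ ≡ true
    p~q~a₁ = proj₂ (Ch-split ad (flat₂ steps) (subst (λ g → Ch ad a₁ (flat₂ steps ++ g) a₁) gap≡ (closed-walk cycle)))

    p∈gap : 1 ≤ cnt p gap
    p∈gap = subst (λ g → 1 ≤ cnt p g) (sym gap≡) (cnt-mid p [] [ q ])

    q∈gap : 1 ≤ cnt q gap
    q∈gap = subst (λ g → 1 ≤ cnt q g) (sym gap≡) (cnt-mid q [ p ] [])

    |gap| : length gap ≡ 2
    |gap| = cong length gap≡

    p∉A : p ∉ˢ A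
    p∉A = gap∉ p p∈gap

    q∉A : q ∉ˢ A
    q∉A = gap∉ q q∈gap

    module Through (aP aQ p q : V) (ap : ad aP p ≡ true) (pq : ad p q ≡ true) (aq : ad aQ q ≡ true) (q∈ : 1 ≤ cnt q gap)
                   (lenP : ∀ {l t} → t ∈ˢ A → t ≢ aP → Ch ad aP l t → Cond l → length l ≤ length gap)
                   (lenQ : ∀ {l t} → t ∈ˢ A → t ≢ aQ → Ch ad aQ l t → Cond l → length l ≤ length gap) where
      cond-q : ∀ {l} → cnt q l ≡ 0 → Cond (p ∷ l) → Cond (q ∷ p ∷ l)
      cond-q {l} h f z with true⊎false (z == q)
      ... | inj₂ e = ≤-trans (≤-reflexive (cong (λ b → ⟦ b ⟧ + cnt z (p ∷ l)) e)) (f z)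
      ... | inj₁ e rewrite ==⇒≡ e = linear (cnt q l ∷ ⟦ q == p ⟧ ∷ ⟦ q == q ⟧ ∷ cnt q gap ∷ ⟦ not (In q) ∧ not (q == x) ⟧ ∷ []) (# 0 ⊕ (# 1 ⊕ (# 2 ⊕ κ 1))) (κ 0 ⊕ (κ 0 ⊕ (κ 1 ⊕ # 3))) (# 2 ⊕ (# 1 ⊕ # 0)) (# 4 ⊕ # 3) (≡≤ h ⊞ ≡≤ (⟦⟧-false (≢⇒==f (λ x → ad≢ pq (sym x)))) ⊞ ⟦⟧≤1 (q == q) ⊞ q∈)

      module _ {t} (l : List V) (t∈ : t ∈ˢ A) (t≢P : t ≢ aP) (t≢Q : t ≢ aQ) (ch : Ch ad p l t) (f : Cond (p ∷ l)) where
        tail≤1 : length l ≤ 1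
        tail≤1 = linear (length l ∷ length gap ∷ []) (κ 1 ⊕ # 0 ⊕ # 1) (# 1 ⊕ κ 2) (# 0) (κ 1) (lenP t∈ t≢P (ap , ch) f ⊞ ≡≤ |gap|)
        tail≤0 : cnt q l ≡ 0 → length l ≤ 0
        tail≤0 h = linear (length l ∷ length gap ∷ []) (κ 2 ⊕ # 0 ⊕ # 1) (# 1 ⊕ κ 2) (# 0) (κ 0) (lenQ {q ∷ p ∷ l} t∈ t≢Q (aq , ad-sym pq , ch) (cond-q {l} h f) ⊞ ≡≤ |gap|)

      -- Each half of the path, seen from `p`, continues a path from `aP` by `p`, so it has at most
      -- one vertex; a half without `q` also continues a path from `aQ` by `q` and `p`, so it has
      -- none. At most one half contains `q`.
      two-at-most : ∀ {s t} l₁ l₂ → s ∈ˢ A → t ∈ˢ A → s ≢ aP → s ≢ aQ → t ≢ aP → t ≢ aQ →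
                    Ch ad s (l₁ ++ p ∷ l₂) t → Cond (l₁ ++ p ∷ l₂) → Simple (l₁ ++ p ∷ l₂) → length (l₁ ++ p ∷ l₂) ≤ 2
      two-at-most l₁ l₂ s∈ t∈ sP sQ tP tQ ch f sm = go (1 ≤? cnt q l₂)
        where
        c₁ : Ch ad p (reverse l₁) _
        c₁ = Ch-reverse ad ad-sym l₁ (proj₁ (Ch-split ad l₁ ch))
        c₂ : Ch ad p l₂ _
        c₂ = proj₂ (Ch-split ad l₁ ch)
        f₁ : Cond (p ∷ reverse l₁)
        f₁ z = linear (cnt z (l₁ ++ p ∷ l₂) ∷ cnt z l₁ ∷ ⟦ z == p ⟧ ∷ cnt z l₂ ∷ cnt z (reverse l₁) ∷ ⟦ Off z ⟧ ∷ cnt z gap ∷ []) (# 0 ⊕ (# 1 ⊕ (# 2 ⊕ # 3) ⊕ # 4)) (# 5 ⊕ # 6 ⊕ (# 0 ⊕ # 1)) (# 2 ⊕ # 4) (# 5 ⊕ # 6) (f z ⊞ ≡≥ (cnt-++ z l₁ (p ∷ l₂)) ⊞ ≡≤ (cnt-reverse z l₁))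
        f₂ : Cond (p ∷ l₂)
        f₂ z = linear (cnt z (l₁ ++ p ∷ l₂) ∷ cnt z l₁ ∷ ⟦ z == p ⟧ ∷ cnt z l₂ ∷ ⟦ Off z ⟧ ∷ cnt z gap ∷ []) (# 0 ⊕ (# 1 ⊕ (# 2 ⊕ # 3))) (# 4 ⊕ # 5 ⊕ # 0) (# 2 ⊕ # 3) (# 4 ⊕ # 5) (f z ⊞ ≡≥ (cnt-++ z l₁ (p ∷ l₂)))
        go : Dec (1 ≤ cnt q l₂) → length (l₁ ++ p ∷ l₂) ≤ 2
        go (no ¬q) = linear (length (l₁ ++ p ∷ l₂) ∷ length l₁ ∷ length (reverse l₁) ∷ length l₂ ∷ []) (# 0 ⊕ (# 1 ⊕ (# 2 ⊕ # 3))) (# 1 ⊕ (κ 1 ⊕ # 3) ⊕ (# 2 ⊕ (κ 1 ⊕ κ 0))) (# 0) (κ 2) (≡≤ (length-++ l₁ {p ∷ l₂}) ⊞ ≡≥ (length-reverse l₁) ⊞ tail≤1 (reverse l₁) s∈ sP sQ c₁ f₁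
                         ⊞ tail≤0 l₂ t∈ tP tQ c₂ f₂ (n≤0⇒n≡0 (≤-pred (≰⇒> ¬q))))
        go (yes y) = linear (length (l₁ ++ p ∷ l₂) ∷ length l₁ ∷ length l₂ ∷ length (reverse l₁) ∷ []) (# 0 ⊕ (# 1 ⊕ (# 2 ⊕ # 3))) (# 1 ⊕ (κ 1 ⊕ # 2) ⊕ (# 3 ⊕ (κ 1 ⊕ κ 0))) (# 0) (κ 2) (≡≤ (length-++ l₁ {p ∷ l₂}) ⊞ ≡≥ (length-reverse l₁) ⊞ tail≤1 l₂ t∈ tP tQ c₂ f₂ ⊞ tail≤0 (reverse l₁) s∈ sP sQ c₁ f₁ none)
          where
          none : cnt q (reverse l₁) ≡ 0
          none = n≤0⇒n≡0 (linear (cnt q (reverse l₁) ∷ cnt q (l₁ ++ p ∷ l₂) ∷ cnt q l₁ ∷ ⟦ q == p ⟧ ∷ cnt q l₂ ∷ []) (# 0 ⊕ (# 1 ⊕ (# 2 ⊕ (# 3 ⊕ # 4) ⊕ κ 1))) (# 2 ⊕ (κ 1 ⊕ (# 1 ⊕ # 4))) (# 0) (κ 0) (≡≤ (cnt-reverse q l₁) ⊞ sm q ⊞ ≡≥ (cnt-++ q l₁ (p ∷ l₂)) ⊞ y))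

    abstract
      -- An ear at `a₁` or `aₖ` can replace the gap. Any other ear meets `p` or `q` and is split
      -- there, or avoids the gap and obeys `len-mid`.
      short : ∀ {s t} l → s ∈ˢ A → t ∈ˢ A → s ≢ t → Ch ad s l t → l ⊑ Q → 2 ≤ length l → length l ≤ 2
      short {s} {t} l s∈ t∈ s≢t ch m two = go (s ≟ aₖ) (t ≟ aₖ) (s ≟ a₁) (t ≟ a₁) (1 ≤? cnt p l) (1 ≤? cnt q l)
        where
        f : Cond l
        f = ear-cond l ch two m
        fr : Cond (reverse l)
        fr z = ≤-trans (≤-reflexive (cnt-reverse z l)) (f z)
        sm : Simple l
        sm z = ≤-trans (⊑-e m z) (⟦⟧≤1 (Q z))
        module Thr = Through aₖ a₁ p q aₖ~p (proj₁ p~q~a₁) (ad-sym (proj₂ p~q~a₁)) q∈gap len-end len-start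
        module Thr' = Through a₁ aₖ q p (ad-sym (proj₂ p~q~a₁)) (ad-sym (proj₁ p~q~a₁)) aₖ~p p∈gap len-start len-end
        go : Dec (s ≡ aₖ) → Dec (t ≡ aₖ) → Dec (s ≡ a₁) → Dec (t ≡ a₁) → Dec (1 ≤ cnt p l) → Dec (1 ≤ cnt q l) → length l ≤ 2
        go (yes e) _ _ _ _ _ = ≤-trans (len-end t∈ (λ y → s≢t (trans e (sym y))) (subst (λ y → Ch ad y l t) e ch) f) (≤-reflexive |gap|)
        go _ (yes e) _ _ _ _ = ≤-trans (≤-reflexive (sym (length-reverse l))) (≤-trans
              (len-end s∈ (λ y → s≢t (trans y (sym e))) (subst (λ y → Ch ad y (reverse l) s) e (Ch-reverse ad ad-sym l ch)) fr) (≤-reflexive |gap|))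
        go _ _ (yes e) _ _ _ = ≤-trans (len-start t∈ (λ y → s≢t (trans e (sym y))) (subst (λ y → Ch ad y l t) e ch) f) (≤-reflexive |gap|)
        go _ _ _ (yes e) _ _ = ≤-trans (≤-reflexive (sym (length-reverse l))) (≤-trans
              (len-start s∈ (λ y → s≢t (trans y (sym e))) (subst (λ y → Ch ad y (reverse l) s) e (Ch-reverse ad ad-sym l ch)) fr) (≤-reflexive |gap|))
        go (no sk) (no tk) (no s1) (no t1) (yes y) _ with cnt-∈ p l y
        ... | l₁ , l₂ , e = subst (λ l → length l ≤ 2) (sym e) (Thr.two-at-most l₁ l₂ s∈ t∈ sk s1 tk t1
                (subst (λ l → Ch ad s l t) e ch) (subst Cond e f) (subst Simple e sm))
        go (no sk) (no tk) (no s1) (no t1) (no _) (yes y) with cnt-∈ q l y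
        ... | l₁ , l₂ , e = subst (λ l → length l ≤ 2) (sym e) (Thr'.two-at-most l₁ l₂ s∈ t∈ s1 sk t1 tk
                (subst (λ l → Ch ad s l t) e ch) (subst Cond e f) (subst Simple e sm))
        go (no sk) (no tk) (no s1) (no t1) (no ¬p) (no ¬q) = ≤-trans (len-mid s∈ t∈ (λ y → s≢t (sym y)) sk tk ch g) (s≤s z≤n)
          where
          g : ∀ z → cnt z l ≤ ⟦ Off z ⟧
          g z with 1 ≤? cnt z gap
          ... | no ¬g = linear (cnt z l ∷ cnt z gap ∷ ⟦ Off z ⟧ ∷ []) (# 0 ⊕ # 1) (# 2 ⊕ # 1 ⊕ κ 0) (# 0) (# 2) (f z ⊞ ≤-pred (≰⇒> ¬g))
          ... | yes y with gap-cnt y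
          ...   | inj₁ refl = ≤-trans (≤-pred (≰⇒> ¬p)) z≤n
          ...   | inj₂ refl = ≤-trans (≤-pred (≰⇒> ¬q)) z≤n

      -- The ear through the edge has at most two interior vertices, which are then `u` and `v`.
      attached : ∀ {u v} → u ∉ˢ A → v ∉ˢ A → ad u v ≡ true → ∃[ s ] ∃[ t ] (s ∈ˢ A × t ∈ˢ A × s ≢ t × ad u s ≡ true × ad v t ≡ true)
      attached {u} {v} u∉ v∉ e with ear-path e u∉ v∉
      ... | s , t , l₁ , l₂ , s∈ , t∈ , s≢t , c₁ , c₂ , ch , m = s , t , s∈ , t∈ , s≢t , direct l₁ c₁ (linear (length l₁ ∷ length l₂ ∷ []) (# 0 ⊕ (κ 2 ⊕ # 1)) (κ 2) (# 0) (κ 0) bound) , direct l₂ c₂ (linear (length l₁ ∷ length l₂ ∷ []) (# 0 ⊕ (κ 2 ⊕ # 1)) (κ 2) (# 1) (κ 0) bound)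
        where
        two : 2 ≤ length (reverse l₁ ++ u ∷ v ∷ l₂)
        two = linear (length (reverse l₁) ∷ length l₂ ∷ length (reverse l₁ ++ u ∷ v ∷ l₂) ∷ []) (# 0 ⊕ (κ 2 ⊕ # 1)) (# 2) (κ 2) (# 2) (≡≥ (length-++ (reverse l₁) {u ∷ v ∷ l₂}))
        bound : length l₁ + (2 + length l₂) ≤ 2
        bound = ≤-trans (≤-reflexive (sym (trans (length-++ (reverse l₁) {u ∷ v ∷ l₂}) (cong (_+ (2 + length l₂)) (length-reverse l₁)))))
                        (short (reverse l₁ ++ u ∷ v ∷ l₂) s∈ t∈ s≢t ch m two)
        direct : ∀ {y z} l → Ch ad y l z → length l ≤ 0 → ad y z ≡ true
        direct [] c _ = c

      no-long : ∀ {s t} u l v → s ∈ˢ A → t ∈ˢ A → ad s u ≡ true → Ch ad u l v → ad v t ≡ true → (u ∷ l ++ [ v ]) ⊑ Q → 1 ≤ length l → s ≡ t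
      no-long {s} {t} u l v s∈ t∈ su ch vt m pos with s ≟ t
      ... | yes e = e
      ... | no s≢t = ⊥-elim (1≰0 (linear (length (l ++ [ v ]) ∷ length l ∷ []) (κ 1 ⊕ # 0 ⊕ (κ 1 ⊕ (# 1 ⊕ κ 1))) (κ 2 ⊕ (# 1 ⊕ # 0)) (κ 1) (κ 0) (short (u ∷ l ++ [ v ]) s∈ t∈ s≢t (su , Ch-++ ad l ch vt) m two ⊞ pos ⊞ ≡≥ (length-++ l {[ v ]}))))
        where
        two : 2 ≤ length (u ∷ l ++ [ v ])
        two = linear (length l ∷ length (l ++ [ v ]) ∷ []) (# 0 ⊕ κ 1) (# 1) (κ 2) (κ 1 ⊕ # 1) (≡≥ (length-++ l {[ v ]}))

      -- By `len-mid` in both directions, one end must be `aₖ` and one must be `a₁`.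
      ends-of : ∀ {s t u v} → s ∈ˢ A → t ∈ˢ A → s ≢ t → u ∉ˢ A → v ∉ˢ A → u ≢ v → cnt u gap ≡ 0 → cnt v gap ≡ 0 →
                ad u s ≡ true → ad u v ≡ true → ad v t ≡ true → (s ≡ aₖ × t ≡ a₁) ⊎ (s ≡ a₁ × t ≡ aₖ)
      ends-of {s} {t} {u} {v} s∈ t∈ s≢t u∉ v∉ u≢v u0 v0 us uv vt = go (s ≟ aₖ) (t ≟ aₖ) (s ≟ a₁) (t ≟ a₁)
        where
        l : List V
        l = u ∷ v ∷ []
        ch : Ch ad s l t
        ch = ad-sym us , uv , vt
        m : l ⊑ Q
        m = ⊑-∷ (not-i u∉) (⊑-∷ (∖-i {S = Q} (not-i v∉) (λ e → u≢v (sym e))) ⊑-[])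
        f : ∀ z → cnt z l ≤ ⟦ Off z ⟧
        f z with true⊎false (z == u) | true⊎false (z == v)
        ... | inj₁ e | _ rewrite ==⇒≡ e = linear (⟦ u == u ⟧ ∷ ⟦ u == v ⟧ ∷ cnt u gap ∷ ⟦ Off u ⟧ ∷ []) (# 0 ⊕ (# 1 ⊕ κ 0) ⊕ # 2) (# 3 ⊕ # 2 ⊕ κ 0) (# 0 ⊕ (# 1 ⊕ κ 0)) (# 3) (ear-cond l ch (s≤s (s≤s z≤n)) m u ⊞ ≡≤ u0)
        ... | inj₂ _ | inj₁ e rewrite ==⇒≡ e = linear (⟦ v == u ⟧ ∷ ⟦ v == v ⟧ ∷ cnt v gap ∷ ⟦ Off v ⟧ ∷ []) (# 0 ⊕ (# 1 ⊕ κ 0) ⊕ # 2) (# 3 ⊕ # 2 ⊕ κ 0) (# 0 ⊕ (# 1 ⊕ κ 0)) (# 3) (ear-cond l ch (s≤s (s≤s z≤n)) m v ⊞ ≡≤ v0)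
        ... | inj₂ e | inj₂ e' rewrite e | e' = z≤n
        go : Dec (s ≡ aₖ) → Dec (t ≡ aₖ) → Dec (s ≡ a₁) → Dec (t ≡ a₁) → (s ≡ aₖ × t ≡ a₁) ⊎ (s ≡ a₁ × t ≡ aₖ)
        go (yes a) _ _ (yes b) = inj₁ (a , b)
        go _ (yes a) (yes b) _ = inj₂ (b , a)
        go (yes a) (yes b) _ _ = ⊥-elim (s≢t (trans a (sym b)))
        go _ _ (yes a) (yes b) = ⊥-elim (s≢t (trans a (sym b)))
        go (yes a) _ (yes b) _ = ⊥-elim (a₁≢aₖ (trans (sym b) a))
        go _ (yes a) _ (yes b) = ⊥-elim (a₁≢aₖ (trans (sym b) a))
        go (no a) (no b) _ _ = ⊥-elim (1≰0 (linear [] (κ 2) (κ 1) (κ 1) (κ 0) (len-mid s∈ t∈ (λ e → s≢t (sym e)) a b ch f)))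
        go _ _ (no a) (no b) = ⊥-elim (1≰0 (linear [] (κ 2) (κ 1) (κ 1) (κ 0) (len-mid' s∈ t∈ (λ e → s≢t (sym e)) a b ch f)))

    not-gap : ∀ {u} → u ≢ p → u ≢ q → cnt u gap ≡ 0
    not-gap {u} u≢p u≢q = trans (cong (cnt u) gap≡) (cong₂ (λ b b' → ⟦ b ⟧ + (⟦ b' ⟧ + 0)) (≢⇒==f u≢p) (≢⇒==f u≢q))

    abstract
      facts : OddFacts G A In x a₁ aₖ p q
      facts = record
        { isolated = λ b b∈ b∉ b≢p b≢q → iso-single b b∈ b∉ (not-gap b≢p b≢q)
        ; isolated-x = iso-x
        ; p∉A = p∉A ; q∉A = q∉A ; a₁∈A = a₁∈ ; aₖ∈A = aₖ∈
        ; p~q = proj₁ p~q~a₁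
        ; attached = attached
        ; no-long = no-long
        ; ends-of = λ s∈ t∈ s≢t u∉ v∉ up uq vp vq us uv vt → ends-of s∈ t∈ s≢t u∉ v∉ (ad≢ uv) (not-gap up uq) (not-gap vp vq) us uv vt }

-- Embedding into W

module Ranking {n} (A B : BSet n) (A⊆B : ∀ z → z ∈ˢ A → z ∈ˢ B) where
  class : Bool → Bool → ℕ
  class true  _     = 0
  class false true  = n
  class false false = n + n

  -- Sorts the vertices into `A`, the rest of `B`, and the others. The rank in this order is a
  -- permutation that takes `A` and `B` to initial segments.
  key : Fin n → ℕ
  key z = class (A z) (B z) + toℕ z

  key-A : ∀ u → key u < n → u ∈ˢ A
  key-A u h with A u | B u
  ... | true  | _ = refl
  ... | false | true = ⊥-elim (1≰0 (linear (class false true ∷ toℕ u ∷ []) (κ 1 ⊕ (# 0 ⊕ # 1)) (# 0) (κ 1) (κ 0) h))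
  ... | false | false = ⊥-elim (1≰0 (linear (n ∷ toℕ u ∷ []) (κ 1 ⊕ (# 0 ⊕ # 0 ⊕ # 1) ⊕ κ 0) (# 0 ⊕ # 0) (κ 1) (κ 0) (h ⊞ z≤n {n})))

  key-B : ∀ u → key u < n + n → u ∈ˢ B
  key-B u h with A u in a | B u in b
  ... | true  | true = refl
  ... | true  | false = trans (sym b) (A⊆B u a)
  ... | false | true = refl
  ... | false | false = ⊥-elim (1≰0 (linear (n ∷ toℕ u ∷ []) (κ 1 ⊕ (# 0 ⊕ # 0 ⊕ # 1)) (# 0 ⊕ # 0) (κ 1) (κ 0) h))

  A-key : ∀ {u} → u ∈ˢ A → key u < n
  A-key {u} p rewrite p = toℕ<n u

  B-key : ∀ {u} → u ∈ˢ B → key u < n + n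
  B-key {u} p with A u
  ... | true = ≤-trans (toℕ<n u) (m≤m+n n n)
  ... | false rewrite p = +-monoʳ-< n (toℕ<n u)

  key-inj : ∀ u v → key u ≡ key v → u ≡ v
  key-inj u v e with A u | B u | A v | B v
  ... | true  | _ | true  | _ = toℕ-injective e
  ... | true  | _ | false | true = ⊥-elim (1≰0 (linear (class false true ∷ toℕ v ∷ toℕ u ∷ []) (# 0 ⊕ # 1 ⊕ (κ 1 ⊕ # 2)) (κ 0 ⊕ # 2 ⊕ # 0) (κ 1) (κ 0) (≡≥ e ⊞ toℕ<n u)))
  ... | true  | _ | false | false = ⊥-elim (1≰0 (linear (n ∷ toℕ v ∷ toℕ u ∷ []) (# 0 ⊕ # 0 ⊕ # 1 ⊕ (κ 1 ⊕ # 2 ⊕ κ 0)) (κ 0 ⊕ # 2 ⊕ (# 0 ⊕ # 0)) (κ 1) (κ 0) (≡≥ e ⊞ toℕ<n u ⊞ z≤n {n})))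
  ... | false | true | true | _ = ⊥-elim (1≰0 (linear (class false true ∷ toℕ u ∷ toℕ v ∷ []) (# 0 ⊕ # 1 ⊕ (κ 1 ⊕ # 2)) (κ 0 ⊕ # 2 ⊕ # 0) (κ 1) (κ 0) (≡≤ e ⊞ toℕ<n v)))
  ... | false | false | true | _ = ⊥-elim (1≰0 (linear (n ∷ toℕ u ∷ toℕ v ∷ []) (# 0 ⊕ # 0 ⊕ # 1 ⊕ (κ 1 ⊕ # 2 ⊕ κ 0)) (κ 0 ⊕ # 2 ⊕ (# 0 ⊕ # 0)) (κ 1) (κ 0) (≡≤ e ⊞ toℕ<n v ⊞ z≤n {n})))
  ... | false | true | false | true = toℕ-injective (+-cancelˡ-≡ n _ _ e)
  ... | false | false | false | false = toℕ-injective (+-cancelˡ-≡ (n + n) _ _ e)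
  ... | false | true | false | false = ⊥-elim (1≰0 (linear (n ∷ toℕ v ∷ toℕ u ∷ []) (# 0 ⊕ # 0 ⊕ # 1 ⊕ (κ 1 ⊕ # 2)) (# 0 ⊕ # 2 ⊕ # 0) (κ 1) (κ 0) (≡≥ e ⊞ toℕ<n u)))
  ... | false | false | false | true = ⊥-elim (1≰0 (linear (n ∷ toℕ u ∷ toℕ v ∷ []) (# 0 ⊕ # 0 ⊕ # 1 ⊕ (κ 1 ⊕ # 2)) (# 0 ⊕ # 2 ⊕ # 0) (κ 1) (κ 0) (≡≤ e ⊞ toℕ<n v)))

  below : Fin n → BSet n
  below v u = key u <ᵇ key v

  below-i : ∀ {u v} → key u < key v → u ∈ˢ below v
  below-i h = t (<⇒<ᵇ h)
    where
    t : ∀ {b} → T b → b ≡ true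
    t {true} _ = refl

  below-e : ∀ {u v} → u ∈ˢ below v → key u < key v
  below-e {u} {v} h = <ᵇ⇒< (key u) (key v) (subst T (sym h) tt)

  self∉ : ∀ v → v ∉ˢ below v
  self∉ v = ¬t⇒f λ h → <-irrefl refl (below-e {v} {v} h)

  rank : Fin n → ℕ
  rank v = countB (below v)

  rank< : ∀ v → rank v < n
  rank< v = ≤-trans (countB-< (below v) (λ _ → true) v (λ _ _ → refl) (self∉ v) refl) (≤-reflexive (countB-true n))

  rank-mono : ∀ u v → key u < key v → rank u < rank v
  rank-mono u v h = countB-< (below u) (below v) u (λ z p → below-i {z} {v} (<-trans (below-e {z} {u} p) h)) (self∉ u) (below-i {u} {v} h)

  perm : Fin n → Fin n
  perm v = fromℕ< (rank< v)

  perm-inj : Injective _≡_ _≡_ perm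
  perm-inj {u} {v} e = go (<-cmp (key u) (key v))
    where
    open import Relation.Binary.Definitions using (Tri; tri<; tri≈; tri>)
    same : rank u ≡ rank v
    same = trans (sym (toℕ-fromℕ< (rank< u))) (trans (cong toℕ e) (toℕ-fromℕ< (rank< v)))
    go : Tri (key u < key v) (key u ≡ key v) (key v < key u) → u ≡ v
    go (tri< h _ _) = ⊥-elim (<-irrefl same (rank-mono u v h))
    go (tri≈ _ h _) = key-inj u v h
    go (tri> _ _ h) = ⊥-elim (<-irrefl (sym same) (rank-mono v u h))

  perm-A : ∀ {v} → v ∈ˢ A → toℕ (perm v) < countB A
  perm-A {v} p rewrite toℕ-fromℕ< (rank< v) =
    countB-< (below v) A v (λ z q → key-A z (<-trans (below-e {z} {v} q) (A-key p))) (self∉ v) p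

  perm-B : ∀ {v} → v ∈ˢ B → toℕ (perm v) < countB B
  perm-B {v} p rewrite toℕ-fromℕ< (rank< v) =
    countB-< (below v) B v (λ z q → key-B z (<-trans (below-e {z} {v} q) (B-key p))) (self∉ v) p

-- The first `c ∸ k + 1` indices of the host form its clique, and the first `k` of these are joined
-- to everything; an edge that misses `A` must therefore be inside `B`.
embeds-W : ∀ {n} (G : Graph n) (A B : BSet n) k c → countB A ≡ k → countB B ≤ c ∸ k + 1 → (∀ z → z ∈ˢ A → z ∈ˢ B) →
           (∀ u v → adj G u v ≡ true → u ∉ˢ A → v ∉ˢ A → u ∈ˢ B × v ∈ˢ B) → EmbedsInto G (WAdj n k c)
embeds-W {n} G A B k c |A| |B| A⊆B edges = perm , perm-inj , λ u v e → (λ q → ad≢ e (perm-inj q)) , go u v e (true⊎false (A u)) (true⊎false (A v))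
  where
  open Ranking A B A⊆B
  m : ℕ
  m = c ∸ k + 1
  ad≢ : ∀ {u v} → adj G u v ≡ true → u ≢ v
  ad≢ {u} e refl = t≢f e (irrefl G u)
  A< : ∀ {v} → v ∈ˢ A → toℕ (perm v) < k
  A< p = subst (toℕ (perm _) <_) |A| (perm-A p)
  B< : ∀ {v} → v ∈ˢ B → toℕ (perm v) < m
  B< p = ≤-trans (perm-B p) |B|
  go : ∀ u v → adj G u v ≡ true → A u ≡ true ⊎ A u ≡ false → A v ≡ true ⊎ A v ≡ false →
       (toℕ (perm u) < m × toℕ (perm v) < m) ⊎ (m ≤ toℕ (perm u) × toℕ (perm v) < k) ⊎ (m ≤ toℕ (perm v) × toℕ (perm u) < k)
  go u v e (inj₁ a) _ with m ≤? toℕ (perm v)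
  ... | yes h = inj₂ (inj₂ (h , A< a))
  ... | no h = inj₁ (B< (A⊆B u a) , ≰⇒> h)
  go u v e (inj₂ _) (inj₁ a) with m ≤? toℕ (perm u)
  ... | yes h = inj₂ (inj₁ (h , A< a))
  ... | no h = inj₁ (≰⇒> h , B< (A⊆B v a))
  go u v e (inj₂ a) (inj₂ b) = inj₁ (B< (proj₁ (edges u v e a b)) , B< (proj₂ (edges u v e a b)))

-- Reading the cycle as a configuration

module Parse {n} (G : Graph n) (c : ℕ)
             (longest : ∀ v r → Ch (adj G) v r v → Simple (v ∷ r) → 2 ≤ length r → suc (length r) ≤ c)
             (A In : BSet n) (x : Fin n) (x∉ : x ∉ˢ In) (x-adj : ∀ a → a ∈ˢ A → adj G x a ≡ true) (A⊆In : ∀ z → z ∈ˢ A → z ∈ˢ In)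
             (h : ℕ) (|A| : countB A ≡ h) (2≤h : 2 ≤ h) (c≤ : c ≤ suc (h + h)) where
  open Surgery G c longest

  split : List V → List V × List Block
  split []      = [] , []
  split (w ∷ r) = if A w then ([] , (w , proj₁ (split r)) ∷ proj₂ (split r)) else (w ∷ proj₁ (split r) , proj₂ (split r))

  split-flat : ∀ r → proj₁ (split r) ++ flat (proj₂ (split r)) ≡ r
  split-flat [] = refl
  split-flat (w ∷ r) with A w
  ... | true  = cong (w ∷_) (split-flat r)
  ... | false = cong (w ∷_) (split-flat r)

  Good : Block → Set
  Good (a , J) = a ∈ˢ A × (∀ z → 1 ≤ cnt z J → z ∉ˢ A)

  cons-out : ∀ {w J} → w ∉ˢ A → (∀ z → 1 ≤ cnt z J → z ∉ˢ A) → ∀ z → 1 ≤ cnt z (w ∷ J) → z ∉ˢ A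
  cons-out {w} w∉ f z p with z ≟ w
  ... | yes refl = w∉
  ... | no _ = f z p

  split-good : ∀ r → (∀ z → 1 ≤ cnt z (proj₁ (split r)) → z ∉ˢ A) × (∀ {B} → B ∈ proj₂ (split r) → Good B)
  split-good [] = (λ _ ()) , λ ()
  split-good (w ∷ r) with A w in e | split-good r
  ... | true  | f , g = (λ _ ()) , λ { (here refl) → e , f ; (there m) → g m }
  ... | false | f , g = cons-out {w} {proj₁ (split r)} e f , g

  split-count : ∀ r → length (proj₂ (split r)) ≡ cntB A r
  split-count [] = refl
  split-count (w ∷ r) with A w
  ... | true  = cong suc (split-count r)
  ... | false = split-count r

  runs : List Block → ℕ
  runs []             = 0
  runs ((_ , J) ∷ bs) = length J + runs bs

  runs-flat : ∀ bs → length (flat bs) ≡ length bs + runs bs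
  runs-flat [] = refl
  runs-flat ((a , J) ∷ bs) = ≤-antisym (linear (length (J ++ flat bs) ∷ length (flat bs) ∷ length J ∷ length bs ∷ runs bs ∷ []) (# 0 ⊕ # 1) (# 2 ⊕ # 1 ⊕ (# 3 ⊕ # 4)) (κ 1 ⊕ # 0) (κ 1 ⊕ # 3 ⊕ (# 2 ⊕ # 4)) (≡≤ (length-++ J {flat bs}) ⊞ ≡≤ (runs-flat bs))) (linear (length J ∷ length (flat bs) ∷ length bs ∷ runs bs ∷ length (J ++ flat bs) ∷ []) (# 0 ⊕ # 1 ⊕ (# 2 ⊕ # 3)) (# 4 ⊕ # 1) (κ 1 ⊕ # 2 ⊕ (# 0 ⊕ # 3)) (κ 1 ⊕ # 4) (≡≥ (length-++ J {flat bs}) ⊞ ≡≥ (runs-flat bs)))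

  -- Otherwise `x` could be inserted between `s` and `t`.
  no-two : ∀ {s t R} → s ∈ˢ A → t ∈ˢ A → CycL In (s ∷ t ∷ R) → ⊥
  no-two {s} {t} s∈ t∈ q = 1≰0 (splice {J = []} {l = [ x ]} q (ad-sym (x-adj s s∈) , x-adj t t∈) f)
    where
    f : ∀ z → cnt z [ x ] ≤ ⟦ not (In z) ⟧ + 0
    f z with z ≟ x
    ... | yes refl rewrite x∉ = ≤-refl
    ... | no _ = z≤n

  nonempty : ∀ bs → 2 ≤ length bs → (∀ {B} → B ∈ bs → Good B) → CycL In (flat bs) → ∀ {a J} → (a , J) ∈ bs → 1 ≤ length J
  nonempty bs two good q {a} {_ ∷ _} m = s≤s z≤n
  nonempty bs two good q {a} {[]} m with ∈-∃++ m
  ... | B₁ , B₂ , refl = ⊥-elim (go (B₂ ++ B₁) refl)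
    where
    rotated : CycL In (a ∷ flat (B₂ ++ B₁))
    rotated = subst (CycL In) (cong (a ∷_) (sym (flat-++ B₂ B₁))) (turn (flat B₁) (a ∷ flat B₂) (subst (CycL In) (flat-++ B₁ _) q))
    go : ∀ D → D ≡ B₂ ++ B₁ → ⊥
    go [] e = 1≰0 (linear (length (B₁ ++ (a , []) ∷ B₂) ∷ length B₂ ∷ length B₁ ∷ length (B₂ ++ B₁) ∷ []) (κ 2 ⊕ (# 0 ⊕ (# 1 ⊕ # 2 ⊕ # 3))) (# 0 ⊕ (# 2 ⊕ (κ 1 ⊕ # 1) ⊕ (# 3 ⊕ κ 0))) (κ 1) (κ 0) (two ⊞ ≡≤ (length-++ B₁ {(a , []) ∷ B₂}) ⊞ ≡≥ (length-++ B₂ {B₁}) ⊞ ≡≤ (cong length (sym e))))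
    go ((b , J) ∷ D) e = no-two (proj₁ (good m)) (proj₁ (good in-bs)) (subst (λ D → CycL In (a ∷ flat D)) (sym e) rotated)
      where
      in-bs : (b , J) ∈ B₁ ++ (a , []) ∷ B₂
      in-bs = [ (λ p → ∈-++⁺ʳ B₁ (there p)) , ∈-++⁺ˡ ]′ (∈-++⁻ B₂ (subst ((b , J) ∈_) e (here refl)))

  unit-block : V × V → Block
  unit-block (a , i) = a , [ i ]

  -- No run is empty, and their total length `c - h` is at most `h + 1`, so at most one run has
  -- length two and the others have length one.
  Shape : List Block → Set
  Shape bs = (∃[ ps ] (bs ≡ map unit-block ps)) ⊎
             (∃[ ps ] ∃[ a ] ∃[ p ] ∃[ q ] ∃[ qs ] (bs ≡ map unit-block ps ++ (a , p ∷ q ∷ []) ∷ map unit-block qs × runs bs ≡ suc (length bs)))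

  runs-≥ : ∀ bs → (∀ {a J} → (a , J) ∈ bs → 1 ≤ length J) → length bs ≤ runs bs
  runs-≥ [] f = z≤n
  runs-≥ ((a , J) ∷ bs) f = linear (length bs ∷ length J ∷ runs bs ∷ []) (κ 1 ⊕ # 0) (# 1 ⊕ # 2) (κ 1 ⊕ # 0) (# 1 ⊕ # 2) (f (here refl) ⊞ runs-≥ bs (λ m → f (there m)))

  units : ∀ bs → (∀ {a J} → (a , J) ∈ bs → 1 ≤ length J) → runs bs ≤ length bs → ∃[ ps ] (bs ≡ map unit-block ps)
  units [] f h = [] , refl
  units ((a , []) ∷ bs) f h = ⊥-elim (1≰0 (f (here refl)))
  units ((a , i ∷ []) ∷ bs) f h with units bs (λ m → f (there m)) (≤-pred h)
  ... | ps , e = (a , i) ∷ ps , cong ((a , [ i ]) ∷_) e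
  units ((a , _ ∷ _ ∷ J) ∷ bs) f h = ⊥-elim (1≰0 (linear (length J ∷ runs bs ∷ length bs ∷ []) (κ 2 ⊕ (# 0 ⊕ # 1) ⊕ (# 2 ⊕ κ 0)) (κ 1 ⊕ # 2 ⊕ (# 1 ⊕ # 0)) (κ 1) (κ 0) (h ⊞ runs-≥ bs (λ m → f (there m)) ⊞ z≤n {length J})))

  shape : ∀ bs → (∀ {a J} → (a , J) ∈ bs → 1 ≤ length J) → runs bs ≤ suc (length bs) → Shape bs
  shape [] f h = inj₁ ([] , refl)
  shape ((a , []) ∷ bs) f h = ⊥-elim (1≰0 (f (here refl)))
  shape ((a , i ∷ []) ∷ bs) f h with shape bs (λ m → f (there m)) (≤-pred h)
  ... | inj₁ (ps , e) = inj₁ ((a , i) ∷ ps , cong ((a , [ i ]) ∷_) e)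
  ... | inj₂ (ps , b , p , q , qs , e , r) = inj₂ ((a , i) ∷ ps , b , p , q , qs , cong ((a , [ i ]) ∷_) e , cong suc r)
  shape ((a , p ∷ q ∷ []) ∷ bs) f h with units bs (λ m → f (there m)) (≤-pred (≤-pred h))
  ... | qs , e = inj₂ ([] , a , p , q , qs , cong ((a , p ∷ q ∷ []) ∷_) e , cong (λ r → suc (suc r)) (≤-antisym (≤-pred (≤-pred h)) (runs-≥ bs (λ m → f (there m)))))
  shape ((a , _ ∷ _ ∷ _ ∷ J) ∷ bs) f h = ⊥-elim (1≰0 (linear (length J ∷ runs bs ∷ length bs ∷ []) (κ 3 ⊕ (# 0 ⊕ # 1) ⊕ (# 2 ⊕ κ 0)) (κ 2 ⊕ # 2 ⊕ (# 1 ⊕ # 0)) (κ 1) (κ 0) (h ⊞ runs-≥ bs (λ m → f (there m)) ⊞ z≤n {length J})))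

  -- A block pairs a vertex of `A` with its successor on the cycle, a step of a configuration pairs
  -- it with its predecessor.
  shift : List (V × V) → V → V × List (V × V)
  shift []             a = a , []
  shift ((b , i) ∷ ps) a = b , (i , proj₁ (shift ps a)) ∷ proj₂ (shift ps a)

  shift-flat : ∀ ps a J → proj₁ (shift ps a) ∷ flat₂ (proj₂ (shift ps a)) ++ J ≡ flat (map unit-block ps) ++ a ∷ J
  shift-flat [] a J = refl
  shift-flat ((b , i) ∷ ps) a J = cong (λ l → b ∷ i ∷ l) (shift-flat ps a J)

  shift-alt : ∀ ps a → a ∈ˢ A → (∀ {b i} → (b , i) ∈ ps → b ∈ˢ A × i ∉ˢ A) →
              proj₁ (shift ps a) ∈ˢ A × Alternating A In x (proj₂ (shift ps a))
  shift-alt [] a a∈ f = a∈ , λ ()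
  shift-alt ((b , i) ∷ ps) a a∈ f with shift-alt ps a a∈ (λ m → f (there m))
  ... | p , q = proj₁ (f (here refl)) , λ { (here refl) → proj₂ (f (here refl)) , p ; (there m) → q m }

  config : ∀ ps a J → 1 ≤ length ps → (∀ {B} → B ∈ map unit-block ps ++ [ (a , J) ] → Good B) →
           CycL In (flat (map unit-block ps ++ [ (a , J) ])) → Σ (Config A In x) λ k → Config.gap k ≡ J
  config ps a J one good q = record
    { a₁ = proj₁ (shift ps a) ; steps = proj₂ (shift ps a) ; gap = J
    ; cycle = subst (CycL In) (trans (flat-++ (map unit-block ps) [ (a , J) ]) (trans (cong (λ l → flat (map unit-block ps) ++ a ∷ l) (++-identityʳ J)) (sym (shift-flat ps a J)))) q
    ; a₁∈ = proj₁ sa ; alt = proj₂ sa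
    ; gap∉ = proj₂ (good {a , J} (∈-++⁺ʳ (map unit-block ps) (here refl))) ; some = nonempty-steps ps one } , refl
    where
    sa = shift-alt ps a (proj₁ (good {a , J} (∈-++⁺ʳ (map unit-block ps) (here refl))))
      (λ {b} {i} m → let g = good {b , [ i ]} (∈-++⁺ˡ (∈-map⁺ unit-block m)) in proj₁ g , proj₂ g i (cnt-mid i [] []))
    nonempty-steps : ∀ ps → 1 ≤ length ps → ∃[ i ] ∃[ b ] ∃[ qs ] proj₂ (shift ps a) ≡ (i , b) ∷ qs
    nonempty-steps ((b , i) ∷ ps) _ = i , proj₁ (shift ps a) , proj₂ (shift ps a) , refl

  base-config : ∀ a r → a ∈ˢ A → CycL In (a ∷ r) →
                (Σ (Config A In x) λ k → ∃[ i ] Config.gap k ≡ [ i ]) ⊎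
                (c ≡ suc (h + h) × Σ (Config A In x) λ k → ∃[ p ] ∃[ q ] Config.gap k ≡ p ∷ q ∷ [])
  base-config a r a∈ cyc₀ = go (shape bs (nonempty bs two good cyc) run≤)
    where
    bs : List Block
    bs = (a , proj₁ (split r)) ∷ proj₂ (split r)
    flat-bs : flat bs ≡ a ∷ r
    flat-bs = cong (a ∷_) (split-flat r)
    cyc : CycL In (flat bs)
    cyc = subst (CycL In) (sym flat-bs) cyc₀
    good : ∀ {B} → B ∈ bs → Good B
    good (here refl) = a∈ , proj₁ (split-good r)
    good (there m) = proj₂ (split-good r) m
    cnt-A : cntB A (a ∷ r) ≡ h
    cnt-A = trans (cntB≡ A (a ∷ r)) (trans (sumF-cong one) (trans (sym (countB≡ A)) |A|))
      where
      one : ∀ z → cnt z (a ∷ r) * ⟦ A z ⟧ ≡ ⟦ A z ⟧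
      one z with true⊎false (A z)
      ... | inj₂ f rewrite f = *-zeroʳ (cnt z (a ∷ r))
      ... | inj₁ t = trans (cong₂ _*_ (trans (vertices cyc₀ z) (⟦⟧-true (A⊆In z t))) refl) (*-identityˡ _)
    |bs| : length bs ≡ h
    |bs| = trans (cong suc (split-count r)) (trans (cong (_+ cntB A r) (sym (⟦⟧-true a∈))) cnt-A)
    two : 2 ≤ length bs
    two = ≤-trans 2≤h (≤-reflexive (sym |bs|))
    total : length bs + runs bs ≡ c
    total = trans (sym (runs-flat bs)) (size-c cyc)
    run≤ : runs bs ≤ suc (length bs)
    run≤ = linear (length (proj₂ (split r)) ∷ length (proj₁ (split r)) ∷ runs (proj₂ (split r)) ∷ c ∷ h ∷ []) (κ 1 ⊕ # 0 ⊕ (# 1 ⊕ # 2) ⊕ (# 3 ⊕ (# 4 ⊕ # 4))) (# 3 ⊕ (κ 1 ⊕ (# 4 ⊕ # 4) ⊕ (κ 1 ⊕ # 0 ⊕ (κ 1 ⊕ # 0)))) (# 1 ⊕ # 2) (κ 2 ⊕ # 0) (≡≤ total ⊞ c≤ ⊞ ≡≥ |bs| ⊞ ≡≥ |bs|)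
    unit-len : ∀ ps → length (map unit-block ps) ≡ length ps
    unit-len [] = refl
    unit-len (_ ∷ ps) = cong suc (unit-len ps)
    go : Shape bs → _
    go (inj₁ ([] , e)) = ⊥-elim (1≰0 (linear (length (proj₂ (split r)) ∷ []) (κ 2 ⊕ (κ 1 ⊕ # 0)) (κ 1 ⊕ # 0 ⊕ κ 0) (κ 1) (κ 0) (two ⊞ ≡≤ (cong length e))))
    -- All runs have length one, so any block may serve as the gap; the first one is rotated to the
    -- end.
    go (inj₁ ((b , i) ∷ ps , e)) = inj₁ (proj₁ k , i , proj₂ k)
      where
      k : Σ (Config A In x) λ k → Config.gap k ≡ [ i ]
      k = config ps b [ i ] (linear (length (proj₂ (split r)) ∷ length (map unit-block ps) ∷ length ps ∷ []) (κ 2 ⊕ (κ 1 ⊕ # 0 ⊕ # 1)) (κ 1 ⊕ # 0 ⊕ (κ 1 ⊕ # 1 ⊕ # 2)) (κ 1) (# 2) (two ⊞ ≡≤ (cong length e) ⊞ ≡≤ (unit-len ps)))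
        (λ {B} m → good (subst (B ∈_) (sym e) ([ there , (λ { (here refl) → here refl }) ]′ (∈-++⁻ (map unit-block ps) m))))
        (subst (CycL In) (sym (flat-++ (map unit-block ps) [ (b , [ i ]) ])) (turn (b ∷ i ∷ []) (flat (map unit-block ps)) (subst (λ bs → CycL In (flat bs)) e cyc)))
    go (inj₂ (ps , b , p , q , qs , e , rs)) = inj₂ (odd , proj₁ k , p , q , proj₂ k)
      where
      odd : c ≡ suc (h + h)
      odd = trans (sym total) (trans (cong (length bs +_) rs) (trans (+-suc (length bs) (length bs)) (cong (λ y → suc (y + y)) |bs|)))
      B₁ = map unit-block ps
      B₂ = map unit-block qs
      g : Block
      g = b , p ∷ q ∷ []
      map-++ : ∀ xs ys → map unit-block (xs ++ ys) ≡ map unit-block xs ++ map unit-block ys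
      map-++ [] ys = refl
      map-++ (z ∷ xs) ys = cong (unit-block z ∷_) (map-++ xs ys)
      rot : flat (B₂ ++ B₁ ++ [ g ]) ≡ flat B₂ ++ (flat B₁ ++ flat [ g ])
      rot = trans (flat-++ B₂ _) (cong (flat B₂ ++_) (flat-++ B₁ _))
      cyc₁ : CycL In (flat (B₂ ++ B₁ ++ [ g ]))
      cyc₁ = subst (CycL In) (sym rot) (turn (flat B₁ ++ flat [ g ]) (flat B₂)
        (subst (CycL In) (trans (cong flat (trans e (sym (++-assoc B₁ [ g ] B₂)))) (trans (flat-++ (B₁ ++ [ g ]) B₂) (cong (_++ flat B₂) (flat-++ B₁ [ g ])))) cyc))
      eq : B₂ ++ B₁ ++ [ g ] ≡ map unit-block (qs ++ ps) ++ [ g ]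
      eq = trans (sym (++-assoc B₂ B₁ [ g ])) (cong (_++ [ g ]) (sym (map-++ qs ps)))
      len : suc (length (qs ++ ps)) ≡ length bs
      len = trans (cong suc (length-++ qs {ps})) (sym (trans (cong length e) (trans (length-++ B₁ {g ∷ B₂}) (trans (cong₂ (λ y z → y + suc z) (unit-len ps) (unit-len qs))
              (trans (+-suc _ _) (cong suc (+-comm (length ps) (length qs))))))))
      k : Σ (Config A In x) λ k → Config.gap k ≡ p ∷ q ∷ []
      k = config (qs ++ ps) b (p ∷ q ∷ []) (linear (length (proj₂ (split r)) ∷ length (qs ++ ps) ∷ []) (κ 2 ⊕ (κ 1 ⊕ # 0)) (κ 1 ⊕ # 0 ⊕ (κ 1 ⊕ # 1)) (κ 1) (# 1) (two ⊞ ≡≥ len))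
        (λ {B} m → good (subst (B ∈_) (sym e) (place' (subst (B ∈_) (sym eq) m))))
        (subst (λ y → CycL In (flat y)) eq cyc₁)
        where
        place' : ∀ {B} → B ∈ B₂ ++ B₁ ++ [ g ] → B ∈ B₁ ++ g ∷ B₂
        place' m with ∈-++⁻ B₂ m
        ... | inj₁ y = ∈-++⁺ʳ B₁ (there y)
        ... | inj₂ y with ∈-++⁻ B₁ y
        ...   | inj₁ z = ∈-++⁺ˡ z
        ...   | inj₂ (here refl) = ∈-++⁺ʳ B₁ (here refl)

-- Exchanging the gap

==-sym : ∀ {n} (u v : Fin n) → (u == v) ≡ (v == u)
==-sym u v with u ≟ v | v ≟ u
... | yes _ | yes _ = refl
... | no _ | no _ = refl
... | yes p | no q = ⊥-elim (q (sym p))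
... | no p | yes q = ⊥-elim (p (sym q))

⊑-∖ : ∀ {n} {l} {S : BSet n} {u} → l ⊑ S → cnt u l ≡ 0 → l ⊑ S ∖ u
⊑-∖ {l = l} {S} {u} m e = ⊑-i λ y → go y (true⊎false (y == u))
  where
  go : ∀ y → y == u ≡ true ⊎ y == u ≡ false → cnt y l ≤ ⟦ (S ∖ u) y ⟧
  go y (inj₁ h) = ≤-trans (≤-reflexive (trans (cong (λ y → cnt y l) (==⇒≡ h)) e)) z≤n
  go y (inj₂ h) = ≤-trans (⊑-e m y) (⟦⟧-mono λ t → ∖-i {S = S} t (==f⇒≢ h))

countB-≗ : ∀ {n} (f g : BSet n) → (∀ z → f z ≡ g z) → countB f ≡ countB g
countB-≗ f g e = trans (countB≡ f) (trans (sumF-cong λ z → cong ⟦_⟧ (e z)) (sym (countB≡ g)))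

countB-two : ∀ {n} (f : BSet n) {a b} → a ≢ b → a ∈ˢ f → b ∈ˢ f → (∀ z → z ∈ˢ f → z ≡ a ⊎ z ≡ b) → countB f ≡ 2
countB-two f {a} {b} a≢b a∈ b∈ only = trans (countB-∖ f a∈) (cong suc (trans (countB-∖ (f ∖ a) (∖-i {S = f} b∈ (λ e → a≢b (sym e))))
  (cong suc (countB-false (f ∖ a ∖ b) λ z → ¬t⇒f λ m → let m₁ , z≢b = ∖-e {S = f ∖ a} m ; m₂ , z≢a = ∖-e {S = f} m₁ in
      [ z≢a , z≢b ]′ (only z m₂)))))

-- Replacing the gap p, q by another edge between a_k and a₁ gives another longest cycle.
module Swap {n} (G : Graph n) (c : ℕ)
               (longest : ∀ v r → Ch (adj G) v r v → Simple (v ∷ r) → 2 ≤ length r → suc (length r) ≤ c)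
               {A In : BSet n} {x : Fin n} (x∉ : x ∉ˢ In) (x-adj : ∀ a → a ∈ˢ A → adj G x a ≡ true)
               (A⊆In : ∀ z → z ∈ˢ A → z ∈ˢ In)
               (reach : ∀ y u → u ≢ y → ∃[ a ] (a ∈ˢ A × Rc (adj G) ((λ _ → true) ∖ y) u a))
               (k : Surgery.Config G c longest A In x) (p q : Fin n) (gap≡ : Surgery.Config.gap k ≡ p ∷ q ∷ [])
               (F : OddFacts G A In x (Surgery.Config.a₁ k) (Surgery.Config.aₖ k) p q)
               (p' q' : Fin n) (p'∉ : p' ∉ˢ A) (q'∉ : q' ∉ˢ A) (p'≢ : p' ≢ p × p' ≢ q) (q'≢ : q' ≢ p × q' ≢ q)
               (aₖp' : adj G (Surgery.Config.aₖ k) p' ≡ true) (p'q' : adj G p' q' ≡ true) (q'a₁ : adj G q' (Surgery.Config.a₁ k) ≡ true) where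
  open Surgery G c longest
  open OddFacts F
  open Config k using (a₁; aₖ; steps; gap; a₁∈; cycle; alt; some)

  ad≢ : ∀ {u v} → ad u v ≡ true → u ≢ v
  ad≢ {u} e refl = t≢f e (irrefl G u)

  not-gap : ∀ {u} → u ≢ p → u ≢ q → cnt u gap ≡ 0
  not-gap {u} u≢p u≢q = trans (cong (cnt u) gap≡) (cong₂ (λ b b' → ⟦ b ⟧ + (⟦ b' ⟧ + 0)) (≢⇒==f u≢p) (≢⇒==f u≢q))

  ∉≢ : ∀ {u s} → u ∉ˢ A → s ∈ˢ A → u ≢ s
  ∉≢ u∉ s∈ refl = t≢f s∈ u∉

  M L' : List V
  M = a₁ ∷ flat₂ steps
  L' = M ++ p' ∷ q' ∷ []

  off-cycle : ∀ {u v} → u ∉ˢ A → v ∉ˢ A → u ≢ p → u ≢ q → ad u v ≡ true → u ∉ˢ In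
  off-cycle u∉ v∉ u≢p u≢q e = ¬t⇒f λ u∈ → t≢f (isolated _ u∈ u∉ u≢p u≢q _ e) v∉

  M≤ : ∀ z → cnt z M ≤ ⟦ In z ⟧
  M≤ z = linear (⟦ z == a₁ ⟧ ∷ cnt z (flat₂ steps ++ gap) ∷ cnt z (flat₂ steps) ∷ cnt z gap ∷ ⟦ In z ⟧ ∷ []) (# 0 ⊕ # 1 ⊕ (# 2 ⊕ # 3)) (# 4 ⊕ # 1) (# 0 ⊕ # 2) (# 4) (≡≤ (vertices cycle z) ⊞ ≡≥ (cnt-++ z (flat₂ steps) gap))

  zero-at : ∀ {z} → z ∉ˢ In → cnt z M ≡ 0
  zero-at {z} z∉ = n≤0⇒n≡0 (≤-trans (M≤ z) (≤-reflexive (⟦⟧-false z∉)))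

  p'∉In : p' ∉ˢ In
  p'∉In = off-cycle p'∉ q'∉ (proj₁ p'≢) (proj₂ p'≢) p'q'

  q'∉In : q' ∉ˢ In
  q'∉In = off-cycle q'∉ p'∉ (proj₁ q'≢) (proj₂ q'≢) (ad-sym p'q')

  cnt-L' : ∀ z → cnt z L' ≡ cnt z M + (⟦ z == p' ⟧ + (⟦ z == q' ⟧ + 0))
  cnt-L' z = cnt-++ z M (p' ∷ q' ∷ [])

  simple' : Simple L'
  simple' z with true⊎false (z == p') | true⊎false (z == q')
  ... | inj₁ e | inj₁ e' = ⊥-elim (ad≢ p'q' (trans (sym (==⇒≡ e)) (==⇒≡ e')))
  ... | inj₁ e | inj₂ e' = linear (⟦ z == a₁ ⟧ ∷ cnt z (flat₂ steps ++ p' ∷ q' ∷ []) ∷ cnt z (flat₂ steps) ∷ ⟦ z == p' ⟧ ∷ ⟦ z == q' ⟧ ∷ []) (# 0 ⊕ # 1 ⊕ (# 0 ⊕ # 2 ⊕ (# 3 ⊕ # 4))) (# 0 ⊕ # 2 ⊕ (# 3 ⊕ (# 4 ⊕ κ 0)) ⊕ (κ 0 ⊕ (κ 1 ⊕ κ 0))) (# 0 ⊕ # 1) (κ 1) (≡≤ (cnt-L' z) ⊞ ≡≤ (zero-at (subst (_∉ˢ In) (sym (==⇒≡ e)) p'∉In)) ⊞ ⟦⟧≤1 (z == p') ⊞ ≡≤ (⟦⟧-false e'))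
  ... | inj₂ e | inj₁ e' = linear (⟦ z == a₁ ⟧ ∷ cnt z (flat₂ steps ++ p' ∷ q' ∷ []) ∷ cnt z (flat₂ steps) ∷ ⟦ z == q' ⟧ ∷ ⟦ z == p' ⟧ ∷ []) (# 0 ⊕ # 1 ⊕ (# 0 ⊕ # 2 ⊕ (# 3 ⊕ # 4))) (# 0 ⊕ # 2 ⊕ (# 4 ⊕ (# 3 ⊕ κ 0)) ⊕ (κ 0 ⊕ (κ 1 ⊕ κ 0))) (# 0 ⊕ # 1) (κ 1) (≡≤ (cnt-L' z) ⊞ ≡≤ (zero-at (subst (_∉ˢ In) (sym (==⇒≡ e')) q'∉In)) ⊞ ⟦⟧≤1 (z == q') ⊞ ≡≤ (⟦⟧-false e))
  ... | inj₂ e | inj₂ e' = linear (⟦ z == a₁ ⟧ ∷ cnt z (flat₂ steps ++ p' ∷ q' ∷ []) ∷ cnt z (flat₂ steps) ∷ ⟦ In z ⟧ ∷ ⟦ z == p' ⟧ ∷ ⟦ z == q' ⟧ ∷ []) (# 0 ⊕ # 1 ⊕ (# 0 ⊕ # 2 ⊕ (# 3 ⊕ (# 4 ⊕ # 5)))) (# 0 ⊕ # 2 ⊕ (# 4 ⊕ (# 5 ⊕ κ 0)) ⊕ (# 3 ⊕ (κ 1 ⊕ (κ 0 ⊕ κ 0)))) (# 0 ⊕ # 1) (κ 1) (≡≤ (cnt-L' z) ⊞ M≤ z ⊞ ⟦⟧≤1 (In z) ⊞ ≡≤ (⟦⟧-false e) ⊞ ≡≤ (⟦⟧-false e'))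

  In' : BSet n
  In' z = memB z L'

  In'≡ : ∀ z → cnt z L' ≡ ⟦ In' z ⟧
  In'≡ z with true⊎false (memB z L')
  ... | inj₁ t = ≤-antisym (≤-trans (simple' z) (≡≥ (⟦⟧-true t))) (≤-trans (⟦⟧≤1 (memB z L')) (mem⁺ z L' t))
  ... | inj₂ f = trans (mem⁻ z L' f) (sym (⟦⟧-false f))

  A⊆In' : ∀ z → z ∈ˢ A → z ∈ˢ In'
  A⊆In' z z∈ = ⟦⟧≥1 (linear (⟦ z == a₁ ⟧ ∷ cnt z (flat₂ steps ++ p' ∷ q' ∷ []) ∷ cnt z (flat₂ steps) ∷ ⟦ z == p' ⟧ ∷ ⟦ z == q' ⟧ ∷ ⟦ In z ⟧ ∷ cnt z (flat₂ steps ++ gap) ∷ cnt z gap ∷ ⟦ In' z ⟧ ∷ []) (# 0 ⊕ # 1 ⊕ (# 0 ⊕ # 2 ⊕ (# 3 ⊕ (# 4 ⊕ κ 0)) ⊕ (# 5 ⊕ (κ 1 ⊕ (# 6 ⊕ # 7))))) (# 8 ⊕ (# 0 ⊕ # 1 ⊕ (# 0 ⊕ # 6 ⊕ (# 5 ⊕ (# 2 ⊕ # 7 ⊕ κ 0))))) (κ 1) (# 8) (≡≤ (In'≡ z) ⊞ ≡≥ (cnt-L' z) ⊞ ≡≥ (vertices cycle z) ⊞ ≡≥ (⟦⟧-true (A⊆In z z∈)) ⊞ ≡≤ (cnt-++ z (flat₂ steps) gap)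
              ⊞ ≡≤ (not-gap (λ e → ∉≢ p∉A z∈ (sym e)) (λ e → ∉≢ q∉A z∈ (sym e)))))

  x∉' : x ∉ˢ In'
  x∉' = ¬t⇒f λ m → 1≰0 (linear (⟦ x == a₁ ⟧ ∷ cnt x (flat₂ steps ++ p' ∷ q' ∷ []) ∷ cnt x (flat₂ steps) ∷ ⟦ x == p' ⟧ ∷ ⟦ x == q' ⟧ ∷ []) (κ 1 ⊕ (# 0 ⊕ # 1 ⊕ (# 0 ⊕ # 2 ⊕ (# 3 ⊕ # 4)))) (# 0 ⊕ # 1 ⊕ (# 0 ⊕ # 2 ⊕ (# 3 ⊕ (# 4 ⊕ κ 0)) ⊕ (κ 0 ⊕ (κ 0 ⊕ κ 0)))) (κ 1) (κ 0) (mem⁺ x L' m ⊞ ≡≤ (cnt-L' x) ⊞ ≡≤ (zero-at x∉) ⊞ ≡≤ (⟦⟧-false (≢⇒==f x≢p')) ⊞ ≡≤ (⟦⟧-false (≢⇒==f x≢q'))))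
    where
    x≢p' : x ≢ p'
    x≢p' refl = t≢f (isolated-x q' p'q') q'∉
    x≢q' : x ≢ q'
    x≢q' refl = t≢f (isolated-x p' (ad-sym p'q')) p'∉

  redirect : ∀ a ps {y y'} → Ch ad a (flat₂ ps) y → ad (final a ps) y' ≡ true → Ch ad a (flat₂ ps) y'
  redirect a [] c e = e
  redirect a ((i , b) ∷ ps) (c₁ , c₂ , c) e = c₁ , c₂ , redirect b ps c e

  k' : Config A In' x
  k' = record
    { a₁ = a₁ ; steps = steps ; gap = p' ∷ q' ∷ []
    ; cycle = cycl (Ch-++ ad (flat₂ steps) (redirect a₁ steps to-p aₖp') (p'q' , q'a₁)) In'≡
        (trans (cong suc (trans (length-++ (flat₂ steps) {p' ∷ q' ∷ []}) (trans (cong (length (flat₂ steps) +_) (sym (cong length gap≡))) (sym (length-++ (flat₂ steps) {gap}))))) (size-c cycle))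
    ; a₁∈ = a₁∈ ; alt = alt ; gap∉ = gap'∉ ; some = some }
    where
    to-p : Ch ad a₁ (flat₂ steps) p
    to-p = proj₁ (Ch-split ad (flat₂ steps) (subst (λ g → Ch ad a₁ (flat₂ steps ++ g) a₁) gap≡ (closed-walk cycle)))
    gap'∉ : ∀ z → 1 ≤ cnt z (p' ∷ q' ∷ []) → z ∉ˢ A
    gap'∉ z h with true⊎false (z == p')
    ... | inj₁ e = subst (_∉ˢ A) (sym (==⇒≡ e)) p'∉
    ... | inj₂ e = subst (_∉ˢ A) (sym (cnt-[] (≤-trans h (≤-reflexive (cong (λ b → ⟦ b ⟧ + cnt z [ q' ]) e))))) q'∉

  -- Only edges that touch the new gap are exempt here, so edges at the old gap are now covered.
  regap : ∀ {s t u v} → s ∈ˢ A → t ∈ˢ A → s ≢ t → u ∉ˢ A → v ∉ˢ A → u ≢ p' → u ≢ q' → v ≢ p' → v ≢ q' →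
          ad u s ≡ true → ad u v ≡ true → ad v t ≡ true → (s ≡ aₖ × t ≡ a₁) ⊎ (s ≡ a₁ × t ≡ aₖ)
  regap = OddFacts.ends-of (Structure.Odd.facts G c longest {A} {In'} {x} x∉' x-adj (λ z _ e → isolated-x z e) A⊆In' reach k' p' q' refl)

-- Host graphs for odd length

module Assembly {n} (G : Graph n) (c : ℕ) {A In : BSet n} {x a₁ aₖ p q : Fin n} (F : OddFacts G A In x a₁ aₖ p q)
               (size : countB A ≡ ⌊ c /2⌋)
               (regap : ∀ p' q' → p' ∉ˢ A → q' ∉ˢ A → p' ≢ p × p' ≢ q → q' ≢ p × q' ≢ q →
                        adj G aₖ p' ≡ true → adj G p' q' ≡ true → adj G q' a₁ ≡ true →
                        ∀ {s t u v} → s ∈ˢ A → t ∈ˢ A → s ≢ t → u ∉ˢ A → v ∉ˢ A → u ≢ p' → u ≢ q' → v ≢ p' → v ≢ q' →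
                        adj G u s ≡ true → adj G u v ≡ true → adj G v t ≡ true → (s ≡ aₖ × t ≡ a₁) ⊎ (s ≡ a₁ × t ≡ aₖ)) where
  open Cyclic G using (ad; ad-sym)
  open OddFacts F

  V : Set
  V = Fin n

  ad≢ : ∀ {u v} → ad u v ≡ true → u ≢ v
  ad≢ {u} e refl = t≢f e (irrefl G u)

  Q : BSet n
  Q z = not (A z)

  ∉≢ : ∀ {u s} → u ∉ˢ A → s ∈ˢ A → u ≢ s
  ∉≢ u∉ s∈ refl = t≢f s∈ u∉

  three : ∀ {u v w} → u ∉ˢ A → v ∉ˢ A → w ∉ˢ A → u ≢ v → u ≢ w → v ≢ w → (u ∷ v ∷ w ∷ []) ⊑ Q
  three u∉ v∉ w∉ uv uw vw = ⊑-∷ (not-i u∉) (⊑-∷ (∖-i {S = Q} (not-i v∉) (λ e → uv (sym e)))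
    (⊑-∷ (∖-i {S = Q ∖ _} (∖-i {S = Q} (not-i w∉) (λ e → uw (sym e))) (λ e → vw (sym e))) ⊑-[]))

  abstract
    -- The path from `s` to `t` has three interior vertices.
    same-end : ∀ {u v w s t} → u ∉ˢ A → v ∉ˢ A → w ∉ˢ A → ad u v ≡ true → ad v w ≡ true → u ≢ w →
               s ∈ˢ A → t ∈ˢ A → ad u s ≡ true → ad w t ≡ true → s ≡ t
    same-end {u} {v} {w} u∉ v∉ w∉ uv vw u≢w s∈ t∈ us wt =
      no-long u [ v ] w s∈ t∈ (ad-sym us) (uv , vw) wt (three u∉ v∉ w∉ (ad≢ uv) u≢w (ad≢ vw)) (s≤s z≤n)

    -- By the length bounds a neighbour of `u` in `A` and one of `v` would coincide, although
    -- `attached` provides distinct ones. With the triangle `u = z` included, this makes the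
    -- components outside `A` stars.
    no-fork : ∀ {u v w z} → u ∉ˢ A → v ∉ˢ A → w ∉ˢ A → z ∉ˢ A → ad u v ≡ true → ad v w ≡ true → ad w z ≡ true →
              u ≢ w → z ≢ v → ⊥
    no-fork {u} {v} {w} {z} u∉ v∉ w∉ z∉ uv vw wz u≢w z≢v with attached u∉ v∉ uv | u ≟ z
    ... | s , s' , s∈ , s'∈ , s≢ , us , vs' | yes refl =
      s≢ (same-end u∉ w∉ v∉ (ad-sym wz) (ad-sym vw) (ad≢ uv) s∈ s'∈ us vs')
    ... | s , s' , s∈ , s'∈ , s≢ , us , vs' | no u≢z with attached w∉ z∉ wz
    ...   | t , t' , t∈ , t'∈ , _ , wt , zt' = s≢ (trans (no-long u (v ∷ [ w ]) z s∈ t'∈ (ad-sym us) (uv , vw , wz) zt' four (s≤s z≤n))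
              (sym (same-end v∉ w∉ z∉ vw wz (λ e → z≢v (sym e)) s'∈ t'∈ vs' zt')))
      where
      four : (u ∷ v ∷ w ∷ z ∷ []) ⊑ Q
      four = ⊑-∷ (not-i u∉) (⊑-∖ (three v∉ w∉ z∉ (ad≢ vw) (λ e → z≢v (sym e)) (ad≢ wz)) u∉l)
        where
        u∉l : cnt u (v ∷ w ∷ z ∷ []) ≡ 0
        u∉l rewrite ≢⇒==f (ad≢ uv) | ≢⇒==f u≢w | ≢⇒==f u≢z = refl

  module XCase (b o r : V) (b∉ : b ∉ˢ A) (o∉ : o ∉ˢ A) (r∉ : r ∉ˢ A) (bo : ad b o ≡ true) (br : ad b r ≡ true) (r≢o : r ≢ o)
               (central : ∀ u v → u ∉ˢ A → v ∉ˢ A → ad u v ≡ true → u ≡ b ⊎ v ≡ b) where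
    abstract
      -- Neighbours of `b` outside `A` are compared with `o` by `same-end`; at `o` itself the
      -- comparison goes through `r`.
      hinge : ∃[ a ] (a ∈ˢ A × (∀ z t → z ∉ˢ A → ad b z ≡ true → t ∈ˢ A → ad z t ≡ true → t ≡ a))
      hinge with attached b∉ o∉ bo | attached b∉ r∉ br
      ... | _ , a , _ , a∈ , _ , _ , oa | _ , a' , _ , a'∈ , _ , _ , ra' = a , a∈ , unique
        where
        unique : ∀ z t → z ∉ˢ A → ad b z ≡ true → t ∈ˢ A → ad z t ≡ true → t ≡ a
        unique z t z∉ bz t∈ zt with z ≟ o
        ... | no z≢o = same-end z∉ b∉ o∉ (ad-sym bz) bo z≢o t∈ a∈ zt oa
        ... | yes refl = trans (same-end z∉ b∉ r∉ (ad-sym bz) br (λ e → r≢o (sym e)) t∈ a'∈ zt ra')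
                               (sym (same-end z∉ b∉ r∉ (ad-sym bz) br (λ e → r≢o (sym e)) a∈ a'∈ oa ra'))

    a : V
    a = proj₁ hinge
    a∈ : a ∈ˢ A
    a∈ = proj₁ (proj₂ hinge)

    part : V → PartX
    part z = if A z then inA else (if ad b z then inX else inB)

    data View (z : V) : Set where
      vA : z ∈ˢ A → part z ≡ inA → View z
      vX : z ∉ˢ A → ad b z ≡ true → part z ≡ inX → View z
      vB : z ∉ˢ A → ad b z ≡ false → part z ≡ inB → View z

    view : ∀ z → View z
    view z with A z in e | ad b z in e'
    ... | true  | _     = vA e (cong (λ t → if t then inA else (if ad b z then inX else inB)) e)
    ... | false | true  = vX e e' (trans (cong (λ t → if t then inA else (if ad b z then inX else inB)) e) (cong (λ t → if t then inX else inB) e'))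
    ... | false | false = vB e e' (trans (cong (λ t → if t then inA else (if ad b z then inX else inB)) e) (cong (λ t → if t then inX else inB) e'))

    -- All adjacencies that the family permits for this partition, so that its conditions hold by
    -- evaluation and `G` matters only in `edge`.
    table : PartX → PartX → V → V → Bool
    table inA inA u v = not (u == v)
    table inA inB u v = true
    table inB inA u v = true
    table inB inB u v = false
    table inX inX u v = false
    table inX inA u v = v == a
    table inX inB u v = v == b
    table inA inX u v = u == a
    table inB inX u v = u == b

    table-sym : ∀ P R u v → table P R u v ≡ table R P v u
    table-sym inA inA u v = cong not (==-sym u v)
    table-sym inA inB u v = refl
    table-sym inA inX u v = refl
    table-sym inB inA u v = refl
    table-sym inB inB u v = refl
    table-sym inB inX u v = refl
    table-sym inX inA u v = refl
    table-sym inX inB u v = refl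
    table-sym inX inX u v = refl

    table-irr : ∀ P u → table P P u u ≡ false
    table-irr inA u = cong not (==-refl u)
    table-irr inB u = refl
    table-irr inX u = refl

    H : Graph n
    H = record { adj = λ u v → table (part u) (part v) u v ; sym = λ u v → table-sym (part u) (part v) u v ; irrefl = λ u → table-irr (part u) u }

    entry : ∀ {u v P R} → part u ≡ P → part v ≡ R → adj H u v ≡ table P R u v
    entry e f = cong₂ (λ P R → table P R _ _) e f

    part-a : part a ≡ inA
    part-a with view a
    ... | vA _ e = e
    ... | vX a∉ _ _ = ⊥-elim (t≢f a∈ a∉)
    ... | vB a∉ _ _ = ⊥-elim (t≢f a∈ a∉)

    part-b : part b ≡ inB
    part-b with view b
    ... | vA b∈ _ = ⊥-elim (t≢f b∈ b∉)
    ... | vX _ e _ = ⊥-elim (t≢f e (irrefl G b))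
    ... | vB _ _ e = e

    size-A : ∀ z → isAX (part z) ≡ A z
    size-A z with view z
    ... | vA p e = trans (cong isAX e) (sym p)
    ... | vX p _ e = trans (cong isAX e) (sym p)
    ... | vB p _ e = trans (cong isAX e) (sym p)

    nbhd : ∀ y → part y ≡ inX → ∀ v → (adj H y v ≡ true) ⇔ (v ≡ a ⊎ v ≡ b)
    nbhd y y∈ v = mk⇔ to from
      where
      to : adj H y v ≡ true → v ≡ a ⊎ v ≡ b
      to h with view v
      ... | vA _ e = inj₁ (==⇒≡ (trans (sym (entry y∈ e)) h))
      ... | vX _ _ e = ⊥-elim (t≢f h (entry y∈ e))
      ... | vB _ _ e = inj₂ (==⇒≡ (trans (sym (entry y∈ e)) h))
      from : v ≡ a ⊎ v ≡ b → adj H y v ≡ true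
      from (inj₁ refl) = trans (entry y∈ part-a) (==-refl a)
      from (inj₂ refl) = trans (entry y∈ part-b) (==-refl b)

    edge : ∀ u v → ad u v ≡ true → adj H u v ≡ true
    edge u v e with view u | view v
    ... | vA _ i | vA _ j = trans (entry i j) (not-i (≢⇒==f (ad≢ e)))
    ... | vA _ i | vB _ _ j = entry i j
    ... | vB _ _ i | vA _ j = entry i j
    ... | vA u∈ i | vX v∉ bv j = trans (entry i j) (trans (cong (_== a) (proj₂ (proj₂ hinge) v u v∉ bv u∈ (ad-sym e))) (==-refl a))
    ... | vX u∉ bu i | vA v∈ j = trans (entry i j) (trans (cong (_== a) (proj₂ (proj₂ hinge) u v u∉ bu v∈ e)) (==-refl a))
    ... | vB u∉ _ i | vX v∉ _ j with central u v u∉ v∉ e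
    ...   | inj₁ u≡b = trans (entry i j) (trans (cong (_== b) u≡b) (==-refl b))
    ...   | inj₂ refl with trans (sym j) part-b
    ...     | ()
    edge u v e | vX u∉ _ i | vB v∉ _ j with central u v u∉ v∉ e
    ...   | inj₂ v≡b = trans (entry i j) (trans (cong (_== b) v≡b) (==-refl b))
    ...   | inj₁ refl with trans (sym i) part-b
    ...     | ()
    edge u v e | vX u∉ bu i | vX v∉ bv j with central u v u∉ v∉ e
    ...   | inj₁ refl with trans (sym i) part-b
    ...     | ()
    edge u v e | vX u∉ bu i | vX v∉ bv j | inj₂ refl with trans (sym j) part-b
    ...     | ()
    edge u v e | vB u∉ bu i | vB v∉ bv j with central u v u∉ v∉ e
    ...   | inj₁ refl = ⊥-elim (t≢f e bv)
    ...   | inj₂ refl = ⊥-elim (t≢f (ad-sym e) bu)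

    inX-H : InX c H
    inX-H = record
      { part = part
      ; sizeA = trans (countB-≗ (λ z → isAX (part z)) A size-A) size
      ; cliqueA = λ u v i j u≢v → trans (entry i j) (not-i (≢⇒==f u≢v))
      ; indepB = λ u v i j → entry i j
      ; indepX = λ u v i j → entry i j
      ; joinAB = λ u v i j → entry i j
      ; a = a ; b = b ; aA = part-a ; bB = part-b
      ; nbhdX = nbhd }

    result : Σ (Graph n) λ H → (InX c H ⊎ InY c H) × EmbedsInto G (λ u v → adj H u v ≡ true)
    result = H , inj₁ inX-H , (λ z → z) , (λ e → e) , edge

  module YCase (u₀ v₀ : V) (u₀∉ : u₀ ∉ˢ A) (v₀∉ : v₀ ∉ˢ A) (u₀≢p : u₀ ≢ p) (u₀≢q : u₀ ≢ q) (v₀≢p : v₀ ≢ p) (v₀≢q : v₀ ≢ q)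
               (u₀v₀ : ad u₀ v₀ ≡ true) where

    pq : ad p q ≡ true
    pq = p~q

    Ends : V → V → Set
    Ends s t = (s ≡ aₖ × t ≡ a₁) ⊎ (s ≡ a₁ × t ≡ aₖ)

    abstract
      -- The edge between `u₀` and `v₀` connects `aₖ` and `a₁` in one direction or the other, so it
      -- can take the place of the gap.
      other-gap : ∀ {s t u v} → s ∈ˢ A → t ∈ˢ A → s ≢ t → u ∉ˢ A → v ∉ˢ A → u ≢ u₀ → u ≢ v₀ → v ≢ u₀ → v ≢ v₀ →
                  ad u s ≡ true → ad u v ≡ true → ad v t ≡ true → Ends s t
      other-gap {s} {t} {u} {v} s∈ t∈ s≢t u∉ v∉ uu uv vu vv us e vt with attached u₀∉ v₀∉ u₀v₀
      ... | s₀ , t₀ , s₀∈ , t₀∈ , s₀≢t₀ , us₀ , vt₀ with ends-of s₀∈ t₀∈ s₀≢t₀ u₀∉ v₀∉ u₀≢p u₀≢q v₀≢p v₀≢q us₀ u₀v₀ vt₀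
      ...   | inj₁ (refl , refl) = regap u₀ v₀ u₀∉ v₀∉ (u₀≢p , u₀≢q) (v₀≢p , v₀≢q) (ad-sym us₀) u₀v₀ vt₀ s∈ t∈ s≢t u∉ v∉ uu uv vu vv us e vt
      ...   | inj₂ (refl , refl) = regap v₀ u₀ v₀∉ u₀∉ (v₀≢p , v₀≢q) (u₀≢p , u₀≢q) (ad-sym vt₀) (ad-sym u₀v₀) us₀ s∈ t∈ s≢t u∉ v∉ uv uu vv vu us e vt

      -- An edge that touches `p` or `q` is disjoint from the one between `u₀` and `v₀`, by
      -- `no-fork`; it is off the gap after the exchange.
      edge-ends : ∀ {s t u v} → s ∈ˢ A → t ∈ˢ A → s ≢ t → u ∉ˢ A → v ∉ˢ A → ad u s ≡ true → ad u v ≡ true → ad v t ≡ true → Ends s t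
      edge-ends {s} {t} {u} {v} s∈ t∈ s≢t u∉ v∉ us uv vt with u ≟ p | u ≟ q | v ≟ p | v ≟ q
      ... | no up | no uq | no vp | no vq = ends-of s∈ t∈ s≢t u∉ v∉ up uq vp vq us uv vt
      ... | yes refl | _ | _ | _ = other-gap s∈ t∈ s≢t u∉ v∉ (λ e → u₀≢p (sym e)) (λ e → v₀≢p (sym e))
              (λ { refl → no-fork q∉A p∉A u₀∉ v₀∉ (ad-sym pq) uv u₀v₀ (λ e → u₀≢q (sym e)) v₀≢p })
              (λ { refl → no-fork q∉A p∉A v₀∉ u₀∉ (ad-sym pq) uv (ad-sym u₀v₀) (λ e → v₀≢q (sym e)) u₀≢p }) us uv vt
      ... | no _ | yes refl | _ | _ = other-gap s∈ t∈ s≢t u∉ v∉ (λ e → u₀≢q (sym e)) (λ e → v₀≢q (sym e))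
              (λ { refl → no-fork p∉A q∉A u₀∉ v₀∉ pq uv u₀v₀ (λ e → u₀≢p (sym e)) v₀≢q })
              (λ { refl → no-fork p∉A q∉A v₀∉ u₀∉ pq uv (ad-sym u₀v₀) (λ e → v₀≢p (sym e)) u₀≢q }) us uv vt
      ... | no _ | no _ | yes refl | _ = other-gap s∈ t∈ s≢t u∉ v∉
              (λ { refl → no-fork q∉A p∉A u₀∉ v₀∉ (ad-sym pq) (ad-sym uv) u₀v₀ (λ e → u₀≢q (sym e)) v₀≢p })
              (λ { refl → no-fork q∉A p∉A v₀∉ u₀∉ (ad-sym pq) (ad-sym uv) (ad-sym u₀v₀) (λ e → v₀≢q (sym e)) u₀≢p })
              (λ e → u₀≢p (sym e)) (λ e → v₀≢p (sym e)) us uv vt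
      ... | no _ | no _ | no _ | yes refl = other-gap s∈ t∈ s≢t u∉ v∉
              (λ { refl → no-fork p∉A q∉A u₀∉ v₀∉ pq (ad-sym uv) u₀v₀ (λ e → u₀≢p (sym e)) v₀≢q })
              (λ { refl → no-fork p∉A q∉A v₀∉ u₀∉ pq (ad-sym uv) (ad-sym u₀v₀) (λ e → v₀≢p (sym e)) u₀≢q })
              (λ e → u₀≢q (sym e)) (λ e → v₀≢q (sym e)) us uv vt

      nbr-in-A : ∀ {u v s} → u ∉ˢ A → v ∉ˢ A → ad u v ≡ true → s ∈ˢ A → ad u s ≡ true → s ≡ a₁ ⊎ s ≡ aₖ
      nbr-in-A {u} {v} {s} u∉ v∉ uv s∈ us with attached u∉ v∉ uv
      ... | s₁ , t₁ , s₁∈ , t₁∈ , s₁≢ , us₁ , vt₁ with s ≟ t₁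
      ...   | no s≢ = [ (λ e → inj₂ (proj₁ e)) , (λ e → inj₁ (proj₁ e)) ]′ (edge-ends s∈ t₁∈ s≢ u∉ v∉ us uv vt₁)
      ...   | yes refl = [ (λ e → inj₁ (proj₂ e)) , (λ e → inj₂ (proj₂ e)) ]′ (edge-ends s₁∈ t₁∈ s₁≢ u∉ v∉ us₁ uv vt₁)

    Fork : V → Set
    Fork z = ∃[ w ] ∃[ w' ] (w ∉ˢ A × w' ∉ˢ A × ad z w ≡ true × ad z w' ≡ true × w ≢ w')

    abstract
      nbr? : ∀ z → Dec (∃[ w ] (w ∉ˢ A × ad z w ≡ true))
      nbr? z = any? λ w → (A w ≟ᵇ false) ×-dec (ad z w ≟ᵇ true)

      fork? : ∀ z → Dec (Fork z)
      fork? z = any? λ w → any? λ w' → (A w ≟ᵇ false) ×-dec ((A w' ≟ᵇ false) ×-dec ((ad z w ≟ᵇ true) ×-dec ((ad z w' ≟ᵇ true) ×-dec ¬? (w ≟ w'))))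

      nbr : V → V
      nbr z with nbr? z
      ... | yes (w , _) = w
      ... | no _ = z

      -- The centre of a star: its vertex with two neighbours outside A or, in a star with a single edge, its smaller end.
      star : V → V
      star z with fork? z | fork? (nbr z) | toℕ z <? toℕ (nbr z)
      ... | yes _ | _     | _     = z
      ... | no _  | yes _ | _     = nbr z
      ... | no _  | no _  | yes _ = z
      ... | no _  | no _  | no _  = nbr z

      nbr-spec : ∀ {z w} → w ∉ˢ A → ad z w ≡ true → nbr z ∉ˢ A × ad z (nbr z) ≡ true
      nbr-spec {z} {w} w∉ e with nbr? z
      ... | yes (_ , y) = y
      ... | no none = ⊥-elim (none (w , w∉ , e))

      nbr-unique : ∀ {z w} → ¬ Fork z → w ∉ˢ A → ad z w ≡ true → nbr z ≡ w
      nbr-unique {z} {w} ¬f w∉ e with nbr z ≟ w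
      ... | yes y = y
      ... | no y = ⊥-elim (¬f (nbr z , w , proj₁ (nbr-spec w∉ e) , w∉ , proj₂ (nbr-spec w∉ e) , e , y))

      star-fork : ∀ {z} → Fork z → star z ≡ z
      star-fork {z} f with fork? z
      ... | yes _ = refl
      ... | no ¬f = ⊥-elim (¬f f)

      star-leaf : ∀ {z} → ¬ Fork z →
                  Fork (nbr z) → star z ≡ nbr z
      star-leaf {z} ¬f g with fork? z | fork? (nbr z)
      ... | yes f | _ = ⊥-elim (¬f f)
      ... | no _ | yes _ = refl
      ... | no _ | no ¬g = ⊥-elim (¬g g)

      star-< : ∀ {z} → ¬ Fork z →
               ¬ Fork (nbr z) →
               (toℕ z < toℕ (nbr z) → star z ≡ z) × (toℕ (nbr z) < toℕ z → star z ≡ nbr z)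
      star-< {z} ¬f ¬g with fork? z | fork? (nbr z) | toℕ z <? toℕ (nbr z)
      ... | yes f | _ | _ = ⊥-elim (¬f f)
      ... | no _ | yes g | _ = ⊥-elim (¬g g)
      ... | no _ | no _ | yes l = (λ _ → refl) , λ l' → ⊥-elim (<-asym l l')
      ... | no _ | no _ | no ¬l = (λ l → ⊥-elim (¬l l)) , λ _ → refl

    abstract
      no-two-forks : ∀ {y z} → y ∉ˢ A → z ∉ˢ A → ad y z ≡ true →
                     Fork y →
                     Fork z → ⊥
      no-two-forks {y} {z} y∉ z∉ yz f g with other z f | other y g
        where
        other : ∀ {y} z → Fork y → ∃[ w ] (w ∉ˢ A × ad y w ≡ true × w ≢ z)
        other z (w , w' , w∉ , w'∉ , e , e' , w≢w') with w ≟ z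
        ... | no y = w , w∉ , e , y
        ... | yes refl = w' , w'∉ , e' , λ q → w≢w' (sym q)
      ... | w , w∉ , yw , w≢z | w' , w'∉ , zw' , w'≢y = no-fork w∉ y∉ z∉ w'∉ (ad-sym yw) yz zw' w≢z w'≢y

    -- A vertex with two neighbours outside `A` is the centre. If neither end is one, the edge is a
    -- whole component and both ends agree on the smaller index.
    star-edge : ∀ {y z} → y ∉ˢ A → z ∉ˢ A → ad y z ≡ true → (star y ≡ y × star z ≡ y) ⊎ (star y ≡ z × star z ≡ z)
    star-edge {y} {z} y∉ z∉ yz with fork? y | fork? z
    ... | yes f | yes g = ⊥-elim (no-two-forks y∉ z∉ yz f g)
    ... | yes f | no ¬g with nbr-unique ¬g y∉ (ad-sym yz)
    ...   | e = inj₁ (star-fork f , trans (star-leaf ¬g (subst Fork (sym e) f)) e)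
    star-edge {y} {z} y∉ z∉ yz | no ¬f | yes g with nbr-unique ¬f z∉ yz
    ...   | e = inj₂ (trans (star-leaf ¬f (subst Fork (sym e) g)) e , star-fork g)
    star-edge {y} {z} y∉ z∉ yz | no ¬f | no ¬g with nbr-unique ¬f z∉ yz | nbr-unique ¬g y∉ (ad-sym yz)
    ...   | e | e' with star-< ¬f (λ g → ¬g (subst Fork e g))
                    | star-< ¬g (λ f → ¬f (subst Fork e' f))
                    | <-cmp (toℕ y) (toℕ z)
    ...     | s₁ , s₂ | t₁ , t₂ | tri< l _ _ = inj₁ (s₁ (subst (λ w → toℕ y < toℕ w) (sym e) l) , trans (t₂ (subst (λ w → toℕ w < toℕ z) (sym e') l)) e')
    ...     | s₁ , s₂ | t₁ , t₂ | tri≈ _ m _ = ⊥-elim (ad≢ yz (toℕ-injective m))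
    ...     | s₁ , s₂ | t₁ , t₂ | tri> _ _ l = inj₂ (trans (s₂ (subst (λ w → toℕ w < toℕ y) (sym e) l)) e , t₁ (subst (λ w → toℕ z < toℕ w) (sym e') l))

    part : V → PartY
    part z = if A z then inA else (if ⌊ nbr? z ⌋ then inY else inB)

    data View (z : V) : Set where
      vA : z ∈ˢ A → part z ≡ inA → View z
      vY : z ∉ˢ A → nbr z ∉ˢ A → ad z (nbr z) ≡ true → part z ≡ inY → View z
      vB : z ∉ˢ A → (∀ w → w ∉ˢ A → ad z w ≡ true → ⊥) → part z ≡ inB → View z

    view : ∀ z → View z
    view z with true⊎false (A z)
    ... | inj₁ e = vA e (cong (λ t → if t then inA else (if ⌊ nbr? z ⌋ then inY else inB)) e)
    ... | inj₂ e with true⊎false ⌊ nbr? z ⌋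
    ...   | inj₁ t with ⌊⌋-e {d = nbr? z} t
    ...     | w , w∉ , zw = vY e (proj₁ (nbr-spec w∉ zw)) (proj₂ (nbr-spec w∉ zw))
              (trans (cong (λ t → if t then inA else (if ⌊ nbr? z ⌋ then inY else inB)) e) (cong (λ t → if t then inY else inB) t))
    view z | inj₂ e | inj₂ f = vB e (λ w w∉ zw → t≢f (⌊⌋-i {d = nbr? z} (w , w∉ , zw)) f)
              (trans (cong (λ t → if t then inA else (if ⌊ nbr? z ⌋ then inY else inB)) e) (cong (λ t → if t then inY else inB) f))

    is-A : ∀ {z} → z ∈ˢ A → part z ≡ inA
    is-A {z} m with view z
    ... | vA _ e = e
    ... | vY z∉ _ _ _ = ⊥-elim (t≢f m z∉)
    ... | vB z∉ _ _ = ⊥-elim (t≢f m z∉)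

    is-Y : ∀ {z w} → z ∉ˢ A → w ∉ˢ A → ad z w ≡ true → part z ≡ inY
    is-Y {z} z∉ w∉ e with view z
    ... | vA z∈ _ = ⊥-elim (t≢f z∈ z∉)
    ... | vY _ _ _ i = i
    ... | vB _ none _ = ⊥-elim (none _ w∉ e)

    Y-e : ∀ {z} → part z ≡ inY → z ∉ˢ A × nbr z ∉ˢ A × ad z (nbr z) ≡ true
    Y-e {z} i with view z
    ... | vY z∉ n∉ e _ = z∉ , n∉ , e
    ... | vA _ j with trans (sym i) j
    ...   | ()
    Y-e {z} i | vB _ _ j with trans (sym i) j
    ...   | ()

    centre : ∀ {y} → part y ≡ inY → part (star y) ≡ inY × star (star y) ≡ star y
    centre {y} i with Y-e i
    ... | y∉ , n∉ , e with star-edge y∉ n∉ e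
    ...   | inj₁ (s , _) = subst (λ w → part w ≡ inY) (sym s) i , cong star s
    ...   | inj₂ (s , t) = subst (λ w → part w ≡ inY) (sym s) (is-Y n∉ y∉ (ad-sym e)) , trans (cong star s) (trans t (sym s))

    leaf-edge : ∀ {y z} → part y ≡ inY → star y ≡ z → y ≢ z → z ∉ˢ A × ad y z ≡ true
    leaf-edge {y} i s y≢z with Y-e i
    ... | y∉ , n∉ , e with star-edge y∉ n∉ e
    ...   | inj₁ (s' , _) = ⊥-elim (y≢z (trans (sym s') s))
    ...   | inj₂ (s' , _) = subst (λ w → w ∉ˢ A × ad y w ≡ true) (trans (sym s') s) (n∉ , e)

    linked : V → V → Bool
    linked u v = not (u == v) ∧ (star u == star v ∧ (u == star u ∨ v == star v))

    linked-sym : ∀ u v → linked u v ≡ linked v u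
    linked-sym u v = cong₂ _∧_ (cong not (==-sym u v)) (cong₂ _∧_ (==-sym (star u) (star v)) (∨-comm (u == star u) (v == star v)))

    linked-e : ∀ {u v} → linked u v ≡ true → u ≢ v × star u ≡ star v × (u ≡ star u ⊎ v ≡ star v)
    linked-e {u} {v} h with ∧-e {not (u == v)} h
    ... | h₁ , t with ∧-e {star u == star v} t
    ...   | h₂ , h₃ = ==f⇒≢ (not-e h₁) , ==⇒≡ h₂ , [ (λ e → inj₁ (==⇒≡ e)) , (λ e → inj₂ (==⇒≡ e)) ]′ (∨-e {u == star u} h₃)

    linked-i : ∀ {u v} → u ≢ v → star u ≡ star v → u ≡ star u ⊎ v ≡ star v → linked u v ≡ true
    linked-i {u} {v} u≢v s d = ∧-i (not-i (≢⇒==f u≢v)) (∧-i (trans (cong (_== star v) s) (==-refl (star v)))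
      ([ (λ e → ∨-i₁ (eq e)) , (λ e → ∨-i₂ {u == star u} (eq e)) ]′ d))
      where
      eq : ∀ {w} → w ≡ star w → w == star w ≡ true
      eq {w} e = trans (cong (_== star w) e) (==-refl (star w))

    -- Centres are joined to both `a₁` and `aₖ` in addition to the edges of `G`, so that each star
    -- sees exactly this pair. Leaves gain nothing, which keeps their degree at 2 in large stars.
    to-A : V → V → Bool
    to-A y v = (star y == y ∧ (v == a₁ ∨ v == aₖ)) ∨ ad y v

    table : PartY → PartY → V → V → Bool
    table inA inA u v = not (u == v)
    table inA inB u v = true
    table inA inY u v = to-A v u
    table inB inA u v = true
    table inB inB u v = false
    table inB inY u v = false
    table inY inA u v = to-A u v
    table inY inB u v = false
    table inY inY u v = linked u v

    table-sym : ∀ P R u v → table P R u v ≡ table R P v u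
    table-sym inA inA u v = cong not (==-sym u v)
    table-sym inA inB u v = refl
    table-sym inA inY u v = refl
    table-sym inB inA u v = refl
    table-sym inB inB u v = refl
    table-sym inB inY u v = refl
    table-sym inY inA u v = refl
    table-sym inY inB u v = refl
    table-sym inY inY u v = linked-sym u v

    table-irr : ∀ P u → table P P u u ≡ false
    table-irr inA u = cong not (==-refl u)
    table-irr inB u = refl
    table-irr inY u = cong (λ b → not b ∧ (star u == star u ∧ (u == star u ∨ u == star u))) (==-refl u)

    H : Graph n
    H = record { adj = λ u v → table (part u) (part v) u v ; sym = λ u v → table-sym (part u) (part v) u v ; irrefl = λ u → table-irr (part u) u }

    entry : ∀ {u v P R} → part u ≡ P → part v ≡ R → adj H u v ≡ table P R u v
    entry e f = cong₂ (λ P R → table P R _ _) e f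

    edge : ∀ u v → ad u v ≡ true → adj H u v ≡ true
    edge u v e with view u | view v
    ... | vA _ i | vA _ j = trans (entry i j) (not-i (≢⇒==f (ad≢ e)))
    ... | vA _ i | vB _ _ j = entry i j
    ... | vA _ i | vY _ _ _ j = trans (entry i j) (∨-i₂ {star v == v ∧ (u == a₁ ∨ u == aₖ)} (ad-sym e))
    ... | vB _ _ i | vA _ j = entry i j
    ... | vB _ none _ | vB v∉ _ _ = ⊥-elim (none v v∉ e)
    ... | vB _ none _ | vY v∉ _ _ _ = ⊥-elim (none v v∉ e)
    ... | vY _ _ _ i | vA _ j = trans (entry i j) (∨-i₂ {star u == u ∧ (v == a₁ ∨ v == aₖ)} e)
    ... | vY u∉ _ _ _ | vB _ none _ = ⊥-elim (none u u∉ (ad-sym e))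
    ... | vY u∉ _ _ i | vY v∉ _ _ j with star-edge u∉ v∉ e
    ...   | inj₁ (s , t) = trans (entry i j) (linked-i (ad≢ e) (trans s (sym t)) (inj₁ (sym s)))
    ...   | inj₂ (s , t) = trans (entry i j) (linked-i (ad≢ e) (trans s (sym t)) (inj₂ (sym t)))

    size-A : ∀ z → isAY (part z) ≡ A z
    size-A z with view z
    ... | vA m e = trans (cong isAY e) (sym m)
    ... | vY m _ _ e = trans (cong isAY e) (sym m)
    ... | vB m _ e = trans (cong isAY e) (sym m)

    nbhd : ∀ z → part z ≡ inY → star z ≡ z → ∀ v → ¬ (part v ≡ inY × star v ≡ z) →
           (∃[ s ] (part s ≡ inY × star s ≡ z × adj H s v ≡ true)) ⇔ (v ≡ a₁ ⊎ v ≡ aₖ)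
    nbhd z z∈ sz v v∉ = mk⇔ to from
      where
      at-centre : ∀ v → v ∈ˢ A → v ≡ a₁ ⊎ v ≡ aₖ → ∃[ s ] (part s ≡ inY × star s ≡ z × adj H s v ≡ true)
      at-centre v v∈ e = z , z∈ , sz , trans (entry z∈ (is-A v∈)) (∨-i₁ (∧-i (trans (cong (_== z) sz) (==-refl z))
        ([ (λ { refl → ∨-i₁ (==-refl a₁) }) , (λ q → ∨-i₂ {v == a₁} (trans (cong (_== aₖ) q) (==-refl aₖ))) ]′ e)))
      from : v ≡ a₁ ⊎ v ≡ aₖ → ∃[ s ] (part s ≡ inY × star s ≡ z × adj H s v ≡ true)
      from (inj₁ e) = at-centre v (subst (_∈ˢ A) (sym e) a₁∈A) (inj₁ e)
      from (inj₂ e) = at-centre v (subst (_∈ˢ A) (sym e) aₖ∈A) (inj₂ e)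
      to : ∃[ s ] (part s ≡ inY × star s ≡ z × adj H s v ≡ true) → v ≡ a₁ ⊎ v ≡ aₖ
      to (s , s∈ , ss , h) with view v
      ... | vB _ _ j = ⊥-elim (t≢f h (entry s∈ j))
      ... | vY _ _ _ j = ⊥-elim (v∉ (j , trans (sym (proj₁ (proj₂ (linked-e (trans (sym (entry s∈ j)) h))))) ss))
      ... | vA v∈ j with ∨-e {star s == s ∧ (v == a₁ ∨ v == aₖ)} (trans (sym (entry s∈ j)) h)
      ...   | inj₁ m = [ (λ e → inj₁ (==⇒≡ e)) , (λ e → inj₂ (==⇒≡ e)) ]′ (∨-e {v == a₁} (proj₂ (∧-e {star s == s} m)))
      ...   | inj₂ m = let s∉ , n∉ , e = Y-e s∈ in nbr-in-A s∉ n∉ e v∈ m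

    class : V → BSet n
    class z v = isYY (part v) ∧ ⌊ star v ≟ z ⌋

    class-e : ∀ {z v} → v ∈ˢ class z → part v ≡ inY × star v ≡ z
    class-e {z} {v} m with ∧-e {isYY (part v)} m
    ... | y , s = yy (part v) y , ==⇒≡ s
      where
      yy : ∀ P → isYY P ≡ true → P ≡ inY
      yy inY _ = refl

    module BigStar (z : V) (z∈ : part z ≡ inY) (sz : star z ≡ z) (3≤ : 3 ≤ countB (class z))
                   (l₀ : V) (l₀∈ : part l₀ ≡ inY) (l₀z : ad l₀ z ≡ true)
                   (w : V) (w∈ : w ∈ˢ A) (l₀w : ad l₀ w ≡ true) where
      z∉ : z ∉ˢ A
      z∉ = proj₁ (Y-e z∈)
      l₀∉ : l₀ ∉ˢ A
      l₀∉ = proj₁ (Y-e l₀∈)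
      w-end : w ≡ a₁ ⊎ w ≡ aₖ
      w-end = nbr-in-A l₀∉ z∉ l₀z w∈ l₀w
      -- `same-end` compares a leaf with `l₀`. For `l₀` itself a second leaf `l'` is needed, and a
      -- star with three vertices has one.
      hangs : ∀ l → part l ≡ inY → star l ≡ z → l ≢ z → ad l w ≡ true × (∀ t → t ∈ˢ A → ad l t ≡ true → t ≡ w)
      hangs l l∈ sl l≢z with leaf-edge l∈ sl l≢z | l ≟ l₀
      ... | _ , lz | no l≢l₀ = go (attached l∉ z∉ lz) , only
        where
        l∉ : l ∉ˢ A
        l∉ = proj₁ (Y-e l∈)
        only : ∀ t → t ∈ˢ A → ad l t ≡ true → t ≡ w
        only t t∈ lt = same-end l∉ z∉ l₀∉ lz (ad-sym l₀z) l≢l₀ t∈ w∈ lt l₀w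
        go : ∃[ t ] ∃[ t' ] (t ∈ˢ A × t' ∈ˢ A × t ≢ t' × ad l t ≡ true × ad z t' ≡ true) → ad l w ≡ true
        go (t , _ , t∈ , _ , _ , lt , _) = subst (λ t → ad l t ≡ true) (only t t∈ lt) lt
      ... | _ | yes refl with pick≢₂ (class z) l₀ z 3≤
      ...   | l' , l'∈ , l'≢l₀ , l'≢z with leaf-edge (proj₁ (class-e l'∈)) (proj₂ (class-e l'∈)) l'≢z
      ...     | _ , l'z with attached (proj₁ (Y-e (proj₁ (class-e l'∈)))) z∉ l'z
      ...       | t' , _ , t'∈ , _ , _ , lt' , _ = l₀w , λ t t∈ lt → trans (via t t∈ lt) (sym (via w w∈ l₀w))
        where
        via : ∀ t → t ∈ˢ A → ad l₀ t ≡ true → t ≡ t'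
        via t t∈ lt = same-end l₀∉ z∉ (proj₁ (Y-e (proj₁ (class-e l'∈)))) l₀z (ad-sym l'z) (λ e → l'≢l₀ (sym e)) t∈ t'∈ lt lt'
      degree-2 : ∀ l → part l ≡ inY → star l ≡ z → l ≢ z → degree H l ≡ 2
      degree-2 l l∈ sl l≢z = countB-two (adj H l) (∉≢ z∉ w∈)
        (trans (entry l∈ z∈) (linked-i l≢z (trans sl (sym sz)) (inj₂ (sym sz))))
        (trans (entry l∈ (is-A w∈)) (∨-i₂ {star l == l ∧ (w == a₁ ∨ w == aₖ)} (proj₁ (hangs l l∈ sl l≢z))))
        only
        where
        not-centre : ∀ {b} → star l == l ∧ b ≡ true → ⊥
        not-centre {b} m = l≢z (trans (sym (==⇒≡ (proj₁ (∧-e {star l == l} m)))) sl)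
        only : ∀ v → adj H l v ≡ true → v ≡ z ⊎ v ≡ w
        only v h with view v
        ... | vB _ _ j = ⊥-elim (t≢f h (entry l∈ j))
        ... | vA v∈ j with ∨-e {star l == l ∧ (v == a₁ ∨ v == aₖ)} (trans (sym (entry l∈ j)) h)
        ...   | inj₁ m = ⊥-elim (not-centre m)
        ...   | inj₂ m = inj₂ (proj₂ (hangs l l∈ sl l≢z) v v∈ m)
        only v h | vY _ _ _ j with linked-e (trans (sym (entry l∈ j)) h)
        ...   | _ , s , inj₁ e = ⊥-elim (l≢z (trans e sl))
        ...   | _ , s , inj₂ e = inj₁ (trans e (trans (sym s) sl))
      result : (∀ l → part l ≡ inY → star l ≡ z → l ≢ z → degree H l ≡ 2) ×
               (∃[ w ] ((w ≡ a₁ ⊎ w ≡ aₖ) × (∀ l → part l ≡ inY → star l ≡ z → l ≢ z → adj H l w ≡ true)))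
      result = degree-2 , w , w-end , λ l l∈ sl l≢z → trans (entry l∈ (is-A w∈)) (∨-i₂ {star l == l ∧ (w == a₁ ∨ w == aₖ)} (proj₁ (hangs l l∈ sl l≢z)))

    big : ∀ z → part z ≡ inY → star z ≡ z → 3 ≤ countB (class z) →
          (∀ l → part l ≡ inY → star l ≡ z → l ≢ z → degree H l ≡ 2) ×
          (∃[ w ] ((w ≡ a₁ ⊎ w ≡ aₖ) × (∀ l → part l ≡ inY → star l ≡ z → l ≢ z → adj H l w ≡ true)))
    big z z∈ sz 3≤ with pick≢ (class z) z (≤-trans (s≤s (s≤s z≤n)) 3≤)
    ... | l₀ , m , l₀≢z with class-e m
    ...   | l₀∈ , sl₀ with leaf-edge l₀∈ sl₀ l₀≢z
    ...     | _ , l₀z with attached (proj₁ (Y-e l₀∈)) (proj₁ (Y-e z∈)) l₀z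
    ...       | w , _ , w∈ , _ , _ , l₀w , _ = BigStar.result z z∈ sz 3≤ l₀ l₀∈ l₀z w w∈ l₀w

    p∈Y : part p ≡ inY
    p∈Y = is-Y p∉A q∉A pq

    u₀∈Y : part u₀ ≡ inY
    u₀∈Y = is-Y u₀∉ v₀∉ u₀v₀

    -- In a common star, `p` and `u₀` together with the edges `p q` and `u₀ v₀` would produce a path
    -- with three edges.
    apart-stars : star p ≢ star u₀
    apart-stars e with p ≟ star p | u₀ ≟ star u₀
    ... | yes a | yes b = u₀≢p (trans b (trans (sym e) (sym a)))
    ... | yes a | no b with leaf-edge u₀∈Y (trans (sym e) (sym a)) u₀≢p
    ...   | _ , up = no-fork q∉A p∉A u₀∉ v₀∉ (ad-sym pq) (ad-sym up) u₀v₀ (λ x → u₀≢q (sym x)) v₀≢p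
    apart-stars e | no a | yes b with leaf-edge p∈Y (trans e (sym b)) (λ x → u₀≢p (sym x))
    ...   | _ , pu = no-fork q∉A p∉A u₀∉ v₀∉ (ad-sym pq) pu u₀v₀ (λ x → u₀≢q (sym x)) v₀≢p
    apart-stars e | no a | no b with leaf-edge p∈Y refl a | leaf-edge u₀∈Y (sym e) (λ x → b (trans x e)) | q ≟ star p
    ...   | c∉ , pc | _ , uc | no q≢c = no-fork q∉A p∉A c∉ u₀∉ (ad-sym pq) pc (ad-sym uc) q≢c u₀≢p
    ...   | c∉ , pc | _ , uc | yes q≡c = no-fork p∉A q∉A u₀∉ v₀∉ pq (subst (λ w → ad w u₀ ≡ true) (sym q≡c) (ad-sym uc)) u₀v₀ (λ x → u₀≢p (sym x)) v₀≢q

    nontrivial : ∀ z → part z ≡ inY → star z ≡ z → ∃[ y ] (part y ≡ inY × star y ≡ z × y ≢ z)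
    nontrivial z z∈ sz with Y-e z∈
    ... | z∉ , n∉ , e with star-edge z∉ n∉ e
    ...   | inj₁ (_ , s) = nbr z , is-Y n∉ z∉ (ad-sym e) , s , λ x → ad≢ e (sym x)
    ...   | inj₂ (s , _) = ⊥-elim (ad≢ e (trans (sym sz) s))

    inY-H : InY c H
    inY-H = record
      { part = part
      ; sizeA = trans (countB-≗ (λ z → isAY (part z)) A size-A) size
      ; cliqueA = λ u v i j u≢v → trans (entry i j) (not-i (≢⇒==f u≢v))
      ; indepB = λ u v i j → entry i j
      ; joinAB = λ u v i j → entry i j
      ; star = star
      ; starCentre = λ y i → centre i
      ; starEdges = λ y y' i j → mk⇔ (λ h → linked-e (trans (sym (entry i j)) h)) (λ { (d , s , e) → trans (entry i j) (linked-i d s e) })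
      ; starNontriv = nontrivial
      ; twoStars = star p , star u₀ , proj₁ (centre p∈Y) , proj₂ (centre p∈Y) , proj₁ (centre u₀∈Y) , proj₂ (centre u₀∈Y) , apart-stars
      ; a = a₁ ; b = aₖ ; aA = is-A a₁∈A ; bA = is-A aₖ∈A
      ; starNbhd = nbhd
      ; bigStars = big }

    result : Σ (Graph n) λ H → (InX c H ⊎ InY c H) × EmbedsInto G (λ u v → adj H u v ≡ true)
    result = H , inj₂ inY-H , (λ z → z) , (λ e → e) , edge

-- The theorem

odd-% : ∀ c h → c ≡ suc (h + h) → c % 2 ≡ 1
odd-% c h refl = trans (cong (λ m → suc m % 2) (trans (cong (h +_) (sym (+-identityʳ h))) (*-comm 2 h))) ([m+kn]%n≡m%n 1 h 2)

theorem1p11 : (n : ℕ) (G : Graph n) → TwoConnected G →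
    (C : Cycle G) → IsLongestCycle G C →
    10 ≤ cycleLength C → cycleLength C ≤ n ∸ 1 →
    (⌊ cycleLength C /2⌋ ∸ 1) * (n ∸ cycleLength C) < outerEdges G C →
    EmbedsInto G (WAdj n ⌊ cycleLength C /2⌋ (cycleLength C))
    ⊎ ((cycleLength C % 2 ≡ 1) ×
    Σ (Graph n) (λ H → (InX (cycleLength C) H ⊎ InY (cycleLength C) H) ×
    EmbedsInto G (λ u v → adj H u v ≡ true)))
theorem1p11 n G tc K longest 10≤c _ big = conclude (Rich.rich G tc K longest 10≤c big)
  where
  open OnCycle G K longest

  h : ℕ
  h = ⌊ c /2⌋

  5≤half' : 5 ≤ h
  5≤half' = Rich.5≤half G tc K longest 10≤c

  Conclusion : Set
  Conclusion = EmbedsInto G (WAdj n h c) ⊎ ((c % 2 ≡ 1) × Σ (Graph n) (λ H → (InX c H ⊎ InY c H) × EmbedsInto G (λ u v → adj H u v ≡ true)))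

  conclude : ∃[ x ] (x ∉ˢ C × h ≤ countB (λ z → ad x z ∧ C z)) → Conclusion
  conclude (x , x∉ , h≤) = go (at-vertex a₀ (A⊆C a₀ a₀∈))
    where
    A : BSet n
    A z = ad x z ∧ C z
    A⊆C : ∀ z → z ∈ˢ A → z ∈ˢ C
    A⊆C z p = proj₂ (∧-e {ad x z} p)
    x-adj : ∀ a → a ∈ˢ A → ad x a ≡ true
    x-adj a p = proj₁ (∧-e p)
    2≤A : 2 ≤ countB A
    2≤A = linear (h ∷ countB (λ z → adj G x z ∧ C z) ∷ []) (κ 5 ⊕ # 0) (# 0 ⊕ # 1) (κ 2) (# 1) (5≤half' ⊞ h≤)
    |A|≡h : countB A ≡ h
    -- Neighbours of `x` are never consecutive on the cycle, as `x` could be inserted between them;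
    -- hence `2 * countB A ≤ c`.
    |A|≡h = ≤-antisym (half-bound (Spread.apart spread A 1 A⊆C 2≤A λ w w' p p' w≢ →
        ear w [ x ] w' (⊑-∷ (not-i x∉) ⊑-[]) (ad-sym (x-adj w p) , x-adj w' p'))) h≤
      where
      half-bound : 2 * countB A ≤ c → countB A ≤ h
      half-bound b with countB A ≤? h
      ... | yes y = y
      ... | no ¬y = ⊥-elim (1≰0 (linear (countB (λ z → adj G x z ∧ C z) ∷ ⌊ suc (length (rest K)) /2⌋ ∷ length (rest K) ∷ []) (# 0 ⊕ (# 0 ⊕ κ 0) ⊕ (κ 1 ⊕ # 1 ⊕ (κ 1 ⊕ # 1 ⊕ (κ 1 ⊕ # 2)))) (κ 1 ⊕ # 2 ⊕ (# 0 ⊕ (# 0 ⊕ (κ 1 ⊕ (# 1 ⊕ # 1))))) (κ 1) (κ 0) (b ⊞ ≰⇒> ¬y ⊞ ≰⇒> ¬y ⊞ half-≤ c)))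
    first : ∃[ a ] a ∈ˢ A
    first = pick A (≤-trans (s≤s z≤n) 2≤A)
    a₀ : Fin n
    a₀ = proj₁ first
    a₀∈ : a₀ ∈ˢ A
    a₀∈ = proj₂ first
    reach : ∀ y u → u ≢ y → ∃[ a ] (a ∈ˢ A × Rc ad ((λ _ → true) ∖ y) u a)
    reach y u u≢y with pick≢ A y 2≤A
    ... | a , a∈ , a≢y = a , a∈ , walk (proj₂ (proj₂ tc) y u a u≢y a≢y)
      where
      walk : ∀ {u v} → Reach G (λ z → z ≢ y) u v → Rc ad ((λ _ → true) ∖ y) u v
      walk (Reach.here p) = Rc.here (∖-i {S = λ _ → true} refl p)
      walk (Reach.step p e r) = Rc.step (∖-i {S = λ _ → true} refl p) e (walk r)
    2≤h : 2 ≤ h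
    2≤h = linear (⌊ c /2⌋ ∷ []) (κ 5) (# 0) (κ 2) (# 0) 5≤half'
    in-A : ∀ z → z ∈ˢ C → ad x z ≡ true → z ∈ˢ A
    in-A z z∈ e = ∧-i e z∈
    go : ∃[ r ] Cyc a₀ r → Conclusion
    go (r , q) with Parse.base-config G c longest' A C x x∉ x-adj A⊆C h |A|≡h 2≤h (half-≤ c) a₀ r a₀∈ (Surgery.cycl (chain q) (verts q) (len q))
      where
      len : ∀ {r} → Cyc a₀ r → suc (length r) ≡ c
      len q = Cyc.size q
    -- No edge avoids `A` here, so `A` also takes the place of `B`.
    ... | inj₁ (k , i , gap≡) = inj₁ (embeds-W G A A h c |A|≡h (≤-trans (≤-reflexive |A|≡h) (≤-trans (m+n≤o⇒m≤o∸n h (half-≥ c)) (m≤m+n _ 1)))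
            (λ z m → m) (λ u v e u∉ v∉ → ⊥-elim (Structure.Even.independent G c longest' {A} {C} {x} x∉ x-adj in-A A⊆C reach k i gap≡ u v u∉ v∉ e)))
    -- An edge outside `A` disjoint from the gap leads to Y; a further neighbour of `p` or `q`
    -- outside `A` leads to X, with that end of the gap as the vertex `b`. With neither, the edge of
    -- the gap is the only one outside `A`, and W is large enough.
    ... | inj₂ (c-odd , k , p , q' , gap≡) = split-edge
            (any? λ u → any? λ v → (A u ≟ᵇ false) ×-dec ((A v ≟ᵇ false) ×-dec ((ad u v ≟ᵇ true) ×-dec (¬? (u ≟ p) ×-dec (¬? (u ≟ q') ×-dec (¬? (v ≟ p) ×-dec ¬? (v ≟ q')))))))
            (any? λ r → (A r ≟ᵇ false) ×-dec ((ad p r ≟ᵇ true) ×-dec ¬? (r ≟ q')))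
            (any? λ r → (A r ≟ᵇ false) ×-dec ((ad q' r ≟ᵇ true) ×-dec ¬? (r ≟ p)))
      where
      F : OddFacts G A C x (Surgery.Config.a₁ k) (Surgery.Config.aₖ k) p q'
      F = Structure.Odd.facts G c longest' {A} {C} {x} x∉ x-adj in-A A⊆C reach k p q' gap≡
      open OddFacts F using (p∉A; q∉A; p~q)
      regap = Swap.regap G c longest' {A} {C} {x} x∉ x-adj A⊆C reach k p q' gap≡ F
      c-odd% : c % 2 ≡ 1
      c-odd% = odd-% c h c-odd
      Apart : Set
      Apart = ∃[ u ] ∃[ v ] (u ∉ˢ A × v ∉ˢ A × ad u v ≡ true × u ≢ p × u ≢ q' × v ≢ p × v ≢ q')
      Leaf : Fin n → Fin n → Set
      Leaf b o = ∃[ r ] (r ∉ˢ A × ad b r ≡ true × r ≢ o)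
      -- An edge outside `A` that misses `b` contains `o`, and with the edges from `b` to `o` and to
      -- `r` it would give a path with three edges or a triangle.
      central : ∀ {b o r} → (∀ {u v} → u ∉ˢ A → v ∉ˢ A → ad u v ≡ true → (u ≡ b ⊎ u ≡ o) ⊎ (v ≡ b ⊎ v ≡ o)) → b ∉ˢ A → o ∉ˢ A → r ∉ˢ A →
                ad b o ≡ true → ad b r ≡ true → r ≢ o → ∀ u v → u ∉ˢ A → v ∉ˢ A → ad u v ≡ true → u ≡ b ⊎ v ≡ b
      central {b} touches b∉ o∉ r∉ bo br r≢o u v u∉ v∉ e with u ≟ b | v ≟ b | touches u∉ v∉ e
      ... | yes y | _ | _ = inj₁ y
      ... | no _ | yes y | _ = inj₂ y
      ... | no u≢ | no _ | inj₁ (inj₁ y) = inj₁ y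
      ... | no _ | no v≢ | inj₂ (inj₁ y) = inj₂ y
      ... | no u≢ | no v≢ | inj₁ (inj₂ refl) = ⊥-elim (Assembly.no-fork G c F |A|≡h regap v∉ o∉ b∉ r∉ (ad-sym e) (ad-sym bo) br v≢ r≢o)
      ... | no u≢ | no v≢ | inj₂ (inj₂ refl) = ⊥-elim (Assembly.no-fork G c F |A|≡h regap u∉ o∉ b∉ r∉ e (ad-sym bo) br u≢ r≢o)
      split-edge : Dec Apart → Dec (Leaf p q') → Dec (Leaf q' p) → Conclusion
      split-edge (yes (u , v , u∉ , v∉ , e , up , uq , vp , vq)) _ _ = inj₂ (c-odd% , Assembly.YCase.result G c F |A|≡h regap u v u∉ v∉ up uq vp vq e)
      split-edge (no none) leaf-p leaf-q = rest' leaf-p leaf-q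
        where
        touches : ∀ {u v} → u ∉ˢ A → v ∉ˢ A → ad u v ≡ true → (u ≡ p ⊎ u ≡ q') ⊎ (v ≡ p ⊎ v ≡ q')
        touches {u} {v} u∉ v∉ e with u ≟ p | u ≟ q' | v ≟ p | v ≟ q'
        ... | yes y | _ | _ | _ = inj₁ (inj₁ y)
        ... | _ | yes y | _ | _ = inj₁ (inj₂ y)
        ... | _ | _ | yes y | _ = inj₂ (inj₁ y)
        ... | _ | _ | _ | yes y = inj₂ (inj₂ y)
        ... | no a | no b | no d | no f = ⊥-elim (none (u , v , u∉ , v∉ , e , a , b , d , f))
        swapped : ∀ {u v} → u ∉ˢ A → v ∉ˢ A → ad u v ≡ true → (u ≡ q' ⊎ u ≡ p) ⊎ (v ≡ q' ⊎ v ≡ p)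
        swapped u∉ v∉ e = [ (λ y → inj₁ (flip⊎ y)) , (λ y → inj₂ (flip⊎ y)) ]′ (touches u∉ v∉ e)
          where
          flip⊎ : ∀ {P R : Set} → P ⊎ R → R ⊎ P
          flip⊎ = [ inj₂ , inj₁ ]′
        rest' : Dec (Leaf p q') → Dec (Leaf q' p) → Conclusion
        rest' (yes (r , r∉ , pr , r≢)) _ = inj₂ (c-odd% , Assembly.XCase.result G c F |A|≡h regap p q' r p∉A q∉A r∉ p~q pr r≢ (central touches p∉A q∉A r∉ p~q pr r≢))
        rest' (no _) (yes (r , r∉ , qr , r≢)) = inj₂ (c-odd% , Assembly.XCase.result G c F |A|≡h regap q' p r q∉A p∉A r∉ (ad-sym p~q) qr r≢ (central swapped q∉A p∉A r∉ (ad-sym p~q) qr r≢))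
        rest' (no np) (no nq) = inj₁ (embeds-W G A B h c |A|≡h |B| (λ z m → ∨-i₁ m) only)
          where
          PQ : BSet n
          PQ z = z == p ∨ z == q'
          B : BSet n
          B z = A z ∨ PQ z
          c∸h : c ∸ h ≡ suc h
          c∸h = trans (cong (_∸ h) c-odd) (m+n∸n≡m (suc h) h)
          |B| : countB B ≤ c ∸ h + 1
          -- `A` with `p` and `q` has `h + 2` vertices, which is exactly `c - h + 1` for
          -- `c = 2 * h + 1`.
          |B| = linear (countB B ∷ countB PQ ∷ countB (_== p) ∷ countB (_== q') ∷ countB A ∷ h ∷ c ∸ h ∷ []) (# 0 ⊕ (# 1 ⊕ (# 2 ⊕ (# 3 ⊕ (# 4 ⊕ (κ 1 ⊕ # 5)))))) (# 4 ⊕ # 1 ⊕ (# 2 ⊕ # 3 ⊕ (κ 1 ⊕ (κ 1 ⊕ (# 5 ⊕ # 6))))) (# 0) (# 6 ⊕ κ 1) (countB-∪ B A PQ (λ z m → ∨-e {A z} m) ⊞ countB-∪ PQ (_== p) (_== q') (λ z m → ∨-e {z == p} m)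
                  ⊞ ≡≤ (countB-point p) ⊞ ≡≤ (countB-point q') ⊞ ≡≤ |A|≡h ⊞ ≡≥ c∸h)
          only : ∀ u v → ad u v ≡ true → u ∉ˢ A → v ∉ˢ A → u ∈ˢ B × v ∈ˢ B
          only u v e u∉ v∉ = [ (λ y → one y e v∉) , (λ y → let a , b = one y (ad-sym e) u∉ in b , a) ]′ (touches u∉ v∉ e)
            where
            at-p : p ∈ˢ B
            at-p = ∨-i₂ {A p} (∨-i₁ (==-refl p))
            at-q : q' ∈ˢ B
            at-q = ∨-i₂ {A q'} (∨-i₂ {q' == p} (==-refl q'))
            one : ∀ {u v} → u ≡ p ⊎ u ≡ q' → ad u v ≡ true → v ∉ˢ A → u ∈ˢ B × v ∈ˢ B
            one {u} {v} (inj₁ refl) e v∉ = at-p , other (v ≟ q')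
              where
              other : Dec (v ≡ q') → v ∈ˢ B
              other (yes y) = subst (_∈ˢ B) (sym y) at-q
              other (no v≢) = ⊥-elim (np (v , v∉ , e , v≢))
            one {u} {v} (inj₂ refl) e v∉ = at-q , other (v ≟ p)
              where
              other : Dec (v ≡ p) → v ∈ˢ B
              other (yes y) = subst (_∈ˢ B) (sym y) at-p
              other (no v≢) = ⊥-elim (nq (v , v∉ , e , v≢))
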